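{- Let $p_1 \equiv 3 \pmod 8$ and $p_2 \equiv 1 \pmod 8$ be primes, let $e_1,e_2$ be positive integers and $N=p_1^{e_1}p_2^{e_2}$. Assume that $\left(\frac{p_1}{p_2}\right)=-1$ and that the multiplicative order of $2$ in $(\mathbb{Z}/N\mathbb{Z})^*$ equals $\varphi(N)/4$. Let $A,B$ be integers with $p_2=A^2+B^2$ and $A$ odd. Let $m$ be the smallest positive integer such that the system $$2^{m+4}=p_1^2X^2+p_2Y^2+2p_1p_2(Z^2+W^2),\qquad XY+2BZW+A(W^2-Z^2)=0$$ has a solution $(X,Y,Z,W)\in\mathbb{Z}^4$. Then $m$ is odd and there is no generalized bent function of type $[m,2N]$.
   Context: For integers $n\ge 1$, $q\ge 2$, write $\mathbb{Z}_q=\mathbb{Z}/q\mathbb{Z}$ and $\zeta_q=e^{2\pi i/q}$. A function $f:\mathbb{Z}_q^n\to\mathbb{Z}_q$ is a generalized bent function (GBF) of type $[n,q]$ if $\alpha_f(\lambda)\overline{\alpha_f(\lambda)}=q^n$ for all $\lambda\in\mathbb{Z}_q^n$, where $\alpha_f(\lambda)=\sum_{x\in\mathbb{Z}_q^n}\zeta_q^{f(x)-\lambda\cdot x}$ and $\lambda\cdot x$ is the standard dot product. $\varphi$ is Euler's totient function. -}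

module Defs where

open import Data.Nat as ℕ using (ℕ; zero; suc; _∸_; _≤_; _<_; _%_; _/_)
open import Data.Nat.GCD using (gcd)
open import Data.Integer as ℤ using (ℤ; +_; -_; 0ℤ; 1ℤ)
open import Data.Bool using (true; false)
open import Data.Integer.Divisibility using () renaming (_∣_ to _∣ℤ_)
open import Data.Fin using (Fin; toℕ)
open import Data.Vec using (Vec; []; _∷_)
open import Data.List using (List; []; _∷_; map; concatMap; foldr; replicate; _++_; length; filter; upTo; allFin; reverse; sum)
open import Data.List.Relation.Unary.All using (All)
open import Data.Product using (Σ; _×_; ∃; ∃-syntax)
open import Relation.Binary.PropositionalEquality using (_≡_; refl)
open import Relation.Nullary using (¬_)

-- Integer polynomials, little-endian coefficient lists:
-- [a₀, a₁, …, a_k] represents a₀ + a₁ t + … + a_k t^k.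

Poly : Set
Poly = List ℤ

infixl 6 _+ₚ_ _-ₚ_
infixl 7 _*ₚ_

_+ₚ_ : Poly → Poly → Poly
[] +ₚ q = q
(a ∷ p) +ₚ [] = a ∷ p
(a ∷ p) +ₚ (b ∷ q) = (a ℤ.+ b) ∷ (p +ₚ q)

negₚ : Poly → Poly
negₚ = map (-_)

_-ₚ_ : Poly → Poly → Poly
p -ₚ q = p +ₚ negₚ q

scaleₚ : ℤ → Poly → Poly
scaleₚ c = map (c ℤ.*_)

_*ₚ_ : Poly → Poly → Poly
[] *ₚ q = []
(a ∷ p) *ₚ q = scaleₚ a q +ₚ (0ℤ ∷ (p *ₚ q))

constₚ : ℤ → Poly
constₚ c = c ∷ []

monoₚ : ℕ → Poly
monoₚ e = replicate e 0ℤ ++ (1ℤ ∷ [])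

sumₚ : List Poly → Poly
sumₚ = foldr _+ₚ_ []

prodₚ : List Poly → Poly
prodₚ = foldr _*ₚ_ (1ℤ ∷ [])

IsZeroₚ : Poly → Set
IsZeroₚ p = All (_≡ 0ℤ) p

_∣ₚ_ : Poly → Poly → Set
g ∣ₚ p = ∃[ h ] IsZeroₚ (p -ₚ g *ₚ h)

-- Exact long division by a monic polynomial (quotient only).
-- Works on big-endian lists; gs = big-endian divisor without its leading 1.

private
  subPrefix : ℤ → List ℤ → List ℤ → List ℤ
  subPrefix c [] rs = rs
  subPrefix c (g ∷ gs) [] = []
  subPrefix c (g ∷ gs) (r ∷ rs) = (r ℤ.- c ℤ.* g) ∷ subPrefix c gs rs

  divBE : ℕ → List ℤ → List ℤ → List ℤ
  divBE zero gs ps = []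
  divBE (suc fuel) gs [] = []
  divBE (suc fuel) gs (c ∷ rest) with length gs ℕ.≤ᵇ length rest
  ... | true = c ∷ divBE fuel gs (subPrefix c gs rest)
  ... | false = []

  tailBE : List ℤ → List ℤ
  tailBE [] = []
  tailBE (x ∷ xs) = xs

-- quotient of p by the monic polynomial g (exact when g ∣ p)
quotₚ : Poly → Poly → Poly
quotₚ p g = reverse (divBE (length p) (tailBE (reverse g)) (reverse p))

xnm1 : ℕ → Poly
xnm1 n = constₚ (- 1ℤ) +ₚ monoₚ n

properDivisors : ℕ → List ℕ
properDivisors n = filter (λ d → (n % suc d) ℕ.≟ 0) (upTo (n ∸ 1)) |> map suc
  where
  _|>_ : ∀ {A B : Set} → A → (A → B) → B
  x |> f = f x

-- cyclotomic polynomials: t^n - 1 = ∏_{d ∣ n} Φ_d, computed recursively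
-- (fuel ≥ n suffices since all recursive calls are on proper divisors)
private
  cycF : ℕ → ℕ → Poly
  cycF zero n = 1ℤ ∷ []
  cycF (suc fuel) n = quotₚ (xnm1 n) (prodₚ (map (cycF fuel) (properDivisors n)))

Φ : ℕ → Poly
Φ n = cycF n n

private
  _ : Φ 1 ≡ (- 1ℤ) ∷ 1ℤ ∷ []
  _ = refl
  _ : Φ 2 ≡ 1ℤ ∷ 1ℤ ∷ []
  _ = refl
  _ : Φ 6 ≡ 1ℤ ∷ (- 1ℤ) ∷ 1ℤ ∷ []
  _ = refl
  _ : Φ 8 ≡ 1ℤ ∷ 0ℤ ∷ 0ℤ ∷ 0ℤ ∷ 1ℤ ∷ []
  _ = refl
  _ : Φ 15 ≡ 1ℤ ∷ (- 1ℤ) ∷ 0ℤ ∷ 1ℤ ∷ (- 1ℤ) ∷ 1ℤ ∷ 0ℤ ∷ (- 1ℤ) ∷ 1ℤ ∷ []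
  _ = refl
  _ : Φ 12 ≡ 1ℤ ∷ 0ℤ ∷ (- 1ℤ) ∷ 0ℤ ∷ 1ℤ ∷ []
  _ = refl

-- Generalized bent functions.
-- Z[ζ_q] ≅ ℤ[t]/(Φ_q) via t ↦ ζ_q = e^{2πi/q} (Φ_q is the minimal
-- polynomial of ζ_q).  An element of ℤ[ζ_q] is represented by a
-- polynomial; two represent the same complex number iff their
-- difference is divisible by Φ_q.

allVecs : (q n : ℕ) → List (Vec (Fin q) n)
allVecs q zero = [] ∷ []
allVecs q (suc n) = concatMap (λ i → map (i ∷_) (allVecs q n)) (allFin q)

-- λ · x as a natural number (its residue mod q is the dot product in ℤ_q)
dot : ∀ {q n} → Vec (Fin q) n → Vec (Fin q) n → ℕ
dot [] [] = 0
dot (a ∷ as) (b ∷ bs) = toℕ a ℕ.* toℕ b ℕ.+ dot as bs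

-- exponent e with ζ_q^e = ζ_q^{f(x) - λ·x}  (using ζ_q^{-1} = ζ_q^{q-1})
expo : ∀ {q n} → (Vec (Fin q) n → Fin q) → Vec (Fin q) n → Vec (Fin q) n → ℕ
expo {q} f lam x = toℕ (f x) ℕ.+ (q ∸ 1) ℕ.* dot lam x

αₚ : (q n : ℕ) → (Vec (Fin q) n → Fin q) → Vec (Fin q) n → Poly
αₚ q n f lam = sumₚ (map (λ x → monoₚ (expo f lam x)) (allVecs q n))

αₚ-conj : (q n : ℕ) → (Vec (Fin q) n → Fin q) → Vec (Fin q) n → Poly
αₚ-conj q n f lam = sumₚ (map (λ x → monoₚ ((q ∸ 1) ℕ.* expo f lam x)) (allVecs q n))

IsGBF : (n q : ℕ) → (Vec (Fin q) n → Fin q) → Set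
IsGBF n q f = ∀ (lam : Vec (Fin q) n) →
  Φ q ∣ₚ (αₚ q n f lam *ₚ αₚ-conj q n f lam -ₚ constₚ (+ (q ℕ.^ n)))

φ : ℕ → ℕ
φ n = length (filter (λ k → gcd k n ℕ.≟ 1) (map suc (upTo n)))

IsMultOrder : ℕ → ℕ → ℕ → Set
IsMultOrder a N k =
  (0 < k) × ((+ N) ∣ℤ (+ (a ℕ.^ k) ℤ.- 1ℤ)) ×
  (∀ j → 0 < j → (+ N) ∣ℤ (+ (a ℕ.^ j) ℤ.- 1ℤ) → k ≤ j)

NonResidue : ℕ → ℕ → Set
NonResidue a p = (¬ ((+ p) ∣ℤ (+ a))) × (∀ (x : ℤ) → ¬ ((+ p) ∣ℤ (x ℤ.* x ℤ.- + a)))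

OddZ : ℤ → Set
OddZ a = ∃[ k ] a ≡ + 2 ℤ.* k ℤ.+ 1ℤ

Solvable : (p₁ p₂ : ℕ) (A B : ℤ) → ℕ → Set
Solvable p₁ p₂ A B m = ∃[ X ] ∃[ Y ] ∃[ Z ] ∃[ W ]
  ((+ (2 ℕ.^ (m ℕ.+ 4)) ≡ (+ p₁) ℤ.^ 2 ℤ.* X ℤ.^ 2 ℤ.+ (+ p₂) ℤ.* Y ℤ.^ 2
       ℤ.+ + 2 ℤ.* (+ p₁) ℤ.* (+ p₂) ℤ.* (Z ℤ.^ 2 ℤ.+ W ℤ.^ 2))
  × (X ℤ.* Y ℤ.+ + 2 ℤ.* B ℤ.* Z ℤ.* W ℤ.+ A ℤ.* (W ℤ.^ 2 ℤ.- Z ℤ.^ 2) ≡ 0ℤ))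

{-# OPTIONS --safe #-}
-- Let ζ = ζ_N.  If f is bent of type [m, 2N], its Fourier coefficients α(λ) ∈ ℤ[ζ] have norm (2N)^m, and
-- shifting λ by N in some coordinates changes α(λ) only modulo 2.  The crux is that two elements of norm
-- (2N)^m which agree modulo 2 differ by a sign.  Multiplication by Gauss sums reduces this to norm 2^m.  An
-- element y of norm 2^m is a unit of absolute value 1 times an element β of the decomposition field of 2, the
-- imaginary cyclic quartic field fixed by σ₂: σ₂ multiplies y by such a unit ε, and σ₂ε = ± ε².  In Gauss-period
-- coordinates the norm equation of β is the given system, so minimality of m says that no element of norm
-- 2^(m-2) exists there.  This fixes the valuations of β at the four primes above 2 from β modulo 2, hence β up
-- to sign; since σ_t ρ = ± ρ^t for every ρ of absolute value 1, the unit is determined up to sign as well.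
-- Consequently 2^m G(λ) = n α(λ), where G sums over even arguments only and n is an integer, so
-- |G(λ)|² = n² N^m / 2^m is an even integer as m is odd.  By Parseval these numbers add up to N^(2m), which
-- is odd.  The oddness of m is the equation modulo p₁, where 2 and p₂ are non-residues.
--
-- ℤ[ζ] is modelled by polynomials in t modulo the annihilator of κ = (1 - t^(N/p₁))(1 - t^(N/p₂)) in
-- ℤ[t]/(t^N - 1), where it has explicit coefficients; no irreducibility of Φ_N is needed.
module Submission where

open import Defs
open import Algebra.Bundles using (CommutativeRing; RawRing)
import Algebra.Properties.CommutativeSemiring.Binomial
import Algebra.Properties.CommutativeSemiring.Exp
import Algebra.Properties.Ring
import Algebra.Properties.Semiring.Exp
import Algebra.Properties.Semiring.Mult
import Algebra.Properties.Semiring.Sum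
import Algebra.Solver.Ring
open import Algebra.Solver.Ring.AlmostCommutativeRing using (fromCommutativeRing; _-Raw-AlmostCommutative⟶_)
open import Data.Empty using (⊥-elim; ⊥)
open import Data.Fin as Fin using (Fin; toℕ; inject₁; fromℕ; fromℕ<)
import Data.Fin.Properties as FinP
open import Data.Integer as ℤ using (ℤ; +_; 0ℤ; 1ℤ; -[1+_])
import Data.Integer.Properties as ℤP
open import Data.List as List using (List; []; _∷_; _++_; map; upTo; length; applyUpTo; filter; tabulate; allFin; concatMap)
open import Data.List.Membership.Propositional using (_∈_)
open import Data.List.Membership.Propositional.Properties using (∈-applyUpTo⁺; ∈-applyUpTo⁻; ∈-++⁻; ∈-filter⁺; ∈-map⁺; ∈-upTo⁺)
import Data.List.Properties as LP
open import Data.List.Relation.Binary.Permutation.Propositional as Perm using (_↭_; ↭-sym)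
open import Data.List.Relation.Binary.Permutation.Propositional.Properties using (∈-resp-↭)
open import Data.List.Relation.Unary.All using (All; []; _∷_)
import Data.List.Relation.Unary.AllPairs.Properties as APP
open import Data.List.Relation.Unary.Unique.Propositional using (Unique)
import Data.List.Relation.Unary.Unique.Propositional.Properties as UP
open import Data.Maybe using (Maybe; just; nothing)
open import Data.Nat as ℕ using (ℕ; zero; suc; _∸_; _≤_; _<_; z≤n; s≤s; NonZero; _!)
open import Data.Nat.Combinatorics as Comb using (nCn≡1; nCk≡n!/k![n-k]!; k![n∸k]!∣n!)
open import Data.Nat.Coprimality using (Coprime; coprime-Bézout; coprime-divisor)
import Data.Nat.DivMod as DM
import Data.Nat.Divisibility as ℕD
open import Data.Nat.GCD using (gcd; gcd[m,n]∣m; gcd[m,n]∣n; gcd-GCD; module Bézout)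
open import Data.Nat.ListAction using (product)
open import Data.Nat.Primality using (Prime; euclidsLemma; prime⇒nonZero; ¬prime[1]; ¬prime[0]; prime⇒nonTrivial; prime[2]; prime⇒irreducible)
open import Data.Nat.Primality.Factorisation using (factorise; PrimeFactorisation)
import Data.Nat.Properties as ℕP
open import Data.Nat.Solver using (module +-*-Solver)
open import Data.Product using (_×_; _,_; proj₁; proj₂; ∃; ∃-syntax)
open import Data.Sum using (inj₁; inj₂; _⊎_)
open import Data.Vec as Vec using (Vec; []; _∷_)
open import Function using (_∘_; id)
open import Level using (0ℓ)
open import Relation.Binary.PropositionalEquality as ≡ using (_≡_; cong; cong₂)
import Relation.Binary.Reasoning.Setoid
open import Relation.Nullary using (¬_; yes; no; Dec)

-- Two devices stand in for absolute values and ideal factorisation. The constant coefficient of x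
-- x̄ κ κ̄ is the sum of the squares of the coefficients of x κ. It is 4 at x = 1 and at least 4 at
-- every nonzero x, because the coefficients of x κ sum to zero along the cosets of the subgroups of
-- order p₁ and p₂. Hence a norm-one element congruent to 1 modulo a prime ℓ is 1, or ±1 if ℓ = 2;
-- applied to σ_ℓ ρ · ρ^(-ℓ), which Frobenius makes congruent to 1, this is the source of σ_t ρ = ±
-- ρ^t. Valuations are replaced by congruences: at 2, high powers of x serve as approximate
-- idempotents; at p₁ and p₂, conjugation is a power of Frobenius, since -1 is a power of p₁ modulo
-- p₂^e₂ and of p₂ modulo p₁^e₁. The residue conditions fix the field: the units modulo N are the
-- cosets ±⟨2⟩ and ±τ⟨2⟩ with τ² in -⟨2⟩, so the quartic field is cyclic and σ_τ² is conjugation. A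
-- and B enter through the imaginary periods U and V: the identity (U² - V²)² + 4(UV)² = (U² + V²)²
-- yields a representation p₂ = x² + (2y)².

record ZRing : Set₁ where
  field
    commRing : CommutativeRing 0ℓ 0ℓ
  open CommutativeRing commRing public
  field
    ι : ℤ → Carrier
    ι-+ : ∀ a b → ι (a ℤ.+ b) ≈ ι a + ι b
    ι-* : ∀ a b → ι (a ℤ.* b) ≈ ι a * ι b
    ι-neg : ∀ a → ι (ℤ.- a) ≈ - ι a
    ι-0 : ι 0ℤ ≈ 0#
    ι-1 : ι 1ℤ ≈ 1#

ℤring : ZRing
ℤring = record
  { commRing = ℤP.+-*-commutativeRing ; ι = id
  ; ι-+ = λ _ _ → ≡.refl ; ι-* = λ _ _ → ≡.refl ; ι-neg = λ _ → ≡.refl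
  ; ι-0 = ≡.refl ; ι-1 = ≡.refl }

-- Congruences, finite sums and Frobenius in a commutative ring

prime∤! : ∀ {p} → Prime p → ∀ k → k < p → ¬ (p ℕD.∣ k !)
prime∤! pr zero _ d = ¬prime[1] (≡.subst Prime (ℕD.∣1⇒≡1 d) pr)
prime∤! pr (suc k) k<p d with euclidsLemma (suc k) (k !) pr d
... | inj₁ p∣k = ℕP.<-irrefl ≡.refl (ℕP.<-≤-trans k<p (ℕD.∣⇒≤ p∣k))
... | inj₂ p∣k! = prime∤! pr k (ℕP.<-trans (ℕP.n<1+n k) k<p) p∣k!

-- The prime p divides p! = C(p,k) · k! · (p-k)! but neither of the two factorials on the right.
prime∣C : ∀ {p} → Prime p → ∀ k → 0 < k → k < p → p ℕD.∣ (p Comb.C k)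
prime∣C {p} pr k 0<k k<p = result
  where
  k≤p = ℕP.<⇒≤ k<p
  instance
    _ = prime⇒nonZero pr
    nz : NonZero (k ! ℕ.* (p ∸ k) !)
    nz = ℕP._!*_!≢0 k (p ∸ k)
  eq : (p Comb.C k) ℕ.* (k ! ℕ.* (p ∸ k) !) ≡ p !
  eq = ≡.trans (≡.cong (ℕ._* (k ! ℕ.* (p ∸ k) !)) (nCk≡n!/k![n-k]! k≤p)) (DM.m/n*n≡m (k![n∸k]!∣n! k≤p))
  p∣p! : ∀ q → .{{NonZero q}} → q ℕD.∣ q !
  p∣p! (suc q) = ℕD.m∣m*n (q !)
  p-k<p : p ∸ k < p
  p-k<p = ℕP.∸-monoʳ-< {p} {k} {0} 0<k k≤p
  result : p ℕD.∣ (p Comb.C k)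
  result with euclidsLemma (p Comb.C k) _ pr (≡.subst (p ℕD.∣_) (≡.sym eq) (p∣p! p))
  ... | inj₁ d = d
  ... | inj₂ d with euclidsLemma (k !) _ pr d
  ... | inj₁ d₁ = ⊥-elim (prime∤! pr k k<p d₁)
  ... | inj₂ d₂ = ⊥-elim (prime∤! pr (p ∸ k) p-k<p d₂)

module Kit (Z : ZRing) where
  open ZRing Z
  open Algebra.Properties.Semiring.Exp semiring public
  open Algebra.Properties.CommutativeSemiring.Exp commutativeSemiring public using (^-distrib-*)
  open Algebra.Properties.Ring ring public using (-‿distribˡ-*; -‿distribʳ-*; -‿involutive; -0#≈0#; x∙y⁻¹≈ε⇒x≈y; x≈y⇒x∙y⁻¹≈ε)

  private
    ℤraw : RawRing 0ℓ 0ℓ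
    ℤraw = ℤ.+-*-rawRing

    mor : ℤraw -Raw-AlmostCommutative⟶ fromCommutativeRing commRing
    mor = record { ⟦_⟧ = ι ; +-homo = ι-+ ; *-homo = ι-* ; -‿homo = ι-neg ; 0-homo = ι-0 ; 1-homo = ι-1 }

    dec : ∀ a b → Maybe (ι a ≈ ι b)
    dec a b with a ℤ.≟ b
    ... | yes e = just (reflexive (≡.cong ι e))
    ... | no _ = nothing

  module S = Algebra.Solver.Ring ℤraw (fromCommutativeRing commRing) mor dec
  open S public using (solve; _:+_; _:*_; _:-_; :-_; _:=_; con; _:^_)
  module RR = Relation.Binary.Reasoning.Setoid setoid

  c# : ℕ → Carrier
  c# n = ι (+ n)

  ι-cong : ∀ {a b} → a ≡ b → ι a ≈ ι b
  ι-cong e = reflexive (≡.cong ι e)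

  ι-^ : ∀ a n → ι (a ℤ.^ n) ≈ ι a ^ n
  ι-^ a zero = ι-1
  ι-^ a (suc n) = trans (ι-* a _) (*-congˡ (ι-^ a n))

  ι-- : ∀ a b → ι (a ℤ.- b) ≈ ι a - ι b
  ι-- a b = trans (ι-+ a _) (+-congˡ (ι-neg b))

  c#-* : ∀ a b → c# (a ℕ.* b) ≈ c# a * c# b
  c#-* a b = trans (ι-cong (ℤP.pos-* a b)) (ι-* _ _)

  c#-^ : ∀ a n → c# (a ℕ.^ n) ≈ c# a ^ n
  c#-^ a zero = ι-1
  c#-^ a (suc n) = trans (c#-* a _) (*-congˡ (c#-^ a n))

  c#-suc : ∀ n → c# (suc n) ≈ 1# + c# n
  c#-suc n = trans (ι-+ 1ℤ (+ n)) (+-congʳ ι-1)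

  1^ : ∀ n → 1# ^ n ≈ 1#
  1^ zero = refl
  1^ (suc n) = trans (*-identityˡ _) (1^ n)

  x-x≈0 : ∀ x → x - x ≈ 0#
  x-x≈0 = -‿inverseʳ

  -≈0⇒≈ : ∀ {x y} → x - y ≈ 0# → x ≈ y
  -≈0⇒≈ {x} {y} e = x∙y⁻¹≈ε⇒x≈y x y e

  ≈⇒-≈0 : ∀ {x y} → x ≈ y → x - y ≈ 0#
  ≈⇒-≈0 e = x≈y⇒x∙y⁻¹≈ε e

  infix 4 _∣_ _≡_[_]
  record _∣_ (d x : Carrier) : Set where
    constructor divs
    field quo : Carrier
          eq : x ≈ d * quo
  open _∣_ public

  _≡_[_] : Carrier → Carrier → Carrier → Set
  x ≡ y [ d ] = d ∣ (x - y)

  ∣-resp : ∀ {d x y} → x ≈ y → d ∣ x → d ∣ y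
  ∣-resp e (divs z p) = divs z (trans (sym e) p)

  ∣-respˡ : ∀ {d d' x} → d ≈ d' → d ∣ x → d' ∣ x
  ∣-respˡ e (divs z p) = divs z (trans p (*-congʳ e))

  ∣-+ : ∀ {d x y} → d ∣ x → d ∣ y → d ∣ (x + y)
  ∣-+ {d} (divs z p) (divs w q) = divs (z + w) (trans (+-cong p q) (sym (distribˡ d z w)))

  ∣-neg : ∀ {d x} → d ∣ x → d ∣ (- x)
  ∣-neg {d} (divs z p) = divs (- z) (trans (-‿cong p) (-‿distribʳ-* d z))

  ∣-- : ∀ {d x y} → d ∣ x → d ∣ y → d ∣ (x - y)
  ∣-- p q = ∣-+ p (∣-neg q)

  ∣-*ˡ : ∀ {d x} c → d ∣ x → d ∣ (c * x)
  ∣-*ˡ {d} c (divs z p) = divs (c * z) (trans (*-congˡ p) (solve 3 (λ d c z → c :* (d :* z) := d :* (c :* z)) refl d c z))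

  ∣-*ʳ : ∀ {d x} c → d ∣ x → d ∣ (x * c)
  ∣-*ʳ {d} c p = ∣-resp (*-comm c _) (∣-*ˡ c p)

  ∣-0 : ∀ {d} → d ∣ 0#
  ∣-0 {d} = divs 0# (sym (zeroʳ d))

  ∣-refl : ∀ {d} → d ∣ d
  ∣-refl {d} = divs 1# (sym (*-identityʳ d))

  ∣-trans : ∀ {a b c} → a ∣ b → b ∣ c → a ∣ c
  ∣-trans {a} (divs z p) (divs w q) = divs (z * w) (trans q (trans (*-congʳ p) (*-assoc a z w)))

  ∣-* : ∀ {a b x y} → a ∣ x → b ∣ y → (a * b) ∣ (x * y)
  ∣-* {a} {b} (divs z p) (divs w q) = divs (z * w) (trans (*-cong p q)
    (solve 4 (λ a b z w → (a :* z) :* (b :* w) := (a :* b) :* (z :* w)) refl a b z w))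

  ^-∣ : ∀ a {m n} → m ≤ n → (a ^ m) ∣ (a ^ n)
  ^-∣ a {m} {n} m≤n = divs (a ^ (n ∸ m)) (trans (^-congʳ a (≡.sym (ℕP.m+[n∸m]≡n m≤n))) (^-homo-* a m (n ∸ m)))

  ≡-refl : ∀ {d x} → x ≡ x [ d ]
  ≡-refl {d} {x} = ∣-resp (sym (x-x≈0 x)) ∣-0

  ≡-reflexive : ∀ {d x y} → x ≈ y → x ≡ y [ d ]
  ≡-reflexive e = ∣-resp (sym (≈⇒-≈0 e)) ∣-0

  ≡-sym : ∀ {d x y} → x ≡ y [ d ] → y ≡ x [ d ]
  ≡-sym {d} {x} {y} p = ∣-resp (solve 2 (λ x y → :- (x :- y) := y :- x) refl x y) (∣-neg p)

  ≡-trans : ∀ {d x y z} → x ≡ y [ d ] → y ≡ z [ d ] → x ≡ z [ d ]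
  ≡-trans {d} {x} {y} {z} p q = ∣-resp (solve 3 (λ x y z → (x :- y) :+ (y :- z) := x :- z) refl x y z) (∣-+ p q)

  ≡-+ : ∀ {d x y u v} → x ≡ y [ d ] → u ≡ v [ d ] → (x + u) ≡ (y + v) [ d ]
  ≡-+ {d} {x} {y} {u} {v} p q = ∣-resp (solve 4 (λ x y u v → (x :- y) :+ (u :- v) := (x :+ u) :- (y :+ v)) refl x y u v) (∣-+ p q)

  ≡-neg : ∀ {d x y} → x ≡ y [ d ] → (- x) ≡ (- y) [ d ]
  ≡-neg {d} {x} {y} p = ∣-resp (solve 2 (λ x y → :- (x :- y) := :- x :- :- y) refl x y) (∣-neg p)

  ≡-* : ∀ {d x y u v} → x ≡ y [ d ] → u ≡ v [ d ] → (x * u) ≡ (y * v) [ d ]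
  ≡-* {d} {x} {y} {u} {v} p q = ∣-resp
    (solve 4 (λ x y u v → (x :- y) :* u :+ y :* (u :- v) := x :* u :- y :* v) refl x y u v) (∣-+ (∣-*ʳ u p) (∣-*ˡ y q))

  ≡-^ : ∀ {d x y} n → x ≡ y [ d ] → (x ^ n) ≡ (y ^ n) [ d ]
  ≡-^ zero p = ≡-refl
  ≡-^ (suc n) p = ≡-* p (≡-^ n p)

  ≡-resp : ∀ {d x y x' y'} → x ≈ x' → y ≈ y' → x ≡ y [ d ] → x' ≡ y' [ d ]
  ≡-resp e f p = ≡-trans (≡-reflexive (sym e)) (≡-trans p (≡-reflexive f))

  ∣⇒≡0 : ∀ {d x} → d ∣ x → x ≡ 0# [ d ]
  ∣⇒≡0 {d} {x} p = ∣-resp (solve 1 (λ x → x := x :- con 0ℤ) refl x ⟨≈⟩ +-congˡ (-‿cong ι-0)) p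
    where _⟨≈⟩_ = trans

  ≡0⇒∣ : ∀ {d x} → x ≡ 0# [ d ] → d ∣ x
  ≡0⇒∣ {d} {x} p = ∣-resp (trans (+-congˡ -0#≈0#) (+-identityʳ x)) p

  ∣-≡ : ∀ {d x y} → x ≡ y [ d ] → d ∣ x → d ∣ y
  ∣-≡ p q = ≡0⇒∣ (≡-trans (≡-sym p) (∣⇒≡0 q))

  ∑ : ∀ {A : Set} → List A → (A → Carrier) → Carrier
  ∑ [] F = 0#
  ∑ (x ∷ xs) F = F x + ∑ xs F

  ∑-cong : ∀ {A : Set} (xs : List A) {F G : A → Carrier} → (∀ x → F x ≈ G x) → ∑ xs F ≈ ∑ xs G
  ∑-cong [] h = refl
  ∑-cong (x ∷ xs) h = +-cong (h x) (∑-cong xs h)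

  ∑-+ : ∀ {A : Set} (xs : List A) (F G : A → Carrier) → ∑ xs (λ x → F x + G x) ≈ ∑ xs F + ∑ xs G
  ∑-+ [] F G = sym (+-identityˡ 0#)
  ∑-+ (x ∷ xs) F G = trans (+-congˡ (∑-+ xs F G))
    (solve 4 (λ a b c d → (a :+ b) :+ (c :+ d) := (a :+ c) :+ (b :+ d)) refl (F x) (G x) (∑ xs F) (∑ xs G))

  ∑-*ˡ : ∀ {A : Set} (xs : List A) c (F : A → Carrier) → c * ∑ xs F ≈ ∑ xs (λ x → c * F x)
  ∑-*ˡ [] c F = zeroʳ c
  ∑-*ˡ (x ∷ xs) c F = trans (distribˡ c _ _) (+-congˡ (∑-*ˡ xs c F))

  ∑-0 : ∀ {A : Set} (xs : List A) → ∑ xs (λ _ → 0#) ≈ 0#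
  ∑-0 [] = refl
  ∑-0 (x ∷ xs) = trans (+-identityˡ _) (∑-0 xs)

  ∑-const : ∀ {A : Set} (xs : List A) c → ∑ xs (λ _ → c) ≈ c# (length xs) * c
  ∑-const [] c = sym (trans (*-congʳ ι-0) (zeroˡ c))
  ∑-const (x ∷ xs) c = trans (+-congˡ (∑-const xs c)) (sym (trans (*-congʳ (c#-suc _))
     (trans (distribʳ c 1# _) (+-congʳ (*-identityˡ c)))))

  ∑-++ : ∀ {A : Set} (xs ys : List A) (F : A → Carrier) → ∑ (xs ++ ys) F ≈ ∑ xs F + ∑ ys F
  ∑-++ [] ys F = sym (+-identityˡ _)
  ∑-++ (x ∷ xs) ys F = trans (+-congˡ (∑-++ xs ys F)) (sym (+-assoc _ _ _))

  ∑-map : ∀ {A B : Set} (xs : List A) (f : A → B) (F : B → Carrier) → ∑ (map f xs) F ≡ ∑ xs (F ∘ f)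
  ∑-map [] f F = ≡.refl
  ∑-map (x ∷ xs) f F = ≡.cong (λ s → F (f x) + s) (∑-map xs f F)

  ∑-↭ : ∀ {A : Set} {xs ys : List A} (F : A → Carrier) → xs ↭ ys → ∑ xs F ≈ ∑ ys F
  ∑-↭ F Perm.refl = refl
  ∑-↭ F (Perm.prep x p) = +-congˡ (∑-↭ F p)
  ∑-↭ F (Perm.swap x y p) = trans (+-congˡ (+-congˡ (∑-↭ F p)))
    (solve 3 (λ a b c → a :+ (b :+ c) := b :+ (a :+ c)) refl (F x) (F y) _)
  ∑-↭ F (Perm.trans p q) = trans (∑-↭ F p) (∑-↭ F q)

  ∑< : ℕ → (ℕ → Carrier) → Carrier
  ∑< zero F = 0#
  ∑< (suc n) F = ∑< n F + F n

  ∑<-cong : ∀ n {F G : ℕ → Carrier} → (∀ i → i < n → F i ≈ G i) → ∑< n F ≈ ∑< n G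
  ∑<-cong zero h = refl
  ∑<-cong (suc n) h = +-cong (∑<-cong n (λ i p → h i (ℕP.m<n⇒m<1+n p))) (h n (ℕP.n<1+n n))

  ∑<-+ : ∀ n (F G : ℕ → Carrier) → ∑< n (λ x → F x + G x) ≈ ∑< n F + ∑< n G
  ∑<-+ zero F G = sym (+-identityˡ 0#)
  ∑<-+ (suc n) F G = trans (+-congʳ (∑<-+ n F G))
    (solve 4 (λ a b c d → (c :+ d) :+ (a :+ b) := (c :+ a) :+ (d :+ b)) refl (F n) (G n) (∑< n F) (∑< n G))

  ∑<-*ˡ : ∀ n c (F : ℕ → Carrier) → c * ∑< n F ≈ ∑< n (λ x → c * F x)
  ∑<-*ˡ zero c F = zeroʳ c
  ∑<-*ˡ (suc n) c F = trans (distribˡ c _ _) (+-congʳ (∑<-*ˡ n c F))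

  ∑<-neg : ∀ n (F : ℕ → Carrier) → - ∑< n F ≈ ∑< n (λ x → - F x)
  ∑<-neg zero F = -0#≈0#
  ∑<-neg (suc n) F = trans (solve 2 (λ a b → :- (a :+ b) := :- a :+ :- b) refl (∑< n F) (F n)) (+-congʳ (∑<-neg n F))

  ∑<-0 : ∀ n → ∑< n (λ _ → 0#) ≈ 0#
  ∑<-0 zero = refl
  ∑<-0 (suc n) = trans (+-identityʳ _) (∑<-0 n)

  ∑<-const : ∀ n c → ∑< n (λ _ → c) ≈ c# n * c
  ∑<-const zero c = sym (trans (*-congʳ ι-0) (zeroˡ c))
  ∑<-const (suc n) c = trans (+-congʳ (∑<-const n c)) (sym (trans (*-congʳ (c#-suc n))
     (trans (distribʳ c 1# _) (trans (+-congʳ (*-identityˡ c)) (+-comm _ _)))))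

  ∑<-first : ∀ n (F : ℕ → Carrier) → ∑< (suc n) F ≈ F 0 + ∑< n (F ∘ suc)
  ∑<-first zero F = +-comm _ _
  ∑<-first (suc n) F = trans (+-congʳ (∑<-first n F)) (+-assoc _ _ _)

  ∑<-++ : ∀ m n (F : ℕ → Carrier) → ∑< (m ℕ.+ n) F ≈ ∑< m F + ∑< n (λ i → F (m ℕ.+ i))
  ∑<-++ m zero F = trans (reflexive (≡.cong (λ k → ∑< k F) (ℕP.+-identityʳ m))) (sym (+-identityʳ _))
  ∑<-++ m (suc n) F = trans (reflexive (≡.cong (λ k → ∑< k F) (ℕP.+-suc m n)))
     (trans (+-congʳ (∑<-++ m n F)) (+-assoc _ _ _))

  ∑-upTo : ∀ n (F : ℕ → Carrier) → ∑ (upTo n) F ≈ ∑< n F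
  ∑-upTo zero F = refl
  ∑-upTo (suc n) F = trans (reflexive (≡.cong (λ l → ∑ l F) (≡.sym (LP.upTo-∷ʳ n))))
    (trans (∑-++ (upTo n) (n ∷ []) F) (+-cong (∑-upTo n F) (+-identityʳ _)))

  ∑<-swap : ∀ m n (F : ℕ → ℕ → Carrier) → ∑< m (λ i → ∑< n (F i)) ≈ ∑< n (λ j → ∑< m (λ i → F i j))
  ∑<-swap zero n F = sym (∑<-0 n)
  ∑<-swap (suc m) n F = trans (+-congʳ (∑<-swap m n F)) (sym (∑<-+ n _ _))

  ∑<-≡ : ∀ {d} n {F G : ℕ → Carrier} → (∀ i → F i ≡ G i [ d ]) → ∑< n F ≡ ∑< n G [ d ]
  ∑<-≡ zero h = ≡-refl
  ∑<-≡ (suc n) h = ≡-+ (∑<-≡ n h) (h n)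

  geom : ℕ → Carrier → Carrier
  geom n u = ∑< n (u ^_)

  geom-tele : ∀ n u → (1# - u) * geom n u ≈ 1# - u ^ n
  geom-tele zero u = trans (zeroʳ _) (sym (x-x≈0 1#))
  geom-tele (suc n) u = trans (distribˡ _ _ _) (trans (+-congʳ (geom-tele n u))
    (solve 3 (λ o u w → (o :- w) :+ (o :- u) :* w := (o :- u :* w) :+ (o :* w :- w)) refl 1# u (u ^ n) ⟨≈⟩
      trans (+-congˡ (≈⇒-≈0 (*-identityˡ _))) (+-identityʳ _)))
    where _⟨≈⟩_ = trans

  1-u∣1-u^ : ∀ u n → (1# - u) ∣ (1# - u ^ n)
  1-u∣1-u^ u n = divs (geom n u) (sym (geom-tele n u))

  -- Each term 1 - u^i of the difference is a multiple of 1 - u. When the geometric sum vanishes, 1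
  -- - u therefore divides n; both the ramification at p and the non-zero-divisor lemmas rest on
  -- this.
  geom-def : ∀ n u → (1# - u) ∣ (c# n - geom n u)
  geom-def zero u = ∣-resp (sym (trans (+-cong ι-0 -0#≈0#) (+-identityˡ _))) ∣-0
  geom-def (suc n) u = ∣-resp (trans (solve 4 (λ o c g w → (c :- g) :+ (o :- w) := (o :+ c) :- (g :+ w)) refl 1# (c# n) (geom n u) (u ^ n))
     (+-congʳ (sym (c#-suc n)))) (∣-+ (geom-def n u) (1-u∣1-u^ u n))

  x-y∣x^n-y^n : ∀ x y n → (x - y) ∣ (x ^ n - y ^ n)
  x-y∣x^n-y^n x y n = ≡-^ {x - y} n ∣-refl

  ×≈c# : ∀ n x → (Algebra.Properties.Semiring.Mult._×_ semiring n x) ≈ c# n * x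
  ×≈c# zero x = sym (trans (*-congʳ ι-0) (zeroˡ x))
  ×≈c# (suc n) x = trans (+-congˡ (×≈c# n x)) (sym (trans (*-congʳ (c#-suc n))
     (trans (distribʳ x 1# _) (+-congʳ (*-identityˡ x)))))

  c#-∣ : ∀ {m n} → m ℕD.∣ n → c# m ∣ c# n
  c#-∣ {m} (ℕD.divides q e) = divs (c# q) (trans (ι-cong (≡.cong +_ (≡.trans e (ℕP.*-comm q m)))) (c#-* m q))

  private
    open Algebra.Properties.Semiring.Sum semiring using (sum; sum-init-last; sum-cong-≋)

    sum-∣ : ∀ {d} n (f : Fin n → Carrier) → (∀ i → d ∣ f i) → d ∣ sum f
    sum-∣ zero f h = ∣-0
    sum-∣ (suc n) f h = ∣-+ (h Fin.zero) (sum-∣ n (f ∘ Fin.suc) (h ∘ Fin.suc))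

  -- The two end terms of the binomial expansion cancel against x^p + y^p, and `prime∣C` makes every
  -- inner term a multiple of p.
  frob : ∀ {p} → Prime p → ∀ x y → ((x + y) ^ p) ≡ (x ^ p + y ^ p) [ c# p ]
  frob {zero} pr = ⊥-elim (¬prime[0] pr)
  frob {suc zero} pr = ⊥-elim (¬prime[1] pr)
  frob {p@(suc (suc n))} pr x y = ∣-resp (sym step) (sum-∣ (suc n) inner inner-∣)
    where
    open Algebra.Properties.CommutativeSemiring.Binomial commutativeSemiring
    open Algebra.Properties.Semiring.Mult semiring using () renaming (_×_ to _×'_)
    f : Fin (suc p) → Carrier
    f = binomialTerm x y p
    inner : Fin (suc n) → Carrier
    inner i = f (Fin.suc (inject₁ i))
    f0 : f Fin.zero ≈ y ^ p
    f0 = trans (×≈c# 1 _) (trans (*-congʳ ι-1) (trans (*-identityˡ _) (*-identityˡ _)))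
    fl : f (Fin.suc (fromℕ (suc n))) ≈ x ^ p
    fl = trans (×≈c# _ _) (trans (*-cong (trans (ι-cong (≡.cong +_ (≡.trans (≡.cong (p Comb.C_) tf) (nCn≡1 p)))) ι-1)
          (*-cong (^-congʳ x tf) (^-congʳ y (≡.trans (≡.cong (p ∸_) tf) (ℕP.n∸n≡0 p)))))
          (trans (*-identityˡ _) (*-identityʳ _)))
      where tf : toℕ (Fin.suc (fromℕ (suc n))) ≡ p
            tf = FinP.toℕ-fromℕ p
    step : (x + y) ^ p - (x ^ p + y ^ p) ≈ sum inner
    step = trans (+-congʳ (trans (theorem p x y) (trans (+-cong f0 (sum-init-last (f ∘ Fin.suc))) (+-congˡ (+-congˡ fl)))))
      (solve 3 (λ a b s → (b :+ (s :+ a)) :- (a :+ b) := s) refl (x ^ p) (y ^ p) (sum inner))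
    inner-∣ : ∀ i → c# p ∣ inner i
    inner-∣ i = ∣-resp (sym (×≈c# _ _)) (∣-*ʳ _ (c#-∣ (prime∣C pr _ (s≤s z≤n)
      (s≤s (≡.subst (_< suc n) (≡.sym (FinP.toℕ-inject₁ i)) (FinP.toℕ<n i))))))

module IK = Kit ℤring

-- Integer polynomials as a commutative ring, and evaluation

module Polynomials where
 open Kit ℤring using () renaming (solve to solveℤ; _:+_ to _⊕_; _:*_ to _⊛_; :-_ to ⊝_; _:=_ to _⊜_; con to conℤ)

 coef : Poly → ℕ → ℤ
 coef [] i = 0ℤ
 coef (a ∷ p) zero = a
 coef (a ∷ p) (suc i) = coef p i

 infix 4 _≋_
 -- Comparing coefficients makes trailing zeros irrelevant. Being a record, the relation lets `p`
 -- and `q` be inferred from a proof.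
 record _≋_ (p q : Poly) : Set where
   constructor mk≋
   field at : ∀ i → coef p i ≡ coef q i
 open _≋_ public

 coef-+ : ∀ p q i → coef (p +ₚ q) i ≡ coef p i ℤ.+ coef q i
 coef-+ [] q i = ≡.sym (ℤP.+-identityˡ _)
 coef-+ (a ∷ p) [] i = ≡.sym (ℤP.+-identityʳ _)
 coef-+ (a ∷ p) (b ∷ q) zero = ≡.refl
 coef-+ (a ∷ p) (b ∷ q) (suc i) = coef-+ p q i

 coef-neg : ∀ p i → coef (negₚ p) i ≡ ℤ.- coef p i
 coef-neg [] i = ≡.refl
 coef-neg (a ∷ p) zero = ≡.refl
 coef-neg (a ∷ p) (suc i) = coef-neg p i

 coef-scale : ∀ c p i → coef (scaleₚ c p) i ≡ c ℤ.* coef p i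
 coef-scale c [] i = ≡.sym (ℤP.*-zeroʳ c)
 coef-scale c (a ∷ p) zero = ≡.refl
 coef-scale c (a ∷ p) (suc i) = coef-scale c p i

 ≋-refl : ∀ {p} → p ≋ p
 ≋-refl = mk≋ λ i → ≡.refl
 ≋-sym : ∀ {p q} → p ≋ q → q ≋ p
 ≋-sym e = mk≋ λ i → ≡.sym (at e i)
 ≋-trans : ∀ {p q r} → p ≋ q → q ≋ r → p ≋ r
 ≋-trans e f = mk≋ λ i → ≡.trans (at e i) (at f i)

 ∷-cong : ∀ {a b p q} → a ≡ b → p ≋ q → (a ∷ p) ≋ (b ∷ q)
 ∷-cong e f = mk≋ λ { zero → e ; (suc i) → at f i }

 0∷[] : (0ℤ ∷ []) ≋ []
 0∷[] = mk≋ λ { zero → ≡.refl ; (suc i) → ≡.refl }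

 +ₚ-cong : ∀ {p p' q q'} → p ≋ p' → q ≋ q' → p +ₚ q ≋ p' +ₚ q'
 +ₚ-cong {p} {p'} {q} {q'} e f = mk≋ λ i → ≡.trans (coef-+ p q i) (≡.trans (cong₂ ℤ._+_ (at e i) (at f i)) (≡.sym (coef-+ p' q' i)))

 negₚ-cong : ∀ {p p'} → p ≋ p' → negₚ p ≋ negₚ p'
 negₚ-cong {p} {p'} e = mk≋ λ i → ≡.trans (coef-neg p i) (≡.trans (cong ℤ.-_ (at e i)) (≡.sym (coef-neg p' i)))

 scale-cong : ∀ {c c' p p'} → c ≡ c' → p ≋ p' → scaleₚ c p ≋ scaleₚ c' p'
 scale-cong {c} {.c} {p} {p'} ≡.refl e = mk≋ λ i → ≡.trans (coef-scale c p i) (≡.trans (cong (c ℤ.*_) (at e i)) (≡.sym (coef-scale c p' i)))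

 +ₚ-comm : ∀ p q → p +ₚ q ≋ q +ₚ p
 +ₚ-comm p q = mk≋ λ i → ≡.trans (coef-+ p q i) (≡.trans (ℤP.+-comm (coef p i) _) (≡.sym (coef-+ q p i)))

 +ₚ-assoc : ∀ p q r → (p +ₚ q) +ₚ r ≋ p +ₚ (q +ₚ r)
 +ₚ-assoc p q r = mk≋ λ i → ≡.trans (coef-+ (p +ₚ q) r i) (≡.trans (cong (ℤ._+ _) (coef-+ p q i))
   (≡.trans (ℤP.+-assoc (coef p i) _ _) (≡.sym (≡.trans (coef-+ p (q +ₚ r) i) (cong (λ z → coef p i ℤ.+ z) (coef-+ q r i))))))

 +ₚ-identityʳ : ∀ p → p +ₚ [] ≋ p
 +ₚ-identityʳ p = mk≋ λ i → ≡.trans (coef-+ p [] i) (ℤP.+-identityʳ _)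

 +ₚ-inverseʳ : ∀ p → p +ₚ negₚ p ≋ []
 +ₚ-inverseʳ p = mk≋ λ i → ≡.trans (coef-+ p (negₚ p) i) (≡.trans (cong (λ z → coef p i ℤ.+ z) (coef-neg p i)) (ℤP.+-inverseʳ (coef p i)))

 +ₚ-swap : ∀ p q r → p +ₚ (q +ₚ r) ≋ q +ₚ (p +ₚ r)
 +ₚ-swap p q r = ≋-trans (≋-sym (+ₚ-assoc p q r)) (≋-trans (+ₚ-cong (+ₚ-comm p q) ≋-refl) (+ₚ-assoc q p r))

 +ₚ-mid : ∀ p q r s → (p +ₚ q) +ₚ (r +ₚ s) ≋ (p +ₚ r) +ₚ (q +ₚ s)
 +ₚ-mid p q r s = ≋-trans (+ₚ-assoc p q _) (≋-trans (+ₚ-cong (≋-refl {p}) (+ₚ-swap q r s)) (≋-sym (+ₚ-assoc p r _)))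

 0∷-+ : ∀ p q → (0ℤ ∷ (p +ₚ q)) ≋ (0ℤ ∷ p) +ₚ (0ℤ ∷ q)
 0∷-+ p q = ∷-cong ≡.refl ≋-refl

 scale-+ₚ : ∀ c p q → scaleₚ c (p +ₚ q) ≋ scaleₚ c p +ₚ scaleₚ c q
 scale-+ₚ c p q = mk≋ λ i → ≡.trans (coef-scale c (p +ₚ q) i) (≡.trans (cong (c ℤ.*_) (coef-+ p q i))
   (≡.trans (ℤP.*-distribˡ-+ c _ _) (≡.sym (≡.trans (coef-+ (scaleₚ c p) _ i) (cong₂ ℤ._+_ (coef-scale c p i) (coef-scale c q i))))))

 scale-+ : ∀ c d p → scaleₚ (c ℤ.+ d) p ≋ scaleₚ c p +ₚ scaleₚ d p
 scale-+ c d p = mk≋ λ i → ≡.trans (coef-scale (c ℤ.+ d) p i) (≡.trans (ℤP.*-distribʳ-+ (coef p i) c d)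
   (≡.sym (≡.trans (coef-+ (scaleₚ c p) _ i) (cong₂ ℤ._+_ (coef-scale c p i) (coef-scale d p i)))))

 scale-scale : ∀ c d p → scaleₚ c (scaleₚ d p) ≋ scaleₚ (c ℤ.* d) p
 scale-scale c d p = mk≋ λ i → ≡.trans (coef-scale c (scaleₚ d p) i) (≡.trans (cong (c ℤ.*_) (coef-scale d p i))
   (≡.trans (≡.sym (ℤP.*-assoc c d _)) (≡.sym (coef-scale (c ℤ.* d) p i))))

 scale-0∷ : ∀ c p → scaleₚ c (0ℤ ∷ p) ≋ 0ℤ ∷ scaleₚ c p
 scale-0∷ c p = ∷-cong (ℤP.*-zeroʳ c) ≋-refl

 scale-zero : ∀ p → scaleₚ 0ℤ p ≋ []
 scale-zero p = mk≋ λ i → ≡.trans (coef-scale 0ℤ p i) (ℤP.*-zeroˡ (coef p i))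

 scale-one : ∀ p → scaleₚ 1ℤ p ≋ p
 scale-one p = mk≋ λ i → ≡.trans (coef-scale 1ℤ p i) (ℤP.*-identityˡ _)

 *ₚ-congʳ : ∀ p {q q'} → q ≋ q' → p *ₚ q ≋ p *ₚ q'
 *ₚ-congʳ [] e = ≋-refl
 *ₚ-congʳ (a ∷ p) e = +ₚ-cong (scale-cong {a} ≡.refl e) (∷-cong ≡.refl (*ₚ-congʳ p e))

 *ₚ-zeroʳ : ∀ p → p *ₚ [] ≋ []
 *ₚ-zeroʳ [] = ≋-refl
 *ₚ-zeroʳ (a ∷ p) = ≋-trans (∷-cong ≡.refl (*ₚ-zeroʳ p)) 0∷[]

 *ₚ-∷ʳ : ∀ p b q → p *ₚ (b ∷ q) ≋ scaleₚ b p +ₚ (0ℤ ∷ (p *ₚ q))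
 *ₚ-∷ʳ [] b q = ≋-sym 0∷[]
 *ₚ-∷ʳ (a ∷ p) b q = ∷-cong (cong (ℤ._+ 0ℤ) (ℤP.*-comm a b))
   (≋-trans (+ₚ-cong ≋-refl (*ₚ-∷ʳ p b q)) (+ₚ-swap (scaleₚ a q) (scaleₚ b p) _))

 *ₚ-comm : ∀ p q → p *ₚ q ≋ q *ₚ p
 *ₚ-comm [] q = ≋-sym (*ₚ-zeroʳ q)
 *ₚ-comm (a ∷ p) q = ≋-trans (+ₚ-cong ≋-refl (∷-cong ≡.refl (*ₚ-comm p q))) (≋-sym (*ₚ-∷ʳ q a p))

 *ₚ-cong : ∀ {p p' q q'} → p ≋ p' → q ≋ q' → p *ₚ q ≋ p' *ₚ q'
 *ₚ-cong {p} {p'} {q} {q'} e f = ≋-trans (*ₚ-congʳ p f) (≋-trans (*ₚ-comm p q') (≋-trans (*ₚ-congʳ q' e) (*ₚ-comm q' p')))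

 *ₚ-distribʳ : ∀ r p q → (p +ₚ q) *ₚ r ≋ p *ₚ r +ₚ q *ₚ r
 *ₚ-distribʳ r [] q = ≋-refl
 *ₚ-distribʳ r (a ∷ p) [] = ≋-sym (+ₚ-identityʳ _)
 *ₚ-distribʳ r (a ∷ p) (b ∷ q) = ≋-trans (+ₚ-cong (scale-+ a b r) (≋-trans (∷-cong ≡.refl (*ₚ-distribʳ r p q)) (0∷-+ (p *ₚ r) (q *ₚ r))))
   (+ₚ-mid (scaleₚ a r) (scaleₚ b r) (0ℤ ∷ (p *ₚ r)) (0ℤ ∷ (q *ₚ r)))

 scale-* : ∀ c p q → scaleₚ c p *ₚ q ≋ scaleₚ c (p *ₚ q)
 scale-* c [] q = ≋-refl
 scale-* c (a ∷ p) q = ≋-sym (≋-trans (scale-+ₚ c (scaleₚ a q) _) (+ₚ-cong (scale-scale c a q)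
   (≋-trans (scale-0∷ c _) (∷-cong ≡.refl (≋-sym (scale-* c p q))))))

 0∷-* : ∀ p q → (0ℤ ∷ p) *ₚ q ≋ 0ℤ ∷ (p *ₚ q)
 0∷-* p q = +ₚ-cong (scale-zero q) ≋-refl

 *ₚ-assoc : ∀ p q r → (p *ₚ q) *ₚ r ≋ p *ₚ (q *ₚ r)
 *ₚ-assoc [] q r = ≋-refl
 *ₚ-assoc (a ∷ p) q r = ≋-trans (*ₚ-distribʳ r (scaleₚ a q) _) (+ₚ-cong (scale-* a q r)
   (≋-trans (0∷-* (p *ₚ q) r) (∷-cong ≡.refl (*ₚ-assoc p q r))))

 *ₚ-identityˡ : ∀ p → (1ℤ ∷ []) *ₚ p ≋ p
 *ₚ-identityˡ p = ≋-trans (+ₚ-cong (scale-one p) 0∷[]) (+ₚ-identityʳ p)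

 polyRing : CommutativeRing 0ℓ 0ℓ
 polyRing = record
   { Carrier = Poly ; _≈_ = _≋_ ; _+_ = _+ₚ_ ; _*_ = _*ₚ_ ; -_ = negₚ ; 0# = [] ; 1# = 1ℤ ∷ []
   ; isCommutativeRing = record
     { isRing = record
       { +-isAbelianGroup = record
         { isGroup = record
           { isMonoid = record
             { isSemigroup = record
               { isMagma = record { isEquivalence = record { refl = ≋-refl ; sym = ≋-sym ; trans = ≋-trans } ; ∙-cong = +ₚ-cong }
               ; assoc = +ₚ-assoc }
             ; identity = (λ p → ≋-refl) , +ₚ-identityʳ }
           ; inverse = (λ p → ≋-trans (+ₚ-comm (negₚ p) p) (+ₚ-inverseʳ p)) , +ₚ-inverseʳ
           ; ⁻¹-cong = negₚ-cong }
         ; comm = +ₚ-comm }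
       ; *-cong = *ₚ-cong
       ; *-assoc = *ₚ-assoc
       ; *-identity = *ₚ-identityˡ , (λ p → ≋-trans (*ₚ-comm p _) (*ₚ-identityˡ p))
       ; distrib = (λ r p q → ≋-trans (*ₚ-comm r _) (≋-trans (*ₚ-distribʳ r p q) (+ₚ-cong (*ₚ-comm p r) (*ₚ-comm q r)))) , *ₚ-distribʳ }
     ; *-comm = *ₚ-comm } }

 polyZ : ZRing
 polyZ = record
   { commRing = polyRing ; ι = constₚ
   ; ι-+ = λ _ _ → ≋-refl ; ι-* = λ a b → ∷-cong (≡.sym (ℤP.+-identityʳ _)) ≋-refl
   ; ι-neg = λ _ → ≋-refl ; ι-0 = 0∷[] ; ι-1 = ≋-refl }

 scale-const : ∀ c p → scaleₚ c p ≋ constₚ c *ₚ p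
 scale-const c p = ≋-sym (≋-trans (+ₚ-cong ≋-refl 0∷[]) (+ₚ-identityʳ _))

 tₚ : Poly
 tₚ = 0ℤ ∷ 1ℤ ∷ []

 t* : ∀ p → tₚ *ₚ p ≋ 0ℤ ∷ p
 t* p = ≋-trans (0∷-* (1ℤ ∷ []) p) (∷-cong ≡.refl (*ₚ-identityˡ p))

 ∷-split : ∀ a p → (a ∷ p) ≋ constₚ a +ₚ tₚ *ₚ p
 ∷-split a p = ≋-sym (≋-trans (+ₚ-cong (≋-refl {constₚ a}) (t* p)) (∷-cong (ℤP.+-identityʳ a) ≋-refl))

 private module PK = Kit polyZ

 monoₚ-t : ∀ e → monoₚ e ≋ tₚ PK.^ e
 monoₚ-t zero = ≋-refl
 monoₚ-t (suc e) = ≋-trans (∷-cong ≡.refl (monoₚ-t e)) (≋-sym (t* _))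

 IsZero⇒ : ∀ {p} → IsZeroₚ p → p ≋ []
 IsZero⇒ [] = ≋-refl
 IsZero⇒ (e ∷ es) = ≋-trans (∷-cong e (IsZero⇒ es)) 0∷[]

 -- Induction through `frob` settles natural numbers. A negative number is reached by expanding 0 =
 -- (-n + n)^p, which spares a distinction on the parity of p.
 fermat : ∀ {p} → Prime p → ∀ a → Kit._≡_[_] ℤring (a ℤ.^ p) a (+ p)
 fermat {p} pr = go
   where
   open Kit ℤring
   0^ : ∀ q → Prime q → 0ℤ ^ q ≡ 0ℤ
   0^ zero pr = ⊥-elim (¬prime[0] pr)
   0^ (suc q) pr = ≡.refl
   ^≡ : ∀ a n → a ℤ.^ n ≡ a ^ n
   ^≡ a zero = ≡.refl
   ^≡ a (suc n) = ≡.cong (λ z → a ℤ.* z) (^≡ a n)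
   pos : ∀ n → (+ n) ^ p ≡ + n [ + p ]
   pos zero = ≡-reflexive (0^ p pr)
   pos (suc n) = ≡-trans {x = (+ suc n) ^ p} {y = 1ℤ ^ p ℤ.+ (+ n) ^ p} (frob pr 1ℤ (+ n)) (≡-+ {x = 1ℤ ^ p} {1ℤ} {(+ n) ^ p} {+ n} (≡-reflexive (1^ p)) (pos n))
   neg : ∀ n → (ℤ.- (+ n)) ^ p ≡ ℤ.- (+ n) [ + p ]
   neg n = ∣-resp {x = ((0ℤ ^ p ℤ.- 0ℤ) ℤ.- ((x ℤ.+ + n) ^ p ℤ.- (x ^ p ℤ.+ (+ n) ^ p))) ℤ.- ((+ n) ^ p ℤ.- + n)}
        (≡.trans (≡.cong (λ w → ((w ℤ.- 0ℤ) ℤ.- ((x ℤ.+ + n) ^ p ℤ.- (x ^ p ℤ.+ (+ n) ^ p))) ℤ.- ((+ n) ^ p ℤ.- + n))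
            (≡.cong (_^ p) {0ℤ} {x ℤ.+ + n} (≡.sym (ℤP.+-inverseˡ (+ n)))))
          (solve 4 (λ a b c d → ((a :- con 0ℤ) :- (a :- (b :+ c))) :- (c :- d) := b :- (:- d)) ≡.refl ((x ℤ.+ + n) ^ p) (x ^ p) ((+ n) ^ p) (+ n)))
        (∣-- (∣-- (≡-reflexive {x = 0ℤ ^ p} (0^ p pr)) (frob pr x (+ n))) (pos n))
     where x = ℤ.- (+ n)
   go : ∀ a → a ℤ.^ p ≡ a [ + p ]
   go a rewrite ^≡ a p with a
   ... | + n = pos n
   ... | -[1+ n ] = neg (suc n)

 module Eval (Z : ZRing) where
   open ZRing Z
   open Kit Z

   ev : Carrier → Poly → Carrier
   ev r [] = 0#
   ev r (a ∷ p) = ι a + r * ev r p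

   ev-+ : ∀ r p q → ev r (p +ₚ q) ≈ ev r p + ev r q
   ev-+ r [] q = sym (+-identityˡ _)
   ev-+ r (a ∷ p) [] = sym (+-identityʳ _)
   ev-+ r (a ∷ p) (b ∷ q) = trans (+-cong (ι-+ a b) (*-congˡ (ev-+ r p q)))
     (solve 5 (λ a b r x y → (a :+ b) :+ r :* (x :+ y) := (a :+ r :* x) :+ (b :+ r :* y)) refl (ι a) (ι b) r (ev r p) (ev r q))

   ev-neg : ∀ r p → ev r (negₚ p) ≈ - ev r p
   ev-neg r [] = sym -0#≈0#
   ev-neg r (a ∷ p) = trans (+-cong (ι-neg a) (*-congˡ (ev-neg r p)))
     (solve 3 (λ a r x → :- a :+ r :* (:- x) := :- (a :+ r :* x)) refl (ι a) r (ev r p))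

   ev-- : ∀ r p q → ev r (p -ₚ q) ≈ ev r p - ev r q
   ev-- r p q = trans (ev-+ r p _) (+-congˡ (ev-neg r q))

   ev-zero : ∀ r p → p ≋ [] → ev r p ≈ 0#
   ev-zero r [] e = refl
   ev-zero r (a ∷ p) e = trans (+-cong (trans (ι-cong (at e 0)) ι-0) (trans (*-congˡ (ev-zero r p (mk≋ λ i → at e (suc i)))) (zeroʳ r))) (+-identityʳ _)

   ev-cong : ∀ r {p q} → p ≋ q → ev r p ≈ ev r q
   ev-cong r {p} {q} e = -≈0⇒≈ (trans (sym (ev-- r p q)) (ev-zero r (p -ₚ q) (≋-trans (+ₚ-cong e ≋-refl) (+ₚ-inverseʳ q))))

   ev-scale : ∀ r c p → ev r (scaleₚ c p) ≈ ι c * ev r p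
   ev-scale r c [] = sym (zeroʳ _)
   ev-scale r c (a ∷ p) = trans (+-cong (ι-* c a) (*-congˡ (ev-scale r c p)))
     (solve 4 (λ c a r x → c :* a :+ r :* (c :* x) := c :* (a :+ r :* x)) refl (ι c) (ι a) r (ev r p))

   ev-* : ∀ r p q → ev r (p *ₚ q) ≈ ev r p * ev r q
   ev-* r [] q = sym (zeroˡ _)
   ev-* r (a ∷ p) q = trans (ev-+ r (scaleₚ a q) _) (trans (+-cong (ev-scale r a q)
     (trans (+-congʳ ι-0) (trans (+-identityˡ _) (*-congˡ (ev-* r p q)))))
     (solve 4 (λ a r x y → a :* y :+ r :* (x :* y) := (a :+ r :* x) :* y) refl (ι a) r (ev r p) (ev r q)))

   ev-const : ∀ r c → ev r (constₚ c) ≈ ι c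
   ev-const r c = trans (+-congˡ (zeroʳ r)) (+-identityʳ _)

   ev-1 : ∀ r → ev r (1ℤ ∷ []) ≈ 1#
   ev-1 r = trans (ev-const r 1ℤ) ι-1

   ev-mono : ∀ r e → ev r (monoₚ e) ≈ r ^ e
   ev-mono r zero = ev-1 r
   ev-mono r (suc e) = trans (+-congʳ ι-0) (trans (+-identityˡ _) (*-congˡ (ev-mono r e)))

   ev-t : ∀ r → ev r tₚ ≈ r
   ev-t r = trans (ev-mono r 1) (*-identityʳ r)

   ev-^ : ∀ r p n → ev r (p PK.^ n) ≈ ev r p ^ n
   ev-^ r p zero = ev-1 r
   ev-^ r p (suc n) = trans (ev-* r p _) (*-congˡ (ev-^ r p n))

   ev-resp : ∀ {r s} p → r ≈ s → ev r p ≈ ev s p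
   ev-resp [] e = refl
   ev-resp (a ∷ p) e = +-congˡ (*-cong e (ev-resp p e))

   ι-∣ : ∀ {d a} → Kit._∣_ ℤring d a → ι d ∣ ι a
   ι-∣ {d} (Kit.divs z p) = divs (ι z) (trans (ι-cong p) (ι-* d z))

   ι-≡ : ∀ {d a b} → Kit._≡_[_] ℤring a b d → ι a ≡ ι b [ ι d ]
   ι-≡ {d} {a} {b} p = ∣-resp (ι-- a b) (ι-∣ p)

   -- Raising to the power ℓ is additive modulo ℓ and fixes the integer coefficients, so only the
   -- argument changes. With r = ζ this says that σ_ℓ is the ℓ-th power map modulo ℓ.
   ev-frob : ∀ {ℓ} → Prime ℓ → ∀ r p → (ev r p ^ ℓ) ≡ ev (r ^ ℓ) p [ c# ℓ ]
   ev-frob {zero} pr = ⊥-elim (¬prime[0] pr)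
   ev-frob {suc ℓ} pr r [] = ≡-reflexive (zeroˡ _)
   ev-frob {ℓ@(suc _)} pr r (a ∷ p) = ≡-trans (frob pr (ι a) (r * ev r p))
     (≡-+ (≡-trans (≡-reflexive (sym (ι-^ a ℓ))) (ι-≡ (fermat pr a)))
          (≡-trans (≡-reflexive (^-distrib-* r (ev r p) ℓ)) (≡-* ≡-refl (ev-frob pr r p))))

-- Long division by monic polynomials

module Division where
 open Polynomials
 open import Data.Bool using (Bool; true; false)
 open import Data.Nat using (_⊔_)
 open import Data.List using (_∷ʳ_; reverse; foldl; initLast; _∷ʳ′_)
 open import Function using (flip)
 open import Relation.Binary.PropositionalEquality using (refl)

 private module PK = Kit polyZ
 open PK using (_^_; solve; _:+_; _:*_; _:-_; :-_; _:=_; con)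

 -- The division loop of Defs is private; these bindings recover it by unification.
 mutual
   divLoop : ℕ → List ℤ → List ℤ → List ℤ
   divLoop = _

   quot-divLoop : ∀ p g → quotₚ p g ≡ reverse (divLoop (length p) (reverse g) (reverse p))
   quot-divLoop p g with length p | reverse g | reverse p
   ... | l | g' | p' with foldl {A = List ℤ} {B = ℤ} (flip _∷_) []
   ... | rev = refl

 mutual
   subPre : ℤ → List ℤ → List ℤ → List ℤ
   subPre = _

   divLoop-step : ∀ l x gs c rest → (length gs ℕ.≤ᵇ length rest) ≡ true →
     divLoop (suc l) (x ∷ gs) (c ∷ rest) ≡ c ∷ divLoop l (x ∷ gs) (subPre c gs rest)
   divLoop-step l x gs c rest e with length gs ℕ.≤ᵇ length rest
   divLoop-step l x gs c rest e | true = refl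

 divLoop-stop : ∀ l x gs c rest → (length gs ℕ.≤ᵇ length rest) ≡ false → divLoop (suc l) (x ∷ gs) (c ∷ rest) ≡ []
 divLoop-stop l x gs c rest e with length gs ℕ.≤ᵇ length rest
 divLoop-stop l x gs c rest e | false = refl

 mutual
   cyc : ℕ → ℕ → Poly
   cyc = _

   Φ-cyc : ∀ n → Φ (suc n) ≡ quotₚ (xnm1 (suc n)) (prodₚ (map (cyc n) (properDivisors (suc n))))
   Φ-cyc n with properDivisors (suc n)
   ... | ds = refl

 cyc-suc : ∀ f n → cyc (suc f) n ≡ quotₚ (xnm1 n) (prodₚ (map (cyc f) (properDivisors n)))
 cyc-suc f n = refl

 snoc : ∀ p c → (p ∷ʳ c) ≋ p +ₚ constₚ c *ₚ tₚ ^ length p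
 snoc [] c = ≋-sym (≋-trans (*ₚ-comm (constₚ c) _) (*ₚ-identityˡ _))
 snoc (a ∷ p) c = ≋-trans (∷-split a (p ∷ʳ c)) (≋-trans (+ₚ-cong (≋-refl {constₚ a}) (*ₚ-congʳ tₚ (snoc p c)))
   (≋-trans (solve 5 (λ a t p c w → a :+ t :* (p :+ c :* w) := (a :+ t :* p) :+ c :* (t :* w)) ≋-refl (constₚ a) tₚ p (constₚ c) (tₚ ^ length p))
   (+ₚ-cong {q = constₚ c *ₚ (tₚ ^ suc (length p))} (≋-sym (∷-split a p)) ≋-refl)))

 reverse-∷ : ∀ c ps → reverse (c ∷ ps) ≋ reverse ps +ₚ constₚ c *ₚ tₚ ^ length ps
 reverse-∷ c ps rewrite LP.unfold-reverse c ps = ≋-trans (snoc (reverse ps) c)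
   (≡.subst (λ n → reverse ps +ₚ constₚ c *ₚ tₚ ^ length (reverse ps) ≋ reverse ps +ₚ constₚ c *ₚ tₚ ^ n) (LP.length-reverse ps) ≋-refl)

 length-subPre : ∀ c gs rs → length gs ≤ length rs → length (subPre c gs rs) ≡ length rs
 length-subPre c [] rs le = refl
 length-subPre c (g ∷ gs) (r ∷ rs) (s≤s le) = cong suc (length-subPre c gs rs le)

 ^-+ : ∀ m n → tₚ ^ (m ℕ.+ n) ≋ tₚ ^ m *ₚ tₚ ^ n
 ^-+ m n = PK.^-homo-* tₚ m n

 -- Big-endian subtraction aligns the leading coefficients; read little-endian, the divisor is
 -- multiplied by t^j, where j is the difference of the lengths.
 reverse-subPre : ∀ c gs rs j → length rs ≡ j ℕ.+ length gs →
   reverse (subPre c gs rs) ≋ reverse rs -ₚ constₚ c *ₚ (tₚ ^ j *ₚ reverse gs)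
 reverse-subPre c [] rs j e = ≋-sym (≋-trans (+ₚ-cong (≋-refl {reverse rs}) (negₚ-cong (≋-trans (*ₚ-congʳ (constₚ c) (*ₚ-zeroʳ (tₚ ^ j))) (*ₚ-zeroʳ (constₚ c))))) (+ₚ-identityʳ (reverse rs)))
 reverse-subPre c (g ∷ gs) [] j e = ⊥-elim (ℕP.0≢1+n (≡.trans e (ℕP.+-suc j _)))
 reverse-subPre c (g ∷ gs) (r ∷ rs) j e =
   ≋-trans (reverse-∷ (r ℤ.- c ℤ.* g) (subPre c gs rs))
   (≋-trans (+ₚ-cong (reverse-subPre c gs rs j e')
       (*ₚ-cong (PK.ι-- r (c ℤ.* g) ⟨≋⟩ +ₚ-cong (≋-refl {constₚ r}) (negₚ-cong (∷-cong (≡.sym (ℤP.+-identityʳ _)) ≋-refl)))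
                (PK.^-congʳ tₚ (length-subPre c gs rs le) ⟨≋⟩ (PK.^-congʳ tₚ e' ⟨≋⟩ ^-+ j (length gs)))))
   (≋-trans (solve 7 (λ R G tj tk c g r → (R :- c :* (tj :* G)) :+ (r :- c :* g) :* (tj :* tk) := (R :+ r :* (tj :* tk)) :- c :* (tj :* (G :+ g :* tk)))
       ≋-refl (reverse rs) (reverse gs) (tₚ ^ j) (tₚ ^ length gs) (constₚ c) (constₚ g) (constₚ r))
    (+ₚ-cong (+ₚ-cong (≋-refl {reverse rs}) (*ₚ-congʳ (constₚ r) (≋-sym (PK.^-congʳ tₚ e' ⟨≋⟩ ^-+ j (length gs)))) ⟨≋⟩ ≋-sym (reverse-∷ r rs))
             (negₚ-cong (*ₚ-congʳ (constₚ c) (*ₚ-congʳ (tₚ ^ j) (≋-sym (reverse-∷ g gs))))))))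
   where
   _⟨≋⟩_ = ≋-trans
   e' : length rs ≡ j ℕ.+ length gs
   e' = ℕP.suc-injective (≡.trans e (ℕP.+-suc j _))
   le : length gs ≤ length rs
   le = ≡.subst (length gs ≤_) (≡.sym e') (ℕP.m≤n+m _ j)

 ≤ᵇ-true : ∀ {m n} → m ≤ n → (m ℕ.≤ᵇ n) ≡ true
 ≤ᵇ-true {m} {n} p with m ℕ.≤ᵇ n in eq
 ... | true = refl
 ... | false = ⊥-elim (≡.subst Data.Bool.T eq (ℕP.≤⇒≤ᵇ p))

 ≤ᵇ-false : ∀ {m n} → n < m → (m ℕ.≤ᵇ n) ≡ false
 ≤ᵇ-false {m} {n} p with m ℕ.≤ᵇ n in eq
 ... | false = refl
 ... | true = ⊥-elim (ℕP.<⇒≱ p (ℕP.≤ᵇ⇒≤ m n (≡.subst Data.Bool.T (≡.sym eq) _)))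

 -- The length of the quotient belongs to the invariant because `quot-exact` reads the degree of the
 -- quotient, and with it monicity, from that length.
 record DivRes (k : ℕ) (g ps : List ℤ) (q : List ℤ) : Set where
   field
     rem : Poly
     rem-len : length rem ≤ k
     div-eq : reverse ps ≋ g *ₚ reverse q +ₚ rem
     q-len : length q ≡ length ps ∸ k

 divLoop-correct : ∀ gs l ps → length ps ≡ l → DivRes (length gs) (reverse (1ℤ ∷ gs)) ps (divLoop l (1ℤ ∷ gs) ps)
 divLoop-correct gs zero [] refl = record
   { rem = [] ; rem-len = z≤n ; div-eq = ≋-sym (*ₚ-zeroʳ (reverse (1ℤ ∷ gs)) ⟪≋⟫) ; q-len = ≡.sym (ℕP.0∸n≡0 (length gs)) }
   where _⟪≋⟫ : ∀ {p} → p ≋ [] → p +ₚ [] ≋ []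
         _⟪≋⟫ {p} e = ≋-trans (+ₚ-identityʳ p) e
 divLoop-correct gs (suc l) (c ∷ rest) e with length gs ℕ.≤? length rest
 ... | no k≰ rewrite divLoop-stop l 1ℤ gs c rest (≤ᵇ-false (ℕP.≰⇒> k≰)) = record
   { rem = reverse (c ∷ rest)
   ; rem-len = ≡.subst (_≤ length gs) (≡.sym (LP.length-reverse (c ∷ rest))) (ℕP.≰⇒> k≰)
   ; div-eq = ≋-sym (+ₚ-cong (*ₚ-zeroʳ (reverse (1ℤ ∷ gs))) (≋-refl {reverse (c ∷ rest)}))
   ; q-len = ≡.sym (ℕP.m≤n⇒m∸n≡0 (ℕP.≰⇒> k≰)) }
 ... | yes k≤ rewrite divLoop-step l 1ℤ gs c rest (≤ᵇ-true k≤) = record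
   { rem = rem ; rem-len = rem-len
   ; div-eq = eq
   ; q-len = ≡.trans (cong suc q-len') (≡.sym (ℕP.+-∸-assoc 1 k≤)) }
   where
   _⟨≋⟩_ = ≋-trans
   k = length gs
   sub = subPre c gs rest
   j = length rest ∸ k
   ej : length rest ≡ j ℕ.+ k
   ej = ≡.sym (ℕP.m∸n+n≡m k≤)
   sub-len : length sub ≡ length rest
   sub-len = length-subPre c gs rest k≤
   q' = divLoop l (1ℤ ∷ gs) sub
   open DivRes (divLoop-correct gs l sub (≡.trans sub-len (ℕP.suc-injective e)))
   q-len' : length q' ≡ j
   q-len' = ≡.trans q-len (cong (_∸ k) sub-len)
   g = reverse (1ℤ ∷ gs)
   eq : reverse (c ∷ rest) ≋ g *ₚ reverse (c ∷ q') +ₚ rem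
   eq = reverse-∷ c rest ⟨≋⟩ (+ₚ-cong (≋-sym (solve 2 (λ s d → (s :- d) :+ d := s) ≋-refl (reverse rest) (constₚ c *ₚ (tₚ ^ j *ₚ reverse gs))))
            (*ₚ-congʳ (constₚ c) (PK.^-congʳ tₚ ej ⟨≋⟩ ^-+ j k))
      ⟨≋⟩ (+ₚ-cong (+ₚ-cong (≋-sym (reverse-subPre c gs rest j ej) ⟨≋⟩ div-eq) (≋-refl {constₚ c *ₚ (tₚ ^ j *ₚ reverse gs)})) (≋-refl {constₚ c *ₚ (tₚ ^ j *ₚ tₚ ^ k)})
      ⟨≋⟩ (solve 7 (λ g q r c tj G tk → (((g :* q :+ r) :+ c :* (tj :* G)) :+ c :* (tj :* tk)) := (g :* q :+ c :* tj :* (G :+ con 1ℤ :* tk)) :+ r)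
             ≋-refl g (reverse q') rem (constₚ c) (tₚ ^ j) (reverse gs) (tₚ ^ k)
      ⟨≋⟩ +ₚ-cong {q = rem} (+ₚ-cong (≋-refl {g *ₚ reverse q'}) (*ₚ-congʳ (constₚ c *ₚ tₚ ^ j) (≋-sym (reverse-∷ 1ℤ gs)))
        ⟨≋⟩ (solve 4 (λ g q c tj → g :* q :+ c :* tj :* g := g :* (q :+ c :* tj)) ≋-refl g (reverse q') (constₚ c) (tₚ ^ j)
        ⟨≋⟩ *ₚ-congʳ g (+ₚ-cong (≋-refl {reverse q'}) (*ₚ-congʳ (constₚ c) (PK.^-congʳ tₚ (≡.sym q-len'))) ⟨≋⟩ ≋-sym (reverse-∷ c q')))) ≋-refl)))

 Monic : Poly → Set
 Monic g = ∃ λ k → (length g ≡ suc k) × (coef g k ≡ 1ℤ)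

 coef-beyond : ∀ p i → length p ≤ i → coef p i ≡ 0ℤ
 coef-beyond [] i le = refl
 coef-beyond (a ∷ p) (suc i) (s≤s le) = coef-beyond p i le

 coef-top : ∀ g s k n → (∀ i → k < i → coef g i ≡ 0ℤ) → (∀ i → n < i → coef s i ≡ 0ℤ) →
   coef (g *ₚ s) (k ℕ.+ n) ≡ coef g k ℤ.* coef s n
 coef-top [] s k n hg hs = refl
 coef-top (a ∷ g) s zero n hg hs = ≡.trans (coef-+ (scaleₚ a s) (0ℤ ∷ (g *ₚ s)) n)
    (≡.trans (cong₂ ℤ._+_ (coef-scale a s n) (tail0 n)) (ℤP.+-identityʳ _))
   where
   g0 : g ≋ []
   g0 = mk≋ λ i → hg (suc i) (s≤s z≤n)
   tail0 : ∀ n → coef (0ℤ ∷ (g *ₚ s)) n ≡ 0ℤ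
   tail0 zero = refl
   tail0 (suc n) = at (*ₚ-cong {g} {[]} {s} {s} g0 ≋-refl) n
 coef-top (a ∷ g) s (suc k) n hg hs = ≡.trans (coef-+ (scaleₚ a s) (0ℤ ∷ (g *ₚ s)) (suc k ℕ.+ n))
   (≡.trans (cong₂ ℤ._+_ (≡.trans (coef-scale a s _) (≡.trans (cong (a ℤ.*_) (hs _ (s≤s (ℕP.m≤n+m n k)))) (ℤP.*-zeroʳ a)))
       (coef-top g s k n (λ i p → hg (suc i) (s≤s p)) hs)) (ℤP.+-identityˡ _))

 -- The top coefficient of s reappears, unchanged, as the top coefficient of g s, in a degree at
 -- least that of g. It must vanish, and s is peeled off from above.
 monic-small : ∀ g → Monic g → ∀ s → (∀ i → length g ≤ suc i → coef (g *ₚ s) i ≡ 0ℤ) → s ≋ []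
 monic-small g (k , len , top) s h = mk≋ λ i → go (length s) (λ i p → coef-beyond s i p) i z≤n
   where
   hg : ∀ i → k < i → coef g i ≡ 0ℤ
   hg i p = coef-beyond g i (≡.subst (_≤ i) (≡.sym len) p)
   go : ∀ n → (∀ i → n ≤ i → coef s i ≡ 0ℤ) → ∀ i → 0 ≤ i → coef s i ≡ 0ℤ
   go zero hs = hs
   go (suc n) hs = go n λ i n≤i → case i n≤i
     where
     sn : coef s n ≡ 0ℤ
     sn = ≡.trans (≡.sym (ℤP.*-identityˡ _)) (≡.trans (cong (ℤ._* coef s n) (≡.sym top))
        (≡.trans (≡.sym (coef-top g s k n hg hs)) (h (k ℕ.+ n) (≡.subst (_≤ suc (k ℕ.+ n)) (≡.sym len) (s≤s (ℕP.m≤m+n k n))))))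
     case : ∀ i → n ≤ i → coef s i ≡ 0ℤ
     case i n≤i with n ℕ.≟ i
     ... | yes refl = sn
     ... | no n≢i = hs i (ℕP.≤∧≢⇒< n≤i n≢i)

 monic-nzd : ∀ g → Monic g → ∀ s → g *ₚ s ≋ [] → s ≋ []
 monic-nzd g mg s e = monic-small g mg s (λ i _ → at e i)

 monic-shape : ∀ g → Monic g → ∃ λ gs → (g ≡ reverse (1ℤ ∷ gs)) × (reverse g ≡ 1ℤ ∷ gs) × (length g ≡ suc (length gs))
 monic-shape g (k , len , top) with initLast g
 ... | p ∷ʳ′ x = reverse p , ≡.trans (cong (p ∷ʳ_) x≡1) (≡.sym (≡.trans (LP.unfold-reverse 1ℤ (reverse p)) (cong (_∷ʳ 1ℤ) (LP.reverse-involutive p))))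
      , ≡.trans (LP.reverse-++ p (x ∷ [])) (cong (_∷ reverse p) x≡1)
      , ≡.trans len (cong suc (≡.trans (≡.sym lp) (≡.sym (LP.length-reverse p))))
   where
   lp : length p ≡ k
   lp = ℕP.suc-injective (≡.trans (ℕP.+-comm 1 (length p)) (≡.trans (≡.sym (LP.length-++ p)) len))
   last : ∀ p → coef (p ∷ʳ x) (length p) ≡ x
   last [] = refl
   last (a ∷ p) = last p
   x≡1 : x ≡ 1ℤ
   x≡1 = ≡.trans (≡.sym (last p)) (≡.trans (cong (coef (p ∷ʳ x)) lp) top)

 divMonic : ∀ g → Monic g → ∀ p → ∃ λ r → (p ≋ g *ₚ quotₚ p g +ₚ r) × (suc (length r) ≤ length g) × (length (quotₚ p g) ≡ suc (length p) ∸ length g)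
 divMonic g mg p with monic-shape g mg
 ... | gs , e₁ , e₂ , e₃ = rem , eq , ≡.subst (suc (length rem) ≤_) (≡.sym e₃) (s≤s rem-len) , len
   where
   dl = divLoop (length p) (1ℤ ∷ gs) (reverse p)
   open DivRes (divLoop-correct gs (length p) (reverse p) (LP.length-reverse p))
   qeq : quotₚ p g ≡ reverse dl
   qeq = ≡.trans (quot-divLoop p g) (cong (λ z → reverse (divLoop (length p) z (reverse p))) e₂)
   eq : p ≋ g *ₚ quotₚ p g +ₚ rem
   eq = ≡.subst₂ (λ u v → u ≋ v +ₚ rem) (LP.reverse-involutive p) (cong₂ _*ₚ_ (≡.sym e₁) (≡.sym qeq)) div-eq
   len : length (quotₚ p g) ≡ suc (length p) ∸ length g
   len = ≡.trans (cong length qeq) (≡.trans (LP.length-reverse dl) (≡.trans q-len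
      (≡.trans (cong (_∸ length gs) (LP.length-reverse p)) (cong (suc (length p) ∸_) (≡.sym e₃)))))

 rem-zero : ∀ g → Monic g → ∀ s r → suc (length r) ≤ length g → g *ₚ s ≋ r → s ≋ []
 rem-zero g mg s r le e = monic-small g mg s (λ i p → ≡.trans (at e i) (coef-beyond r i (ℕP.≤-pred (ℕP.≤-trans le p))))

 -- For any cofactor h, the difference of h and the computed quotient, times g, equals a remainder
 -- of degree below g, so it is zero. Comparing leading coefficients then shows that the quotient is
 -- monic.
 quot-exact : ∀ g p → Monic g → Monic p → ∀ h → p ≋ g *ₚ h → (p ≋ g *ₚ quotₚ p g) × Monic (quotₚ p g)
 quot-exact g p mg@(k , lg , tg) (n , lp , tp) h e with divMonic g mg p
 ... | r , eq , rl , ql = p≋ , j , len-q , top-q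
   where
   _⟨≋⟩_ = ≋-trans
   q = quotₚ p g
   diff : g *ₚ (h -ₚ q) ≋ r
   diff = solve 3 (λ g h q → g :* (h :- q) := g :* h :- g :* q) ≋-refl g h q ⟨≋⟩ (+ₚ-cong (≋-sym e ⟨≋⟩ eq) (≋-refl {negₚ (g *ₚ q)})
      ⟨≋⟩ solve 2 (λ a r → (a :+ r) :- a := r) ≋-refl (g *ₚ q) r)
   h-q : h -ₚ q ≋ []
   h-q = rem-zero g mg (h -ₚ q) r rl diff
   p≋ : p ≋ g *ₚ q
   p≋ = e ⟨≋⟩ *ₚ-congʳ g (PK.-≈0⇒≈ h-q)
   hg : ∀ i → k < i → coef g i ≡ 0ℤ
   hg i lt = coef-beyond g i (≡.subst (_≤ i) (≡.sym lg) lt)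
   ql' : length q ≡ suc n ∸ k
   ql' = ≡.trans ql (cong₂ (λ a b → suc a ∸ b) lp lg)
   -- p has a nonzero coefficient at n, so k ≤ n
   k≤n : k ≤ n
   k≤n with k ℕ.≤? n
   ... | yes le = le
   ... | no k≰n = ⊥-elim (1≢0 (≡.trans (≡.sym tp) (≡.trans (at p≋ n) (at (*ₚ-congʳ g q0 ⟨≋⟩ *ₚ-zeroʳ g) n))))
     where
     1≢0 : ¬ (1ℤ ≡ 0ℤ)
     1≢0 ()
     q0 : q ≋ []
     q0 = mk≋ λ i → coef-beyond q i (≡.subst (_≤ i) (≡.sym (≡.trans ql' (ℕP.m≤n⇒m∸n≡0 (ℕP.≰⇒> k≰n)))) z≤n)
   j = n ∸ k
   len-q : length q ≡ suc j
   len-q = ≡.trans ql' (ℕP.+-∸-assoc 1 k≤n)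
   top-q : coef q j ≡ 1ℤ
   top-q = ≡.trans (≡.sym (ℤP.*-identityˡ _)) (≡.trans (cong (ℤ._* coef q j) (≡.sym tg))
     (≡.trans (≡.sym (coef-top g q k j hg (λ i lt → coef-beyond q i (≡.subst (_≤ i) (≡.sym len-q) lt))))
     (≡.trans (≡.sym (at p≋ (k ℕ.+ j))) (≡.trans (cong (coef p) (ℕP.m+[n∸m]≡n k≤n)) tp))))

 length-+ₚ : ∀ p q → length (p +ₚ q) ≡ length p ⊔ length q
 length-+ₚ [] q = refl
 length-+ₚ (a ∷ p) [] = refl
 length-+ₚ (a ∷ p) (b ∷ q) = cong suc (length-+ₚ p q)

 length-*ₚ : ∀ a p b q → length ((a ∷ p) *ₚ (b ∷ q)) ≡ suc (length p ℕ.+ length q)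
 length-*ₚ a [] b q = ≡.trans (length-+ₚ (scaleₚ a (b ∷ q)) (0ℤ ∷ [])) (≡.trans (cong (_⊔ 1) (LP.length-map (a ℤ.*_) (b ∷ q))) (cong suc (ℕP.⊔-identityʳ _)))
 length-*ₚ a (a' ∷ p) b q = ≡.trans (length-+ₚ (scaleₚ a (b ∷ q)) (0ℤ ∷ ((a' ∷ p) *ₚ (b ∷ q)))) (≡.trans (cong₂ _⊔_ (LP.length-map (a ℤ.*_) (b ∷ q)) (cong suc (length-*ₚ a' p b q)))
    (ℕP.m≤n⇒m⊔n≡n (s≤s (ℕP.≤-trans (ℕP.m≤n+m (length q) (length p)) (ℕP.n≤1+n _)))))

 monic-* : ∀ g h → Monic g → Monic h → Monic (g *ₚ h)
 monic-* g@(a ∷ g') h@(b ∷ h') (k , refl , tg) (n , refl , th) = k ℕ.+ n , length-*ₚ a g' b h' ,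
   ≡.trans (coef-top g h k n (λ i lt → coef-beyond g i lt) (λ i lt → coef-beyond h i lt)) (cong₂ ℤ._*_ tg th)

 monic-1 : Monic (1ℤ ∷ [])
 monic-1 = 0 , refl , refl

 monic-xnm1 : ∀ n → Monic (xnm1 (suc n))
 monic-xnm1 n = suc n , cong suc (lm n) , tm n
   where
   lm : ∀ n → length (monoₚ n) ≡ suc n
   lm zero = refl
   lm (suc n) = cong suc (lm n)
   tm : ∀ n → coef (monoₚ n) n ≡ 1ℤ
   tm zero = refl
   tm (suc n) = tm n

 xnm1-t : ∀ n → xnm1 n ≋ tₚ ^ n -ₚ (1ℤ ∷ [])
 xnm1-t n = ≋-trans (+ₚ-comm (constₚ (ℤ.- 1ℤ)) (monoₚ n)) (+ₚ-cong (monoₚ-t n) ≋-refl)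

 private
   cancelℤ : ∀ k x → 0 < k → + k ℤ.* x ≡ 0ℤ → x ≡ 0ℤ
   cancelℤ (suc k) x _ e = ℤP.*-cancelˡ-≡ (+ suc k) x 0ℤ (≡.trans e (≡.sym (ℤP.*-zeroʳ (+ suc k))))

 -- Divide y by g with remainder r. Then g divides k r, whose degree is too small, so k r = 0 and r
 -- = 0. Thus the quotient by a monic polynomial has no torsion.
 monic-torsion : ∀ g → Monic g → ∀ k y → 0 < k → g PK.∣ (constₚ (+ k) *ₚ y) → g PK.∣ y
 monic-torsion g mg k y 0<k (PK.divs s e) with divMonic g mg y
 ... | r , eq , rl , _ = PK.divs q (eq ⟨≋⟩ (+ₚ-cong (≋-refl {g *ₚ q}) r0 ⟨≋⟩ +ₚ-identityʳ _))
   where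
   _⟨≋⟩_ = ≋-trans
   q = quotₚ y g
   K = constₚ (+ k)
   d : g *ₚ (s -ₚ K *ₚ q) ≋ scaleₚ (+ k) r
   d = solve 4 (λ g s K q → g :* (s :- K :* q) := g :* s :- K :* (g :* q)) ≋-refl g s K q
      ⟨≋⟩ (+ₚ-cong (≋-sym e ⟨≋⟩ *ₚ-congʳ K eq) (≋-refl {negₚ (K *ₚ (g *ₚ q))})
      ⟨≋⟩ (solve 3 (λ K a r → K :* (a :+ r) :- K :* a := K :* r) ≋-refl K (g *ₚ q) r ⟨≋⟩ ≋-sym (scale-const (+ k) r)))
   s0 : s -ₚ K *ₚ q ≋ []
   s0 = rem-zero g mg (s -ₚ K *ₚ q) (scaleₚ (+ k) r) (≡.subst (λ l → suc l ≤ length g) (≡.sym (LP.length-map _ r)) rl) d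
   r0 : r ≋ []
   r0 = mk≋ λ i → cancelℤ k (coef r i) 0<k (≡.trans (≡.sym (coef-scale (+ k) r i)) (≡.trans (≡.sym (at d i)) (at (*ₚ-congʳ g s0 ⟨≋⟩ *ₚ-zeroʳ g) i)))

-- The product formula for t^n - 1

module CyclotomicProducts where
 open Polynomials
 open Division
 open import Data.Nat using (_%_)
 open import Data.Nat.GCD using (gcd[m,n]≢0)
 open import Data.Nat.GCD using (module GCD)
 open import Induction.WellFounded using (Acc; acc)
 open import Data.List.Membership.Propositional.Properties using (∈-map⁻; ∈-filter⁻; ∈-upTo⁻)
 open import Data.List.Relation.Unary.Any using (here; there)
 import Data.List.Relation.Unary.All as All
 open import Data.List.Relation.Unary.AllPairs as AP using (AllPairs; []; _∷_)

 pd-∈⁻ : ∀ n d → d ∈ properDivisors (suc n) → (0 < d) × (d < suc n) × (d ℕD.∣ suc n)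
 pd-∈⁻ n d m with ∈-map⁻ suc m
 ... | d' , m' , ≡.refl with ∈-filter⁻ (λ d → (suc n % suc d) ℕ.≟ 0) {xs = upTo n} m'
 ... | u , e = s≤s z≤n , s≤s (∈-upTo⁻ u) , ℕD.m%n≡0⇒n∣m (suc n) (suc d') e

 pd-∈⁺ : ∀ n d → 0 < d → d < suc n → d ℕD.∣ suc n → d ∈ properDivisors (suc n)
 pd-∈⁺ n (suc d) _ (s≤s d<n) dv = ∈-map⁺ suc (∈-filter⁺ (λ d → (suc n % suc d) ℕ.≟ 0) (∈-upTo⁺ d<n) (ℕD.n∣m⇒m%n≡0 (suc n) (suc d) dv))

 pd-asc : ∀ n → AllPairs _<_ (properDivisors n)
 pd-asc n = APP.map⁺ (AP.map s≤s (APP.filter⁺ (λ d → (n % suc d) ℕ.≟ 0) (APP.applyUpTo⁺₁ id (n ∸ 1) (λ i<j _ → i<j))))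

 module _ (Z : ZRing) where
   open ZRing Z
   open Kit Z
   
   module Exact 
     (M : Carrier → Set)
     (M-1 : M 1#) (M-* : ∀ x y → M x → M y → M (x * y))
     (M-nzd : ∀ x → M x → ∀ y → x * y ≈ 0# → y ≈ 0#)
     (M-tor : ∀ x → M x → ∀ k y → 0 < k → x ∣ (c# k * y) → x ∣ y)
     (t : Carrier) (φ : ℕ → Carrier) where

     ∏φ : List ℕ → Carrier
     ∏φ [] = 1#
     ∏φ (d ∷ ds) = φ d * ∏φ ds

     module _ (M-quot : ∀ n → M (∏φ (properDivisors (suc n))) → ∏φ (properDivisors (suc n)) ∣ (t ^ suc n - 1#) →
                  (φ (suc n) * ∏φ (properDivisors (suc n)) ≈ t ^ suc n - 1#) × M (φ (suc n))) where

       -- The field `sub` separates the factors: (t^n - 1)/(t^g - 1) is congruent to n/g modulo t^g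
       -- - 1, so its divisor φ n is coprime to earlier factors up to an integer.
       record P (n : ℕ) : Set where
         field
           monic : M (φ n)
           prod : φ n * ∏φ (properDivisors n) ≈ t ^ n - 1#
           sub : ∀ g k → g ℕ.* k ≡ n → 0 < g → 1 < k → φ n ∣ geom k (t ^ g)
         φ∣ : φ n ∣ (t ^ n - 1#)
         φ∣ = divs _ (sym prod)

       t-∣ : ∀ {m n} → m ℕD.∣ n → (t ^ m - 1#) ∣ (t ^ n - 1#)
       t-∣ {m} {n} (ℕD.divides q e) = ∣-resp (+-cong (trans (^-assocʳ t m q) (^-congʳ t (≡.trans (ℕP.*-comm m q) (≡.sym e)))) (-‿cong (1^ q)))
         (x-y∣x^n-y^n (t ^ m) 1# q)

       -- Modulo φ d both t^c - 1 and t^d - 1 kill y, hence by Bézout so does t^g - 1 with g =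
       -- gcd(c,d). Since φ d divides the geometric sum of length k = d/g in t^g, which is k modulo
       -- t^g - 1, it divides k y, and torsion-freeness removes k.
       key1 : ∀ c d y → 0 < c → c < d → P c → P d → φ d ∣ (φ c * y) → φ d ∣ y
       key1 c d y 0<c c<d Pc Pd h = M-tor (φ d) (P.monic Pd) k y (ℕP.<-trans (s≤s z≤n) 1<k) (∣-resp eqk (∣-+ (∣-*ʳ y (P.sub Pd g k gk 0<g 1<k)) (∣-*ˡ s ht)))
         where
         g = gcd c d
         0<d : 0 < d
         0<d = ℕP.<-trans 0<c c<d
         0<g : 0 < g
         0<g = ℕP.n≢0⇒n>0 (gcd[m,n]≢0 c d (inj₁ (ℕP.n>0⇒n≢0 0<c)))
         g∣d = gcd[m,n]∣n c d
         k = ℕD.quotient g∣d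
         gk : g ℕ.* k ≡ d
         gk = ≡.sym (ℕD.m∣n⇒n≡m*quotient g∣d)
         g≤c : g ≤ c
         g≤c = ℕD.∣⇒≤ {{ℕ.>-nonZero 0<c}} (gcd[m,n]∣m c d)
         1<k : 1 < k
         1<k = ℕD.quotient>1 g∣d (ℕP.≤-<-trans g≤c c<d)
         hc : φ d ∣ ((t ^ c - 1#) * y)
         hc = ∣-resp (trans (solve 3 (λ p q y → (p :* y) :* q := (p :* q) :* y) refl (φ c) (∏φ (properDivisors c)) y) (*-congʳ (P.prod Pc)))
                (∣-*ʳ (∏φ (properDivisors c)) h)
         hcm : ∀ a → φ d ∣ ((t ^ (a ℕ.* c) - 1#) * y)
         hcm a = ∣-trans hc (∣-* (t-∣ (ℕD.n∣m*n a)) ∣-refl)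
         hdm : ∀ b → φ d ∣ (t ^ (b ℕ.* d) - 1#)
         hdm b = ∣-trans (P.φ∣ Pd) (t-∣ (ℕD.n∣m*n b))
         ht : φ d ∣ ((t ^ g - 1#) * y)
         ht with Bézout.identity {c} {d} {g} (Data.Nat.GCD.gcd-GCD c d)
         ... | Bézout.+- a b e = ∣-resp
             (trans (+-congʳ (*-congʳ (+-congʳ (trans (^-congʳ t (≡.sym e)) (^-homo-* t g (b ℕ.* d))))))
               (solve 4 (λ tg tb y o → (tg :* tb :- o) :* y :- (tb :- o) :* (tg :* y) := (tg :- o) :* y :+ (o :- con 1ℤ) :* (tg :* y)) refl (t ^ g) (t ^ (b ℕ.* d)) y 1#
               ⟨≈⟩ trans (+-congˡ (trans (*-congʳ (≈⇒-≈0 (sym ι-1))) (zeroˡ _))) (+-identityʳ _)))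
             (∣-- (hcm a) (∣-*ʳ (t ^ g * y) (hdm b)))
           where _⟨≈⟩_ = trans
         ... | Bézout.-+ a b e = ∣-resp
             (trans (+-congʳ (*-congʳ (+-congʳ (trans (^-congʳ t (≡.sym e)) (^-homo-* t g (a ℕ.* c))))))
               (solve 4 (λ tg tb y o → (tg :* tb :- o) :* y :- tg :* ((tb :- o) :* y) := (tg :- o) :* y :+ (o :- con 1ℤ) :* (tg :* y)) refl (t ^ g) (t ^ (a ℕ.* c)) y 1#
               ⟨≈⟩ trans (+-congˡ (trans (*-congʳ (≈⇒-≈0 (sym ι-1))) (zeroˡ _))) (+-identityʳ _)))
             (∣-- (∣-*ʳ y (hdm b)) (∣-*ˡ (t ^ g) (hcm a)))
           where _⟨≈⟩_ = trans
         s = - quo (geom-def k (t ^ g))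
         eqk : geom k (t ^ g) * y + s * ((t ^ g - 1#) * y) ≈ c# k * y
         eqk = trans (solve 5 (λ G z u y o → G :* y :+ (:- z) :* ((u :- o) :* y) := (G :+ (o :- u) :* z) :* y) refl
                   (geom k (t ^ g)) (quo (geom-def k (t ^ g))) (t ^ g) y 1#)
                 (*-congʳ (trans (+-congˡ (sym (eq (geom-def k (t ^ g))))) (solve 2 (λ G c → G :+ (c :- G) := c) refl (geom k (t ^ g)) (c# k))))

       -- After division by the first factor, `key1` shows that the later ones still divide the
       -- quotient; the ascending order supplies its hypothesis c < d.
       key2 : ∀ ds X → AllPairs _<_ ds → All (λ d → (0 < d) × P d) ds → (∀ d → d ∈ ds → φ d ∣ X) → ∏φ ds ∣ X
       key2 [] X _ _ h = divs X (sym (*-identityˡ X))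
       key2 (d ∷ ds) X (a ∷ as) ((0<d , Pd) ∷ Ps) h = ∣-resp (sym (eq hd)) (∣-* ∣-refl (key2 ds (quo hd) as Ps h'))
         where
         hd = h d (here ≡.refl)
         h' : ∀ c → c ∈ ds → φ c ∣ quo hd
         h' c m = key1 d c (quo hd) 0<d (All.lookup a m) Pd (proj₂ (All.lookup Ps m)) (∣-resp (eq hd) (h c (there m)))

       key3 : ∀ d cs y → P d → All (λ c → (0 < c) × (c < d) × P c) cs → φ d ∣ (∏φ cs * y) → φ d ∣ y
       key3 d [] y Pd _ h = ∣-resp (*-identityˡ y) h
       key3 d (c ∷ cs) y Pd ((0<c , c<d , Pc) ∷ as) h = key3 d cs y Pd as (key1 c d _ 0<c c<d Pc Pd (∣-resp (*-assoc _ _ _) h))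

       ∏φ-∣ : ∀ {d} ds → d ∈ ds → φ d ∣ ∏φ ds
       ∏φ-∣ (d ∷ ds) (here ≡.refl) = ∣-*ʳ _ ∣-refl
       ∏φ-∣ (d ∷ ds) (there m) = ∣-*ˡ _ (∏φ-∣ ds m)

       ∏φ-M : ∀ ds → All (λ d → (0 < d) × P d) ds → M (∏φ ds)
       ∏φ-M [] _ = M-1
       ∏φ-M (d ∷ ds) ((_ , Pd) ∷ as) = M-* _ _ (P.monic Pd) (∏φ-M ds as)

       step : ∀ n → (∀ {d} → d < suc n → 0 < d → P d) → P (suc n)
       step n rec = record { monic = proj₂ mq ; prod = proj₁ mq ; sub = sub }
         where
         pd = properDivisors (suc n)
         good : ∀ m → suc m ≤ suc n → All (λ d → (0 < d) × P d) (properDivisors (suc m))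
         good m le = All.tabulate λ {d} h → let (a , b , _) = pd-∈⁻ m d h in a , rec (ℕP.<-≤-trans b le) a
         div : ∏φ pd ∣ (t ^ suc n - 1#)
         div = key2 pd _ (pd-asc (suc n)) (good n ℕP.≤-refl) (λ d h → let (a , b , c) = pd-∈⁻ n d h in ∣-trans (P.φ∣ (rec b a)) (t-∣ c))
         mq = M-quot n (∏φ-M pd (good n ℕP.≤-refl)) div
         sub : ∀ g k → g ℕ.* k ≡ suc n → 0 < g → 1 < k → φ (suc n) ∣ geom k (t ^ g)
         -- T is t^g - 1 in factored form, and the product over the proper divisors of n equals T C.
         -- Multiplying by T turns the claim φ n · C = geom into t^n - 1 = t^n - 1, and the monic T
         -- cancels.
         sub g@(suc g') k e _ 1<k = divs C (sym (-≈0⇒≈ (M-nzd T MT _ zero-eq)))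
           where
           0<g : 0 < g
           0<g = s≤s z≤n
           g<n : g < suc n
           g<n = ≡.subst (g <_) e (ℕP.m<m*n g k 1<k)
           Pg = rec g<n 0<g
           T = φ g * ∏φ (properDivisors g)
           MT : M T
           MT = M-* _ _ (P.monic Pg) (∏φ-M _ (good g' (ℕP.<⇒≤ g<n)))
           mem : ∀ d → 0 < d → d ≤ g → d ℕD.∣ g → d ∈ pd
           mem d 0<d d≤g dv = pd-∈⁺ n d 0<d (ℕP.≤-<-trans d≤g g<n) (ℕD.∣-trans dv (ℕD.divides k (≡.trans (≡.sym e) (ℕP.*-comm g k))))
           h1 : ∏φ (properDivisors g) ∣ ∏φ pd
           h1 = key2 _ _ (pd-asc g) (good g' (ℕP.<⇒≤ g<n)) (λ d h → let (a , b , c) = pd-∈⁻ g' d h in ∏φ-∣ pd (mem d a (ℕP.<⇒≤ b) c))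
           h2 : φ g ∣ quo h1
           h2 = key3 g (properDivisors g) (quo h1) Pg
             (All.tabulate λ {d} h → let (a , b , _) = pd-∈⁻ g' d h in a , b , rec (ℕP.<-trans b g<n) a)
             (∣-resp (eq h1) (∏φ-∣ pd (mem g 0<g ℕP.≤-refl ℕD.∣-refl)))
           C = quo h2
           zero-eq : T * (φ (suc n) * C - geom k (t ^ g)) ≈ 0#
           zero-eq = trans (solve 5 (λ a b f C G → (a :* b) :* (f :* C :- G) := f :* (b :* (a :* C)) :- (a :* b) :* G) refl
                (φ g) (∏φ (properDivisors g)) (φ (suc n)) C (geom k (t ^ g)))
             (trans (+-cong (trans (*-congˡ (trans (*-congˡ (sym (eq h2))) (sym (eq h1)))) (proj₁ mq))
                      (-‿cong (trans (*-congʳ (P.prod Pg)) (solve 3 (λ u o G → (u :- o) :* G := :- ((o :- u) :* G)) refl (t ^ g) 1# (geom k (t ^ g))))))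
             (trans (+-congˡ (-‿cong (-‿cong (trans (geom-tele k (t ^ g)) (+-congˡ (-‿cong (trans (^-assocʳ t g k) (^-congʳ t e))))))))
             (solve 2 (λ o u → (u :- o) :- (:- (o :- u)) := con 0ℤ) refl 1# (t ^ suc n) ⟨≈⟩ ι-0)))
             where _⟨≈⟩_ = trans

       allP : ∀ n → Acc _<_ n → 0 < n → P n
       allP (suc n) (acc rs) _ = step n (λ {d} lt 0<d → allP d (rs lt) 0<d)

-- The recursively computed cyclotomic polynomials and their roots

module Cyclotomic where
 open Polynomials
 open Division
 open CyclotomicProducts
 open import Data.Nat.Induction using (<-wellFounded)
 open import Induction.WellFounded using (Acc; acc)
 open import Data.List.Relation.Unary.Any using (here; there)
 import Data.List.Relation.Unary.All as All
 open import Data.List.Relation.Unary.AllPairs using ([]; _∷_)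

 open Kit polyZ using () renaming (_^_ to _^ₚ_; _∣_ to _∣ₚ'_; divs to divsₚ)

 module Cyclo (ψ : ℕ → Poly) where
   module E = Exact polyZ Monic monic-1 monic-* monic-nzd monic-torsion tₚ ψ

   module _ (ψ-quot : ∀ n → ψ (suc n) ≡ quotₚ (xnm1 (suc n)) (E.∏φ (properDivisors (suc n)))) where

     quotient : ∀ n → Monic (E.∏φ (properDivisors (suc n))) → E.∏φ (properDivisors (suc n)) ∣ₚ' (tₚ ^ₚ suc n -ₚ (1ℤ ∷ [])) →
                  (ψ (suc n) *ₚ E.∏φ (properDivisors (suc n)) ≋ tₚ ^ₚ suc n -ₚ (1ℤ ∷ [])) × Monic (ψ (suc n))
     quotient n mg (divsₚ h e) = ≡.subst (λ q → (q *ₚ G ≋ tₚ ^ₚ suc n -ₚ (1ℤ ∷ [])) × Monic q) (≡.sym (ψ-quot n))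
             (≋-trans (*ₚ-comm (quotₚ (xnm1 (suc n)) G) G) (≋-trans (≋-sym (proj₁ pm)) (xnm1-t (suc n))) , proj₂ pm)
       where
       G = E.∏φ (properDivisors (suc n))
       pm = quot-exact G (xnm1 (suc n)) mg (monic-xnm1 n) h (≋-trans (xnm1-t (suc n)) e)

     ψ-prod : ∀ n → 0 < n → ψ n *ₚ E.∏φ (properDivisors n) ≋ tₚ ^ₚ n -ₚ (1ℤ ∷ [])
     ψ-prod n 0<n = E.P.prod (E.allP quotient n (<-wellFounded n) 0<n)

 module Fuel (cy : ℕ → ℕ → Poly)
   (cy-suc : ∀ f n → cy (suc f) n ≡ quotₚ (xnm1 n) (prodₚ (map (cy f) (properDivisors n)))) where

   ψ : ℕ → Poly
   ψ n = cy n n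

   open Cyclo ψ

   -- Recursive calls go to proper divisors, so each one still has fuel at least its argument.
   fuel : ∀ f n → suc n ≤ f → Acc _<_ f → cy f (suc n) ≡ ψ (suc n)
   fuel (suc f) n (s≤s n≤f) (acc rs) = ≡.trans (cy-suc f (suc n)) (≡.trans (cong (λ ps → quotₚ (xnm1 (suc n)) (prodₚ ps)) maps) (≡.sym (cy-suc n (suc n))))
     where
     each : ∀ m → n ≤ m → suc m ≤ suc f → ∀ {d} → d ∈ properDivisors (suc n) → cy m d ≡ ψ d
     each m le lt {zero} h = ⊥-elim (ℕP.<-irrefl ≡.refl (proj₁ (pd-∈⁻ n 0 h)))
     each m le lt {suc d} h = fuel m d (ℕP.≤-trans (ℕP.≤-pred (proj₁ (proj₂ (pd-∈⁻ n (suc d) h)))) le) (rs lt)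
     maps : map (cy f) (properDivisors (suc n)) ≡ map (cy n) (properDivisors (suc n))
     maps = ≡.trans (LP.map-cong-local {f = cy f} {g = ψ} (All.tabulate (each f n≤f ℕP.≤-refl)))
       (≡.sym (LP.map-cong-local {f = cy n} {g = ψ} (All.tabulate (each n ℕP.≤-refl (s≤s n≤f)))))

   ∏≡ : ∀ ds → prodₚ (map ψ ds) ≡ E.∏φ ds
   ∏≡ [] = ≡.refl
   ∏≡ (d ∷ ds) = cong (ψ d *ₚ_) (∏≡ ds)

   ψ-quot : ∀ n → ψ (suc n) ≡ quotₚ (xnm1 (suc n)) (E.∏φ (properDivisors (suc n)))
   ψ-quot n = ≡.trans (cy-suc n (suc n)) (cong (quotₚ (xnm1 (suc n))) (≡.trans (cong prodₚ
       (LP.map-cong-local {f = cy n} {g = ψ} (All.tabulate each))) (∏≡ (properDivisors (suc n)))))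
     where
     each : ∀ {d} → d ∈ properDivisors (suc n) → cy n d ≡ ψ d
     each {zero} h = ⊥-elim (ℕP.<-irrefl ≡.refl (proj₁ (pd-∈⁻ n 0 h)))
     each {suc d} h = fuel n d (ℕP.≤-pred (proj₁ (proj₂ (pd-∈⁻ n (suc d) h)))) (<-wellFounded n)

   cyc-prod : ∀ n → 0 < n → ψ n *ₚ E.∏φ (properDivisors n) ≋ tₚ ^ₚ n -ₚ (1ℤ ∷ [])
   cyc-prod = ψ-prod ψ-quot

   module _ (Z : ZRing) where
     open ZRing Z
     open Kit Z

     module _ (ω : Carrier) (n : ℕ) (ω^n≈1 : ω ^ suc n ≈ 1#)
       (ω-nzd : ∀ d → 0 < d → d < suc n → d ℕD.∣ suc n → ∀ y → (ω ^ d - 1#) * y ≈ 0# → y ≈ 0#) where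
       open Eval Z

       private
         ev-prod : ∀ d → 0 < d → ev ω (ψ d) * ev ω (E.∏φ (properDivisors d)) ≈ ω ^ d - 1#
         ev-prod d 0<d = trans (sym (ev-* ω (ψ d) (E.∏φ (properDivisors d)))) (trans (ev-cong ω (cyc-prod d 0<d))
           (trans (ev-- ω (tₚ ^ₚ d) (1ℤ ∷ [])) (+-cong (trans (ev-^ ω tₚ d) (^-congˡ d (ev-t ω))) (-‿cong (ev-1 ω)))))

         nzd : ∀ ds → (∀ d → d ∈ ds → d ∈ properDivisors (suc n)) → ∀ y → ev ω (E.∏φ ds) * y ≈ 0# → y ≈ 0#
         nzd [] h y e = trans (sym (trans (*-congʳ (ev-1 ω)) (*-identityˡ y))) e
         nzd (d ∷ ds) h y e = nzd ds (λ c m → h c (there m)) y (ω-nzd d (proj₁ pd) (proj₁ (proj₂ pd)) (proj₂ (proj₂ pd)) _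
            (trans (*-congʳ (sym (ev-prod d (proj₁ pd)))) (trans (solve 4 (λ a b c y → (a :* b) :* (c :* y) := b :* ((a :* c) :* y)) refl
                (ev ω (ψ d)) (ev ω (E.∏φ (properDivisors d))) (ev ω (E.∏φ ds)) y)
              (trans (*-congˡ (trans (*-congʳ (sym (ev-* ω (ψ d) (E.∏φ ds)))) e)) (zeroʳ _)))))
           where pd = pd-∈⁻ n d (h d (here ≡.refl))

       -- The product of Φ_d(ω) over all divisors d of n is ω^n - 1 = 0. For proper d the factor
       -- Φ_d(ω) divides ω^d - 1, hence is not a zero divisor, and only Φ_n(ω) can account for the
       -- zero.
       cyc-root : ev ω (ψ (suc n)) ≈ 0#
       cyc-root = nzd (properDivisors (suc n)) (λ d m → m) _ (trans (*-comm _ _) (trans (ev-prod (suc n) (s≤s z≤n)) (≈⇒-≈0 ω^n≈1)))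

 module Φcyc = Fuel cyc cyc-suc

-- Coefficients modulo t^N - 1

module CyclicCoefficients where
 open Polynomials
 open import Relation.Binary.PropositionalEquality using (refl)

 private module PK = Kit polyZ
 open IK using (∑<)

 module Coef (N' : ℕ) where
   N : ℕ
   N = suc N'

   δ : ℕ → ℤ
   δ j with N ℕD.∣? j
   ... | yes _ = 1ℤ
   ... | no _ = 0ℤ

   δ-yes : ∀ {j} → N ℕD.∣ j → δ j ≡ 1ℤ
   δ-yes {j} p with N ℕD.∣? j
   ... | yes _ = refl
   ... | no q = ⊥-elim (q p)

   δ-no : ∀ {j} → ¬ (N ℕD.∣ j) → δ j ≡ 0ℤ
   δ-no {j} p with N ℕD.∣? j
   ... | yes q = ⊥-elim (p q)
   ... | no _ = refl

   δ-iff : ∀ {i j} → (N ℕD.∣ i → N ℕD.∣ j) → (N ℕD.∣ j → N ℕD.∣ i) → δ i ≡ δ j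
   δ-iff {i} f g with N ℕD.∣? i
   ... | yes p = ≡.sym (δ-yes (f p))
   ... | no q = ≡.sym (δ-no (λ p → q (g p)))

   δ-per : ∀ j k → δ (j ℕ.+ k ℕ.* N) ≡ δ j
   δ-per j k = δ-iff (λ p → ℕD.∣m+n∣m⇒∣n (≡.subst (N ℕD.∣_) (ℕP.+-comm j _) p) (ℕD.n∣m*n k)) (λ p → ℕD.∣m∣n⇒∣m+n p (ℕD.n∣m*n k))

   -- The coefficient of t^j after reduction modulo t^N - 1. Adding `N'` to an index subtracts one
   -- modulo N without leaving the natural numbers.
   cf : Poly → ℕ → ℤ
   cf [] j = 0ℤ
   cf (a ∷ p) j = a ℤ.* δ j ℤ.+ cf p (j ℕ.+ N')

   cf-zero : ∀ p → p ≋ [] → ∀ j → cf p j ≡ 0ℤ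
   cf-zero [] e j = refl
   cf-zero (a ∷ p) e j = cong₂ ℤ._+_ (cong (ℤ._* δ j) (at e 0)) (cf-zero p (mk≋ λ i → at e (suc i)) _)

   cf-+ : ∀ p q j → cf (p +ₚ q) j ≡ cf p j ℤ.+ cf q j
   cf-+ [] q j = ≡.sym (ℤP.+-identityˡ _)
   cf-+ (a ∷ p) [] j = ≡.sym (ℤP.+-identityʳ _)
   cf-+ (a ∷ p) (b ∷ q) j = ≡.trans (cong (λ z → (a ℤ.+ b) ℤ.* δ j ℤ.+ z) (cf-+ p q _))
     (IK.solve 5 (λ a b d x y → (a IK.:+ b) IK.:* d IK.:+ (x IK.:+ y) IK.:= (a IK.:* d IK.:+ x) IK.:+ (b IK.:* d IK.:+ y)) refl a b (δ j) (cf p (j ℕ.+ N')) (cf q (j ℕ.+ N')))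

   cf-scale : ∀ c p j → cf (scaleₚ c p) j ≡ c ℤ.* cf p j
   cf-scale c [] j = ≡.sym (ℤP.*-zeroʳ c)
   cf-scale c (a ∷ p) j = ≡.trans (cong (λ z → (c ℤ.* a) ℤ.* δ j ℤ.+ z) (cf-scale c p _))
     (IK.solve 4 (λ c a d x → (c IK.:* a) IK.:* d IK.:+ c IK.:* x IK.:= c IK.:* (a IK.:* d IK.:+ x)) refl c a (δ j) (cf p (j ℕ.+ N')))

   cf-neg : ∀ p j → cf (negₚ p) j ≡ ℤ.- cf p j
   cf-neg [] j = refl
   cf-neg (a ∷ p) j = ≡.trans (cong (λ z → (ℤ.- a) ℤ.* δ j ℤ.+ z) (cf-neg p _))
     (IK.solve 3 (λ a d x → (IK.:- a) IK.:* d IK.:+ (IK.:- x) IK.:= IK.:- (a IK.:* d IK.:+ x)) refl a (δ j) (cf p (j ℕ.+ N')))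

   cf-cong : ∀ {p q} → p ≋ q → ∀ j → cf p j ≡ cf q j
   cf-cong {p} {q} e j = ℤP.i-j≡0⇒i≡j _ _ (≡.trans (≡.sym (≡.trans (cf-+ p (negₚ q) j) (cong (λ z → cf p j ℤ.+ z) (cf-neg q j))))
     (cf-zero (p -ₚ q) (≋-trans (+ₚ-cong e (≋-refl {negₚ q})) (+ₚ-inverseʳ q)) j))

   cf-const* : ∀ c p j → cf (constₚ c *ₚ p) j ≡ c ℤ.* cf p j
   cf-const* c p j = ≡.trans (≡.sym (cf-cong (scale-const c p) j)) (cf-scale c p j)

   cf-per : ∀ p j k → cf p (j ℕ.+ k ℕ.* N) ≡ cf p j
   cf-per [] j k = refl
   cf-per (a ∷ p) j k = cong₂ (λ u v → a ℤ.* u ℤ.+ v) (δ-per j k)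
     (≡.trans (cong (cf p) (+-*-Solver.solve 3 (λ j k n → j +-*-Solver.:+ k +-*-Solver.:+ n +-*-Solver.:= j +-*-Solver.:+ n +-*-Solver.:+ k) refl j (k ℕ.* N) N'))
        (cf-per p (j ℕ.+ N') k))

   cf-t* : ∀ p j → cf (tₚ *ₚ p) (suc j) ≡ cf p j
   cf-t* p j = ≡.trans (cf-cong (t* p) (suc j)) (≡.trans (ℤP.+-identityˡ _)
     (≡.trans (cong (cf p) (≡.trans (≡.sym (ℕP.+-suc j N')) (cong (j ℕ.+_) (≡.sym (ℕP.*-identityˡ N))))) (cf-per p j 1)))

   cf-t^ : ∀ k p j → cf (tₚ PK.^ k *ₚ p) (k ℕ.+ j) ≡ cf p j
   cf-t^ zero p j = cf-cong (*ₚ-identityˡ p) j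
   cf-t^ (suc k) p j = ≡.trans (cf-cong (*ₚ-assoc tₚ (tₚ PK.^ k) p) (suc (k ℕ.+ j))) (≡.trans (cf-t* (tₚ PK.^ k *ₚ p) (k ℕ.+ j)) (cf-t^ k p j))

   cf-1 : ∀ j → cf (1ℤ ∷ []) j ≡ δ j
   cf-1 j = ≡.trans (ℤP.+-identityʳ _) (ℤP.*-identityˡ (δ j))

   cf-mul : ∀ x {y y'} → (∀ j → cf y j ≡ cf y' j) → ∀ j → cf (x *ₚ y) j ≡ cf (x *ₚ y') j
   cf-mul [] h j = refl
   cf-mul (a ∷ x) {y} {y'} h j = ≡.trans (unf y) (≡.trans (cong₂ ℤ._+_ (cong (a ℤ.*_) (h j)) (cf-mul x h (j ℕ.+ N'))) (≡.sym (unf y')))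
     where
     unf : ∀ y → cf ((a ∷ x) *ₚ y) j ≡ a ℤ.* cf y j ℤ.+ cf (x *ₚ y) (j ℕ.+ N')
     unf y = ≡.trans (cf-+ (scaleₚ a y) (0ℤ ∷ (x *ₚ y)) j) (cong₂ ℤ._+_ (cf-scale a y j) (ℤP.+-identityˡ _))

   cf-∷ : ∀ a x y j → cf ((a ∷ x) *ₚ y) j ≡ a ℤ.* cf y j ℤ.+ cf (x *ₚ y) (j ℕ.+ N')
   cf-∷ a x y j = ≡.trans (cf-+ (scaleₚ a y) (0ℤ ∷ (x *ₚ y)) j) (cong₂ ℤ._+_ (cf-scale a y j) (ℤP.+-identityˡ _))

   Unit : ℕ → Set
   Unit a = ∃ λ a' → ∃ λ k → a ℕ.* a' ≡ 1 ℕ.+ k ℕ.* N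

   unit-∣ : ∀ {a} → Unit a → ∀ j → N ℕD.∣ a ℕ.* j → N ℕD.∣ j
   unit-∣ {a} (a' , k , e) j d = ℕD.∣m+n∣m⇒∣n {N} {k ℕ.* N ℕ.* j} (≡.subst (N ℕD.∣_) eq (ℕD.∣n⇒∣m*n a' d)) (ℕD.∣m⇒∣m*n j (ℕD.n∣m*n k))
     where
     open +-*-Solver
     eq : a' ℕ.* (a ℕ.* j) ≡ k ℕ.* N ℕ.* j ℕ.+ j
     eq = ≡.trans (solve 3 (λ a a' j → a' :* (a :* j) := (a :* a') :* j) refl a a' j) (≡.trans (cong (ℕ._* j) e)
        (solve 2 (λ kn j → (con 1 :+ kn) :* j := kn :* j :+ j) refl (k ℕ.* N) j))

   open Eval polyZ using (ev)

   sub : ℕ → Poly → Poly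
   sub a = ev (tₚ PK.^ a)

   cf-const+ : ∀ b q j → cf (constₚ b +ₚ q) j ≡ b ℤ.* δ j ℤ.+ cf q j
   cf-const+ b q j = ≡.trans (cf-+ (constₚ b) q j) (cong (λ z → z ℤ.+ cf q j) (ℤP.+-identityʳ (b ℤ.* δ j)))

   -- Multiplication by a unit permutes the residues modulo N, so the substitution of t^a for t
   -- merely relabels coefficients.
   cf-sub : ∀ a → Unit a → ∀ z j → cf (sub a z) (a ℕ.* j) ≡ cf z j
   cf-sub a u [] j = refl
   cf-sub a u (b ∷ z) j = ≡.trans (cf-const+ b (tₚ PK.^ a *ₚ sub a z) (a ℕ.* j)) (cong₂ (λ x y → b ℤ.* x ℤ.+ y)
       (δ-iff (unit-∣ {a} u j) (ℕD.∣n⇒∣m*n a))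
       (≡.trans (≡.sym (cf-per (tₚ PK.^ a *ₚ sub a z) (a ℕ.* j) a)) (≡.trans (cong (cf (tₚ PK.^ a *ₚ sub a z)) eq)
         (≡.trans (cf-t^ a (sub a z) (a ℕ.* (j ℕ.+ N'))) (cf-sub a u z (j ℕ.+ N'))))))
     where
     open +-*-Solver
     eq : a ℕ.* j ℕ.+ a ℕ.* N ≡ a ℕ.+ a ℕ.* (j ℕ.+ N')
     eq = solve 3 (λ a j n → a :* j :+ a :* (con 1 :+ n) := a :+ a :* (j :+ n)) refl a j N'

   cf-sub0 : ∀ a → Unit a → ∀ z → (∀ j → cf z j ≡ 0ℤ) → ∀ j → cf (sub a z) j ≡ 0ℤ
   cf-sub0 a u@(a' , k , e) z h j = ≡.trans (≡.sym (cf-per (sub a z) j (k ℕ.* j))) (≡.trans (cong (cf (sub a z)) eq) (≡.trans (cf-sub a u z (a' ℕ.* j)) (h _)))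
     where
     open +-*-Solver
     eq : j ℕ.+ k ℕ.* j ℕ.* N ≡ a ℕ.* (a' ℕ.* j)
     eq = ≡.sym (≡.trans (≡.sym (ℕP.*-assoc a a' j)) (≡.trans (cong (ℕ._* j) e) (solve 3 (λ k n j → (con 1 :+ k :* n) :* j := j :+ k :* j :* n) refl k N j)))

   cyc-shift : ∀ (F : ℕ → ℤ) → (∀ j → F (j ℕ.+ N) ≡ F j) → ∑< N (λ j → F (suc j)) ≡ ∑< N F
   cyc-shift F per = ≡.sym (≡.trans (IK.∑<-first N' F) (≡.trans (ℤP.+-comm (F 0) _) (cong (λ z → ∑< N' (λ j → F (suc j)) ℤ.+ z) (≡.sym (per 0)))))

   δ-small : ∀ j → suc j < N → δ (suc j) ≡ 0ℤ
   δ-small j lt = δ-no (ℕD.>⇒∤ lt)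

   cf-conj : ∀ y k → cf (sub N' y) k ≡ ∑< N (λ j → δ (j ℕ.+ k) ℤ.* cf y j)
   cf-conj [] k = ≡.sym (≡.trans (IK.∑<-cong N (λ j _ → ℤP.*-zeroʳ (δ (j ℕ.+ k)))) (IK.∑<-0 N))
   cf-conj (b ∷ y) k = ≡.trans (cf-const+ b (tₚ PK.^ N' *ₚ sub N' y) k) (≡.trans (cong (λ z → b ℤ.* δ k ℤ.+ z) shift)
       (≡.sym (≡.trans (IK.∑<-cong N (λ j _ → IK.solve 4 (λ d b e c → d IK.:* (b IK.:* e IK.:+ c) IK.:= b IK.:* (d IK.:* e) IK.:+ d IK.:* c) refl (δ (j ℕ.+ k)) b (δ j) (cf y (j ℕ.+ N'))))
         (≡.trans (IK.∑<-+ N _ _) (cong₂ ℤ._+_ first refl)))))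
     where
     open +-*-Solver
     first : ∑< N (λ j → b ℤ.* (δ (j ℕ.+ k) ℤ.* δ j)) ≡ b ℤ.* δ k
     first = ≡.trans (≡.sym (IK.∑<-*ˡ N b _)) (cong (b ℤ.*_) (≡.trans (IK.∑<-first N' (λ j → δ (j ℕ.+ k) ℤ.* δ j))
       (≡.trans (cong₂ ℤ._+_ (≡.trans (cong (δ k ℤ.*_) (δ-yes (N ℕD.∣0))) (ℤP.*-identityʳ (δ k)))
          (≡.trans (IK.∑<-cong N' (λ j lt → ≡.trans (cong (δ (suc j ℕ.+ k) ℤ.*_) (δ-small j (s≤s lt))) (ℤP.*-zeroʳ (δ (suc j ℕ.+ k))))) (IK.∑<-0 N')))
          (ℤP.+-identityʳ (δ k)))))
     F : ℕ → ℤ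
     F j = δ (j ℕ.+ k) ℤ.* cf y (j ℕ.+ N')
     second : ∑< N F ≡ ∑< N (λ j → δ (j ℕ.+ suc k) ℤ.* cf y j)
     second = ≡.trans (≡.sym (cyc-shift F (λ j → cong₂ ℤ._*_
          (≡.trans (cong δ (solve 3 (λ j n k → (j :+ (con 1 :+ n)) :+ k := (j :+ k) :+ con 1 :* (con 1 :+ n)) refl j N' k)) (δ-per (j ℕ.+ k) 1))
          (≡.trans (cong (cf y) (solve 2 (λ j n → (j :+ (con 1 :+ n)) :+ n := (j :+ n) :+ con 1 :* (con 1 :+ n)) refl j N')) (cf-per y (j ℕ.+ N') 1)))))
       (IK.∑<-cong N (λ j _ → cong₂ ℤ._*_ (cong δ (≡.sym (ℕP.+-suc j k)))
          (≡.trans (cong (cf y) (solve 2 (λ j n → (con 1 :+ j) :+ n := j :+ con 1 :* (con 1 :+ n)) refl j N')) (cf-per y j 1))))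
     shift : cf (tₚ PK.^ N' *ₚ sub N' y) k ≡ ∑< N F
     shift = ≡.trans (≡.sym (cf-per (tₚ PK.^ N' *ₚ sub N' y) k 1)) (≡.trans (cong (cf (tₚ PK.^ N' *ₚ sub N' y)) (solve 2 (λ k n → k :+ con 1 :* (con 1 :+ n) := n :+ (con 1 :+ k)) refl k N'))
       (≡.trans (cf-t^ N' (sub N' y) (suc k)) (≡.trans (cf-conj y (suc k)) (≡.sym second))))

   -- The substitution t ↦ t^(N-1) is inversion of exponents, so the product is a correlation. For x
   -- = y and k = 0 it is a sum of squares, the only source of positivity in the proof.
   cf-conv : ∀ x y k → cf (x *ₚ sub N' y) k ≡ ∑< N (λ j → cf x (j ℕ.+ k) ℤ.* cf y j)
   cf-conv [] y k = ≡.sym (IK.∑<-0 N)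
   cf-conv (a ∷ x) y k = ≡.trans (cf-∷ a x (sub N' y) k) (≡.trans (cong₂ ℤ._+_
       (≡.trans (cong (a ℤ.*_) (cf-conj y k)) (IK.∑<-*ˡ N a (λ j → δ (j ℕ.+ k) ℤ.* cf y j)))
       (≡.trans (cf-conv x y (k ℕ.+ N')) (IK.∑<-cong N (λ j _ → cong (λ i → cf x i ℤ.* cf y j) (≡.sym (ℕP.+-assoc j k N'))))))
     (≡.trans (≡.sym (IK.∑<-+ N _ _)) (IK.∑<-cong N (λ j _ → IK.solve 4 (λ a d c e → a IK.:* (d IK.:* c) IK.:+ e IK.:* c IK.:= (a IK.:* d IK.:+ e) IK.:* c) refl a (δ (j ℕ.+ k)) (cf y j) (cf x (j ℕ.+ k ℕ.+ N'))))))

-- The cyclotomic ring as a quotient, with its trace and positive form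

module CyclotomicIntegers where
 open Polynomials using (module Eval)

 open IK using () renaming (∑< to ∑ℤ)

 sq≥0 : ∀ x → 0ℤ ℤ.≤ x ℤ.* x
 sq≥0 (+ n) = ≡.subst (0ℤ ℤ.≤_) (ℤP.pos-* n n) (ℤ.+≤+ z≤n)
 sq≥0 -[1+ n ] = ℤ.+≤+ z≤n

 sq≥1 : ∀ x → ¬ (x ≡ 0ℤ) → 1ℤ ℤ.≤ x ℤ.* x
 sq≥1 (+ zero) h = ⊥-elim (h ≡.refl)
 sq≥1 (+ suc n) h = ℤ.+≤+ (s≤s z≤n)
 sq≥1 -[1+ n ] h = ℤ.+≤+ (s≤s z≤n)

 ∑ℤ≥0 : ∀ n (F : ℕ → ℤ) → (∀ j → 0ℤ ℤ.≤ F j) → 0ℤ ℤ.≤ ∑ℤ n F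
 ∑ℤ≥0 zero F h = ℤP.≤-refl
 ∑ℤ≥0 (suc n) F h = ℤP.+-mono-≤ (∑ℤ≥0 n F h) (h n)

 ∑ℤ-first : ∀ n F → (∀ i → 0 < i → i < suc n → F i ≡ 0ℤ) → ∑ℤ (suc n) F ≡ F 0
 ∑ℤ-first n F h = ≡.trans (IK.∑<-first n F) (≡.trans (cong (λ z → F 0 ℤ.+ z) (≡.trans (IK.∑<-cong n (λ i lt → h (suc i) (s≤s z≤n) (s≤s lt))) (IK.∑<-0 n))) (ℤP.+-identityʳ _))

 erase : ℕ → (ℕ → ℤ) → ℕ → ℤ
 erase a F j with j ℕ.≟ a
 ... | yes _ = 0ℤ
 ... | no _ = F j

 erase-≢ : ∀ a F {j} → ¬ (j ≡ a) → erase a F j ≡ F j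
 erase-≢ a F {j} ne with j ℕ.≟ a
 ... | yes e = ⊥-elim (ne e)
 ... | no _ = ≡.refl

 erase-≡ : ∀ a F → erase a F a ≡ 0ℤ
 erase-≡ a F with a ℕ.≟ a
 ... | yes _ = ≡.refl
 ... | no ne = ⊥-elim (ne ≡.refl)

 erase≥0 : ∀ a F → (∀ j → 0ℤ ℤ.≤ F j) → ∀ j → 0ℤ ℤ.≤ erase a F j
 erase≥0 a F h j with j ℕ.≟ a
 ... | yes _ = ℤP.≤-refl
 ... | no _ = h j

 ∑ℤ-erase : ∀ n a F → a < n → ∑ℤ n F ≡ F a ℤ.+ ∑ℤ n (erase a F)
 ∑ℤ-erase (suc n) a F a<n with a ℕ.≟ n
 ... | yes ≡.refl = ≡.trans (ℤP.+-comm _ (F n)) (cong (λ z → F n ℤ.+ z) (≡.trans (IK.∑<-cong n (λ i lt → ≡.sym (erase-≢ n F (ℕP.<⇒≢ lt))))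
         (≡.sym (≡.trans (cong (λ z → ∑ℤ n (erase n F) ℤ.+ z) (erase-≡ n F)) (ℤP.+-identityʳ _)))))
 ... | no a≢n = ≡.trans (cong₂ ℤ._+_ (∑ℤ-erase n a F (ℕP.≤∧≢⇒< (ℕP.≤-pred a<n) a≢n)) (≡.sym (erase-≢ a F (λ e → a≢n (≡.sym e))))) (ℤP.+-assoc (F a) _ _)

 find≢0 : ∀ n (F : ℕ → ℤ) → (∀ i → i < n → F i ≡ 0ℤ) ⊎ (∃ λ i → i < n × ¬ (F i ≡ 0ℤ))
 find≢0 zero F = inj₁ λ i ()
 find≢0 (suc n) F with find≢0 n F
 ... | inj₂ (i , lt , ne) = inj₂ (i , ℕP.m<n⇒m<1+n lt , ne)
 ... | inj₁ h with F n ℤ.≟ 0ℤ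
 ... | no ne = inj₂ (n , ℕP.n<1+n n , ne)
 ... | yes e = inj₁ λ i lt → case i lt
   where
   case : ∀ i → i < suc n → F i ≡ 0ℤ
   case i lt with i ℕ.≟ n
   ... | yes ≡.refl = e
   ... | no ne = h i (ℕP.≤∧≢⇒< (ℕP.≤-pred lt) ne)

 ∑-zero-another : ∀ n (F : ℕ → ℤ) → ∑ℤ (suc n) F ≡ 0ℤ → ¬ (F 0 ≡ 0ℤ) → ∃ λ i → 0 < i × i < suc n × ¬ (F i ≡ 0ℤ)
 ∑-zero-another n F e ne with find≢0 n (λ i → F (suc i))
 ... | inj₂ (i , lt , h) = suc i , s≤s z≤n , s≤s lt , h
 ... | inj₁ h = ⊥-elim (ne (≡.trans (≡.sym (∑ℤ-first n F (λ { (suc i) _ (s≤s lt) → h i lt }))) e))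

 record CoefData : Set₁ where
   field
     P : ZRing
     N' : ℕ
   open ZRing P public
   open Kit P public
   N : ℕ
   N = suc N'
   Unit : ℕ → Set
   Unit a = ∃ λ a' → ∃ λ k → a ℕ.* a' ≡ 1 ℕ.+ k ℕ.* N
   field
     t : Carrier
     rep : Carrier → Poly
     rep-ev : ∀ x → Eval.ev P t (rep x) ≈ x
     δ : ℕ → ℤ
     δ-yes : ∀ {j} → N ℕD.∣ j → δ j ≡ 1ℤ
     δ-no : ∀ {j} → ¬ (N ℕD.∣ j) → δ j ≡ 0ℤ
     cf : Carrier → ℕ → ℤ
     cf-cong : ∀ {x y} → x ≈ y → ∀ j → cf x j ≡ cf y j
     cf-+ : ∀ x y j → cf (x + y) j ≡ cf x j ℤ.+ cf y j
     cf-neg : ∀ x j → cf (- x) j ≡ ℤ.- cf x j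
     cf-const* : ∀ c x j → cf (ι c * x) j ≡ c ℤ.* cf x j
     cf-per : ∀ x j k → cf x (j ℕ.+ k ℕ.* N) ≡ cf x j
     cf-t^ : ∀ k x j → cf (t ^ k * x) (k ℕ.+ j) ≡ cf x j
     cf-1 : ∀ j → cf 1# j ≡ δ j
     cf-mul : ∀ x {y y'} → (∀ j → cf y j ≡ cf y' j) → ∀ j → cf (x * y) j ≡ cf (x * y') j
     sub : ℕ → Carrier → Carrier
     sub-cong : ∀ a {x y} → x ≈ y → sub a x ≈ sub a y
     sub-+ : ∀ a x y → sub a (x + y) ≈ sub a x + sub a y
     sub-* : ∀ a x y → sub a (x * y) ≈ sub a x * sub a y
     sub-ι : ∀ a c → sub a (ι c) ≈ ι c
     sub-t : ∀ a → sub a t ≈ t ^ a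
     cf-sub0 : ∀ a → Unit a → ∀ z → (∀ j → cf z j ≡ 0ℤ) → ∀ j → cf (sub a z) j ≡ 0ℤ
     cf-sub : ∀ a → Unit a → ∀ z j → cf (sub a z) (a ℕ.* j) ≡ cf z j
     cf-conv : ∀ x y k → cf (x * sub N' y) k ≡ ∑ℤ N (λ j → cf x (j ℕ.+ k) ℤ.* cf y j)

 -- `GH` expresses the independence of the root of unity t^G of order p₁ and t^H of order p₂; `divN`
 -- says that no other primes divide N.
 module Ring (D : CoefData) (p₁ p₂ G H : ℕ)
   (N≡₁ : suc (CoefData.N' D) ≡ p₁ ℕ.* G) (N≡₂ : suc (CoefData.N' D) ≡ p₂ ℕ.* H) (3≤p₁ : 3 ≤ p₁) (3≤p₂ : 3 ≤ p₂)
   (GH : ∀ i j → suc (CoefData.N' D) ℕD.∣ i ℕ.* G ℕ.+ j ℕ.* H → (p₁ ℕD.∣ i) × (p₂ ℕD.∣ j))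
   (divN : ∀ k → k ℕD.∣ suc (CoefData.N' D) → 1 < k → (p₁ ℕD.∣ k) ⊎ (p₂ ℕD.∣ k)) where
   open CoefData D

   infix 4 _∼_ _≈R_
   record _∼_ (x y : Carrier) : Set where
     constructor mk∼
     field at∼ : ∀ j → cf x j ≡ cf y j
   open _∼_ public

   ≈⇒∼ : ∀ {x y} → x ≈ y → x ∼ y
   ≈⇒∼ e = mk∼ (cf-cong e)
   ∼-refl : ∀ {x} → x ∼ x
   ∼-refl = mk∼ λ j → ≡.refl
   ∼-sym : ∀ {x y} → x ∼ y → y ∼ x
   ∼-sym e = mk∼ λ j → ≡.sym (at∼ e j)
   ∼-trans : ∀ {x y z} → x ∼ y → y ∼ z → x ∼ z
   ∼-trans e f = mk∼ λ j → ≡.trans (at∼ e j) (at∼ f j)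
   ∼-+ : ∀ {x y u v} → x ∼ y → u ∼ v → (x + u) ∼ (y + v)
   ∼-+ e f = mk∼ λ j → ≡.trans (cf-+ _ _ j) (≡.trans (cong₂ ℤ._+_ (at∼ e j) (at∼ f j)) (≡.sym (cf-+ _ _ j)))
   ∼-neg : ∀ {x y} → x ∼ y → (- x) ∼ (- y)
   ∼-neg e = mk∼ λ j → ≡.trans (cf-neg _ j) (≡.trans (cong ℤ.-_ (at∼ e j)) (≡.sym (cf-neg _ j)))
   ∼-*ˡ : ∀ c {x y} → x ∼ y → (c * x) ∼ (c * y)
   ∼-*ˡ c e = mk∼ (cf-mul c (at∼ e))
   ∼-*ʳ : ∀ c {x y} → x ∼ y → (x * c) ∼ (y * c)
   ∼-*ʳ c {x} {y} e = ∼-trans (≈⇒∼ (*-comm x c)) (∼-trans (∼-*ˡ c e) (≈⇒∼ (*-comm c y)))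
   ∼-* : ∀ {x y u v} → x ∼ y → u ∼ v → (x * u) ∼ (y * v)
   ∼-* {x} {y} {u} {v} e f = ∼-trans (∼-*ˡ x f) (∼-*ʳ v e)
   ∼-sub : ∀ a → Unit a → ∀ {x y} → x ∼ y → sub a x ∼ sub a y
   ∼-sub a u {x} {y} e = mk∼ λ j → ℤP.i-j≡0⇒i≡j _ _ (≡.trans (≡.sym (≡.trans (cf-+ _ _ j) (cong (λ z → cf (sub a x) j ℤ.+ z) (cf-neg _ j))))
       (≡.trans (cf-cong sub-- j) (cf-sub0 a u (x - y) (λ i → ≡.trans (cf-+ x (- y) i) (≡.trans (cong₂ ℤ._+_ (at∼ e i) (cf-neg y i)) (ℤP.+-inverseʳ (cf y i)))) j)))
     where
     sub-- : sub a x - sub a y ≈ sub a (x - y)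
     sub-- = sym (trans (sub-+ a x (- y)) (+-congˡ (trans (sub-cong a (sym (solve 1 (λ y → con (ℤ.- 1ℤ) :* y := :- y) refl y)))
         (trans (sub-* a _ y) (trans (*-congʳ (sub-ι a (ℤ.- 1ℤ))) (solve 1 (λ y → con (ℤ.- 1ℤ) :* y := :- y) refl (sub a y)))))))

   ∼0-tor : ∀ k {x} → ¬ (k ≡ 0ℤ) → (ι k * x) ∼ 0# → x ∼ 0#
   ∼0-tor k {x} k≢0 e = mk∼ λ j → ≡.trans (ℤP.*-cancelˡ-≡ k (cf x j) 0ℤ {{ℤ.≢-nonZero k≢0}} (≡.trans (≡.sym (cf-const* k x j)) (≡.trans (at∼ e j) (≡.trans (cf-cong (sym (zeroʳ (ι k))) j) (≡.trans (cf-const* k 0# j) (cong (k ℤ.*_) (z0 j))))))) (≡.sym (z0 j))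
     where
     z0 : ∀ j → cf 0# j ≡ 0ℤ
     z0 j = ≡.trans (cf-cong (sym (trans (*-congʳ ι-0) (zeroˡ 1#))) j) (cf-const* 0ℤ 1# j)

   cf-0 : ∀ j → cf 0# j ≡ 0ℤ
   cf-0 j = ≡.trans (cf-cong (sym (trans (*-congʳ ι-0) (zeroˡ 1#))) j) (cf-const* 0ℤ 1# j)

   ∼-diff : ∀ {x y} → (x - y) ∼ 0# → x ∼ y
   ∼-diff {x} {y} e = mk∼ λ j → ℤP.i-j≡0⇒i≡j _ _ (≡.trans (≡.sym (≡.trans (cf-+ x (- y) j) (cong (λ z → cf x j ℤ.+ z) (cf-neg y j)))) (≡.trans (at∼ e j) (cf-0 j)))

   t^N∼1 : t ^ N ∼ 1#
   t^N∼1 = mk∼ λ j → ≡.trans (≡.sym (cf-per (t ^ N) j 1)) (≡.trans (cong (cf (t ^ N)) (≡.trans (ℕP.+-comm j _) (cong (ℕ._+ j) (ℕP.*-identityˡ N))))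
      (≡.trans (cf-cong (sym (*-identityʳ (t ^ N))) _) (cf-t^ N 1# j)))

   t^kN∼1 : ∀ k → t ^ (k ℕ.* N) ∼ 1#
   t^kN∼1 zero = ∼-refl
   t^kN∼1 (suc k) = ∼-trans (≈⇒∼ (^-homo-* t N (k ℕ.* N))) (∼-trans (∼-* t^N∼1 (t^kN∼1 k)) (≈⇒∼ (*-identityˡ 1#)))

   -- `Ng` and `Nh` sum the subgroups of order p₁ and p₂. A character of the cyclic group is
   -- faithful exactly when it is non-trivial on both, so `ê` is p₁p₂ times the idempotent of the
   -- primitive characters, and over ℚ it generates the same ideal as `κ`.
   g h κ Ng Nh ê : Carrier
   g = t ^ G
   h = t ^ H
   κ = (1# - g) * (1# - h)
   Ng = geom p₁ g
   Nh = geom p₂ h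
   ê = (c# p₁ - Ng) * (c# p₂ - Nh)

   g^p∼1 : g ^ p₁ ∼ 1#
   g^p∼1 = ∼-trans (≈⇒∼ (trans (^-assocʳ t G p₁) (^-congʳ t (≡.trans (ℕP.*-comm G p₁) (≡.sym N≡₁))))) t^N∼1
   h^p∼1 : h ^ p₂ ∼ 1#
   h^p∼1 = ∼-trans (≈⇒∼ (trans (^-assocʳ t H p₂) (^-congʳ t (≡.trans (ℕP.*-comm H p₂) (≡.sym N≡₂))))) t^N∼1

   [1-u]N∼0 : ∀ u p → u ^ p ∼ 1# → ((1# - u) * geom p u) ∼ 0#
   [1-u]N∼0 u p e = ∼-trans (≈⇒∼ (geom-tele p u)) (∼-trans (∼-+ ∼-refl (∼-neg e)) (≈⇒∼ (x-x≈0 1#)))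

   κNg∼0 : (κ * Ng) ∼ 0#
   κNg∼0 = ∼-trans (≈⇒∼ (solve 3 (λ a b c → (a :* b) :* c := b :* (a :* c)) refl (1# - g) (1# - h) Ng)) (∼-trans (∼-*ˡ _ ([1-u]N∼0 g p₁ g^p∼1)) (≈⇒∼ (zeroʳ _)))
   κNh∼0 : (κ * Nh) ∼ 0#
   κNh∼0 = ∼-trans (≈⇒∼ (*-assoc _ _ _)) (∼-trans (∼-*ˡ _ ([1-u]N∼0 h p₂ h^p∼1)) (≈⇒∼ (zeroʳ _)))

   record _≈R_ (x y : Carrier) : Set where
     constructor mkR
     field unR : (x * κ) ∼ (y * κ)
   open _≈R_ public

   ≈⇒R : ∀ {x y} → x ≈ y → x ≈R y
   ≈⇒R e = mkR (≈⇒∼ (*-congʳ e))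
   ∼⇒R : ∀ {x y} → x ∼ y → x ≈R y
   ∼⇒R e = mkR (∼-*ʳ κ e)
   R-sym : ∀ {x y} → x ≈R y → y ≈R x
   R-sym e = mkR (∼-sym (unR e))
   R-trans : ∀ {x y z} → x ≈R y → y ≈R z → x ≈R z
   R-trans e f = mkR (∼-trans (unR e) (unR f))
   R-+ : ∀ {x y u v} → x ≈R y → u ≈R v → (x + u) ≈R (y + v)
   R-+ e f = mkR (∼-trans (≈⇒∼ (distribʳ κ _ _)) (∼-trans (∼-+ (unR e) (unR f)) (≈⇒∼ (sym (distribʳ κ _ _)))))
   R-neg : ∀ {x y} → x ≈R y → (- x) ≈R (- y)
   R-neg e = mkR (∼-trans (≈⇒∼ (sym (-‿distribˡ-* _ κ))) (∼-trans (∼-neg (unR e)) (≈⇒∼ (-‿distribˡ-* _ κ))))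
   R-* : ∀ {x y u v} → x ≈R y → u ≈R v → (x * u) ≈R (y * v)
   R-* {x} {y} {u} {v} e f = mkR (∼-trans (≈⇒∼ (*-assoc x u κ)) (∼-trans (∼-*ˡ x (unR f))
      (∼-trans (≈⇒∼ (solve 3 (λ x v k → x :* (v :* k) := v :* (x :* k)) refl x v κ)) (∼-trans (∼-*ˡ v (unR e)) (≈⇒∼ (solve 3 (λ y v k → v :* (y :* k) := (y :* v) :* k) refl y v κ))))))

   ringR : ZRing
   ringR = record
     { commRing = record
       { Carrier = Carrier ; _≈_ = _≈R_ ; _+_ = _+_ ; _*_ = _*_ ; -_ = -_ ; 0# = 0# ; 1# = 1#
       ; isCommutativeRing = record
         { isRing = record
           { +-isAbelianGroup = record
             { isGroup = record
               { isMonoid = record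
                 { isSemigroup = record
                   { isMagma = record { isEquivalence = record { refl = ≈⇒R refl ; sym = R-sym ; trans = R-trans } ; ∙-cong = R-+ }
                   ; assoc = λ x y z → ≈⇒R (+-assoc x y z) }
                 ; identity = (λ x → ≈⇒R (+-identityˡ x)) , (λ x → ≈⇒R (+-identityʳ x)) }
               ; inverse = (λ x → ≈⇒R (-‿inverseˡ x)) , (λ x → ≈⇒R (-‿inverseʳ x))
               ; ⁻¹-cong = R-neg }
             ; comm = λ x y → ≈⇒R (+-comm x y) }
           ; *-cong = R-*
           ; *-assoc = λ x y z → ≈⇒R (*-assoc x y z)
           ; *-identity = (λ x → ≈⇒R (*-identityˡ x)) , (λ x → ≈⇒R (*-identityʳ x))
           ; distrib = (λ x y z → ≈⇒R (distribˡ x y z)) , (λ x y z → ≈⇒R (distribʳ x y z)) }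
         ; *-comm = λ x y → ≈⇒R (*-comm x y) } }
     ; ι = ι ; ι-+ = λ a b → ≈⇒R (ι-+ a b) ; ι-* = λ a b → ≈⇒R (ι-* a b) ; ι-neg = λ a → ≈⇒R (ι-neg a) ; ι-0 = ≈⇒R ι-0 ; ι-1 = ≈⇒R ι-1 }

   R-tor : ∀ k x → ¬ (k ≡ 0ℤ) → (ι k * x) ≈R 0# → x ≈R 0#
   R-tor k x k≢0 e = mkR (∼-trans (∼0-tor k k≢0 (∼-trans (≈⇒∼ (sym (*-assoc _ _ _))) (∼-trans (unR e) (≈⇒∼ (zeroˡ κ))))) (≈⇒∼ (sym (zeroˡ κ))))

   Ng≈0 : Ng ≈R 0#
   Ng≈0 = mkR (∼-trans (≈⇒∼ (*-comm Ng κ)) (∼-trans κNg∼0 (≈⇒∼ (sym (zeroˡ κ)))))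
   Nh≈0 : Nh ≈R 0#
   Nh≈0 = mkR (∼-trans (≈⇒∼ (*-comm Nh κ)) (∼-trans κNh∼0 (≈⇒∼ (sym (zeroˡ κ)))))

   c₀ : Carrier → ℤ
   c₀ x = cf x 0

   N∣kN'⇒ : ∀ k → N ℕD.∣ k ℕ.* N' → N ℕD.∣ k
   N∣kN'⇒ k d = ℕD.∣m+n∣m⇒∣n {N} {k ℕ.* N'} (≡.subst (N ℕD.∣_) (≡.trans (ℕP.*-suc k N') (ℕP.+-comm k _)) (ℕD.n∣m*n k)) d

   c₀-mono : ∀ k → c₀ (t ^ k) ≡ δ k
   c₀-mono k = ≡.trans (≡.sym (cf-per (t ^ k) 0 k)) (≡.trans (cong (cf (t ^ k)) (ℕP.*-suc k N')) (≡.trans (cf-cong (sym (*-identityʳ (t ^ k))) _)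
      (≡.trans (cf-t^ k 1# (k ℕ.* N')) (≡.trans (cf-1 _) iff))))
     where
     iff : δ (k ℕ.* N') ≡ δ k
     iff with N ℕD.∣? k
     ... | yes d = ≡.trans (δ-yes (ℕD.∣m⇒∣m*n N' d)) (≡.sym (δ-yes d))
     ... | no nd = ≡.trans (δ-no (λ d → nd (N∣kN'⇒ k d))) (≡.sym (δ-no nd))

   c₀-- : ∀ x y → c₀ (x - y) ≡ c₀ x ℤ.- c₀ y
   c₀-- x y = ≡.trans (cf-+ x (- y) 0) (cong (λ z → c₀ x ℤ.+ z) (cf-neg y 0))

   gh^ : ∀ i j → g ^ i * h ^ j ≈ t ^ (i ℕ.* G ℕ.+ j ℕ.* H)
   gh^ i j = trans (*-cong (trans (^-assocʳ t G i) (^-congʳ t (ℕP.*-comm G i))) (trans (^-assocʳ t H j) (^-congʳ t (ℕP.*-comm H j)))) (sym (^-homo-* t (i ℕ.* G) (j ℕ.* H)))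

   c₀-gh-no : ∀ i j → ¬ ((p₁ ℕD.∣ i) × (p₂ ℕD.∣ j)) → c₀ (g ^ i * h ^ j) ≡ 0ℤ
   c₀-gh-no i j ne = ≡.trans (cf-cong (gh^ i j) 0) (≡.trans (c₀-mono _) (δ-no (λ d → ne (GH i j d))))

   c₀-1 : c₀ 1# ≡ 1ℤ
   c₀-1 = ≡.trans (cf-1 0) (δ-yes (N ℕD.∣0))

   ¬p∣1 : ∀ {p} → 3 ≤ p → ¬ (p ℕD.∣ 1)
   ¬p∣1 {p} 3≤p d = ℕP.<⇒≱ (ℕP.≤-trans (s≤s (s≤s z≤n)) 3≤p) (ℕD.∣⇒≤ d)

   c₀-κ : c₀ κ ≡ 1ℤ
   c₀-κ = ≡.trans (cf-cong (trans (*-cong (+-congˡ (-‿cong (sym (*-identityʳ g)))) (+-congˡ (-‿cong (sym (*-identityʳ h)))))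
         (solve 3 (λ o g h → (o :- g) :* (o :- h) := (o :* o :- o :* h) :- (g :* o :- g :* h)) refl 1# (g ^ 1) (h ^ 1))) 0)
      (≡.trans (c₀-- _ _) (cong₂ ℤ._-_ (≡.trans (c₀-- _ _) (cong₂ ℤ._-_ (≡.trans (cf-cong (*-identityˡ 1#) 0) c₀-1) (c₀-gh-no 0 1 (λ d → ¬p∣1 3≤p₂ (proj₂ d)))))
         (≡.trans (c₀-- _ _) (cong₂ ℤ._-_ (c₀-gh-no 1 0 (λ d → ¬p∣1 3≤p₁ (proj₁ d))) (c₀-gh-no 1 1 (λ d → ¬p∣1 3≤p₁ (proj₁ d)))))))

   -- The constant coefficient of κ is 1, so comparing constant coefficients in k y κ = n κ exhibits
   -- n as a multiple of k.
   R-int : ∀ k y n → (ι k * y) ≈R ι n → k IK.∣ n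
   R-int k y n e = IK.divs (c₀ (y * κ)) (≡.trans (≡.sym (≡.trans (cf-const* n κ 0) (≡.trans (cong (n ℤ.*_) c₀-κ) (ℤP.*-identityʳ n))))
      (≡.trans (≡.sym (at∼ (unR e) 0)) (≡.trans (cf-cong (*-assoc _ _ _) 0) (cf-const* k (y * κ) 0))))

   Kp : Carrier → ℤ
   Kp x = c₀ (x * κ)

   Kp-cong : ∀ {x y} → x ≈R y → Kp x ≡ Kp y
   Kp-cong e = at∼ (unR e) 0
   Kp-+ : ∀ x y → Kp (x + y) ≡ Kp x ℤ.+ Kp y
   Kp-+ x y = ≡.trans (cf-cong (distribʳ κ x y) 0) (cf-+ _ _ 0)
   Kp-neg : ∀ x → Kp (- x) ≡ ℤ.- Kp x
   Kp-neg x = ≡.trans (cf-cong (sym (-‿distribˡ-* x κ)) 0) (cf-neg _ 0)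

   -- Multiplication by κ produces the exponent pairs (i,j), (i,j+1), (i+1,j), (i+1,j+1), of which
   -- only the last can be trivial here. Thus `Kp` detects the inverse of g h among such monomials.
   Kp-gh-no : ∀ i j → ¬ (p₁ ℕD.∣ i) → ¬ (p₂ ℕD.∣ j) → ¬ ((p₁ ℕD.∣ suc i) × (p₂ ℕD.∣ suc j)) → Kp (g ^ i * h ^ j) ≡ 0ℤ
   Kp-gh-no i j a b c = ≡.trans (cf-cong (solve 5 (λ x y o g h → (x :* y) :* ((o :- g) :* (o :- h)) := (o :* o :* (x :* y) :- o :* (x :* (h :* y))) :- (o :* ((g :* x) :* y) :- ((g :* x) :* (h :* y)))) refl (g ^ i) (h ^ j) 1# g h) 0)
      (≡.trans (c₀-- _ _) (cong₂ ℤ._-_ (≡.trans (c₀-- _ _) (cong₂ ℤ._-_ (≡.trans (cf-cong (trans (*-congʳ (*-identityˡ 1#)) (*-identityˡ _)) 0) (c₀-gh-no i j (λ d → a (proj₁ d)))) (≡.trans (cf-cong (*-identityˡ _) 0) (c₀-gh-no i (suc j) (λ d → a (proj₁ d))))))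
         (≡.trans (c₀-- _ _) (cong₂ ℤ._-_ (≡.trans (cf-cong (*-identityˡ _) 0) (c₀-gh-no (suc i) j (λ d → b (proj₂ d)))) (c₀-gh-no (suc i) (suc j) c)))))

   N∣GH : ∀ i j → p₁ ℕD.∣ i → p₂ ℕD.∣ j → N ℕD.∣ i ℕ.* G ℕ.+ j ℕ.* H
   N∣GH i j d e = ℕD.∣m∣n⇒∣m+n (≡.subst (ℕD._∣ (i ℕ.* G)) (≡.sym N≡₁) (ℕD.*-monoˡ-∣ G d)) (≡.subst (ℕD._∣ (j ℕ.* H)) (≡.sym N≡₂) (ℕD.*-monoˡ-∣ H e))

   Kp-gh-yes : ∀ i j → ¬ (p₁ ℕD.∣ i) → ¬ (p₂ ℕD.∣ j) → p₁ ℕD.∣ suc i → p₂ ℕD.∣ suc j → Kp (g ^ i * h ^ j) ≡ 1ℤ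
   Kp-gh-yes i j a b c d = ≡.trans (cf-cong (solve 5 (λ x y o g h → (x :* y) :* ((o :- g) :* (o :- h)) := (o :* o :* (x :* y) :- o :* (x :* (h :* y))) :- (o :* ((g :* x) :* y) :- ((g :* x) :* (h :* y)))) refl (g ^ i) (h ^ j) 1# g h) 0)
      (≡.trans (c₀-- _ _) (cong₂ ℤ._-_ (≡.trans (c₀-- _ _) (cong₂ ℤ._-_ (≡.trans (cf-cong (trans (*-congʳ (*-identityˡ 1#)) (*-identityˡ _)) 0) (c₀-gh-no i j (λ d → a (proj₁ d)))) (≡.trans (cf-cong (*-identityˡ _) 0) (c₀-gh-no i (suc j) (λ d → a (proj₁ d))))))
         (≡.trans (c₀-- _ _) (cong₂ ℤ._-_ (≡.trans (cf-cong (*-identityˡ _) 0) (c₀-gh-no (suc i) j (λ d → b (proj₂ d)))) (≡.trans (cf-cong (gh^ (suc i) (suc j)) 0) (≡.trans (c₀-mono _) (δ-yes (N∣GH (suc i) (suc j) c d))))))))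

   κ∣ê : κ ∣ ê
   κ∣ê = ∣-* (geom-def p₁ g) (geom-def p₂ h)

   -- The constant coefficient averages over all N characters and `ê` retains p₁p₂ times the
   -- primitive ones, so this is p₁p₂/N times the trace of the cyclotomic field.
   T : Carrier → ℤ
   T x = c₀ (x * ê)

   T-cong : ∀ {x y} → x ≈R y → T x ≡ T y
   T-cong {x} {y} e = ≡.trans (cf-cong (re x) 0) (≡.trans (cf-mul (quo κ∣ê) (at∼ (unR e)) 0) (cf-cong (sym (re y)) 0))
     where
     re : ∀ x → x * ê ≈ quo κ∣ê * (x * κ)
     re x = trans (*-congˡ (eq κ∣ê)) (solve 3 (λ x k s → x :* (k :* s) := s :* (x :* k)) refl x κ (quo κ∣ê))
   T-+ : ∀ x y → T (x + y) ≡ T x ℤ.+ T y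
   T-+ x y = ≡.trans (cf-cong (distribʳ ê x y) 0) (cf-+ _ _ 0)
   T-neg : ∀ x → T (- x) ≡ ℤ.- T x
   T-neg x = ≡.trans (cf-cong (sym (-‿distribˡ-* x ê)) 0) (cf-neg _ 0)

   cf-∑ : ∀ n (F : ℕ → Carrier) j → cf (∑< n F) j ≡ ∑ℤ n (λ i → cf (F i) j)
   cf-∑ zero F j = cf-0 j
   cf-∑ (suc n) F j = ≡.trans (cf-+ _ _ j) (cong (ℤ._+ cf (F n) j) (cf-∑ n F j))

   c₀-geom : ∀ p (F : ℕ → Carrier) → 0 < p → c₀ (F 0) ≡ 1ℤ → (∀ i → 0 < i → i < p → c₀ (F i) ≡ 0ℤ) → c₀ (∑< p F) ≡ 1ℤ
   c₀-geom (suc p) F _ h0 h = ≡.trans (cf-∑ (suc p) F 0) (≡.trans (∑ℤ-first p _ h) h0)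

   0<p₁ = ℕP.≤-trans (s≤s z≤n) 3≤p₁
   0<p₂ = ℕP.≤-trans (s≤s z≤n) 3≤p₂
   p∤ : ∀ {p i} → 0 < i → i < p → ¬ (p ℕD.∣ i)
   p∤ {p} {suc i} _ lt d = ℕP.<⇒≱ lt (ℕD.∣⇒≤ d)

   c₀-Ng : c₀ Ng ≡ 1ℤ
   c₀-Ng = c₀-geom p₁ (g ^_) 0<p₁ c₀-1 (λ i a b → ≡.trans (cf-cong (sym (*-identityʳ _)) 0) (c₀-gh-no i 0 (λ d → p∤ a b (proj₁ d))))
   c₀-Nh : c₀ Nh ≡ 1ℤ
   c₀-Nh = c₀-geom p₂ (h ^_) 0<p₂ c₀-1 (λ i a b → ≡.trans (cf-cong (sym (*-identityˡ _)) 0) (c₀-gh-no 0 i (λ d → p∤ a b (proj₂ d))))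
   c₀-NgNh : c₀ (Ng * Nh) ≡ 1ℤ
   c₀-NgNh = ≡.trans (cf-cong (trans (*-comm Ng Nh) (∑<-*ˡ p₁ Nh (g ^_))) 0) (c₀-geom p₁ (λ i → Nh * g ^ i) 0<p₁ (≡.trans (cf-cong (*-identityʳ Nh) 0) c₀-Nh)
      (λ i a b → ≡.trans (cf-cong (trans (*-comm Nh _) (∑<-*ˡ p₂ (g ^ i) (h ^_))) 0) (≡.trans (cf-∑ p₂ (λ j → g ^ i * h ^ j) 0)
         (≡.trans (IK.∑<-cong p₂ (λ j _ → c₀-gh-no i j (λ d → p∤ a b (proj₁ d)))) (IK.∑<-0 p₂)))))

   T-ι : ∀ n → T (ι n) ≡ n ℤ.* ((+ p₁ ℤ.- 1ℤ) ℤ.* (+ p₂ ℤ.- 1ℤ))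
   T-ι n = ≡.trans (cf-const* n ê 0) (cong (n ℤ.*_) (≡.trans (cf-cong (solve 4 (λ a b x y → (a :- x) :* (b :- y) := (a :* b :- a :* y) :- (b :* x :- x :* y)) refl (c# p₁) (c# p₂) Ng Nh) 0)
      (≡.trans (c₀-- _ _) (≡.trans (cong₂ ℤ._-_ (≡.trans (c₀-- _ _) (cong₂ ℤ._-_ (≡.trans (cf-const* (+ p₁) (c# p₂) 0) (cong (+ p₁ ℤ.*_) (≡.trans (cf-cong (sym (*-identityʳ _)) 0) (≡.trans (cf-const* (+ p₂) 1# 0) (cong (+ p₂ ℤ.*_) c₀-1)))))
           (≡.trans (cf-const* (+ p₁) Nh 0) (cong (+ p₁ ℤ.*_) c₀-Nh))))
         (≡.trans (c₀-- _ _) (cong₂ ℤ._-_ (≡.trans (cf-const* (+ p₂) Ng 0) (cong (+ p₂ ℤ.*_) c₀-Ng)) c₀-NgNh)))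
       (IK.solve 2 (λ a b → (a IK.:* (b IK.:* IK.con 1ℤ) IK.:- a IK.:* IK.con 1ℤ) IK.:- (b IK.:* IK.con 1ℤ IK.:- IK.con 1ℤ) IK.:= (a IK.:- IK.con 1ℤ) IK.:* (b IK.:- IK.con 1ℤ)) ≡.refl (+ p₁) (+ p₂))))))

   -- Because κ kills `Ng` and `Nh`, the element `ê` acts on multiples of κ as the integer p₁p₂.
   T-κ : ∀ x → T (x * κ) ≡ (+ p₁ ℤ.* + p₂) ℤ.* Kp x
   T-κ x = ≡.trans (at∼ (∼-trans (≈⇒∼ (solve 6 (λ x k a b u v → (x :* k) :* ((a :- u) :* (b :- v)) := (a :* b) :* (x :* k) :- ((x :* (b :- v)) :* (k :* u) :+ (x :* a) :* (k :* v))) refl x κ (c# p₁) (c# p₂) Ng Nh))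
       (∼-trans (∼-+ (≈⇒∼ (*-congʳ (sym (ι-* (+ p₁) (+ p₂))))) (∼-neg (∼-+ (∼-*ˡ _ κNg∼0) (∼-*ˡ _ κNh∼0)))) (≈⇒∼ (trans (+-congˡ (trans (-‿cong (trans (+-cong (zeroʳ _) (zeroʳ _)) (+-identityˡ 0#))) -0#≈0#)) (+-identityʳ _))))) 0)
     (cf-const* (+ p₁ ℤ.* + p₂) (x * κ) 0)

   sub-^ : ∀ a x n → sub a (x ^ n) ≈ sub a x ^ n
   sub-^ a x zero = trans (sub-cong a (sym ι-1)) (trans (sub-ι a 1ℤ) ι-1)
   sub-^ a x (suc n) = trans (sub-* a x _) (*-congˡ (sub-^ a x n))

   sub-1 : ∀ a → sub a 1# ≈ 1#
   sub-1 a = sub-^ a 1# 0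

   sub-neg : ∀ a x → sub a (- x) ≈ - sub a x
   sub-neg a x = trans (sub-cong a (sym (solve 1 (λ y → con (ℤ.- 1ℤ) :* y := :- y) refl x))) (trans (sub-* a _ x) (trans (*-congʳ (sub-ι a _)) (solve 1 (λ y → con (ℤ.- 1ℤ) :* y := :- y) refl (sub a x))))

   sub-- : ∀ a x y → sub a (x - y) ≈ sub a x - sub a y
   sub-- a x y = trans (sub-+ a x _) (+-congˡ (sub-neg a y))

   sub-t^ : ∀ a k → sub a (t ^ k) ≈ (t ^ k) ^ a
   sub-t^ a k = trans (sub-^ a t k) (trans (^-congˡ k (sub-t a)) (trans (^-assocʳ t a k) (trans (^-congʳ t (ℕP.*-comm a k)) (sym (^-assocʳ t k a)))))

   sub-geom : ∀ a n u → sub a (geom n u) ≈ geom n (sub a u)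
   sub-geom a zero u = trans (sub-cong a (sym ι-0)) (trans (sub-ι a 0ℤ) ι-0)
   sub-geom a (suc n) u = trans (sub-+ a _ _) (+-cong (sub-geom a n u) (sub-^ a u n))

   t^-unit : ∀ a (u : Unit a) k → ((t ^ k) ^ a) ^ proj₁ u ∼ t ^ k
   t^-unit a (a' , m , e) k = ∼-trans (≈⇒∼ (trans (^-assocʳ (t ^ k) a a') (trans (^-congʳ (t ^ k) e) (trans (*-congˡ (trans (^-assocʳ t k (m ℕ.* N)) (^-congʳ t (≡.sym (ℕP.*-assoc k m N))))) refl))))
      (∼-trans (∼-*ˡ (t ^ k) (t^kN∼1 (k ℕ.* m))) (≈⇒∼ (*-identityʳ _)))

   -- both Ng and its image are eigenvectors of g, and p₁ times either equals their product
   Ng-inv : ∀ a → Unit a → ∀ p k → 0 < p → (t ^ k) ^ p ∼ 1# → geom p ((t ^ k) ^ a) ∼ geom p (t ^ k)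
   Ng-inv a ua p k 0<p u^p = ∼-diff (∼0-tor (+ p) (λ e → ℕP.<⇒≢ 0<p (≡.sym (ℤP.+-injective e)))
       (∼-trans (≈⇒∼ (solve 3 (λ p x y → p :* (x :- y) := (p :- y) :* x :- (p :- x) :* y) refl (c# p) M' M))
         (∼-trans (∼-+ z1 (∼-neg z2)) (≈⇒∼ (x-x≈0 0#)))))
     where
     u = t ^ k
     M = geom p u
     M' = geom p (u ^ a)
     z2 : ((c# p - M') * M) ∼ 0#
     z2 = ∼-trans (≈⇒∼ (trans (*-congʳ (trans (eq (geom-def p (u ^ a))) (*-congʳ (eq (1-u∣1-u^ u a))))) (solve 4 (λ a b c d → ((a :* b) :* c) :* d := (b :* c) :* (a :* d)) refl (1# - u) _ _ M)))
        (∼-trans (∼-*ˡ _ ([1-u]N∼0 u p u^p)) (≈⇒∼ (zeroʳ _)))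
     ua^p : (u ^ a) ^ p ∼ 1#
     ua^p = ∼-trans (≈⇒∼ (trans (^-assocʳ u a p) (trans (^-congʳ u (ℕP.*-comm a p)) (sym (^-assocʳ u p a))))) (go a)
       where go : ∀ a → (u ^ p) ^ a ∼ 1#
             go zero = ∼-refl
             go (suc a) = ∼-trans (∼-* u^p (go a)) (≈⇒∼ (*-identityˡ 1#))
     [1-u]M' : ((1# - u) * M') ∼ 0#
     [1-u]M' = ∼-trans (∼-*ʳ M' (∼-+ ∼-refl (∼-neg (∼-sym (t^-unit a ua k))))) (∼-trans (≈⇒∼ (trans (*-congʳ (eq (1-u∣1-u^ (u ^ a) (proj₁ ua)))) (solve 3 (λ a b c → (a :* b) :* c := b :* (a :* c)) refl _ _ M')))
        (∼-trans (∼-*ˡ _ ([1-u]N∼0 (u ^ a) p ua^p)) (≈⇒∼ (zeroʳ _))))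
     z1 : ((c# p - M) * M') ∼ 0#
     z1 = ∼-trans (≈⇒∼ (trans (*-congʳ (eq (geom-def p u))) (solve 3 (λ a b c → (a :* b) :* c := b :* (a :* c)) refl (1# - u) _ M')))
        (∼-trans (∼-*ˡ _ [1-u]M') (≈⇒∼ (zeroʳ _)))

   sub-ê : ∀ a → Unit a → sub a ê ∼ ê
   sub-ê a u = ∼-trans (≈⇒∼ (trans (sub-* a _ _) (*-cong (trans (sub-- a _ _) (+-cong (sub-ι a _) (-‿cong (trans (sub-geom a p₁ g) (gm p₁ (sub-t^ a G))))))
        (trans (sub-- a _ _) (+-cong (sub-ι a _) (-‿cong (trans (sub-geom a p₂ h) (gm p₂ (sub-t^ a H)))))))))
      (∼-* (∼-+ ∼-refl (∼-neg (Ng-inv a u p₁ G 0<p₁ g^p∼1))) (∼-+ ∼-refl (∼-neg (Ng-inv a u p₂ H 0<p₂ h^p∼1))))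
     where
     gm : ∀ n {u v} → u ≈ v → geom n u ≈ geom n v
     gm n e = ∑<-cong n (λ i _ → ^-congˡ i e)

   T-σ : ∀ a → Unit a → ∀ x → T (sub a x) ≡ T x
   T-σ a u x = ≡.trans (≡.sym (at∼ (∼-trans (≈⇒∼ (sub-* a x ê)) (∼-*ˡ (sub a x) (sub-ê a u))) 0))
      (≡.trans (cong (cf (sub a (x * ê))) (≡.sym (ℕP.*-zeroʳ a))) (cf-sub a u (x * ê) 0))

   -- For a unit a, t^k is a power of t^(ka), so 1 - t^k is a multiple of its own image. This lets
   -- the substitution descend to `_≈R_`.
   κ-sub : ∀ a → (u : Unit a) → ∃ λ s → κ ∼ (s * sub a κ)
   κ-sub a u = s₁ * s₂ , ∼-trans (∼-* (part G) (part H)) (≈⇒∼ (trans (solve 4 (λ a b c d → (a :* b) :* (c :* d) := (a :* c) :* (b :* d)) refl s₁ _ s₂ _) (*-congˡ (sym (trans (sub-* a _ _) refl)))))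
     where
     s : ℕ → Carrier
     s k = geom (proj₁ u) ((t ^ k) ^ a)
     s₁ = s G
     s₂ = s H
     part : ∀ k → (1# - t ^ k) ∼ (s k * sub a (1# - t ^ k))
     part k = ∼-trans (∼-+ ∼-refl (∼-neg (∼-sym (t^-unit a u k)))) (≈⇒∼ (trans (sym (geom-tele (proj₁ u) ((t ^ k) ^ a)))
        (trans (*-comm _ _) (*-congˡ (sym (trans (sub-- a 1# (t ^ k)) (+-cong (sub-1 a) (-‿cong (sub-t^ a k)))))))))

   R-σ : ∀ a → Unit a → ∀ {x y} → x ≈R y → sub a x ≈R sub a y
   R-σ a u {x} {y} e = mkR (∼-trans (re x) (∼-trans (∼-*ˡ s (∼-sub a u (unR e))) (∼-sym (re y))))
     where
     s = proj₁ (κ-sub a u)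
     re : ∀ x → (sub a x * κ) ∼ (s * sub a (x * κ))
     re x = ∼-trans (∼-*ˡ (sub a x) (proj₂ (κ-sub a u))) (≈⇒∼ (trans (solve 3 (λ x s k → x :* (s :* k) := s :* (x :* k)) refl (sub a x) s (sub a κ)) (*-congˡ (sym (sub-* a x κ)))))

   N'≥2 : 2 ≤ N'
   N'≥2 = ℕP.≤-pred (ℕP.≤-trans 3≤p₁ (ℕD.∣⇒≤ (ℕD.divides G (≡.trans N≡₁ (ℕP.*-comm p₁ G)))))

   unit-N' : Unit N'
   unit-N' = N' , ℕ.pred N' , go N' N'≥2
     where
     go : ∀ n → 2 ≤ n → n ℕ.* n ≡ 1 ℕ.+ ℕ.pred n ℕ.* suc n
     go (suc n) _ = +-*-Solver.solve 1 (λ n → (con' 1 +' n) *' (con' 1 +' n) =' con' 1 +' n *' (con' 2 +' n)) ≡.refl n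
       where open +-*-Solver renaming (con to con'; _:+_ to _+'_; _:*_ to _*'_; _:=_ to _='_)

   κ̄ : Carrier
   κ̄ = sub N' κ

   -- The weight κ κ̄ makes L(x x̄) the sum of the squares of the coefficients of x κ, a positive
   -- definite form on the quotient; its value at 1 is 4, from the four monomials of κ.
   L : Carrier → ℤ
   L x = c₀ (x * (κ * κ̄))

   L-cong : ∀ {x y} → x ≈R y → L x ≡ L y
   L-cong {x} {y} e = ≡.trans (cf-cong (re x) 0) (≡.trans (cf-mul κ̄ (at∼ (unR e)) 0) (cf-cong (sym (re y)) 0))
     where
     re : ∀ x → x * (κ * κ̄) ≈ κ̄ * (x * κ)
     re x = solve 3 (λ x k s → x :* (k :* s) := s :* (x :* k)) refl x κ κ̄
   L-+ : ∀ x y → L (x + y) ≡ L x ℤ.+ L y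
   L-+ x y = ≡.trans (cf-cong (distribʳ _ x y) 0) (cf-+ _ _ 0)
   L-ι* : ∀ k x → L (ι k * x) ≡ k ℤ.* L x
   L-ι* k x = ≡.trans (cf-cong (*-assoc _ _ _) 0) (cf-const* k _ 0)

   p∤N' : ∀ p X → N ≡ p ℕ.* X → 3 ≤ p → ¬ (p ℕD.∣ N')
   p∤N' p X e 3≤p d = ¬p∣1 3≤p (ℕD.∣m+n∣m⇒∣n {p} {N'} (≡.subst (p ℕD.∣_) (≡.trans (≡.sym e) (ℕP.+-comm 1 N')) (ℕD.m∣m*n X)) d)

   pair∼ : ∀ k → ((1# - t ^ k) * sub N' (1# - t ^ k)) ∼ ((1# - t ^ k) + (1# - (t ^ k) ^ N'))
   pair∼ k = ∼-trans (≈⇒∼ (trans (*-congˡ (trans (sub-- N' 1# (t ^ k)) (+-cong (sub-1 N') (-‿cong (sub-t^ N' k)))))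
         (solve 3 (λ o x y → (o :- x) :* (o :- y) := (o :* (o :- x) :- o :* y) :+ x :* y) refl 1# (t ^ k) ((t ^ k) ^ N'))))
      (∼-trans (∼-+ (≈⇒∼ (+-cong (*-identityˡ _) (-‿cong (*-identityˡ _)))) (∼-trans (≈⇒∼ (trans (^-assocʳ t k N) refl)) (t^kN∼1 k)))
         (≈⇒∼ (solve 3 (λ o x y → ((o :- x) :- y) :+ o := (o :- x) :+ (o :- y)) refl 1# (t ^ k) ((t ^ k) ^ N'))))

   c₀-κκ̄ : c₀ (κ * κ̄) ≡ + 4
   c₀-κκ̄ = ≡.trans (at∼ (∼-trans (≈⇒∼ (trans (*-congˡ (sub-* N' _ _)) (solve 4 (λ a b c d → (a :* b) :* (c :* d) := (a :* c) :* (b :* d)) refl (1# - g) (1# - h) (sub N' (1# - g)) (sub N' (1# - h))))) (∼-* (pair∼ G) (pair∼ H))) 0)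
     (≡.trans (cf-cong (trans (*-cong (+-congʳ (+-congˡ (-‿cong (sym (*-identityʳ g))))) (+-congʳ (+-congˡ (-‿cong (sym (*-identityʳ h))))))
         (solve 5 (λ o a a' b b' → ((o :- a) :+ (o :- a')) :* ((o :- b) :+ (o :- b')) :=
            con (+ 4) :* (o :* o) :+ (con (ℤ.- (+ 2)) :* (o :* b) :+ (con (ℤ.- (+ 2)) :* (o :* b') :+ (con (ℤ.- (+ 2)) :* (a :* o) :+ (con (ℤ.- (+ 2)) :* (a' :* o)
              :+ (con 1ℤ :* (a :* b) :+ (con 1ℤ :* (a :* b') :+ (con 1ℤ :* (a' :* b) :+ con 1ℤ :* (a' :* b'))))))))) refl 1# (g ^ 1) (g ^ N') (h ^ 1) (h ^ N'))) 0)
      (cf-+' (cst (+ 4) (≡.trans (cf-cong (*-identityˡ 1#) 0) c₀-1))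
      (cf-+' (cz _ 0 1 (λ d → ¬p∣1 3≤p₂ (proj₂ d))) (cf-+' (cz _ 0 N' (λ d → q₂ (proj₂ d))) (cf-+' (cz _ 1 0 (λ d → ¬p∣1 3≤p₁ (proj₁ d))) (cf-+' (cz _ N' 0 (λ d → q₁ (proj₁ d)))
        (cf-+' (cz _ 1 1 (λ d → ¬p∣1 3≤p₁ (proj₁ d))) (cf-+' (cz _ 1 N' (λ d → ¬p∣1 3≤p₁ (proj₁ d))) (cf-+' (cz _ N' 1 (λ d → q₁ (proj₁ d))) (cz _ N' N' (λ d → q₁ (proj₁ d))))))))))))
     where
     q₁ = p∤N' p₁ G N≡₁ 3≤p₁
     q₂ = p∤N' p₂ H N≡₂ 3≤p₂
     cf-+' : ∀ {x y a b} → c₀ x ≡ a → c₀ y ≡ b → c₀ (x + y) ≡ a ℤ.+ b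
     cf-+' e f = ≡.trans (cf-+ _ _ 0) (cong₂ ℤ._+_ e f)
     cst : ∀ k {x a} → c₀ x ≡ a → c₀ (ι k * x) ≡ k ℤ.* a
     cst k e = ≡.trans (cf-const* k _ 0) (cong (k ℤ.*_) e)
     cz : ∀ k i j → ¬ ((p₁ ℕD.∣ i) × (p₂ ℕD.∣ j)) → c₀ (ι k * (g ^ i * h ^ j)) ≡ 0ℤ
     cz k i j ne = ≡.trans (cst k (c₀-gh-no i j ne)) (ℤP.*-zeroʳ k)

   L-ι : ∀ n → L (ι n) ≡ n ℤ.* + 4
   L-ι n = ≡.trans (cf-const* n _ 0) (cong (n ℤ.*_) c₀-κκ̄)

   B : Carrier → ℤ
   B x = L (x * sub N' x)

   B-sum : ∀ x → B x ≡ ∑ℤ N (λ j → cf (x * κ) j ℤ.* cf (x * κ) j)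
   B-sum x = ≡.trans (cf-cong (trans (solve 4 (λ x y k l → (x :* y) :* (k :* l) := (x :* k) :* (y :* l)) refl x (sub N' x) κ κ̄) (*-congˡ (sym (sub-* N' x κ)))) 0)
      (≡.trans (cf-conv (x * κ) (x * κ) 0) (IK.∑<-cong N (λ j _ → cong (λ i → cf (x * κ) i ℤ.* cf (x * κ) j) (ℕP.+-identityʳ j))))

   B≥0 : ∀ x → 0ℤ ℤ.≤ B x
   B≥0 x = ≡.subst (0ℤ ℤ.≤_) (≡.sym (B-sum x)) (∑ℤ≥0 N _ (λ j → sq≥0 (cf (x * κ) j)))

   cf-% : ∀ x j → cf x j ≡ cf x (j ℕ.% N)
   cf-% x j = ≡.trans (cong (cf x) (DM.m≡m%n+[m/n]*n j N)) (cf-per x (j ℕ.% N) (j ℕ./ N))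

   %-∣ : ∀ a b c → a ℕ.% N ≡ b ℕ.% N → N ℕD.∣ b ℕ.+ c → N ℕD.∣ a ℕ.+ c
   %-∣ a b c e d = ℕD.m%n≡0⇒n∣m _ N (≡.trans (DM.%-distribˡ-+ a c N) (≡.trans (cong (λ z → (z ℕ.+ c ℕ.% N) ℕ.% N) e) (≡.trans (≡.sym (DM.%-distribˡ-+ b c N)) (ℕD.n∣m⇒m%n≡0 _ N d))))

   module _ (x : Carrier) where
     private
       y = x * κ
       f = cf y

       zsum : ∀ u k p → (y * geom p u) ∼ 0# → u ≈ t ^ k → ∀ j → ∑ℤ p (λ i → f (j ℕ.+ k ℕ.* i ℕ.* N')) ≡ 0ℤ
       zsum u k p e eu j = ≡.trans (IK.∑<-cong p (λ i _ → ≡.sym (term i))) (≡.trans (≡.sym (cf-∑ p (λ i → y * u ^ i) j)) (≡.trans (cf-cong (sym (∑<-*ˡ p y (u ^_))) j) (≡.trans (at∼ e j) (cf-0 j))))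
         where
         term : ∀ i → cf (y * u ^ i) j ≡ f (j ℕ.+ k ℕ.* i ℕ.* N')
         term i = ≡.trans (cf-cong (trans (*-comm y _) (*-congʳ (trans (^-congˡ i eu) (^-assocʳ t k i)))) j)
           (≡.trans (≡.sym (cf-per (t ^ (k ℕ.* i) * y) j (k ℕ.* i))) (≡.trans (cong (cf (t ^ (k ℕ.* i) * y)) (sv j (k ℕ.* i) N')) (cf-t^ (k ℕ.* i) y (j ℕ.+ k ℕ.* i ℕ.* N'))))
           where
           sv : ∀ j c n → j ℕ.+ c ℕ.* suc n ≡ c ℕ.+ (j ℕ.+ c ℕ.* n)
           sv = +-*-Solver.solve 3 (λ j c n → j +' c *' (con' 1 +' n) =' c +' (j +' c *' n)) ≡.refl
             where open +-*-Solver renaming (con to con'; _:+_ to _+'_; _:*_ to _*'_; _:=_ to _='_)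

       zg : ∀ j → ∑ℤ p₁ (λ i → f (j ℕ.+ G ℕ.* i ℕ.* N')) ≡ 0ℤ
       zg = zsum g G p₁ (∼-trans (≈⇒∼ (*-assoc x κ Ng)) (∼-trans (∼-*ˡ x κNg∼0) (≈⇒∼ (zeroʳ x)))) refl
       zh : ∀ j → ∑ℤ p₂ (λ i → f (j ℕ.+ H ℕ.* i ℕ.* N')) ≡ 0ℤ
       zh = zsum h H p₂ (∼-trans (≈⇒∼ (*-assoc x κ Nh)) (∼-trans (∼-*ˡ x κNh∼0) (≈⇒∼ (zeroʳ x)))) refl

       another : ∀ p k j → 0 < p → ∑ℤ p (λ i → f (j ℕ.+ k ℕ.* i ℕ.* N')) ≡ 0ℤ → ¬ (f j ≡ 0ℤ) → ∃ λ i → 0 < i × i < p × ¬ (f (j ℕ.+ k ℕ.* i ℕ.* N') ≡ 0ℤ)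
       another (suc p) k j _ e ne = ∑-zero-another p (λ i → f (j ℕ.+ k ℕ.* i ℕ.* N')) e
         (λ z → ne (≡.trans (cong f (≡.sym (≡.trans (cong (λ w → j ℕ.+ w ℕ.* N') (ℕP.*-zeroʳ k)) (ℕP.+-identityʳ j)))) z))

       coset : ∀ j i → N ℕD.∣ j ℕ.+ j ℕ.* N' ℕ.+ i → N ℕD.∣ i
       coset j i d = ℕD.∣m+n∣m⇒∣n {N} {j ℕ.+ j ℕ.* N'} d (≡.subst (N ℕD.∣_) (ℕP.*-suc j N') (ℕD.n∣m*n j))

       open +-*-Solver using () renaming (solve to slv; con to con'; _:+_ to _+'_; _:*_ to _*'_; _:=_ to _='_)

       -- The coefficients of x κ sum to zero along each coset of ⟨g⟩ and of ⟨h⟩. A nonzero one at j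
       -- forces another along ⟨g⟩ and another along ⟨h⟩, and the former a further one along ⟨h⟩.
       -- `GH` keeps the four positions distinct, and each contributes at least 1.
       four : ∀ j → ¬ (f j ≡ 0ℤ) → + 4 ℤ.≤ ∑ℤ N (λ j → f j ℤ.* f j)
       four j fj with another p₁ G j 0<p₁ (zg j) fj | another p₂ H j 0<p₂ (zh j) fj
       ... | i , 0<i , i<p , f₁ | k , 0<k , k<p , f₂ with another p₂ H (j ℕ.+ G ℕ.* i ℕ.* N') 0<p₂ (zh _) f₁
       ... | l , 0<l , l<p , f₃ = ≡.subst (+ 4 ℤ.≤_) (≡.sym total) (ℤP.+-mono-≤ (one j₀ (nz fj)) (ℤP.+-mono-≤ (one j₁ (nz f₁)) (ℤP.+-mono-≤ (one j₂ (nz f₂)) (ℤP.+-mono-≤ (one j₃ (nz f₃)) rest≥0))))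
         where
         F : ℕ → ℤ
         F j = f j ℤ.* f j
         a b c : ℕ
         a = G ℕ.* i ℕ.* N'
         b = H ℕ.* k ℕ.* N'
         c = H ℕ.* l ℕ.* N'
         J₀ = j
         J₁ = j ℕ.+ a
         J₂ = j ℕ.+ b
         J₃ = j ℕ.+ a ℕ.+ c
         j₀ = J₀ ℕ.% N
         j₁ = J₁ ℕ.% N
         j₂ = J₂ ℕ.% N
         j₃ = J₃ ℕ.% N
         nz : ∀ {m} → ¬ (f m ≡ 0ℤ) → ¬ (f (m ℕ.% N) ≡ 0ℤ)
         nz {m} h e = h (≡.trans (cf-% y m) e)
         one : ∀ m → ¬ (f m ≡ 0ℤ) → 1ℤ ℤ.≤ F m
         one m = sq≥1 (f m)
         p₁∤i = p∤ 0<i i<p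
         p₂∤k = p∤ 0<k k<p
         p₂∤l = p∤ 0<l l<p
         -- an index congruent to j forces N to divide the offset, which is a combination of G and H
         off : ∀ u v → N ℕD.∣ u ℕ.* N' ℕ.* G ℕ.+ v ℕ.* H → p₁ ℕD.∣ u
         off u v d = unN (proj₁ (GH (u ℕ.* N') v d))
           where
           unN : p₁ ℕD.∣ u ℕ.* N' → p₁ ℕD.∣ u
           unN (ℕD.divides q e) = ℕD.∣m+n∣m⇒∣n {p₁} {u ℕ.* N'} (≡.subst (p₁ ℕD.∣_) (≡.trans (cong (u ℕ.*_) (≡.sym N≡₁)) (≡.trans (ℕP.*-suc u N') (ℕP.+-comm u _))) (ℕD.∣n⇒∣m*n u (ℕD.m∣m*n G))) (ℕD.divides q e)
         off' : ∀ u v → N ℕD.∣ u ℕ.* G ℕ.+ v ℕ.* N' ℕ.* H → p₂ ℕD.∣ v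
         off' u v d = unN (proj₂ (GH u (v ℕ.* N') d))
           where
           unN : p₂ ℕD.∣ v ℕ.* N' → p₂ ℕD.∣ v
           unN (ℕD.divides q e) = ℕD.∣m+n∣m⇒∣n {p₂} {v ℕ.* N'} (≡.subst (p₂ ℕD.∣_) (≡.trans (cong (v ℕ.*_) (≡.sym N≡₂)) (≡.trans (ℕP.*-suc v N') (ℕP.+-comm v _))) (ℕD.∣n⇒∣m*n v (ℕD.m∣m*n H))) (ℕD.divides q e)
         base : ∀ w → N ℕD.∣ j ℕ.+ j ℕ.* N'
         base w = ≡.subst (N ℕD.∣_) (ℕP.*-suc j N') (ℕD.n∣m*n j)
         ne01 : ¬ (j₁ ≡ j₀)
         ne01 e = p₁∤i (off i 0 (≡.subst (N ℕD.∣_) (slv 3 (λ G i n → G *' i *' n =' i *' n *' G +' con' 0) ≡.refl G i N')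
            (coset j a (≡.subst (N ℕD.∣_) (slv 3 (λ j a n → (j +' a) +' j *' n =' j +' j *' n +' a) ≡.refl j a N') (%-∣ J₁ J₀ (j ℕ.* N') e (base 0))))))
         ne02 : ¬ (j₂ ≡ j₀)
         ne02 e = p₂∤k (off' 0 k (≡.subst (N ℕD.∣_) (slv 3 (λ H k n → H *' k *' n =' k *' n *' H) ≡.refl H k N')
            (coset j b (≡.subst (N ℕD.∣_) (slv 3 (λ j a n → (j +' a) +' j *' n =' j +' j *' n +' a) ≡.refl j b N') (%-∣ J₂ J₀ (j ℕ.* N') e (base 0))))))
         ne03 : ¬ (j₃ ≡ j₀)
         ne03 e = p₁∤i (off i (l ℕ.* N') (≡.subst (N ℕD.∣_) (slv 5 (λ G i n H l → G *' i *' n +' H *' l *' n =' i *' n *' G +' l *' n *' H) ≡.refl G i N' H l)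
            (coset j (a ℕ.+ c) (≡.subst (N ℕD.∣_) (slv 4 (λ j a c n → (j +' a +' c) +' j *' n =' j +' j *' n +' (a +' c)) ≡.refl j a c N') (%-∣ J₃ J₀ (j ℕ.* N') e (base 0))))))
         base₂ : N ℕD.∣ J₂ ℕ.+ (j ℕ.* N' ℕ.+ H ℕ.* k)
         base₂ = ≡.subst (N ℕD.∣_) (slv 3 (λ j c n → (j +' c) *' (con' 1 +' n) =' (j +' c *' n) +' (j *' n +' c)) ≡.refl j (H ℕ.* k) N') (ℕD.n∣m*n (j ℕ.+ H ℕ.* k))
         ne12 : ¬ (j₁ ≡ j₂)
         ne12 e = p₁∤i (off i k (≡.subst (N ℕD.∣_) (slv 5 (λ G i n H k → G *' i *' n +' H *' k =' i *' n *' G +' k *' H) ≡.refl G i N' H k)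
            (coset j (a ℕ.+ H ℕ.* k) (≡.subst (N ℕD.∣_) (slv 4 (λ j a n c → (j +' a) +' (j *' n +' c) =' j +' j *' n +' (a +' c)) ≡.refl j a N' (H ℕ.* k)) (%-∣ J₁ J₂ (j ℕ.* N' ℕ.+ H ℕ.* k) e base₂)))))
         ne32 : ¬ (j₃ ≡ j₂)
         ne32 e = p₁∤i (off i (l ℕ.* N' ℕ.+ k) (≡.subst (N ℕD.∣_) (slv 6 (λ G i n H l k → G *' i *' n +' H *' l *' n +' H *' k =' i *' n *' G +' (l *' n +' k) *' H) ≡.refl G i N' H l k)
            (coset j (a ℕ.+ c ℕ.+ H ℕ.* k) (≡.subst (N ℕD.∣_) (slv 5 (λ j a c n d → (j +' a +' c) +' (j *' n +' d) =' j +' j *' n +' (a +' c +' d)) ≡.refl j a c N' (H ℕ.* k)) (%-∣ J₃ J₂ (j ℕ.* N' ℕ.+ H ℕ.* k) e base₂)))))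
         ne31 : ¬ (j₃ ≡ j₁)
         ne31 e = p₂∤l (off' 0 l (≡.subst (N ℕD.∣_) (slv 3 (λ H k n → H *' k *' n =' k *' n *' H) ≡.refl H l N')
            (coset J₁ c (≡.subst (N ℕD.∣_) (slv 3 (λ j a n → (j +' a) +' j *' n =' j +' j *' n +' a) ≡.refl J₁ c N') (%-∣ J₃ J₁ (J₁ ℕ.* N') e (≡.subst (N ℕD.∣_) (ℕP.*-suc J₁ N') (ℕD.n∣m*n J₁)))))))
         lt : ∀ m → m ℕ.% N < N
         lt m = DM.m%n<n m N
         F₁ = erase j₀ F
         F₂ = erase j₁ F₁
         F₃ = erase j₂ F₂
         F₄ = erase j₃ F₃
         pos = erase≥0 j₃ F₃ (erase≥0 j₂ F₂ (erase≥0 j₁ F₁ (erase≥0 j₀ F (λ m → sq≥0 (f m)))))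
         rest≥0 : 0ℤ ℤ.≤ ∑ℤ N F₄
         rest≥0 = ∑ℤ≥0 N F₄ pos
         total : ∑ℤ N F ≡ F j₀ ℤ.+ (F j₁ ℤ.+ (F j₂ ℤ.+ (F j₃ ℤ.+ ∑ℤ N F₄)))
         total = ≡.trans (∑ℤ-erase N j₀ F (lt J₀)) (cong (λ z → F j₀ ℤ.+ z) (≡.trans (∑ℤ-erase N j₁ F₁ (lt J₁)) (cong₂ ℤ._+_ (erase-≢ j₀ F ne01)
           (≡.trans (∑ℤ-erase N j₂ F₂ (lt J₂)) (cong₂ ℤ._+_ (≡.trans (erase-≢ j₁ F₁ (λ e → ne12 (≡.sym e))) (erase-≢ j₀ F ne02))
           (≡.trans (∑ℤ-erase N j₃ F₃ (lt J₃)) (cong (λ z → z ℤ.+ ∑ℤ N F₄) (≡.trans (erase-≢ j₂ F₂ ne32) (≡.trans (erase-≢ j₁ F₁ ne31) (erase-≢ j₀ F ne03))))))))))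

     B-min : (x ≈R 0#) ⊎ (+ 4 ℤ.≤ B x)
     B-min with find≢0 N f
     ... | inj₁ z = inj₁ (mkR (mk∼ λ j → ≡.trans (cf-% y j) (≡.trans (z _ (DM.m%n<n j N)) (≡.sym (≡.trans (cf-cong (zeroˡ κ) j) (cf-0 j))))))
     ... | inj₂ (j , _ , ne) = inj₂ (≡.subst (+ 4 ℤ.≤_) (≡.sym (B-sum x)) (four j ne))

-- The interface of the cyclotomic ring

open Polynomials
open CyclotomicIntegers
record UnitMod (N a : ℕ) : Set where
  constructor unit
  field
    inv wit : ℕ
    inv-eq : a ℕ.* inv ≡ 1 ℕ.+ wit ℕ.* N

-- All later arguments speak of ζ through these laws. `int` transfers divisibility between integers
-- from the ring to ℤ, `L` carries the positive form, `T` is the trace up to a factor, and `Kp`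
-- reads off coordinates against Gauss periods.
record CRing (N' p₁ p₂ G H : ℕ) : Set₁ where
  field
    Z : ZRing
  open ZRing Z public
  open Kit Z public
  open Eval Z public
  N : ℕ
  N = suc N'
  Unit : ℕ → Set
  Unit = UnitMod N
  field
    ζ : Carrier
    ζ^N : ζ ^ N ≈ 1#
    rep : Carrier → Poly
    rep-ev : ∀ x → ev ζ (rep x) ≈ x
    σ : ℕ → Carrier → Carrier
    σ-cong : ∀ {a} → Unit a → ∀ {x y} → x ≈ y → σ a x ≈ σ a y
    σ-+ : ∀ a x y → σ a (x + y) ≈ σ a x + σ a y
    σ-* : ∀ a x y → σ a (x * y) ≈ σ a x * σ a y
    σ-ι : ∀ a c → σ a (ι c) ≈ ι c
    σ-ζ : ∀ a → σ a ζ ≈ ζ ^ a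
    unit-N' : Unit N'
    tor : ∀ k x → ¬ (k ≡ 0ℤ) → ι k * x ≈ 0# → x ≈ 0#
    int : ∀ k y n → ι k * y ≈ ι n → Kit._∣_ ℤring k n
    Ng≈0 : geom p₁ (ζ ^ G) ≈ 0#
    Nh≈0 : geom p₂ (ζ ^ H) ≈ 0#
    L : Carrier → ℤ
    L-cong : ∀ {x y} → x ≈ y → L x ≡ L y
    L-+ : ∀ x y → L (x + y) ≡ L x ℤ.+ L y
    L-ι* : ∀ k x → L (ι k * x) ≡ k ℤ.* L x
    L-ι : ∀ n → L (ι n) ≡ n ℤ.* + 4
    B≥0 : ∀ x → 0ℤ ℤ.≤ L (x * σ N' x)
    B-min : ∀ x → (x ≈ 0#) ⊎ (+ 4 ℤ.≤ L (x * σ N' x))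
    T : Carrier → ℤ
    T-cong : ∀ {x y} → x ≈ y → T x ≡ T y
    T-+ : ∀ x y → T (x + y) ≡ T x ℤ.+ T y
    T-neg : ∀ x → T (- x) ≡ ℤ.- T x
    T-ι : ∀ n → T (ι n) ≡ n ℤ.* ((+ p₁ ℤ.- 1ℤ) ℤ.* (+ p₂ ℤ.- 1ℤ))
    T-σ : ∀ a → Unit a → ∀ x → T (σ a x) ≡ T x
    Kp : Carrier → ℤ
    Kp-cong : ∀ {x y} → x ≈ y → Kp x ≡ Kp y
    Kp-+ : ∀ x y → Kp (x + y) ≡ Kp x ℤ.+ Kp y
    Kp-neg : ∀ x → Kp (- x) ≡ ℤ.- Kp x
    T-κ : ∀ x → T (x * ((1# - ζ ^ G) * (1# - ζ ^ H))) ≡ (+ p₁ ℤ.* + p₂) ℤ.* Kp x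
    Kp-no : ∀ i j → ¬ (p₁ ℕD.∣ i) → ¬ (p₂ ℕD.∣ j) → ¬ ((p₁ ℕD.∣ suc i) × (p₂ ℕD.∣ suc j)) → Kp ((ζ ^ G) ^ i * (ζ ^ H) ^ j) ≡ 0ℤ
    Kp-yes : ∀ i j → ¬ (p₁ ℕD.∣ i) → ¬ (p₂ ℕD.∣ j) → p₁ ℕD.∣ suc i → p₂ ℕD.∣ suc j → Kp ((ζ ^ G) ^ i * (ζ ^ H) ^ j) ≡ 1ℤ

module Make (N' p₁ p₂ G H : ℕ)
  (N≡₁ : suc N' ≡ p₁ ℕ.* G) (N≡₂ : suc N' ≡ p₂ ℕ.* H) (3≤p₁ : 3 ≤ p₁) (3≤p₂ : 3 ≤ p₂)
  (GH : ∀ i j → suc N' ℕD.∣ i ℕ.* G ℕ.+ j ℕ.* H → (p₁ ℕD.∣ i) × (p₂ ℕD.∣ j))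
  (divN : ∀ k → k ℕD.∣ suc N' → 1 < k → (p₁ ℕD.∣ k) ⊎ (p₂ ℕD.∣ k)) where

  module C = CyclicCoefficients.Coef N'
  module E = Eval polyZ

  coefData : CoefData
  coefData = record
    { P = polyZ ; N' = N' ; t = tₚ ; rep = λ p → p ; rep-ev = ev-t-id
    ; δ = C.δ ; δ-yes = C.δ-yes ; δ-no = C.δ-no
    ; cf = C.cf ; cf-cong = C.cf-cong ; cf-+ = C.cf-+ ; cf-neg = C.cf-neg ; cf-const* = C.cf-const*
    ; cf-per = C.cf-per ; cf-t^ = C.cf-t^ ; cf-1 = C.cf-1 ; cf-mul = C.cf-mul
    ; sub = C.sub ; sub-cong = λ a → E.ev-cong _ ; sub-+ = λ a → E.ev-+ _ ; sub-* = λ a → E.ev-* _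
    ; sub-ι = λ a → E.ev-const (Kit._^_ polyZ tₚ a) ; sub-t = λ a → E.ev-t (Kit._^_ polyZ tₚ a)
    ; cf-sub0 = C.cf-sub0 ; cf-sub = C.cf-sub ; cf-conv = C.cf-conv }
    where
    ev-t-id : ∀ p → E.ev tₚ p ≋ p
    ev-t-id [] = ≋-refl
    ev-t-id (a ∷ p) = ≋-trans (+ₚ-cong' (*ₚ-congʳ tₚ (ev-t-id p))) (≋-sym (∷-split a p))
      where
      open import Defs using (_+ₚ_)
      +ₚ-cong' : ∀ {q r} → q ≋ r → constₚ a +ₚ q ≋ constₚ a +ₚ r
      +ₚ-cong' = +ₚ-cong (≋-refl {constₚ a})

module Abs (D : CoefData) (p₁ p₂ G H : ℕ)
  (N≡₁ : suc (CoefData.N' D) ≡ p₁ ℕ.* G) (N≡₂ : suc (CoefData.N' D) ≡ p₂ ℕ.* H) (3≤p₁ : 3 ≤ p₁) (3≤p₂ : 3 ≤ p₂)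
  (GH : ∀ i j → suc (CoefData.N' D) ℕD.∣ i ℕ.* G ℕ.+ j ℕ.* H → (p₁ ℕD.∣ i) × (p₂ ℕD.∣ j))
  (divN : ∀ k → k ℕD.∣ suc (CoefData.N' D) → 1 < k → (p₁ ℕD.∣ k) ⊎ (p₂ ℕD.∣ k)) where
  open CoefData D using (N'; t; rep; rep-ev; sub; sub-cong; sub-+; sub-*; sub-ι; sub-t; P)
  module R = CyclotomicIntegers.Ring D p₁ p₂ G H N≡₁ N≡₂ 3≤p₁ 3≤p₂ GH divN
  module ER = Eval R.ringR

  ev-same : ∀ r p → ER.ev r p ≡ Eval.ev P r p
  ev-same r [] = ≡.refl
  ev-same r (a ∷ p) = cong (λ z → ZRing._+_ P (ZRing.ι P a) (ZRing._*_ P r z)) (ev-same r p)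

  private
    module KR = Kit R.ringR
    module KP = Kit P
    open ZRing R.ringR using (reflexive; trans; sym; *-cong; +-cong; -‿cong; refl; *-congˡ; +-congˡ)
    infixl 7 _*_
    _*_ = ZRing._*_ P

  ^-same : ∀ x n → x KR.^ n ≡ x KP.^ n
  ^-same x zero = ≡.refl
  ^-same x (suc n) = cong (x *_) (^-same x n)

  geom-same : ∀ n u → KR.geom n u ≡ KP.geom n u
  geom-same zero u = ≡.refl
  geom-same (suc n) u = cong₂ (ZRing._+_ P) (geom-same n u) (^-same u n)

  mono-same : ∀ i j → ((t KR.^ G) KR.^ i) * ((t KR.^ H) KR.^ j) ≡ ((t KP.^ G) KP.^ i) * ((t KP.^ H) KP.^ j)
  mono-same i j = cong₂ _*_ (≡.trans (^-same _ i) (cong (KP._^ i) (^-same t G))) (≡.trans (^-same _ j) (cong (KP._^ j) (^-same t H)))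

  un : ∀ {a} → UnitMod (suc N') a → CoefData.Unit D a
  un (unit a' k e) = a' , k , e

  cring : CRing N' p₁ p₂ G H
  cring = record
    { Z = R.ringR ; ζ = t ; ζ^N = trans (reflexive (^-same t (suc N'))) (R.∼⇒R R.t^N∼1) ; rep = rep
    ; rep-ev = λ x → R.R-trans (ZRing.reflexive R.ringR (ev-same t (rep x))) (R.≈⇒R (rep-ev x))
    ; σ = sub ; σ-cong = λ {a} u → R.R-σ a (un u)
    ; σ-+ = λ a x y → R.≈⇒R (sub-+ a x y) ; σ-* = λ a x y → R.≈⇒R (sub-* a x y) ; σ-ι = λ a c → R.≈⇒R (sub-ι a c)
    ; σ-ζ = λ a → trans (R.≈⇒R (sub-t a)) (reflexive (≡.sym (^-same t a))) ; unit-N' = let (a' , k , e) = R.unit-N' in unit a' k e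
    ; tor = R.R-tor ; int = R.R-int
    ; Ng≈0 = trans (reflexive (≡.trans (geom-same p₁ _) (cong (KP.geom p₁) (^-same t G)))) R.Ng≈0
    ; Nh≈0 = trans (reflexive (≡.trans (geom-same p₂ _) (cong (KP.geom p₂) (^-same t H)))) R.Nh≈0
    ; L = R.L ; L-cong = R.L-cong ; L-+ = R.L-+ ; L-ι* = R.L-ι* ; L-ι = R.L-ι ; B≥0 = R.B≥0 ; B-min = R.B-min
    ; T = R.T ; T-cong = R.T-cong ; T-+ = R.T-+ ; T-neg = R.T-neg ; T-ι = R.T-ι ; T-σ = λ a u → R.T-σ a (un u)
    ; Kp = R.Kp ; Kp-cong = R.Kp-cong ; Kp-+ = R.Kp-+ ; Kp-neg = R.Kp-neg
    ; T-κ = λ x → ≡.trans (cong₂ (λ u v → R.T (x * ((ZRing._-_ P (ZRing.1# P) u) * (ZRing._-_ P (ZRing.1# P) v)))) (^-same t G) (^-same t H)) (R.T-κ x)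
    ; Kp-no = λ i j a b c → ≡.trans (cong R.Kp (mono-same i j)) (R.Kp-gh-no i j a b c)
    ; Kp-yes = λ i j a b c d → ≡.trans (cong R.Kp (mono-same i j)) (R.Kp-gh-yes i j a b c d) }

unit-* : ∀ {N a b} → UnitMod N a → UnitMod N b → UnitMod N (a ℕ.* b)
unit-* {N} {a} {b} (unit a' k e) (unit b' l f) = unit (a' ℕ.* b') (k ℕ.+ l ℕ.+ k ℕ.* l ℕ.* N)
  (≡.trans (solve 4 (λ a b a' b' → (a :* b) :* (a' :* b') := (a :* a') :* (b :* b')) ≡.refl a b a' b')
  (≡.trans (cong₂ ℕ._*_ e f) (solve 3 (λ k l n → (con 1 :+ k :* n) :* (con 1 :+ l :* n) := con 1 :+ (k :+ l :+ k :* l :* n) :* n) ≡.refl k l N)))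
  where open +-*-Solver

unit-*⁻ˡ : ∀ {N} a b → UnitMod N (a ℕ.* b) → UnitMod N a
unit-*⁻ˡ a b (unit c k e) = unit (b ℕ.* c) k (≡.trans (≡.sym (ℕP.*-assoc a b c)) e)

unit-*⁻ʳ : ∀ {N} a b → UnitMod N (a ℕ.* b) → UnitMod N b
unit-*⁻ʳ a b u = unit-*⁻ˡ b a (≡.subst (UnitMod _) (ℕP.*-comm a b) u)

unit-1 : ∀ {N} → UnitMod N 1
unit-1 = unit 1 0 ≡.refl

unit-^ : ∀ {N a} → UnitMod N a → ∀ n → UnitMod N (a ℕ.^ n)
unit-^ u zero = unit-1
unit-^ u (suc n) = unit-* u (unit-^ u n)

-- Galois action, conjugation and elements of norm one

module Basics {N' p₁ p₂ G H : ℕ} (CR : CRing N' p₁ p₂ G H) where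
  open CRing CR

  infix 4 _≈±_
  _≈±_ : Carrier → Carrier → Set
  x ≈± y = (x ≈ y) ⊎ (x ≈ - y)

  σ-neg : ∀ {a} → Unit a → ∀ x → σ a (- x) ≈ - σ a x
  σ-neg {a} u x = trans (σ-cong u (sym (m1 x))) (trans (σ-* a _ x) (trans (*-congʳ (σ-ι a _)) (m1 _)))
    where m1 : ∀ y → ι (ℤ.- 1ℤ) * y ≈ - y
          m1 y = solve 1 (λ y → con (ℤ.- 1ℤ) :* y := :- y) refl y

  σ-- : ∀ {a} → Unit a → ∀ x y → σ a (x - y) ≈ σ a x - σ a y
  σ-- {a} u x y = trans (σ-+ a x _) (+-congˡ (σ-neg u y))

  σ-0 : ∀ {a} → Unit a → σ a 0# ≈ 0#
  σ-0 {a} u = trans (σ-cong u (sym ι-0)) (trans (σ-ι a 0ℤ) ι-0)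

  σ-1 : ∀ {a} → Unit a → σ a 1# ≈ 1#
  σ-1 {a} u = trans (σ-cong u (sym ι-1)) (trans (σ-ι a 1ℤ) ι-1)

  σ-^ : ∀ {a} → Unit a → ∀ x n → σ a (x ^ n) ≈ σ a x ^ n
  σ-^ u x zero = σ-1 u
  σ-^ {a} u x (suc n) = trans (σ-* a x _) (*-congˡ (σ-^ u x n))

  σ-ζ^ : ∀ {a} → Unit a → ∀ k → σ a (ζ ^ k) ≈ (ζ ^ k) ^ a
  σ-ζ^ {a} u k = trans (σ-^ u ζ k) (trans (^-congˡ k (σ-ζ a)) (^-swap ζ a k))
    where
    ^-swap : ∀ x m n → (x ^ m) ^ n ≈ (x ^ n) ^ m
    ^-swap x m n = trans (^-assocʳ x m n) (trans (^-congʳ x (ℕP.*-comm m n)) (sym (^-assocʳ x n m)))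

  ^-swap : ∀ x m n → (x ^ m) ^ n ≈ (x ^ n) ^ m
  ^-swap x m n = trans (^-assocʳ x m n) (trans (^-congʳ x (ℕP.*-comm m n)) (sym (^-assocʳ x n m)))

  σ-ev : ∀ {a} → Unit a → ∀ r p → σ a (ev r p) ≈ ev (σ a r) p
  σ-ev u r [] = σ-0 u
  σ-ev {a} u r (c ∷ p) = trans (σ-+ a _ _) (+-cong (σ-ι a c) (trans (σ-* a r _) (*-congˡ (σ-ev u r p))))

  σ-rep : ∀ {a} → Unit a → ∀ x → σ a x ≈ ev (ζ ^ a) (rep x)
  σ-rep {a} u x = trans (σ-cong u (sym (rep-ev x))) (trans (σ-ev u ζ (rep x)) (ev-resp (rep x) (σ-ζ a)))

  ζ^kN : ∀ k → ζ ^ (k ℕ.* N) ≈ 1#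
  ζ^kN k = trans (^-congʳ ζ (ℕP.*-comm k N)) (trans (sym (^-assocʳ ζ N k)) (trans (^-congˡ k ζ^N) (1^ k)))

  ζ-mod : ∀ a b k → a ≡ b ℕ.+ k ℕ.* N → ζ ^ a ≈ ζ ^ b
  ζ-mod a b k e = trans (^-congʳ ζ e) (trans (^-homo-* ζ b (k ℕ.* N)) (trans (*-congˡ (ζ^kN k)) (*-identityʳ _)))

  ζ-∣ : ∀ {a} → N ℕD.∣ a → ζ ^ a ≈ 1#
  ζ-∣ (ℕD.divides q e) = trans (^-congʳ ζ e) (ζ^kN q)

  σ-mod : ∀ {a b} → Unit a → Unit b → ζ ^ a ≈ ζ ^ b → ∀ x → σ a x ≈ σ b x
  σ-mod ua ub e x = trans (σ-rep ua x) (trans (ev-resp (rep x) e) (sym (σ-rep ub x)))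

  σ-σ : ∀ {a b} → Unit a → Unit b → ∀ x → σ a (σ b x) ≈ σ (a ℕ.* b) x
  σ-σ {a} {b} ua ub x = trans (σ-cong ua (σ-rep ub x)) (trans (σ-ev ua _ (rep x)) (trans (ev-resp (rep x) (trans (σ-ζ^ ua b)
     (trans (^-assocʳ ζ b a) (^-congʳ ζ (ℕP.*-comm b a))))) (sym (σ-rep (unit-* {N} {a} {b} ua ub) x))))

  σ-id : ∀ x → σ 1 x ≈ x
  σ-id x = trans (σ-rep unit-1 x) (trans (ev-resp (rep x) (*-identityʳ ζ)) (rep-ev x))

  σ-is-id : ∀ {a} → Unit a → ζ ^ a ≈ ζ → ∀ x → σ a x ≈ x
  σ-is-id u e x = trans (σ-mod u unit-1 (trans e (sym (*-identityʳ ζ))) x) (σ-id x)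

  σ-comm : ∀ {a b} → Unit a → Unit b → ∀ x → σ a (σ b x) ≈ σ b (σ a x)
  σ-comm {a} {b} ua ub x = trans (σ-σ ua ub x) (trans (reflexive (cong (λ c → σ c x) (ℕP.*-comm a b))) (sym (σ-σ ub ua x)))

  σ-∣ : ∀ {a} → Unit a → ∀ {d x} → d ∣ x → σ a d ∣ σ a x
  σ-∣ {a} u (divs q e) = divs (σ a q) (trans (σ-cong u e) (σ-* a _ _))

  σ-∣ι : ∀ {a} → Unit a → ∀ {c x} → ι c ∣ x → ι c ∣ σ a x
  σ-∣ι {a} u {c} d = ∣-respˡ (σ-ι a c) (σ-∣ u d)

  σ-≡ι : ∀ {a} → Unit a → ∀ {c x y} → x ≡ y [ ι c ] → σ a x ≡ σ a y [ ι c ]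
  σ-≡ι {a} u {c} {x} {y} d = ∣-resp (σ-- u x y) (σ-∣ι u d)

  σ-∑ : ∀ {a} → Unit a → ∀ n F → σ a (∑< n F) ≈ ∑< n (λ i → σ a (F i))
  σ-∑ u zero F = σ-0 u
  σ-∑ {a} u (suc n) F = trans (σ-+ a _ _) (+-congʳ (σ-∑ u n F))

  σ-± : ∀ {a} → Unit a → ∀ {x y} → x ≈± y → σ a x ≈± σ a y
  σ-± u (inj₁ e) = inj₁ (σ-cong u e)
  σ-± u (inj₂ e) = inj₂ (trans (σ-cong u e) (σ-neg u _))

  ±-trans : ∀ {x y z} → x ≈± y → y ≈± z → x ≈± z
  ±-trans (inj₁ e) (inj₁ f) = inj₁ (trans e f)
  ±-trans (inj₁ e) (inj₂ f) = inj₂ (trans e f)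
  ±-trans (inj₂ e) (inj₁ f) = inj₂ (trans e (-‿cong f))
  ±-trans (inj₂ e) (inj₂ f) = inj₁ (trans e (trans (-‿cong f) (-‿involutive _)))

  ±-*ˡ : ∀ c {x y} → x ≈± y → c * x ≈± c * y
  ±-*ˡ c (inj₁ e) = inj₁ (*-congˡ e)
  ±-*ˡ c (inj₂ e) = inj₂ (trans (*-congˡ e) (sym (-‿distribʳ-* c _)))

  ±-^ : ∀ {x y} n → x ≈± y → x ^ n ≈± y ^ n
  ±-^ zero e = inj₁ refl
  ±-^ (suc n) e = ±-trans (±-*ˡ _ (±-^ n e)) (±-comm (±-*ˡ _ e))
    where
    ±-comm : ∀ {a b c d} → a * b ≈± c * d → b * a ≈± d * c
    ±-comm (inj₁ e) = inj₁ (trans (*-comm _ _) (trans e (*-comm _ _)))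
    ±-comm (inj₂ e) = inj₂ (trans (*-comm _ _) (trans e (-‿cong (*-comm _ _))))

  ±-≡2 : ∀ {x y} → x ≈± y → x ≡ y [ c# 2 ]
  ±-≡2 (inj₁ e) = ≡-reflexive e
  ±-≡2 {x} {y} (inj₂ e) = divs (- y) (trans (+-congʳ e) (solve 1 (λ y → :- y :- y := con (+ 2) :* :- y) refl y))

  infix 9 _̄
  _̄ : Carrier → Carrier
  x ̄ = σ N' x

  conj-cong : ∀ {x y} → x ≈ y → x ̄ ≈ y ̄
  conj-cong = σ-cong unit-N'

  ζζ̄ : ζ ^ (N' ℕ.* N') ≈ ζ
  ζζ̄ = trans (^-congʳ ζ (go N' (UnitMod.inv-eq unit-N'))) (trans (*-congˡ (ζ^kN (ℕ.pred N'))) (*-identityʳ ζ))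
    where
    go : ∀ n → n ℕ.* UnitMod.inv unit-N' ≡ 1 ℕ.+ UnitMod.wit unit-N' ℕ.* N → n ℕ.* n ≡ 1 ℕ.+ ℕ.pred n ℕ.* suc n
    go (suc n) _ = solve' 1 (λ n → (con' 1 +' n) *' (con' 1 +' n) =' con' 1 +' n *' (con' 2 +' n)) ≡.refl n
      where open +-*-Solver renaming (solve to solve'; con to con'; _:+_ to _+'_; _:*_ to _*'_; _:=_ to _='_)

  conj-conj : ∀ x → (x ̄) ̄ ≈ x
  conj-conj x = trans (σ-σ unit-N' unit-N' x) (σ-is-id (unit-* {N} {N'} {N'} unit-N' unit-N') ζζ̄ x)

  conj-ζ^ : ∀ k → ζ ^ k * (ζ ^ k) ̄ ≈ 1#
  conj-ζ^ k = trans (*-congˡ (σ-ζ^ unit-N' k)) (trans (^-assocʳ ζ k N) (ζ^kN k))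

  nrm-* : ∀ x y → (x * y) * (x * y) ̄ ≈ (x * x ̄) * (y * y ̄)
  nrm-* x y = trans (*-congˡ (σ-* N' x y)) (solve 4 (λ a b c d → (a :* b) :* (c :* d) := (a :* c) :* (b :* d)) refl x y (x ̄) (y ̄))

  nrm-σ : ∀ {a} → Unit a → ∀ {x n} → x * x ̄ ≈ ι n → σ a x * (σ a x) ̄ ≈ ι n
  nrm-σ {a} u {x} {n} e = trans (*-congˡ (σ-comm unit-N' u x)) (trans (sym (σ-* a _ _)) (trans (σ-cong u e) (σ-ι a n)))

  nrm-conj : ∀ {x n} → x * x ̄ ≈ n → x ̄ * (x ̄) ̄ ≈ n
  nrm-conj {x} e = trans (*-congˡ (conj-conj x)) (trans (*-comm _ _) e)

  nrm-^ : ∀ x n → x ^ n * (x ^ n) ̄ ≈ (x * x ̄) ^ n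
  nrm-^ x n = trans (*-congˡ (σ-^ unit-N' x n)) (sym (^-distrib-* x (x ̄) n))

  nrm-neg : ∀ x → (- x) * (- x) ̄ ≈ x * x ̄
  nrm-neg x = trans (*-congˡ (σ-neg unit-N' x)) (solve 2 (λ x y → (:- x) :* (:- y) := x :* y) refl x (x ̄))

  tor-cancel : ∀ k {x y} → ¬ (k ≡ 0ℤ) → ι k * x ≈ ι k * y → x ≈ y
  tor-cancel k {x} {y} nz e = -≈0⇒≈ (tor k (x - y) nz (trans (solve 3 (λ k x y → k :* (x :- y) := k :* x :- k :* y) refl (ι k) x y) (≈⇒-≈0 e)))

  ι-inj : ∀ a b → ι a ≈ ι b → a ≡ b
  ι-inj a b e = ℤP.*-cancelʳ-≡ a b (+ 4) (≡.trans (≡.sym (L-ι a)) (≡.trans (L-cong e) (L-ι b)))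

  c#-nz : ∀ {n} → 0 < n → ¬ (+ n ≡ 0ℤ)
  c#-nz {suc n} _ ()

  c#-cancel : ∀ n {x y} → 0 < n → c# n * x ≈ c# n * y → x ≈ y
  c#-cancel n 0<n = tor-cancel (+ n) (c#-nz 0<n)

  ∣-cancel : ∀ n {d x} → 0 < n → (c# n * d) ∣ (c# n * x) → d ∣ x
  ∣-cancel n {d} 0<n (divs q e) = divs q (c#-cancel n 0<n (trans e (*-assoc _ _ _)))

  2∤1 : ¬ (c# 2 ∣ 1#)
  2∤1 (divs q e) with int (+ 2) q 1ℤ (trans (sym e) (sym ι-1))
  ... | IK.divs z f = no2 z f
    where
    no2 : ∀ z → 1ℤ ≡ + 2 ℤ.* z → ⊥
    no2 z f = bad (ℤ.∣ z ∣) (≡.trans (cong ℤ.∣_∣ f) (ℤP.abs-* (+ 2) z))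
      where bad : ∀ n → 1 ≡ 2 ℕ.* n → ⊥
            bad zero ()
            bad (suc n) e with ≡.trans e (ℕP.*-suc 2 n)
            ... | ()

  geom-mul : ∀ m n u → geom (n ℕ.* m) u ≈ geom m u * geom n (u ^ m)
  geom-mul m zero u = sym (zeroʳ _)
  geom-mul m (suc n) u = trans (reflexive (cong (λ k → geom k u) (ℕP.+-comm m (n ℕ.* m)))) (trans (∑<-++ (n ℕ.* m) m (u ^_))
     (trans (+-cong (geom-mul m n u) (trans (∑<-cong m (λ i _ → ^-homo-* u (n ℕ.* m) i)) (sym (∑<-*ˡ m (u ^ (n ℕ.* m)) (u ^_)))))
     (trans (+-congˡ (trans (*-comm _ _) (*-congˡ (trans (^-congʳ u (ℕP.*-comm n m)) (sym (^-assocʳ u m n)))))) (sym (distribˡ _ _ _)))))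

  geom-cong : ∀ n {u v} → u ≈ v → geom n u ≈ geom n v
  geom-cong n e = ∑<-cong n (λ i _ → ^-congˡ i e)

  module Nzd (N≡₁ : N ≡ p₁ ℕ.* G) (N≡₂ : N ≡ p₂ ℕ.* H) (0<p₁ : 0 < p₁) (0<p₂ : 0 < p₂)
             (divN : ∀ k → k ℕD.∣ N → 1 < k → (p₁ ℕD.∣ k) ⊎ (p₂ ℕD.∣ k)) where

    -- The powers of ζ^d form a group of order k, which p₁ or p₂ divides. Its sum splits into cosets
    -- of the subgroup of that prime order, and each of these sums to zero.
    geom-0 : ∀ d k → d ℕ.* k ≡ N → 1 < k → geom k (ζ ^ d) ≈ 0#
    geom-0 d k e 1<k with divN k (ℕD.divides d (≡.sym e)) 1<k
    ... | inj₁ (ℕD.divides q f) = part p₁ G q 0<p₁ N≡₁ f Ng≈0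
      where
      part : ∀ p X q → 0 < p → N ≡ p ℕ.* X → k ≡ q ℕ.* p → geom p (ζ ^ X) ≈ 0# → geom k (ζ ^ d) ≈ 0#
      part p X q 0<p ne f z = trans (reflexive (cong (λ k → geom k (ζ ^ d)) (≡.trans f (ℕP.*-comm q p)))) (trans (geom-mul q p (ζ ^ d))
        (trans (*-congˡ (trans (geom-cong p (trans (^-assocʳ ζ d q) (^-congʳ ζ dq))) z)) (zeroʳ _)))
        where dq : d ℕ.* q ≡ X
              dq = ℕP.*-cancelˡ-≡ (d ℕ.* q) X p {{ℕ.>-nonZero 0<p}} (≡.trans (≡.trans (ℕP.*-comm p _) (≡.trans (ℕP.*-assoc d q p) (cong (d ℕ.*_) (≡.sym f)))) (≡.trans e ne))
    ... | inj₂ (ℕD.divides q f) = part p₂ H q 0<p₂ N≡₂ f Nh≈0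
      where
      part : ∀ p X q → 0 < p → N ≡ p ℕ.* X → k ≡ q ℕ.* p → geom p (ζ ^ X) ≈ 0# → geom k (ζ ^ d) ≈ 0#
      part p X q 0<p ne f z = trans (reflexive (cong (λ k → geom k (ζ ^ d)) (≡.trans f (ℕP.*-comm q p)))) (trans (geom-mul q p (ζ ^ d))
        (trans (*-congˡ (trans (geom-cong p (trans (^-assocʳ ζ d q) (^-congʳ ζ dq))) z)) (zeroʳ _)))
        where dq : d ℕ.* q ≡ X
              dq = ℕP.*-cancelˡ-≡ (d ℕ.* q) X p {{ℕ.>-nonZero 0<p}} (≡.trans (≡.trans (ℕP.*-comm p _) (≡.trans (ℕP.*-assoc d q p) (cong (d ℕ.*_) (≡.sym f)))) (≡.trans e ne))

    -- Bézout replaces j by d = gcd(j,N). With k = N/d the geometric sum of ζ^d of length k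
    -- vanishes, so 1 - ζ^d divides the integer k, which is not a zero divisor.
    nzd : ∀ j → ¬ (N ℕD.∣ j) → ∀ y → (1# - ζ ^ j) * y ≈ 0# → y ≈ 0#
    nzd j N∤j y e = tor (+ k) y (c#-nz (ℕP.<-trans (s≤s z≤n) 1<k)) (trans (*-congʳ (trans (sym (trans (+-congˡ (trans (-‿cong (geom-0 d k dk 1<k)) -0#≈0#)) (+-identityʳ _))) (eq (geom-def k (ζ ^ d)))))
        (trans (solve 3 (λ a b c → (a :* b) :* c := b :* (a :* c)) refl (1# - ζ ^ d) _ y) (trans (*-congˡ ed) (zeroʳ _))))
      where
      d = gcd j N
      d∣N = gcd[m,n]∣n j N
      k = ℕD.quotient d∣N
      dk : d ℕ.* k ≡ N
      dk = ≡.sym (ℕD.m∣n⇒n≡m*quotient d∣N)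
      d≢N : ¬ (d ≡ N)
      d≢N f = N∤j (≡.subst (ℕD._∣ j) f (gcd[m,n]∣m j N))
      1<k : 1 < k
      1<k = ℕD.quotient>1 d∣N (ℕP.≤∧≢⇒< (ℕD.∣⇒≤ d∣N) d≢N)
      ejm : ∀ x → (1# - ζ ^ (x ℕ.* j)) * y ≈ 0#
      ejm x = trans (*-congʳ (trans (+-congˡ (-‿cong (trans (^-congʳ ζ (ℕP.*-comm x j)) (sym (^-assocʳ ζ j x))))) (eq (1-u∣1-u^ (ζ ^ j) x))))
         (trans (solve 3 (λ a b c → (a :* b) :* c := b :* (a :* c)) refl (1# - ζ ^ j) _ y) (trans (*-congˡ e) (zeroʳ _)))
      ed : (1# - ζ ^ d) * y ≈ 0#
      ed with Bézout.identity {j} {N} {d} (gcd-GCD j N)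
      ... | Bézout.+- x w f = trans (*-congʳ (+-congˡ (-‿cong (sym (ζ-mod (x ℕ.* j) d w (≡.sym f)))))) (ejm x)
      ... | Bézout.-+ x w f = trans (solve 4 (λ o a b y → (o :- a) :* y := (o :- a :* b) :* y :- a :* ((o :- b) :* y) :+ (a :* (o :* y) :- a :* y)) refl 1# (ζ ^ d) (ζ ^ (x ℕ.* j)) y)
          (trans (+-cong (+-cong (trans (*-congʳ (trans (+-congˡ (-‿cong (trans (sym (^-homo-* ζ d (x ℕ.* j))) (trans (^-congʳ ζ f) (ζ^kN w))))) (x-x≈0 1#))) (zeroˡ y)) (-‿cong (trans (*-congˡ (ejm x)) (zeroʳ _))))
             (≈⇒-≈0 (*-congˡ (*-identityˡ y)))) (trans (+-congʳ (x-x≈0 0#)) (+-identityˡ 0#)))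

  frobσ : ∀ {ℓ} → Prime ℓ → Unit ℓ → ∀ x → (x ^ ℓ) ≡ σ ℓ x [ c# ℓ ]
  frobσ {ℓ} pr u x = ≡-resp (^-congˡ ℓ (rep-ev x)) (sym (σ-rep u x)) (ev-frob pr ζ (rep x))

  B : Carrier → ℤ
  B x = L (x * x ̄)

  -- For η = 1 + ℓx of norm 1, B(x+1) = 4 - (ℓ-1)B(x), while B is 0 or at least 4.
  module NormOne (η : Carrier) (n1 : η * η ̄ ≈ 1#) (ℓ : ℕ) (0<ℓ : 0 < ℓ) (cong1 : η ≡ 1# [ c# ℓ ]) where
    private
      x = quo cong1
      η≈ : η ≈ 1# + c# ℓ * x
      η≈ = trans (solve 2 (λ a o → a := o :+ (a :- o)) refl η 1#) (+-congˡ (eq cong1))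
      η̄≈ : η ̄ ≈ 1# + c# ℓ * x ̄
      η̄≈ = trans (conj-cong η≈) (trans (σ-+ N' _ _) (+-cong (σ-1 unit-N') (trans (σ-* N' _ _) (*-congʳ (σ-ι N' _)))))
      -- Expanding (1 + ℓx)(1 + ℓx̄) = 1 and cancelling ℓ; the linear term of (x+1)(x̄+1) thereby
      -- becomes a multiple of x x̄.
      tr : x + x ̄ ≈ ι (ℤ.- (+ ℓ)) * (x * x ̄)
      tr = c#-cancel ℓ 0<ℓ (-≈0⇒≈ (begin
        c# ℓ * (x + x ̄) - c# ℓ * (ι (ℤ.- (+ ℓ)) * (x * x ̄))  ≈⟨ +-congˡ (-‿cong (*-congˡ (*-congʳ (ι-neg (+ ℓ))))) ⟩
        c# ℓ * (x + x ̄) - c# ℓ * (- c# ℓ * (x * x ̄))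
          ≈⟨ solve 3 (λ l x y → l :* (x :+ y) :- l :* (:- l :* (x :* y)) := (con 1ℤ :+ l :* x) :* (con 1ℤ :+ l :* y) :- con 1ℤ) refl (c# ℓ) x (x ̄) ⟩
        (ι 1ℤ + c# ℓ * x) * (ι 1ℤ + c# ℓ * x ̄) - ι 1ℤ  ≈⟨ +-cong (*-cong (+-congʳ ι-1) (+-congʳ ι-1)) (-‿cong ι-1) ⟩
        (1# + c# ℓ * x) * (1# + c# ℓ * x ̄) - 1#  ≈⟨ +-congʳ (trans (sym (*-cong η≈ η̄≈)) n1) ⟩
        1# - 1#  ≈⟨ x-x≈0 1# ⟩
        0# ∎))
        where open RR
      B1 : B (x + 1#) ≡ + 4 ℤ.- (+ ℓ ℤ.- 1ℤ) ℤ.* B x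
      B1 = ≡.trans (L-cong (trans (*-congˡ (trans (σ-+ N' x 1#) (+-congˡ (σ-1 unit-N')))) (trans (solve 3 (λ x y o → (x :+ o) :* (y :+ o) := x :* y :+ (o :* (x :+ y) :+ o :* o)) refl x (x ̄) 1#)
           (+-congˡ (+-cong (trans (*-identityˡ _) tr) (trans (*-identityˡ 1#) (sym ι-1)))))))
         (≡.trans (L-+ _ _) (≡.trans (cong (λ z → B x ℤ.+ z) (≡.trans (L-+ _ _) (cong₂ ℤ._+_ (L-ι* _ _) (L-ι 1ℤ))))
           (IK.solve 2 (λ l b → b IK.:+ ((IK.:- l) IK.:* b IK.:+ IK.con (+ 4)) IK.:= IK.con (+ 4) IK.:- (l IK.:- IK.con 1ℤ) IK.:* b) ≡.refl (+ ℓ) (B x))))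
      x0⇒ : x ≈ 0# → η ≈ 1#
      x0⇒ e = trans η≈ (trans (+-congˡ (trans (*-congˡ e) (zeroʳ _))) (+-identityʳ 1#))

    big : 3 ≤ ℓ → η ≈ 1#
    big 3≤ℓ with B-min x
    ... | inj₁ e = x0⇒ e
    ... | inj₂ b = ⊥-elim (ℤP.≤⇒≯ (B≥0 (x + 1#)) (≡.subst (ℤ._< 0ℤ) (≡.sym B1) neg))
      where
      k≥2 : + 2 ℤ.≤ + ℓ ℤ.- 1ℤ
      k≥2 = ℤP.≤-trans (ℤ.+≤+ (ℕP.pred-mono-≤ 3≤ℓ)) (ℤP.≤-reflexive (pm ℓ 0<ℓ))
        where pm : ∀ l → 0 < l → + (ℕ.pred l) ≡ + l ℤ.- 1ℤ
              pm (suc l) _ = ≡.refl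
      m8 : + 8 ℤ.≤ (+ ℓ ℤ.- 1ℤ) ℤ.* B x
      m8 = ℤP.≤-trans (ℤP.*-monoˡ-≤-nonNeg (+ 2) b) (ℤP.*-monoʳ-≤-nonNeg (B x) {{ℤ.nonNegative (B≥0 x)}} k≥2)
      neg : + 4 ℤ.- (+ ℓ ℤ.- 1ℤ) ℤ.* B x ℤ.< 0ℤ
      neg = ℤP.≤-<-trans (ℤP.+-monoʳ-≤ (+ 4) (ℤP.neg-mono-≤ m8)) ℤ.-<+

    two : ℓ ≡ 2 → η ≈± 1#
    two ≡.refl with B-min x | B-min (x + 1#)
    ... | inj₁ e | _ = inj₁ (x0⇒ e)
    ... | inj₂ _ | inj₁ e = inj₂ (trans η≈ (trans (solve 2 (λ x o → o :+ con (+ 2) :* x := con (+ 2) :* (x :+ o) :- o) refl x 1#) (trans (+-congʳ (trans (*-congˡ e) (zeroʳ _))) (+-identityˡ _))))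
    ... | inj₂ b | inj₂ c = ⊥-elim (absurd (B x) b (≡.subst (+ 4 ℤ.≤_) B1 c))
      where
      absurd : ∀ z → + 4 ℤ.≤ z → + 4 ℤ.≤ + 4 ℤ.- (1ℤ ℤ.* z) → ⊥
      absurd z b c = ℤP.≤⇒≯ (ℤP.≤-trans c (ℤP.+-monoʳ-≤ (+ 4) (ℤP.neg-mono-≤ (ℤP.≤-trans b (ℤP.≤-reflexive (≡.sym (ℤP.*-identityˡ z))))))) (ℤ.+<+ (s≤s z≤n))

  -- The quotient of the two sides, written σ_ℓ ρ · ρ̄^ℓ, has norm 1 and is congruent to 1 modulo ℓ
  -- by Frobenius, so `NormOne` applies; the sign can only occur for ℓ = 2.
  σ-prime-pow : ∀ {ρ} → ρ * ρ ̄ ≈ 1# → ∀ {ℓ} → Prime ℓ → Unit ℓ → σ ℓ ρ ≈± ρ ^ ℓ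
  σ-prime-pow {ρ} n {ℓ} pr u = back (pick ℓ pr (ℓ ℕ.≟ 2))
    where
    r' = ρ ̄ ^ ℓ
    pn : ρ ^ ℓ * r' ≈ 1#
    pn = trans (sym (^-distrib-* ρ (ρ ̄) ℓ)) (trans (^-congˡ ℓ n) (1^ ℓ))
    η = σ ℓ ρ * r'
    n1 : η * η ̄ ≈ 1#
    n1 = trans (nrm-* _ _) (trans (*-cong (trans (nrm-σ u (trans n (sym ι-1))) ι-1) (trans (*-congˡ (trans (σ-^ unit-N' (ρ ̄) ℓ) (^-congˡ ℓ (conj-conj ρ)))) (trans (*-comm _ _) pn))) (*-identityˡ 1#))
    c1 : η ≡ 1# [ c# ℓ ]
    c1 = ≡-trans (≡-* (≡-sym (frobσ pr u ρ)) ≡-refl) (≡-reflexive pn)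
    0<ℓ : ∀ ℓ → Prime ℓ → 0 < ℓ
    0<ℓ zero p = ⊥-elim (¬prime[0] p)
    0<ℓ (suc _) p = s≤s z≤n
    pick : ∀ ℓ' → Prime ℓ' → Relation.Nullary.Dec (ℓ ≡ 2) → η ≈± 1#
    pick _ _ (yes e) = NormOne.two η n1 ℓ (0<ℓ ℓ pr) c1 e
    pick _ _ (no ne) = inj₁ (NormOne.big η n1 ℓ (0<ℓ ℓ pr) c1 (ge3 ℓ pr ne))
      where
      ge3 : ∀ ℓ → Prime ℓ → ¬ (ℓ ≡ 2) → 3 ≤ ℓ
      ge3 zero p _ = ⊥-elim (¬prime[0] p)
      ge3 (suc zero) p _ = ⊥-elim (¬prime[1] p)
      ge3 (suc (suc zero)) p ne = ⊥-elim (ne ≡.refl)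
      ge3 (suc (suc (suc l))) p _ = s≤s (s≤s (s≤s z≤n))
    back : η ≈± 1# → σ ℓ ρ ≈± ρ ^ ℓ
    back h = ±-trans (inj₁ re) (±-trans (±-*ˡ (ρ ^ ℓ) h) (inj₁ (*-identityʳ _)))
      where
      re : σ ℓ ρ ≈ ρ ^ ℓ * η
      re = sym (trans (solve 3 (λ a s b → a :* (s :* b) := s :* (a :* b)) refl (ρ ^ ℓ) (σ ℓ ρ) r') (trans (*-congˡ pn) (*-identityʳ _)))

  -- A unit has only unit prime factors, so the prime case composes along a factorisation of k.
  σ-pow : ∀ {ρ} → ρ * ρ ̄ ≈ 1# → ∀ k → 0 < k → Unit k → σ k ρ ≈± ρ ^ k
  σ-pow {ρ} n k 0<k u = ≡.subst (λ k → Unit k → σ k ρ ≈± ρ ^ k) (≡.sym isFactorisation) (go factors factorsPrime) u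
    where
    instance _ = ℕ.>-nonZero 0<k
    open PrimeFactorisation (factorise k)
    go : ∀ ps → All Prime ps → Unit (product ps) → σ (product ps) ρ ≈± ρ ^ product ps
    go [] [] u = inj₁ (trans (σ-id ρ) (sym (*-identityʳ ρ)))
    go (p ∷ ps) (pr ∷ prs) u = ±-trans (inj₁ (sym (σ-σ up ups ρ))) (±-trans (σ-± up (go ps prs ups)) (±-trans (inj₁ (σ-^ up ρ (product ps)))
         (±-trans (±-^ (product ps) (σ-prime-pow n pr up)) (inj₁ (^-assocʳ ρ p (product ps))))))
      where
      up = unit-*⁻ˡ {N} p (product ps) u
      ups = unit-*⁻ʳ {N} p (product ps) u

-- Local divisibility above 2, p₁ and p₂

open Division
private
  module PK = Kit polyZ

module Pow (Z : ZRing) where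
  open ZRing Z
  open Kit Z
  open Eval Z

  -- The congruence is the derivative of the power map. When x - y is divisible by p, it shows
  -- whether the cofactor contributes a further factor.
  powDiff : ∀ x y n → ∃ λ s → (x ^ suc n - y ^ suc n ≈ (x - y) * s) × (s ≡ c# (suc n) * y ^ n [ x - y ])
  powDiff x y zero = 1# , trans (+-cong (*-identityʳ x) (-‿cong (*-identityʳ y))) (sym (*-identityʳ _)) ,
    ≡-reflexive (sym (trans (*-congʳ ι-1) (*-identityˡ 1#)))
  powDiff x y (suc n) with powDiff x y n
  ... | s , e , c = x ^ suc n + y * s ,
     trans (solve 4 (λ x y a b → x :* a :- y :* b := (x :- y) :* a :+ y :* (a :- b)) refl x y (x ^ suc n) (y ^ suc n))
       (trans (+-congˡ (*-congˡ e)) (solve 4 (λ x y a s → (x :- y) :* a :+ y :* ((x :- y) :* s) := (x :- y) :* (a :+ y :* s)) refl x y (x ^ suc n) s)) ,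
     ≡-trans (≡-+ (≡-^ (suc n) (∣-refl {x - y})) (≡-* (≡-refl {x - y} {y}) c)) (≡-reflexive
        (trans (solve 3 (λ y k z → y :* z :+ y :* (k :* z) := (con 1ℤ :+ k) :* (y :* z)) refl y (c# (suc n)) (y ^ n)) (*-congʳ (sym (ι-+ 1ℤ (+ suc n))))))

  frob- : ∀ {p} → Prime p → ∀ x y → ((x - y) ^ p) ≡ (x ^ p - y ^ p) [ c# p ]
  frob- {p} pr x y = ≡-sym (∣-resp (solve 3 (λ a b c → a :- (b :+ c) := (a :- c) :- b) refl (x ^ p) ((x - y) ^ p) (y ^ p))
      (≡-resp (^-congˡ p (solve 2 (λ x y → (x :- y) :+ y := x) refl x y)) refl (frob pr (x - y) y)))

  frob-iter : ∀ {p} → Prime p → ∀ x y k → ((x - y) ^ (p ℕ.^ k)) ≡ (x ^ (p ℕ.^ k) - y ^ (p ℕ.^ k)) [ c# p ]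
  frob-iter pr x y zero = ≡-reflexive (trans (*-identityʳ _) (+-cong (sym (*-identityʳ x)) (-‿cong (sym (*-identityʳ y)))))
  frob-iter {p} pr x y (suc k) = ≡-resp (asc (x - y)) (+-cong (asc x) (-‿cong (asc y))) (≡-trans (≡-^ p (frob-iter pr x y k)) (frob- pr _ _))
    where asc : ∀ z → (z ^ (p ℕ.^ k)) ^ p ≈ z ^ (p ℕ.^ suc k)
          asc z = trans (^-assocʳ z (p ℕ.^ k) p) (^-congʳ z (ℕP.*-comm (p ℕ.^ k) p))

  frob-∑ : ∀ {p} → Prime p → ∀ n (F : ℕ → Carrier) → ((∑< n F) ^ p) ≡ ∑< n (λ i → F i ^ p) [ c# p ]
  frob-∑ {zero} pr = ⊥-elim (¬prime[0] pr)
  frob-∑ {suc p} pr zero F = ≡-reflexive (zeroˡ _)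
  frob-∑ {p@(suc _)} pr (suc n) F = ≡-trans (frob pr (∑< n F) (F n)) (≡-+ (frob-∑ pr n F) ≡-refl)

  ev-≡ : ∀ {d r s} p → r ≡ s [ d ] → ev r p ≡ ev s p [ d ]
  ev-≡ [] e = ≡-refl
  ev-≡ (a ∷ p) e = ≡-+ ≡-refl (≡-* e (ev-≡ p e))

  ev-ι : ∀ c p → ev (ι c) p ≈ ι (Eval.ev ℤring c p)
  ev-ι c [] = sym ι-0
  ev-ι c (a ∷ p) = trans (+-congˡ (trans (*-congˡ (ev-ι c p)) (sym (ι-* c _)))) (sym (ι-+ a _))

  ev-geom : ∀ r n q → ev r (PK.geom n q) ≈ geom n (ev r q)
  ev-geom r zero q = refl
  ev-geom r (suc n) q = trans (ev-+ r (PK.geom n q) (q PK.^ n)) (+-cong (ev-geom r n q) (ev-^ r q n))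

1ₚ : Poly
1ₚ = 1ℤ ∷ []

t-1 : Poly
t-1 = (ℤ.- 1ℤ) ∷ 1ℤ ∷ []

-- Multiplied by 1 - t, the difference is (1 - t)^p - (1 - t^p), divisible by p by Frobenius;
-- division by the monic t - 1 removes the extra factor.
cyc-p : ∀ {p} → Prime p → ∃ λ v → (((1ₚ -ₚ tₚ) PK.^ (p ∸ 1)) -ₚ PK.geom p tₚ) ≋ (constₚ (+ p) *ₚ v)
cyc-p {zero} pr = ⊥-elim (¬prime[0] pr)
cyc-p {p@(suc p')} pr = negₚ Q , res
  where
  open PK using (solve; _:+_; _:*_; _:-_; :-_; _:=_; con)
  _⟨≋⟩_ = ≋-trans
  q = ((1ₚ -ₚ tₚ) PK.^ p') -ₚ PK.geom p tₚ
  fr = Pow.frob- polyZ pr 1ₚ tₚ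
  z = PK.quo fr
  K = constₚ (+ p)
  [1-t]q : (1ₚ -ₚ tₚ) *ₚ q ≋ K *ₚ z
  [1-t]q = solve 3 (λ a b c → a :* (b :- c) := a :* b :- a :* c) ≋-refl (1ₚ -ₚ tₚ) ((1ₚ -ₚ tₚ) PK.^ p') (PK.geom p tₚ)
    ⟨≋⟩ (+ₚ-cong (≋-refl {(1ₚ -ₚ tₚ) PK.^ p}) (negₚ-cong (PK.geom-tele p tₚ ⟨≋⟩ +ₚ-cong (≋-sym (PK.1^ p)) (≋-refl {negₚ (tₚ PK.^ p)}))) ⟨≋⟩ PK.eq fr)
  m : Monic t-1
  m = 1 , ≡.refl , ≡.refl
  dm = divMonic t-1 m z
  Q = Defs.quotₚ z t-1
  r = proj₁ dm
  d : t-1 *ₚ (negₚ q -ₚ K *ₚ Q) ≋ Defs.scaleₚ (+ p) r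
  d = solve 5 (λ a b q k Q → a :* (:- q :- k :* Q) := (b :* q :- (b :+ a) :* q) :- k :* (a :* Q)) ≋-refl t-1 (1ₚ -ₚ tₚ) q K Q
     ⟨≋⟩ (+ₚ-cong (+ₚ-cong [1-t]q (negₚ-cong (*ₚ-cong {(1ₚ -ₚ tₚ) +ₚ t-1} {[]} {q} {q} (mk≋ λ { zero → ≡.refl ; (suc zero) → ≡.refl ; (suc (suc i)) → ≡.refl }) ≋-refl))) (≋-refl {negₚ (K *ₚ (t-1 *ₚ Q))})
     ⟨≋⟩ (+ₚ-cong (+ₚ-identityʳ (K *ₚ z) ⟨≋⟩ *ₚ-congʳ K (proj₁ (proj₂ dm))) (≋-refl {negₚ (K *ₚ (t-1 *ₚ Q))})
     ⟨≋⟩ (solve 3 (λ k a r → k :* (a :+ r) :- k :* a := k :* r) ≋-refl K (t-1 *ₚ Q) r ⟨≋⟩ ≋-sym (scale-const (+ p) r))))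
  z0 : negₚ q -ₚ K *ₚ Q ≋ []
  z0 = rem-zero t-1 m (negₚ q -ₚ K *ₚ Q) (Defs.scaleₚ (+ p) r) (≡.subst (λ l → suc l ≤ 2) (≡.sym (LP.length-map (+ p ℤ.*_) r)) (proj₁ (proj₂ (proj₂ dm)))) d
  res : q ≋ K *ₚ negₚ Q
  res = solve 3 (λ q k Q → q := k :* (:- Q) :- (:- q :- k :* Q)) ≋-refl q K Q ⟨≋⟩ (+ₚ-cong (≋-refl {K *ₚ negₚ Q}) (negₚ-cong z0) ⟨≋⟩ +ₚ-identityʳ _)

-- At t = 1 the power vanishes and the geometric sum is p. Hence v is -1 modulo 1 - u, so (1 -
-- u)^(p-1) is p times an element that is a unit modulo 1 - u.
cyc-p-at1 : ∀ {p} (pr : Prime p) → Eval.ev ℤring 1ℤ (proj₁ (cyc-p pr)) ≡ ℤ.- 1ℤ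
cyc-p-at1 {zero} pr = ⊥-elim (¬prime[0] pr)
cyc-p-at1 {suc zero} pr = ⊥-elim (¬prime[1] pr)
cyc-p-at1 {p@(suc (suc p''))} pr = ℤP.*-cancelˡ-≡ (+ p) _ (ℤ.- 1ℤ) (≡.trans (≡.sym (ev-const*)) (≡.trans (≡.sym (E.ev-cong 1ℤ (proj₂ (cyc-p pr)))) lhs))
  where
  module E = Eval ℤring
  v = proj₁ (cyc-p pr)
  ev-const* : E.ev 1ℤ (constₚ (+ p) *ₚ v) ≡ + p ℤ.* E.ev 1ℤ v
  ev-const* = ≡.trans (E.ev-* 1ℤ (constₚ (+ p)) v) (cong (ℤ._* E.ev 1ℤ v) (E.ev-const 1ℤ (+ p)))
  pw = (1ₚ -ₚ tₚ) PK.^ suc p''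
  geom1 : ∀ n → IK.geom n 1ℤ ≡ + n
  geom1 n = ≡.trans (IK.∑<-cong n (λ i _ → IK.1^ i)) (≡.trans (IK.∑<-const n 1ℤ) (ℤP.*-identityʳ (+ n)))
  lhs : E.ev 1ℤ (pw -ₚ PK.geom p tₚ) ≡ + p ℤ.* (ℤ.- 1ℤ)
  lhs = ≡.trans (E.ev-- 1ℤ pw (PK.geom p tₚ)) (≡.trans (cong₂ ℤ._-_ (≡.trans (E.ev-^ 1ℤ (1ₚ -ₚ tₚ) (suc p'')) ≡.refl)
       (≡.trans (Pow.ev-geom ℤring 1ℤ p tₚ) (geom1 p))) (≡.trans (ℤP.+-identityˡ _) (≡.trans (≡.sym (ℤP.-1*i≡-i (+ p))) (ℤP.*-comm (ℤ.- 1ℤ) (+ p)))))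

module Local {N' p₁ p₂ G H : ℕ} (CR : CRing N' p₁ p₂ G H) where
  open CRing CR
  open Basics CR hiding (B)
  open Pow Z

  module Two (u2 : Unit 2) (f' : ℕ) (ζ2f : ζ ^ (2 ℕ.^ suc f') ≈ ζ) where
    private f = suc f'

    pow2 : ∀ j x → (x ^ (2 ℕ.^ j)) ≡ σ (2 ℕ.^ j) x [ c# 2 ]
    pow2 zero x = ≡-reflexive (trans (*-identityʳ x) (sym (σ-id x)))
    pow2 (suc j) x = ≡-resp (trans (^-assocʳ x (2 ℕ.^ j) 2) (^-congʳ x (ℕP.*-comm (2 ℕ.^ j) 2))) (σ-σ u2 (unit-^ u2 j) x)
       (≡-trans (≡-^ 2 (pow2 j x)) (frobσ prime[2] u2 _))

    pow2f : ∀ x → (x ^ (2 ℕ.^ f)) ≡ x [ c# 2 ]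
    pow2f x = ≡-trans (pow2 f x) (≡-reflexive (σ-is-id (unit-^ u2 f) ζ2f x))

    lift2 : ∀ {a b} m → a ≡ b [ c# 2 ] → (a ^ (2 ℕ.^ m)) ≡ b ^ (2 ℕ.^ m) [ c# 2 ^ suc m ]
    lift2 zero h = ≡-resp (sym (*-identityʳ _)) (sym (*-identityʳ _)) (∣-respˡ (sym (*-identityʳ _)) h)
    lift2 {a} {b} (suc m) h = ∣-resp (trans (solve 2 (λ a b → (a :+ b) :* (a :- b) := a :* a :- b :* b) refl A B) (+-cong (sq A (asc a)) (-‿cong (sq B (asc b)))))
        (∣-* two∣ (lift2 m h))
      where
      A = a ^ (2 ℕ.^ m)
      B = b ^ (2 ℕ.^ m)
      asc : ∀ z → (z ^ (2 ℕ.^ m)) ^ 2 ≈ z ^ (2 ℕ.^ suc m)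
      asc z = trans (^-assocʳ z (2 ℕ.^ m) 2) (^-congʳ z (ℕP.*-comm (2 ℕ.^ m) 2))
      sq : ∀ z {w} → z ^ 2 ≈ w → z * z ≈ w
      sq z e = trans (*-congˡ (sym (*-identityʳ z))) e
      two∣ : c# 2 ∣ (A + B)
      two∣ = ∣-resp (solve 2 (λ a b → (a :- b) :+ con (+ 2) :* b := a :+ b) refl A B) (∣-+ (∣-trans (∣-*ʳ (c# 2 ^ m) ∣-refl) (lift2 m h)) (∣-*ʳ B ∣-refl))

    -- σ₂ fixes every prime above 2, so x and σ₂x have equal valuations there. In place of
    -- valuations, E is a high power of x, acting as 0 where x is even and as 1 elsewhere. The part
    -- x - E x is even, and dividing it by 2 lowers m; for E x one uses σ₂E ≡ E² modulo 2^(m+1)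
    -- together with x ∣ E.
    local2 : ∀ m x y → c# 2 ^ m ∣ (x * y) → c# 2 ^ m ∣ (σ 2 x * y)
    local2 zero x y h = divs (σ 2 x * y) (sym (*-identityˡ _))
    local2 (suc m) x y h = ∣-resp (solve 3 (λ s z y → (z :- s :* z) :* y :+ s :* (z :* y) := z :* y) refl (σ 2 E) (σ 2 x) y) (∣-+ part1 part2)
      where
      K = 2 ℕ.^ m
      M = 2 ℕ.^ f ∸ 1
      e = x ^ M
      E = e ^ K
      sM : suc M ≡ 2 ℕ.^ f
      sM = ℕP.m+[n∸m]≡n {1} (ℕP.m^n>0 2 f)
      ex : (e * x) ≡ x [ c# 2 ]
      ex = ≡-resp (trans (^-congʳ x (≡.sym sM)) (*-comm x _)) refl (pow2f x)
      ekx : ∀ k → (e ^ k * x) ≡ x [ c# 2 ]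
      ekx zero = ≡-reflexive (*-identityˡ x)
      ekx (suc k) = ≡-trans (≡-reflexive (*-assoc e _ x)) (≡-trans (≡-* ≡-refl (ekx k)) ex)
      d : c# 2 ∣ (x - E * x)
      d = ≡-sym (ekx K)
      x₁ = quo d
      M≥1 : ∃ λ M' → M ≡ suc M'
      M≥1 = go M (≡.subst (2 ≤_) (≡.sym sM) (ℕP.*-monoʳ-≤ 2 (ℕP.m^n>0 2 f')))
        where go : ∀ M → 2 ≤ suc M → ∃ λ M' → M ≡ suc M'
              go zero (s≤s ())
              go (suc M) _ = M , ≡.refl
      K≥1 : ∃ λ K' → K ≡ suc K'
      K≥1 = go K (ℕP.m^n>0 2 m)
        where go : ∀ K → 1 ≤ K → ∃ λ K' → K ≡ suc K'
              go (suc K) _ = K , ≡.refl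
      E∣ : x ∣ E
      E∣ = ∣-trans (∣-trans (divs (x ^ proj₁ M≥1) (^-congʳ x (proj₂ M≥1))) (divs (e ^ proj₁ K≥1) refl)) (∣-resp (^-congʳ e (≡.sym (proj₂ K≥1))) ∣-refl)
      Ey : c# 2 ^ suc m ∣ (E * y)
      Ey = ∣-resp (trans (solve 3 (λ x q y → (x :* y) :* q := (x :* q) :* y) refl x (quo E∣) y) (*-congʳ (sym (eq E∣)))) (∣-*ʳ (quo E∣) h)
      x₁y : c# 2 ^ m ∣ (x₁ * y)
      x₁y = ∣-cancel 2 (s≤s z≤n) (∣-resp (trans (solve 3 (λ x E y → x :* y :- E :* (x :* y) := (x :- E :* x) :* y) refl x E y) (trans (*-congʳ (eq d)) (*-assoc _ _ _))) (∣-- h (∣-*ˡ E h)))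
      part1 : c# 2 ^ suc m ∣ ((σ 2 x - σ 2 E * σ 2 x) * y)
      part1 = ∣-resp (trans (sym (*-assoc _ _ _)) (*-congʳ (trans (trans (*-congʳ (sym (σ-ι 2 (+ 2)))) (sym (σ-* 2 _ x₁))) (trans (σ-cong u2 (sym (eq d))) (trans (σ-- u2 x _) (+-congˡ (-‿cong (σ-* 2 E x))))))))
        (∣-* (∣-refl {c# 2}) (local2 m x₁ y x₁y))
      σE : σ 2 E ≡ E * E [ c# 2 ^ suc m ]
      σE = ≡-resp (sym (σ-^ u2 e K)) (^-distrib-* e e K) (lift2 m (≡-resp refl (*-congˡ (*-identityʳ e)) (≡-sym (frobσ prime[2] u2 e))))
      part2 : c# 2 ^ suc m ∣ (σ 2 E * (σ 2 x * y))
      part2 = ∣-≡ (≡-* (≡-sym σE) ≡-refl) (∣-resp (solve 3 (λ E z y → (E :* z) :* (E :* y) := (E :* E) :* (z :* y)) refl E (σ 2 x) y) (∣-*ˡ (E * σ 2 x) Ey))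

  -- `Jk` says that -1 is a power of p modulo M, the part of N prime to p. Conjugation then fixes
  -- every prime above p, so a norm divisible by p² comes from an element divisible by p. The
  -- element π = 1 - ζ^M carries the total ramification.
  module AtP (p : ℕ) (pr : Prime p) (e' M : ℕ) (N≡ : N ≡ p ℕ.^ suc e' ℕ.* M)
             (gp : geom p (ζ ^ (p ℕ.^ e' ℕ.* M)) ≈ 0#)
             (J' k : ℕ) (Jk : p ℕ.^ suc J' ℕ.+ 1 ≡ k ℕ.* M)
             (π-nzd : ∀ y → (1# - ζ ^ M) * y ≈ 0# → y ≈ 0#) where
    private
      J = suc J'
      γ = ζ ^ M
      π = 1# - γ
      u = γ ^ (p ℕ.^ e')
      Q = p ℕ.^ J
      0<p : 0 < p
      0<p = ℕP.<-trans (s≤s z≤n) (ℕ.nonTrivial⇒n>1 p {{prime⇒nonTrivial pr}})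
      2≤p : 2 ≤ p
      2≤p = ℕ.nonTrivial⇒n>1 p {{prime⇒nonTrivial pr}}

      u≈ : u ≈ ζ ^ (p ℕ.^ e' ℕ.* M)
      u≈ = trans (^-assocʳ ζ M (p ℕ.^ e')) (^-congʳ ζ (ℕP.*-comm M _))

      gu : geom p u ≈ 0#
      gu = trans (geom-cong p u≈) gp

      π∣1-u : π ∣ (1# - u)
      π∣1-u = 1-u∣1-u^ γ (p ℕ.^ e')

      1-u∣p : (1# - u) ∣ c# p
      1-u∣p = ∣-resp (trans (+-congˡ (trans (-‿cong gu) -0#≈0#)) (+-identityʳ _)) (geom-def p u)

      π∣p : π ∣ c# p
      π∣p = ∣-trans π∣1-u 1-u∣p

      v = ev u (proj₁ (cyc-p pr))
      n = p ∸ 1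

      [1-u]^n : (1# - u) ^ n ≈ c# p * v
      [1-u]^n = begin
        (1# - u) ^ n  ≈⟨ sym (trans (+-congˡ (trans (-‿cong gu) -0#≈0#)) (+-identityʳ _)) ⟩
        (1# - u) ^ n - geom p u  ≈⟨ +-cong (^-congˡ n (sym (trans (ev-- u 1ₚ tₚ) (+-cong (ev-1 u) (-‿cong (ev-t u)))))) (-‿cong (sym (trans (ev-geom u p tₚ) (geom-cong p (ev-t u))))) ⟩
        ev u (1ₚ -ₚ tₚ) ^ n - ev u (PK.geom p tₚ)  ≈⟨ +-congʳ (sym (ev-^ u (1ₚ -ₚ tₚ) n)) ⟩
        ev u ((1ₚ -ₚ tₚ) PK.^ n) - ev u (PK.geom p tₚ)  ≈⟨ sym (ev-- u ((1ₚ -ₚ tₚ) PK.^ n) (PK.geom p tₚ)) ⟩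
        ev u (((1ₚ -ₚ tₚ) PK.^ n) -ₚ PK.geom p tₚ)  ≈⟨ ev-cong u (proj₂ (cyc-p pr)) ⟩
        ev u (constₚ (+ p) *ₚ proj₁ (cyc-p pr))  ≈⟨ trans (ev-* u (constₚ (+ p)) (proj₁ (cyc-p pr))) (*-congʳ (ev-const u (+ p))) ⟩
        c# p * v ∎
        where open RR

      v≡-1 : v ≡ ι (ℤ.- 1ℤ) [ π ]
      v≡-1 = ≡-trans (ev-≡ (proj₁ (cyc-p pr)) (≡-sym (∣-resp (+-congʳ (sym ι-1)) π∣1-u))) (≡-reflexive (trans (ev-ι 1ℤ (proj₁ (cyc-p pr))) (ι-cong (cyc-p-at1 pr))))

      fi = frob-iter pr 1# γ e'
      s = quo fi
      πp : π ^ (p ℕ.^ e') ≈ (1# - u) + c# p * s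
      πp = trans (solve 3 (λ a b c → a := b :+ (a :- b)) refl (π ^ (p ℕ.^ e')) (1# ^ (p ℕ.^ e') - u) 1#) (+-cong (+-congʳ (1^ (p ℕ.^ e'))) (eq fi))

      D = p ℕ.^ e' ℕ.* n

    module _ (3≤p : 3 ≤ p) where
      private
        n'' = p ∸ 3
        n≡' : n ≡ suc (suc n'')
        n≡' = ≡.trans (cong (_∸ 1) (≡.sym (ℕP.m+[n∸m]≡n 3≤p))) ≡.refl
        A = 1# - u
        Bq = c# p * s
        pdf = powDiff (A + Bq) A (suc n'')
        y = proj₁ pdf
        A+B-A : (A + Bq) - A ≈ Bq
        A+B-A = solve 2 (λ a b → (a :+ b) :- a := b) refl A Bq
        -- Since p is at least 3, the derivative term still contains a positive power of 1 - u.
        π∣y : π ∣ y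
        π∣y = ∣-≡ (≡-sym (∣-trans (∣-resp (sym A+B-A) (∣-*ʳ s π∣p)) (proj₂ (proj₂ pdf)))) (∣-*ˡ _ (∣-*ʳ _ π∣1-u))
        w = v + s * y
        π^D : π ^ D ≈ c# p * w
        π^D = begin
          π ^ D ≈⟨ sym (^-assocʳ π (p ℕ.^ e') n) ⟩
          (π ^ (p ℕ.^ e')) ^ n ≈⟨ ^-congˡ n πp ⟩
          (A + Bq) ^ n ≈⟨ ^-congʳ (A + Bq) n≡' ⟩
          (A + Bq) ^ suc (suc n'') ≈⟨ solve 2 (λ a b → a := b :+ (a :- b)) refl ((A + Bq) ^ suc (suc n'')) (A ^ suc (suc n'')) ⟩
          A ^ suc (suc n'') + ((A + Bq) ^ suc (suc n'') - A ^ suc (suc n'')) ≈⟨ +-cong (trans (^-congʳ A (≡.sym n≡')) [1-u]^n) (trans (proj₁ (proj₂ pdf)) (*-congʳ A+B-A)) ⟩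
          c# p * v + Bq * y ≈⟨ solve 4 (λ p v s y → p :* v :+ (p :* s) :* y := p :* (v :+ s :* y)) refl (c# p) v s y ⟩
          c# p * w ∎
          where open RR
        w≡-1 : π ∣ (w + 1#)
        w≡-1 = ∣-resp (trans (+-congʳ (+-congˡ (-‿cong (ι-neg 1ℤ)))) (trans (solve 3 (λ v o z → (v :- (:- o)) :+ z := (v :+ z) :+ o) refl v (ι 1ℤ) (s * y)) (+-congˡ ι-1))) (∣-+ v≡-1 (∣-*ˡ s π∣y))
        b₀ = quo w≡-1
        -- As w ≡ -1 modulo π, the equation π^D = p w reads p = p π b₀ - π^D. Substituting it
        -- repeatedly for p pushes p into the ideal of π^D, in the manner of Nakayama's lemma.
        iter : ∀ k → ∃ λ a → ∃ λ b → c# p ≈ π ^ k * (c# p * b) + π ^ D * a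
        iter zero = 0# , 1# , sym (trans (+-cong (trans (*-identityˡ _) (*-identityʳ _)) (zeroʳ _)) (+-identityʳ _))
        iter (suc k) = a - π ^ k * b , b * b₀ , trans h (trans (+-congʳ (*-congˡ (*-congʳ step)))
               (solve 7 (λ pk p b0 P b a d → pk :* ((p :* (P :* b0) :- d) :* b) :+ d :* a := (P :* pk) :* (p :* (b :* b0)) :+ d :* (a :- pk :* b)) refl (π ^ k) (c# p) b₀ π b a (π ^ D)))
          where
          a = proj₁ (iter k)
          b = proj₁ (proj₂ (iter k))
          h = proj₂ (proj₂ (iter k))
          step : c# p ≈ c# p * (π * b₀) - π ^ D
          step = sym (trans (+-cong (*-congˡ (sym (eq w≡-1))) (-‿cong π^D)) (trans (solve 3 (λ p w o → p :* (w :+ o) :- p :* w := p :* o) refl (c# p) w 1#) (*-identityʳ _)))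
        p∈ : π ^ D ∣ c# p
        p∈ = divs (c# p * proj₁ (proj₂ (iter D)) + proj₁ (iter D)) (trans (proj₂ (proj₂ (iter D))) (sym (distribˡ (π ^ D) _ _)))

        -- conj ≡ Frob^J mod π
        ζQ : ζ ^ Q ≡ ζ ^ N' [ π ]
        ζQ = ∣-≡ (≡-reflexive (trans (solve 4 (λ o z a b → (o :- z :* a) :* b := o :* b :- (z :* b) :* a) refl 1# ζ (ζ ^ Q) (ζ ^ N')) (+-cong (*-identityˡ _) (-‿cong (trans (*-congʳ ζ^N) (*-identityˡ _))))))
             (∣-*ʳ (ζ ^ N') (∣-resp (+-congˡ (-‿cong (trans (^-assocʳ ζ M k) (^-congʳ ζ (≡.trans (ℕP.*-comm M k) (≡.trans (≡.sym Jk) (ℕP.+-comm Q 1))))))) (1-u∣1-u^ γ k))) ⟪ ∣⇒neg ⟫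
          where
          _⟪_⟫ : ∀ {A B : Set} → A → (A → B) → B
          a ⟪ f ⟫ = f a
          ∣⇒neg : π ∣ (ζ ^ N' - ζ ^ Q) → π ∣ (ζ ^ Q - ζ ^ N')
          ∣⇒neg = ≡-sym

        frobp : ∀ j z → (z ^ (p ℕ.^ j)) ≡ ev (ζ ^ (p ℕ.^ j)) (rep z) [ c# p ]
        frobp j z = ≡-resp (^-congˡ (p ℕ.^ j) (rep-ev z)) refl (go j)
          where
          go : ∀ j → (ev ζ (rep z) ^ (p ℕ.^ j)) ≡ ev (ζ ^ (p ℕ.^ j)) (rep z) [ c# p ]
          go zero = ≡-reflexive (trans (*-identityʳ _) (ev-resp (rep z) (sym (*-identityʳ ζ))))
          go (suc j) = ≡-resp (asc _) (ev-resp (rep z) (asc ζ)) (≡-trans (≡-^ p (go j)) (ev-frob pr _ (rep z)))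
            where asc : ∀ z → (z ^ (p ℕ.^ j)) ^ p ≈ z ^ (p ℕ.^ suc j)
                  asc z = trans (^-assocʳ z (p ℕ.^ j) p) (^-congʳ z (ℕP.*-comm (p ℕ.^ j) p))

        conj≡ : ∀ z → (z ^ Q) ≡ z ̄ [ π ]
        conj≡ z = ≡-trans (∣-trans π∣p (frobp J z)) (≡-trans (ev-≡ (rep z) ζQ) (≡-reflexive (sym (σ-rep unit-N' z))))

        -- Modulo π, z^Q is z̄ and so z^(Q²) is z. Hence z^(Q+1) ≡ z z̄ ≡ 0, and Q² exceeds Q.
        π-red : ∀ z → π ∣ (z * z ̄) → π ∣ z
        π-red z h = ∣-≡ (≡-trans (≡-reflexive (sym (^-assocʳ z Q Q))) (≡-trans (≡-^ Q (conj≡ z)) (≡-trans (conj≡ (z ̄)) (≡-reflexive (conj-conj z)))))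
            (∣-trans (∣-≡ (≡-* ≡-refl (≡-sym (conj≡ z))) h) (^-∣ z 1+Q≤Q²))
          where
          2≤Q : 2 ≤ Q
          2≤Q = ℕP.≤-trans 2≤p (ℕP.m≤m*n p (p ℕ.^ J') {{ℕ.>-nonZero (ℕP.m^n>0 p {{ℕ.>-nonZero 0<p}} J')}})
          1+Q≤Q² : suc Q ≤ Q ℕ.* Q
          1+Q≤Q² = ℕP.≤-trans (ℕP.≤-trans (ℕP.+-monoˡ-≤ Q (ℕP.≤-trans (s≤s z≤n) 2≤Q)) (ℕP.≤-reflexive (cong (Q ℕ.+_) (≡.sym (ℕP.+-identityʳ Q))))) (ℕP.*-monoˡ-≤ Q 2≤Q)

        π-nzd^ : ∀ k y → π ^ k * y ≈ 0# → y ≈ 0#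
        π-nzd^ zero y e = trans (sym (*-identityˡ y)) e
        π-nzd^ (suc k) y e = π-nzd^ k y (π-nzd _ (trans (sym (*-assoc _ _ _)) e))

        π-cancel : ∀ k {x y} → π ^ k * x ≈ π ^ k * y → x ≈ y
        π-cancel k {x} {y} e = -≈0⇒≈ (π-nzd^ k (x - y) (trans (solve 3 (λ k x y → k :* (x :- y) := k :* x :- k :* y) refl (π ^ k) x y) (≈⇒-≈0 e)))

        γγ̄ : γ * γ ̄ ≈ 1#
        γγ̄ = conj-ζ^ M

        π≈ : π ≈ - γ * π ̄
        π≈ = sym (trans (*-congˡ (trans (σ-- unit-N' 1# γ) (+-congʳ (σ-1 unit-N')))) (trans (solve 3 (λ g h o → :- g :* (o :- h) := g :* h :- g :* o) refl γ (γ ̄) 1#) (+-cong γγ̄ (-‿cong (*-identityʳ γ)))))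

        -- If y = π^i z with i < D, then y ȳ is z z̄ times π^(2i) up to a unit, because π̄ is an
        -- associate of π, while p² contributes π^(2D). So π divides z z̄, and `π-red` gives one
        -- more power.
        go-up : ∀ y → (c# p * c# p) ∣ (y * y ̄) → ∀ i → i ≤ D → π ^ i ∣ y
        go-up y h zero _ = divs y (sym (*-identityˡ y))
        go-up y h (suc i) i<D = ∣-resp (sym (eq dy)) (∣-respˡ (*-comm _ π) (∣-* ∣-refl (π-red z (divs q' (π-cancel (i ℕ.+ i) fin)))))
          where
          dy = go-up y h i (ℕP.<⇒≤ i<D)
          z = quo dy
          -- y ȳ = π^i π̄^i z z̄ and π^i = (-γ)^i π̄^i
          d2 : (π ^ D * π ^ D) ∣ (y * y ̄)
          d2 = ∣-trans (∣-* p∈ p∈) h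
          q₀ = quo d2
          q' = π ^ ((D ∸ suc i) ℕ.+ (D ∸ i)) * ((- γ) ^ i * q₀)
          split : π ^ D * π ^ D ≈ π ^ (i ℕ.+ i) * (π * π ^ ((D ∸ suc i) ℕ.+ (D ∸ i)))
          split = trans (sym (^-homo-* π D D)) (trans (^-congʳ π ar) (^-homo-* π (i ℕ.+ i) (suc ((D ∸ suc i) ℕ.+ (D ∸ i)))))
            where
            ar : D ℕ.+ D ≡ i ℕ.+ i ℕ.+ suc ((D ∸ suc i) ℕ.+ (D ∸ i))
            ar = ≡.trans (cong₂ ℕ._+_ (≡.sym (ℕP.m+[n∸m]≡n i<D)) (≡.sym (ℕP.m+[n∸m]≡n (ℕP.<⇒≤ i<D))))
               (slv 3 (λ i a b → (con' 1 +' i +' a) +' (i +' b) =' i +' i +' (con' 1 +' (a +' b))) ≡.refl i (D ∸ suc i) (D ∸ i))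
              where open +-*-Solver renaming (solve to slv; con to con'; _:+_ to _+'_; _:*_ to _*'_; _:=_ to _='_)
          π^i : π ^ i ≈ (- γ) ^ i * (π ̄) ^ i
          π^i = trans (^-congˡ i π≈) (^-distrib-* (- γ) (π ̄) i)
          ȳ : y ̄ ≈ (π ̄) ^ i * z ̄
          ȳ = trans (conj-cong (eq dy)) (trans (σ-* N' _ _) (*-congʳ (σ-^ unit-N' π i)))
          fin : π ^ (i ℕ.+ i) * (z * z ̄) ≈ π ^ (i ℕ.+ i) * (π * q')
          fin = begin
            π ^ (i ℕ.+ i) * (z * z ̄) ≈⟨ *-congʳ (^-homo-* π i i) ⟩
            (π ^ i * π ^ i) * (z * z ̄) ≈⟨ *-congʳ (*-congˡ π^i) ⟩
            (π ^ i * ((- γ) ^ i * (π ̄) ^ i)) * (z * z ̄) ≈⟨ solve 5 (λ a g b z w → (a :* (g :* b)) :* (z :* w) := g :* ((a :* z) :* (b :* w))) refl (π ^ i) ((- γ) ^ i) ((π ̄) ^ i) z (z ̄) ⟩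
            (- γ) ^ i * ((π ^ i * z) * ((π ̄) ^ i * z ̄)) ≈⟨ *-congˡ (*-cong (sym (eq dy)) (sym ȳ)) ⟩
            (- γ) ^ i * (y * y ̄) ≈⟨ *-congˡ (eq d2) ⟩
            (- γ) ^ i * (π ^ D * π ^ D * q₀) ≈⟨ *-congˡ (*-congʳ split) ⟩
            (- γ) ^ i * (π ^ (i ℕ.+ i) * (π * π ^ ((D ∸ suc i) ℕ.+ (D ∸ i))) * q₀) ≈⟨ solve 5 (λ g a p b q → g :* (a :* (p :* b) :* q) := a :* (p :* (b :* (g :* q)))) refl ((- γ) ^ i) (π ^ (i ℕ.+ i)) π (π ^ ((D ∸ suc i) ℕ.+ (D ∸ i))) q₀ ⟩
            π ^ (i ℕ.+ i) * (π * q') ∎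
            where open RR

      local-p : ∀ y → (c# p * c# p) ∣ (y * y ̄) → c# p ∣ y
      local-p y h = ∣-trans (divs w π^D) (go-up y h D ℕP.≤-refl)

      local-p^ : ∀ k y → c# p ^ (k ℕ.+ k) ∣ (y * y ̄) → c# p ^ k ∣ y
      local-p^ zero y h = divs y (sym (*-identityˡ y))
      local-p^ (suc k) y h = ∣-resp (sym (eq d)) (∣-* ∣-refl (local-p^ k z (∣-cancel p 0<p (∣-cancel p 0<p (∣-resp norm (∣-respˡ pw h))))))
        where
        pw : c# p ^ suc (k ℕ.+ suc k) ≈ c# p * (c# p * c# p ^ (k ℕ.+ k))
        pw = *-congˡ (^-congʳ (c# p) (ℕP.+-suc k k))
        d = local-p y (∣-trans (divs (c# p ^ (k ℕ.+ k)) (trans pw (sym (*-assoc _ _ _)))) h)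
        z = quo d
        norm : y * y ̄ ≈ c# p * (c# p * (z * z ̄))
        norm = trans (*-cong (eq d) (trans (conj-cong (eq d)) (trans (σ-* N' _ _) (*-congʳ (σ-ι N' _))))) (solve 3 (λ p z w → (p :* z) :* (p :* w) := p :* (p :* (z :* w))) refl (c# p) z (z ̄))

-- Integers modulo a prime

module ModularIntegers where
 import Data.Integer.Divisibility.Signed as SD
 open import Data.List.Membership.Propositional.Properties using (∈-∃++; ∈-++⁺ˡ; ∈-++⁺ʳ)
 open import Data.List.Relation.Unary.Any using (here; there)
 import Data.List.Relation.Unary.All as All
 open import Data.List.Relation.Unary.AllPairs using ([]; _∷_)
 open import Data.List.Relation.Binary.Permutation.Propositional using (↭-trans; ↭-refl; prep)
 open import Data.List.Relation.Binary.Permutation.Propositional.Properties using (shift; ↭-length)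
 open import Relation.Binary.PropositionalEquality using (refl)

 open IK using (_∣_; divs; quo; eq; _≡_[_]; _^_; ≡-trans; ≡-sym; ≡-*; ≡-+; ≡-neg; ≡-^; ≡-refl; ≡-reflexive; ∣-resp; solve; _:+_; _:*_; _:-_; :-_; _:=_; con)

 -- The pigeonhole principle for lists: each head is removed from the larger list by a permutation.
 -- It replaces explicit bijections whenever two sums over residues are compared.
 unique-↭ : ∀ {A : Set} (xs ys : List A) → Unique xs → (∀ x → x ∈ xs → x ∈ ys) → length ys ≤ length xs → xs ↭ ys
 unique-↭ [] [] _ _ _ = ↭-refl
 unique-↭ (x ∷ xs) ys (x∉ ∷ u) h le with ∈-∃++ (h x (here refl))
 ... | as , bs , refl = ↭-trans (prep x (unique-↭ xs (as ++ bs) u h' le')) (↭-sym (shift x as bs))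
   where
   le' : length (as ++ bs) ≤ length xs
   le' = ℕP.≤-pred (≡.subst (_≤ suc (length xs)) (↭-length (shift x as bs)) le)
   h' : ∀ z → z ∈ xs → z ∈ as ++ bs
   h' z m with ∈-++⁻ as (h z (there m))
   ... | inj₁ a = ∈-++⁺ˡ a
   ... | inj₂ (here refl) = ⊥-elim (All.lookup x∉ m refl)
   ... | inj₂ (there b) = ∈-++⁺ʳ as b

 toℕ∣ : ∀ {d a} → (+ d) ∣ a → d ℕD.∣ ℤ.∣ a ∣
 toℕ∣ {d} {a} (divs q e) = SD.∣⇒∣ᵤ {+ d} {a} (SD.divides q (≡.trans e (ℤP.*-comm (+ d) q)))

 fromℕ∣ : ∀ {d a} → d ℕD.∣ ℤ.∣ a ∣ → (+ d) ∣ a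
 fromℕ∣ {d} {a} h with SD.∣ᵤ⇒∣ {+ d} {a} h
 ... | SD.divides q e = divs q (≡.trans e (ℤP.*-comm q (+ d)))

 mod⇒≡ : ∀ {p a b} .{{_ : NonZero p}} → a ℕ.% p ≡ b ℕ.% p → (+ a) ≡ (+ b) [ + p ]
 mod⇒≡ {p} {a} {b} e = divs (+ (a ℕ./ p) ℤ.- + (b ℕ./ p)) (≡.trans (cong₂ ℤ._-_ (re a) (≡.trans (re b) (cong (λ r → + r ℤ.+ + p ℤ.* + (b ℕ./ p)) (≡.sym e))))
    (solve 4 (λ r p x y → (r :+ p :* x) :- (r :+ p :* y) := p :* (x :- y)) refl (+ (a ℕ.% p)) (+ p) (+ (a ℕ./ p)) (+ (b ℕ./ p))))
   where
   re : ∀ a → + a ≡ + (a ℕ.% p) ℤ.+ + p ℤ.* + (a ℕ./ p)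
   re a = ≡.trans (cong +_ (≡.trans (DM.m≡m%n+[m/n]*n a p) (cong (a ℕ.% p ℕ.+_) (ℕP.*-comm _ p)))) (cong (λ z → + (a ℕ.% p) ℤ.+ z) (ℤP.pos-* p (a ℕ./ p)))

 pos-^ : ∀ a n → + (a ℕ.^ n) ≡ (+ a) ^ n
 pos-^ a zero = refl
 pos-^ a (suc n) = ≡.trans (ℤP.pos-* a _) (cong (+ a ℤ.*_) (pos-^ a n))

 ^≡ℤ : ∀ a n → a ℤ.^ n ≡ a ^ n
 ^≡ℤ a zero = refl
 ^≡ℤ a (suc n) = cong (λ z → a ℤ.* z) (^≡ℤ a n)

 NRes : ℤ → ℕ → Set
 NRes a p = ∀ x → ¬ ((x ℤ.* x) ≡ a [ + p ])

 res? : ∀ a p → .{{NonZero p}} → (∃ λ x → (x ℤ.* x) ≡ a [ + p ]) ⊎ NRes a p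
 res? a p = concl (bounded p)
   where
   open import Data.Integer.DivMod using (a≡a%ℕn+[a/ℕn]*n; n%ℕd<d; _%ℕ_; _/ℕ_)
   dec : ∀ x → Dec ((x ℤ.* x) ≡ a [ + p ])
   dec x with p ℕD.∣? ℤ.∣ x ℤ.* x ℤ.- a ∣
   ... | yes h = yes (fromℕ∣ h)
   ... | no h = no (λ d → h (toℕ∣ d))
   fin : ∀ x → ∃ λ r → r < p × (x ≡ + r [ + p ])
   fin x = x %ℕ p , n%ℕd<d x p , divs (x /ℕ p) (≡.trans (cong (ℤ._- + (x %ℕ p)) (a≡a%ℕn+[a/ℕn]*n x p)) (solve 3 (λ r q p → (r :+ q :* p) :- r := p :* q) refl (+ (x %ℕ p)) (x /ℕ p) (+ p)))
   bounded : ∀ k → (∃ λ x → (x ℤ.* x) ≡ a [ + p ]) ⊎ (∀ r → r < k → ¬ ((+ r ℤ.* + r) ≡ a [ + p ]))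
   bounded zero = inj₂ λ r ()
   bounded (suc k) with dec (+ k)
   ... | yes d = inj₁ (+ k , d)
   ... | no nd with bounded k
   ... | inj₁ x = inj₁ x
   ... | inj₂ g = inj₂ case
     where
     case : ∀ r → r < suc k → ¬ ((+ r ℤ.* + r) ≡ a [ + p ])
     case r lt d with r ℕ.≟ k
     ... | yes refl = nd d
     ... | no ne = g r (ℕP.≤∧≢⇒< (ℕP.≤-pred lt) ne) d
   concl : (∃ λ x → (x ℤ.* x) ≡ a [ + p ]) ⊎ (∀ r → r < p → ¬ ((+ r ℤ.* + r) ≡ a [ + p ])) → (∃ λ x → (x ℤ.* x) ≡ a [ + p ]) ⊎ NRes a p
   concl (inj₁ x) = inj₁ x
   concl (inj₂ g) = inj₂ λ x d → let (r , lt , c) = fin x in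
     g r lt (≡-trans {x = + r ℤ.* + r} {y = x ℤ.* x} (≡-* {x = + r} {x} {+ r} {x} (≡-sym {x = x} {+ r} c) (≡-sym {x = x} {+ r} c)) d)

 module ModP (p : ℕ) (pr : Prime p) where
   instance
     nzp : NonZero p
     nzp = prime⇒nonZero pr

   p>1 : 1 < p
   p>1 = ℕ.nonTrivial⇒n>1 p {{prime⇒nonTrivial pr}}

   euclid : ∀ a b → (+ p) ∣ (a ℤ.* b) → ((+ p) ∣ a) ⊎ ((+ p) ∣ b)
   euclid a b h with euclidsLemma ℤ.∣ a ∣ ℤ.∣ b ∣ pr (≡.subst (p ℕD.∣_) (ℤP.abs-* a b) (toℕ∣ h))
   ... | inj₁ x = inj₁ (fromℕ∣ x)
   ... | inj₂ x = inj₂ (fromℕ∣ x)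

   p∤1 : ¬ ((+ p) ∣ 1ℤ)
   p∤1 h = ℕP.<⇒≱ p>1 (ℕD.∣⇒≤ (toℕ∣ {p} {1ℤ} h))

   cancel : ∀ a x y → ¬ ((+ p) ∣ a) → (a ℤ.* x) ≡ (a ℤ.* y) [ + p ] → x ≡ y [ + p ]
   cancel a x y na h = concl (euclid a (x ℤ.- y) (∣-resp {x = a ℤ.* x ℤ.- a ℤ.* y} (solve 3 (λ a x y → a :* x :- a :* y := a :* (x :- y)) refl a x y) h))
     where
     concl : ((+ p) ∣ a) ⊎ ((+ p) ∣ (x ℤ.- y)) → (+ p) ∣ (x ℤ.- y)
     concl (inj₁ z) = ⊥-elim (na z)
     concl (inj₂ z) = z

   p' = p ∸ 1
   sp' : suc p' ≡ p
   sp' = ℕP.m+[n∸m]≡n {1} (ℕP.<⇒≤ p>1)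

   fermat₁ : ∀ a → ¬ ((+ p) ∣ a) → (a ^ p') ≡ 1ℤ [ + p ]
   fermat₁ a na = cancel a (a ^ p') 1ℤ na (≡-trans {x = a ℤ.* a ^ p'} {y = a} (∣-resp {x = a ℤ.^ p ℤ.- a} (cong (ℤ._- a) (≡.trans (^≡ℤ a p) (cong (a ^_) (≡.sym sp')))) (fermat pr a))
      (≡-reflexive {x = a} (≡.sym (ℤP.*-identityʳ a))))

   inverse : ∀ a → ¬ ((+ p) ∣ a) → ∃ λ b → (a ℤ.* b) ≡ 1ℤ [ + p ]
   inverse a na = a ^ (p' ∸ 1) , ∣-resp {x = a ^ p' ℤ.- 1ℤ} (cong (λ k → a ^ k ℤ.- 1ℤ) (≡.sym (ℕP.m+[n∸m]≡n {1} (ℕP.m<n⇒0<n∸m p>1)))) (fermat₁ a na)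

   ∣-cong : ∀ {a b} → a ≡ b [ + p ] → (+ p) ∣ a → (+ p) ∣ b
   ∣-cong {a} {b} = IK.∣-≡ {+ p} {a} {b}

   sq-∣ : ∀ a → (+ p) ∣ (a ℤ.* a) → (+ p) ∣ a
   sq-∣ a h with euclid a a h
   ... | inj₁ x = x
   ... | inj₂ x = x

   -- x² ≡ n y² with y invertible exhibits n as a square
   ratio : ∀ n x y → ¬ ((+ p) ∣ y) → (x ℤ.* x) ≡ (n ℤ.* (y ℤ.* y)) [ + p ] → ∃ λ z → (z ℤ.* z) ≡ n [ + p ]
   ratio n x y ny h = x ℤ.* b , ≡-trans {x = (x ℤ.* b) ℤ.* (x ℤ.* b)} {y = (n ℤ.* (y ℤ.* y)) ℤ.* (b ℤ.* b)}
       (∣-resp {x = (x ℤ.* x) ℤ.* (b ℤ.* b) ℤ.- (n ℤ.* (y ℤ.* y)) ℤ.* (b ℤ.* b)} (cong (ℤ._- (n ℤ.* (y ℤ.* y)) ℤ.* (b ℤ.* b)) (solve 2 (λ x b → (x :* x) :* (b :* b) := (x :* b) :* (x :* b)) refl x b))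
          (≡-* {x = x ℤ.* x} {n ℤ.* (y ℤ.* y)} {b ℤ.* b} {b ℤ.* b} h (≡-refl {x = b ℤ.* b})))
       (∣-resp {x = n ℤ.* ((y ℤ.* b) ℤ.* (y ℤ.* b)) ℤ.- n ℤ.* (1ℤ ℤ.* 1ℤ)} (solve 3 (λ n y b → n :* ((y :* b) :* (y :* b)) :- n :* (con 1ℤ :* con 1ℤ) := (n :* (y :* y)) :* (b :* b) :- n) refl n y b)
          (≡-* {x = n} {n} {(y ℤ.* b) ℤ.* (y ℤ.* b)} {1ℤ ℤ.* 1ℤ} (≡-refl {x = n}) (≡-* {x = y ℤ.* b} {1ℤ} {y ℤ.* b} {1ℤ} e e)))
     where
     b = proj₁ (inverse y ny)
     e = proj₂ (inverse y ny)

   sq-diff : ∀ c a b → ¬ ((+ p) ∣ c) → (c ℤ.* (a ℤ.* a)) ≡ (c ℤ.* (b ℤ.* b)) [ + p ] → ((+ p) ∣ (a ℤ.- b)) ⊎ ((+ p) ∣ (a ℤ.+ b))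
   sq-diff c a b nc h = euclid (a ℤ.- b) (a ℤ.+ b) (∣-resp {x = a ℤ.* a ℤ.- b ℤ.* b} (solve 2 (λ a b → a :* a :- b :* b := (a :- b) :* (a :+ b)) refl a b) (cancel c (a ℤ.* a) (b ℤ.* b) nc h))

   sq-inj : ∀ c i j → ¬ (p ℕD.∣ c) → (c ℕ.* (j ℕ.* j)) ℕ.% p ≡ (c ℕ.* (i ℕ.* i)) ℕ.% p → i < j → j ℕ.+ i < p → ⊥
   sq-inj c i j nc e i<j j+i<p = concl (sq-diff (+ c) (+ j) (+ i) (λ d → nc (toℕ∣ {p} {+ c} d)) (≡.subst₂ (λ x y → x ≡ y [ + p ]) (ps j) (ps i) (mod⇒≡ {p} {c ℕ.* (j ℕ.* j)} {c ℕ.* (i ℕ.* i)} e)))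
     where
     ps : ∀ a → + (c ℕ.* (a ℕ.* a)) ≡ + c ℤ.* (+ a ℤ.* + a)
     ps a = ≡.trans (ℤP.pos-* c (a ℕ.* a)) (cong (λ z → + c ℤ.* z) (ℤP.pos-* a a))
     jmi : + j ℤ.- + i ≡ + (j ∸ i)
     jmi = ≡.trans (ℤP.m-n≡m⊖n j i) (ℤP.⊖-≥ (ℕP.<⇒≤ i<j))
     concl : ((+ p) ∣ (+ j ℤ.- + i)) ⊎ ((+ p) ∣ (+ j ℤ.+ + i)) → ⊥
     concl (inj₁ a) = ℕP.<⇒≱ (ℕP.≤-<-trans (ℕP.≤-trans (ℕP.m∸n≤m j i) (ℕP.m≤m+n j i)) j+i<p) (ℕD.∣⇒≤ {{ℕ.>-nonZero (ℕP.m<n⇒0<n∸m i<j)}} (toℕ∣ {p} {+ (j ∸ i)} (≡.subst (λ z → (+ p) ∣ z) jmi a)))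
     concl (inj₂ b) = ℕP.<⇒≱ j+i<p (ℕD.∣⇒≤ {{ℕ.>-nonZero (ℕP.<-≤-trans (ℕP.≤-<-trans z≤n i<j) (ℕP.m≤m+n j i))}} (toℕ∣ {p} {+ (j ℕ.+ i)} b))

   module Odd (h : ℕ) (p≡ : p ≡ suc (h ℕ.+ h)) where
     p'≡ : p' ≡ h ℕ.+ h
     p'≡ = cong (_∸ 1) p≡

     p∤2 : ¬ ((+ p) ∣ (+ 2))
     p∤2 d = even≢odd (ℕP.≤-antisym (ℕD.∣⇒≤ (toℕ∣ {p} {+ 2} d)) p>1)
       where even≢odd : p ≡ 2 → ⊥
             even≢odd e = go h (≡.trans (≡.sym p≡) e)
               where go : ∀ h → suc (h ℕ.+ h) ≡ 2 → ⊥
                     go (suc h) e with ≡.trans (≡.sym (cong suc (ℕP.+-suc h h))) (ℕP.suc-injective e)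
                     ... | ()

     -- A square root x of a would satisfy x^(p-1) ≡ a^h ≡ -1, against Fermat and p odd.
     euler-easy : ∀ a → (a ^ h) ≡ (ℤ.- 1ℤ) [ + p ] → NRes a p
     euler-easy a e x d = p∤2 (∣-resp {x = (x ^ p' ℤ.- (ℤ.- 1ℤ)) ℤ.- (x ^ p' ℤ.- 1ℤ)} (solve 1 (λ y → (y :- (:- con 1ℤ)) :- (y :- con 1ℤ) := con (+ 2)) refl (x ^ p')) (IK.∣-- x1 (fermat₁ x nx)))
       where
       x2h : x ^ p' ≡ (x ℤ.* x) ^ h
       x2h = ≡.trans (cong (x ^_) p'≡) (≡.trans (IK.^-homo-* x h h) (≡.sym (IK.^-distrib-* x x h)))
       x1 : (x ^ p') ≡ (ℤ.- 1ℤ) [ + p ]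
       x1 = ≡-trans {x = x ^ p'} {y = a ^ h} {z = ℤ.- 1ℤ} (∣-resp {x = (x ℤ.* x) ^ h ℤ.- a ^ h} (cong (ℤ._- a ^ h) (≡.sym x2h)) (≡-^ {x = x ℤ.* x} {a} h d)) e
       nx : ¬ ((+ p) ∣ x)
       nx px = p∤1 (∣-resp {x = 1ℤ ℤ.* 1ℤ} refl (sqm (≡.subst (λ z → (+ p) ∣ z) refl (IK.∣-neg {x = (x ^ p') ℤ.- (ℤ.- 1ℤ) ℤ.- x ^ p'} (IK.∣-- x1 (pow∣ p' p'>0))))))
         where
         p'>0 : 0 < p'
         p'>0 = ℕP.m<n⇒0<n∸m p>1
         pow∣ : ∀ n → 0 < n → (+ p) ∣ (x ^ n)
         pow∣ (suc n) _ = IK.∣-*ʳ (x ^ n) px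
         sqm : (+ p) ∣ (ℤ.- ((x ^ p') ℤ.- (ℤ.- 1ℤ) ℤ.- x ^ p')) → (+ p) ∣ (1ℤ ℤ.* 1ℤ)
         sqm d = ∣-resp {x = ℤ.- (ℤ.- ((x ^ p') ℤ.- (ℤ.- 1ℤ) ℤ.- x ^ p'))} (solve 1 (λ y → :- (:- (y :- (:- con 1ℤ) :- y)) := con 1ℤ :* con 1ℤ) refl (x ^ p')) (IK.∣-neg d)

   -- If A ≡ B modulo p, the cofactor of A - B in A^p - B^p is congruent to p B^(p-1) and so
   -- divisible by p; every p-th power gains one more factor p.
   lift : ∀ a b k → a ≡ b [ + p ] → (a ^ (p ℕ.^ k)) ≡ (b ^ (p ℕ.^ k)) [ (+ p) ^ suc k ]
   lift a b zero h = ∣-resp {x = a ℤ.- b} (cong₂ ℤ._-_ (≡.sym (ℤP.*-identityʳ a)) (≡.sym (ℤP.*-identityʳ b))) (IK.∣-respˡ (≡.sym (ℤP.*-identityʳ (+ p))) h)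
   lift a b (suc k) h = ∣-resp {x = A ^ p ℤ.- B ^ p} (cong₂ ℤ._-_ (asc a) (asc b)) (≡.subst (λ q → (+ p) ^ suc (suc k) ∣ (A ^ q ℤ.- B ^ q)) sp' goal)
     where
     A = a ^ (p ℕ.^ k)
     B = b ^ (p ℕ.^ k)
     asc : ∀ z → (z ^ (p ℕ.^ k)) ^ p ≡ z ^ (p ℕ.^ suc k)
     asc z = ≡.trans (IK.^-assocʳ z (p ℕ.^ k) p) (cong (z ^_) (ℕP.*-comm (p ℕ.^ k) p))
     ih = lift a b k h
     pdf = Pow.powDiff ℤring A B p'
     s = proj₁ pdf
     p∣A-B : (+ p) ∣ (A ℤ.- B)
     p∣A-B = IK.∣-trans {b = (+ p) ^ suc k} (IK.∣-*ʳ ((+ p) ^ k) (IK.∣-refl {+ p})) ih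
     p∣s : (+ p) ∣ s
     p∣s = IK.∣-≡ {x = (+ suc p') ℤ.* B ^ p'} {y = s} (≡-sym {x = s} {y = (+ suc p') ℤ.* B ^ p'} (IK.∣-trans p∣A-B (proj₂ (proj₂ pdf)))) (IK.∣-*ʳ (B ^ p') (≡.subst (λ q → (+ p) ∣ (+ q)) (≡.sym sp') IK.∣-refl))
     goal : (+ p) ^ suc (suc k) ∣ (A ^ suc p' ℤ.- B ^ suc p')
     goal = ∣-resp {x = s ℤ.* (A ℤ.- B)} (≡.trans (ℤP.*-comm s _) (≡.sym (proj₁ (proj₂ pdf)))) (IK.∣-* p∣s ih)

-- Quadratic Gauss sums

open ModularIntegers
module Sums (Z : ZRing) where
  open ZRing Z
  open Kit Z

  ∑-applyUpTo : ∀ {A : Set} (f : ℕ → A) n (F : A → Carrier) → ∑ (applyUpTo f n) F ≈ ∑< n (λ i → F (f i))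
  ∑-applyUpTo f zero F = refl
  ∑-applyUpTo f (suc n) F = trans (+-congˡ (∑-applyUpTo (f ∘ suc) n F)) (sym (∑<-first n (λ i → F (f i))))

  ∑<-rev : ∀ n (F : ℕ → Carrier) → ∑< n (λ i → F (n ∸ suc i)) ≈ ∑< n F
  ∑<-rev zero F = refl
  ∑<-rev (suc n) F = trans (∑<-first n (λ i → F (n ∸ i))) (trans (+-congˡ (∑<-rev n F)) (+-comm _ _))

  cyc-shift : ∀ n (F : ℕ → Carrier) → (∀ j → F (j ℕ.+ n) ≈ F j) → ∑< n (λ j → F (suc j)) ≈ ∑< n F
  cyc-shift n F per = trans (cancelˡ (F 0) (trans (sym (∑<-first n F)) (trans (+-comm _ _) (+-congʳ (per 0))))) refl
    where
    cancelˡ : ∀ a {b c} → a + b ≈ a + c → b ≈ c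
    cancelˡ a {b} {c} e = trans (solve 2 (λ a b → b := (a :+ b) :- a) refl a b) (trans (+-congʳ e) (solve 2 (λ a c → (a :+ c) :- a := c) refl a c))

  cyc-shifts : ∀ n (F : ℕ → Carrier) → (∀ j → F (j ℕ.+ n) ≈ F j) → ∀ x → ∑< n (λ j → F (x ℕ.+ j)) ≈ ∑< n F
  cyc-shifts n F per zero = refl
  cyc-shifts n F per (suc x) = trans (cyc-shifts n (λ j → F (suc j)) (λ j → per (suc j)) x) (cyc-shift n F per)

module _ {N' p₁ p₂ G H : ℕ} (CR : CRing N' p₁ p₂ G H) where
  open CRing CR
  
  module Gauss 
    (p h X : ℕ) (pr : Prime p) (p≡ : p ≡ suc (h ℕ.+ h)) (N≡ : N ≡ p ℕ.* X)
    (nzd : ∀ j → ¬ (N ℕD.∣ j) → ∀ y → (1# - ζ ^ j) * y ≈ 0# → y ≈ 0#) where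
    open Basics CR hiding (B)
    open Sums Z

    private
      instance
        nzp : NonZero p
        nzp = prime⇒nonZero pr
      module S' = +-*-Solver

    u : Carrier
    u = ζ ^ X

    u^p : u ^ p ≈ 1#
    u^p = trans (^-assocʳ ζ X p) (ζ-∣ (≡.subst (N ℕD.∣_) (≡.trans N≡ (ℕP.*-comm p X)) ℕD.∣-refl))

    u-p : ∀ a k → u ^ (a ℕ.+ p ℕ.* k) ≈ u ^ a
    u-p a k = trans (^-homo-* u a (p ℕ.* k)) (trans (*-congˡ (trans (sym (^-assocʳ u p k)) (trans (^-congˡ k u^p) (1^ k)))) (*-identityʳ _))

    u-% : ∀ a → u ^ a ≈ u ^ (a ℕ.% p)
    u-% a = trans (^-congʳ u (≡.trans (DM.m≡m%n+[m/n]*n a p) (cong (a ℕ.% p ℕ.+_) (ℕP.*-comm _ p)))) (u-p (a ℕ.% p) (a ℕ./ p))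

    X>0 : 0 < X
    X>0 = go X N≡
      where go : ∀ X → N ≡ p ℕ.* X → 0 < X
            go zero e = ⊥-elim (ℕP.0≢1+n (≡.sym (≡.trans e (ℕP.*-zeroʳ p))))
            go (suc X) _ = s≤s z≤n

    geom-u : ∀ k → ¬ (p ℕD.∣ k) → geom p (u ^ k) ≈ 0#
    geom-u k nk = nzd (X ℕ.* k) N∤ _ (trans (*-congʳ (+-congˡ (-‿cong (sym (^-assocʳ ζ X k))))) (trans (geom-tele p (u ^ k)) (trans (+-congˡ (-‿cong (trans (^-swap u k p) (trans (^-congˡ k u^p) (1^ k))))) (x-x≈0 1#))))
      where
      N∤ : ¬ (N ℕD.∣ X ℕ.* k)
      N∤ d = nk (ℕD.*-cancelˡ-∣ X {{ℕ.>-nonZero X>0}} (≡.subst (ℕD._∣ (X ℕ.* k)) (≡.trans N≡ (ℕP.*-comm p X)) d))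

    geom-1 : geom p u ≈ 0#
    geom-1 = trans (geom-cong p (sym (*-identityʳ u))) (geom-u 1 (λ d → ℕP.<⇒≱ (ℕ.nonTrivial⇒n>1 p {{prime⇒nonTrivial pr}}) (ℕD.∣⇒≤ d)))

    -- Only x from 1 to (p-1)/2 occur, so each residue in c times the nonzero squares is met once.
    -- `S` = 1 + 2 w(1) is the Gauss sum; the half sum (S - 1)/2 is the element whose congruences
    -- modulo 2 decide the character of 2.
    w : ℕ → Carrier
    w c = ∑< h (λ x → u ^ (c ℕ.* (suc x ℕ.* suc x)))

    w-mod : ∀ c d → c ℕ.% p ≡ d ℕ.% p → w c ≈ w d
    w-mod c d e = ∑<-cong h (λ x _ → trans (u-% (c ℕ.* (suc x ℕ.* suc x))) (trans (^-congʳ u (≡.trans (DM.%-distribˡ-* c (suc x ℕ.* suc x) p) (≡.trans (cong (λ z → (z ℕ.* ((suc x ℕ.* suc x) ℕ.% p)) ℕ.% p) e) (≡.sym (DM.%-distribˡ-* d (suc x ℕ.* suc x) p))))) (sym (u-% (d ℕ.* (suc x ℕ.* suc x))))))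

    σ-w : ∀ {a} → Unit a → ∀ c → σ a (w c) ≈ w (a ℕ.* c)
    σ-w {a} ua c = trans (σ-∑ ua h (λ x → u ^ (c ℕ.* (suc x ℕ.* suc x)))) (∑<-cong h (λ x _ → let k = c ℕ.* (suc x ℕ.* suc x) in
      trans (σ-^ ua u k) (trans (^-congˡ k (σ-ζ^ ua X)) (trans (^-assocʳ u a k) (^-congʳ u (≡.sym (ℕP.*-assoc a c (suc x ℕ.* suc x))))))))

    S : Carrier
    S = 1# + c# 2 * w 1

    σ-S : ∀ {a} → Unit a → σ a S ≈ 1# + c# 2 * w a
    σ-S {a} ua = trans (σ-+ a _ _) (+-cong (σ-1 ua) (trans (σ-* a _ _) (*-cong (σ-ι a _) (trans (σ-w ua 1) (reflexive (cong w (ℕP.*-identityʳ a)))))))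

    private
      h<p : h < p
      h<p = ≡.subst (h <_) (≡.sym p≡) (s≤s (ℕP.m≤m+n h h))

      small : ∀ x → x < h → ¬ (p ℕD.∣ suc x)
      small x lt d = ℕP.<⇒≱ (ℕP.≤-<-trans lt h<p) (ℕD.∣⇒≤ d)

      reflect : ∀ a y → a ℕ.+ y ≡ p → u ^ (a ℕ.* a) ≈ u ^ (y ℕ.* y)
      reflect a y e = trans (sym (u-p (a ℕ.* a) y)) (trans (^-congʳ u (≡.trans (cong (λ p → a ℕ.* a ℕ.+ p ℕ.* y) (≡.sym e))
         (≡.trans (S'.solve 2 (λ a y → a S'.:* a S'.:+ (a S'.:+ y) S'.:* y S'.:= y S'.:* y S'.:+ (a S'.:+ y) S'.:* a) ≡.refl a y) (cong (λ p → y ℕ.* y ℕ.+ p ℕ.* a) e)))) (u-p (y ℕ.* y) a))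

      full : ∑< p (λ x → u ^ (x ℕ.* x)) ≈ S
      full = trans (reflexive (cong (λ k → ∑< k F) p≡)) (trans (∑<-first (h ℕ.+ h) F) (+-congˡ (trans (∑<-++ h h (F ∘ suc)) (trans (+-cong (∑<-cong h (λ x _ → ^-congʳ u (≡.sym (ℕP.*-identityˡ (suc x ℕ.* suc x)))))
          (trans (∑<-cong h (λ x lt → trans (reflect (suc (h ℕ.+ x)) (h ∸ x) (ar x lt)) (^-congʳ u (≡.trans (cong₂ ℕ._*_ (sc x lt) (sc x lt)) (≡.sym (ℕP.*-identityˡ (suc (h ∸ suc x) ℕ.* suc (h ∸ suc x))))))))
            (∑<-rev h (λ x → u ^ (1 ℕ.* (suc x ℕ.* suc x)))))) (solve 1 (λ w → w :+ w := con (+ 2) :* w) refl (w 1))))))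
        where
        F : ℕ → Carrier
        F x = u ^ (x ℕ.* x)
        sc : ∀ x → x < h → h ∸ x ≡ suc (h ∸ suc x)
        sc x lt = ≡.sym (≡.trans (≡.sym (ℕP.+-∸-assoc 1 lt)) ≡.refl)
        ar : ∀ x → x < h → suc (h ℕ.+ x) ℕ.+ (h ∸ x) ≡ p
        ar x lt = ≡.trans (cong suc (≡.trans (ℕP.+-assoc h x _) (cong (h ℕ.+_) (ℕP.m+[n∸m]≡n (ℕP.<⇒≤ lt))))) (≡.sym p≡)

    -- The exponents of the two half sums are distinct and nonzero, and there are p - 1 of them.
    -- They exhaust the nonzero residues, whose roots of unity sum to -1.
    rel : ∀ c d → ¬ (p ℕD.∣ c) → ¬ (p ℕD.∣ d) →
      (∀ x y → ¬ (p ℕD.∣ x) → ¬ (p ℕD.∣ y) → ¬ ((c ℕ.* (x ℕ.* x)) ℕ.% p ≡ (d ℕ.* (y ℕ.* y)) ℕ.% p)) → w c + w d ≈ - 1#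
    rel c d nc nd hyp = trans (+-cong (wl c) (wl d)) (trans (sym (∑-++ (lst c) (lst d) (u ^_))) (trans (∑-↭ (u ^_) perm) (trans (∑-applyUpTo suc (h ℕ.+ h) (u ^_))
        (trans (solve 2 (λ a o → a := (o :+ a) :- o) refl (∑< (h ℕ.+ h) (λ i → u ^ suc i)) 1#) (trans (+-congʳ (trans (sym (∑<-first (h ℕ.+ h) (u ^_))) (trans (reflexive (cong (λ k → geom k u) (≡.sym p≡))) geom-1))) (+-identityˡ _))))))
      where
      f : ℕ → ℕ → ℕ
      f c x = (c ℕ.* (suc x ℕ.* suc x)) ℕ.% p
      lst : ℕ → List ℕ
      lst c = applyUpTo (f c) h
      wl : ∀ c → w c ≈ ∑ (lst c) (u ^_)
      wl c = trans (∑<-cong h (λ x _ → u-% (c ℕ.* (suc x ℕ.* suc x)))) (sym (∑-applyUpTo (f c) h (u ^_)))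
      inj : ∀ c → ¬ (p ℕD.∣ c) → ∀ {i j} → i < j → j < h → ¬ (f c i ≡ f c j)
      inj c nc {i} {j} i<j j<h e = ModP.sq-inj p pr c (suc i) (suc j) nc (≡.sym e) (s≤s i<j) (≡.subst (suc j ℕ.+ suc i <_) (≡.sym p≡) (s≤s (ℕP.+-mono-≤ j<h (ℕP.<-trans i<j j<h))))
      uniq : ∀ c → ¬ (p ℕD.∣ c) → Unique (lst c)
      uniq c nc = APP.applyUpTo⁺₁ (f c) h (λ i<j j<h → inj c nc i<j j<h)
      pos : ∀ c → ¬ (p ℕD.∣ c) → ∀ x → x < h → ∃ λ i → i < h ℕ.+ h × f c x ≡ suc i
      pos c nc x lt = go (f c x) ≡.refl
        where
        go : ∀ v → f c x ≡ v → ∃ λ i → i < h ℕ.+ h × f c x ≡ suc i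
        go zero e with euclidsLemma c _ pr (ℕD.m%n≡0⇒n∣m _ p e)
        ... | inj₁ a = ⊥-elim (nc a)
        ... | inj₂ b with euclidsLemma (suc x) (suc x) pr b
        ... | inj₁ b' = ⊥-elim (small x lt b')
        ... | inj₂ b' = ⊥-elim (small x lt b')
        go (suc v) e = v , ℕP.≤-pred (≡.subst₂ _<_ e p≡ (DM.m%n<n _ p)) , e
      mem : ∀ c → ¬ (p ℕD.∣ c) → ∀ z → z ∈ lst c → z ∈ applyUpTo suc (h ℕ.+ h)
      mem c nc z m with ∈-applyUpTo⁻ (f c) m
      ... | x , lt , ≡.refl with pos c nc x lt
      ... | i , i<  , e = ≡.subst (_∈ applyUpTo suc (h ℕ.+ h)) (≡.sym e) (∈-applyUpTo⁺ suc i<)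
      disj : ∀ {z} → z ∈ lst c × z ∈ lst d → ⊥
      disj (m , m') with ∈-applyUpTo⁻ (f c) m | ∈-applyUpTo⁻ (f d) m'
      ... | x , lt , e | y , lt' , e' = hyp (suc x) (suc y) (small x lt) (small y lt') (≡.trans (≡.sym e) e')
      perm : lst c ++ lst d ↭ applyUpTo suc (h ℕ.+ h)
      perm = unique-↭ _ _ (UP.++⁺ (uniq c nc) (uniq d nd) disj) sub
          (ℕP.≤-reflexive (≡.trans (LP.length-applyUpTo suc (h ℕ.+ h)) (≡.sym (≡.trans (LP.length-++ (lst c)) (cong₂ ℕ._+_ (LP.length-applyUpTo (f c) h) (LP.length-applyUpTo (f d) h))))))
        where
        sub : ∀ z → z ∈ lst c ++ lst d → z ∈ applyUpTo suc (h ℕ.+ h)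
        sub z m with ∈-++⁻ (lst c) m
        ... | inj₁ a = mem c nc z a
        ... | inj₂ b = mem d nd z b

    private
      v : Carrier
      v = u ̄
      uv : u * v ≈ 1#
      uv = conj-ζ^ X
      v≈ : v ≈ u ^ N'
      v≈ = σ-ζ^ unit-N' X
      v^p : v ^ p ≈ 1#
      v^p = trans (^-congˡ p v≈) (trans (^-swap u N' p) (trans (^-congˡ N' u^p) (1^ N')))
      v-p : ∀ a k → v ^ (a ℕ.+ p ℕ.* k) ≈ v ^ a
      v-p a k = trans (^-homo-* v a (p ℕ.* k)) (trans (*-congˡ (trans (sym (^-assocʳ v p k)) (trans (^-congˡ k v^p) (1^ k)))) (*-identityʳ _))

    p∤N' : ¬ (p ℕD.∣ N')
    p∤N' d = ℕP.<⇒≱ (ℕ.nonTrivial⇒n>1 p {{prime⇒nonTrivial pr}}) (ℕD.∣⇒≤ (ℕD.∣m+n∣m⇒∣n {p} {N'} (≡.subst (p ℕD.∣_) (≡.trans (≡.sym N≡) (ℕP.+-comm 1 N')) (ℕD.m∣m*n X)) d))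

    p∤2 : ¬ (p ℕD.∣ 2)
    p∤2 d = ModP.Odd.p∤2 p pr h p≡ (fromℕ∣ {p} {+ 2} d)

    -- Substituting y ↦ x + y turns the double sum into a sum of full geometric sums.
    SS̄ : S * S ̄ ≈ c# p
    SS̄ = begin
      S * S ̄ ≈⟨ *-cong (sym full) (trans (conj-cong (sym full)) (trans (σ-∑ unit-N' p U) (∑<-cong p (λ x _ → σ-^ unit-N' u (x ℕ.* x))))) ⟩
      ∑< p U * ∑< p V ≈⟨ trans (*-comm (∑< p U) (∑< p V)) (trans (∑<-*ˡ p (∑< p V) U) (∑<-cong p (λ x _ → trans (*-comm (∑< p V) (U x)) (*-congˡ (sym (cyc-shifts p V perV x)))))) ⟩
      ∑< p (λ x → U x * ∑< p (λ y → V (x ℕ.+ y))) ≈⟨ ∑<-cong p (λ x _ → trans (∑<-*ˡ p (U x) (λ y → V (x ℕ.+ y))) (∑<-cong p (λ y _ → term x y))) ⟩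
      ∑< p (λ x → ∑< p (λ y → V y * (v ^ (2 ℕ.* y)) ^ x)) ≈⟨ ∑<-swap p p (λ x y → V y * (v ^ (2 ℕ.* y)) ^ x) ⟩
      ∑< p (λ y → ∑< p (λ x → V y * (v ^ (2 ℕ.* y)) ^ x)) ≈⟨ ∑<-cong p (λ y _ → sym (∑<-*ˡ p (V y) ((v ^ (2 ℕ.* y)) ^_))) ⟩
      ∑< p (λ y → V y * geom p (v ^ (2 ℕ.* y))) ≈⟨ reflexive (cong (λ k → ∑< k (λ y → V y * geom p (v ^ (2 ℕ.* y)))) p≡) ⟩
      ∑< (suc (h ℕ.+ h)) (λ y → V y * geom p (v ^ (2 ℕ.* y))) ≈⟨ ∑<-first (h ℕ.+ h) (λ y → V y * geom p (v ^ (2 ℕ.* y))) ⟩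
      V 0 * geom p 1# + ∑< (h ℕ.+ h) (λ y → V (suc y) * geom p (v ^ (2 ℕ.* suc y)))
        ≈⟨ +-cong (trans (*-identityˡ _) (trans (∑<-cong p (λ i _ → 1^ i)) (trans (∑<-const p 1#) (*-identityʳ _))))
             (trans (∑<-cong (h ℕ.+ h) (λ y lt → trans (*-congˡ (gz y lt)) (zeroʳ _))) (∑<-0 (h ℕ.+ h))) ⟩
      c# p + 0# ≈⟨ +-identityʳ _ ⟩
      c# p ∎
      where
      open RR
      U V : ℕ → Carrier
      U x = u ^ (x ℕ.* x)
      V x = v ^ (x ℕ.* x)
      perV : ∀ j → V (j ℕ.+ p) ≈ V j
      perV j = trans (^-congʳ v (S'.solve 2 (λ j p → (j S'.:+ p) S'.:* (j S'.:+ p) S'.:= j S'.:* j S'.:+ p S'.:* (j S'.:+ j S'.:+ p)) ≡.refl j p)) (v-p (j ℕ.* j) (j ℕ.+ j ℕ.+ p))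
      term : ∀ x y → U x * V (x ℕ.+ y) ≈ V y * (v ^ (2 ℕ.* y)) ^ x
      term x y = trans (*-congˡ (trans (^-congʳ v (S'.solve 2 (λ x y → (x S'.:+ y) S'.:* (x S'.:+ y) S'.:= x S'.:* x S'.:+ (y S'.:* y S'.:+ (S'.con 2 S'.:* y) S'.:* x)) ≡.refl x y))
          (trans (^-homo-* v (x ℕ.* x) (y ℕ.* y ℕ.+ (2 ℕ.* y) ℕ.* x)) (*-congˡ (trans (^-homo-* v (y ℕ.* y) ((2 ℕ.* y) ℕ.* x)) (*-congˡ (sym (^-assocʳ v (2 ℕ.* y) x))))))))
        (trans (sym (*-assoc (U x) (V x) (V y * (v ^ (2 ℕ.* y)) ^ x))) (trans (*-congʳ (trans (sym (^-distrib-* u v (x ℕ.* x))) (trans (^-congˡ (x ℕ.* x) uv) (1^ (x ℕ.* x))))) (*-identityˡ _)))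
      gz : ∀ y → y < h ℕ.+ h → geom p (v ^ (2 ℕ.* suc y)) ≈ 0#
      gz y lt = trans (geom-cong p (trans (^-congˡ (2 ℕ.* suc y) v≈) (^-assocʳ u N' (2 ℕ.* suc y)))) (geom-u (N' ℕ.* (2 ℕ.* suc y)) nd)
        where
        nd : ¬ (p ℕD.∣ N' ℕ.* (2 ℕ.* suc y))
        nd d with euclidsLemma N' _ pr d
        ... | inj₁ a = p∤N' a
        ... | inj₂ b with euclidsLemma 2 (suc y) pr b
        ... | inj₁ a = p∤2 a
        ... | inj₂ c = ℕP.<⇒≱ (≡.subst (suc y <_) (≡.sym p≡) (s≤s lt)) (ℕD.∣⇒≤ c)

    open Pow Z using (frob-∑)

    -- Frobenius in ring form: combined with the value of S² it yields quadratic reciprocity.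
    S-frob : ∀ {q} → Prime q → (S ^ q) ≡ 1# + c# 2 * w q [ c# q ]
    S-frob {q} prq = ≡-trans (frob prq 1# (c# 2 * w 1)) (≡-+ (≡-reflexive (1^ q)) (≡-trans (≡-reflexive (^-distrib-* (c# 2) (w 1) q)) (≡-* two wq)))
      where
      two : (c# 2 ^ q) ≡ c# 2 [ c# q ]
      two = ≡-trans (≡-reflexive (sym (ι-^ (+ 2) q))) (ι-≡ (fermat prq (+ 2)))
      wq : (w 1 ^ q) ≡ w q [ c# q ]
      wq = ≡-trans (frob-∑ prq h (λ x → u ^ (1 ℕ.* (suc x ℕ.* suc x)))) (≡-reflexive (∑<-cong h (λ x _ → let k = suc x ℕ.* suc x in
        trans (^-assocʳ u (1 ℕ.* k) q) (^-congʳ u (≡.trans (ℕP.*-comm (1 ℕ.* k) q) (cong (q ℕ.*_) (ℕP.*-identityˡ k)))))))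

-- Uniqueness of the representation of a prime as a sum of two squares

module TwoSquareUniqueness where
 open import Relation.Binary.PropositionalEquality using (refl)

 open IK using (solve; _:+_; _:*_; _:-_; :-_; _:=_; con; _∣_; divs; quo; eq)

 sqabs : ∀ i → i ℤ.* i ≡ + (ℤ.∣ i ∣ ℕ.* ℤ.∣ i ∣)
 sqabs (+ n) = ≡.sym (ℤP.pos-* n n)
 sqabs -[1+ n ] = refl

 sq≡⇒± : ∀ x y → x ℤ.* x ≡ y ℤ.* y → (x ≡ y) ⊎ (x ≡ ℤ.- y)
 sq≡⇒± x y e with ℤP.i*j≡0⇒i≡0∨j≡0 (x ℤ.- y) {x ℤ.+ y} (≡.trans (solve 2 (λ x y → (x :- y) :* (x :+ y) := x :* x :- y :* y) refl x y) (≡.trans (cong (λ z → z ℤ.- y ℤ.* y) e) (ℤP.+-inverseʳ (y ℤ.* y))))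
 ... | inj₁ z = inj₁ (ℤP.i-j≡0⇒i≡j x y z)
 ... | inj₂ z = inj₂ (≡.trans (solve 2 (λ x y → x := (x :+ y) :+ (:- y)) refl x y) (≡.trans (cong (ℤ._+ (ℤ.- y)) z) (ℤP.+-identityˡ _)))

 -- p = x² + t² = A² + B²; p divides (xB - tA)(xB + tA), and D² + S² = p² bounds D.
 module TwoSquares (p : ℕ) (pr : Prime p) where
   private
     module M = ModP p pr
     0<p : 0 < p
     0<p = ℕP.<-trans (s≤s z≤n) M.p>1
     P = + p

   small : ∀ q S → (P ℤ.* q) ℤ.* (P ℤ.* q) ℤ.+ S ℤ.* S ≡ P ℤ.* P → (q ≡ 0ℤ) ⊎ (S ≡ 0ℤ)
   small q S e = go ℤ.∣ q ∣ refl
     where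
     ne : (p ℕ.* ℤ.∣ q ∣) ℕ.* (p ℕ.* ℤ.∣ q ∣) ℕ.+ ℤ.∣ S ∣ ℕ.* ℤ.∣ S ∣ ≡ p ℕ.* p
     ne = ℤP.+-injective (≡.trans (cong₂ ℤ._+_ (≡.trans (cong (λ z → + (z ℕ.* z)) (≡.sym (ℤP.abs-* P q))) (≡.sym (sqabs (P ℤ.* q)))) (≡.sym (sqabs S))) (≡.trans e (≡.sym (ℤP.pos-* p p))))
     go : ∀ Q → ℤ.∣ q ∣ ≡ Q → (q ≡ 0ℤ) ⊎ (S ≡ 0ℤ)
     go zero h = inj₁ (ℤP.∣i∣≡0⇒i≡0 h)
     go (suc zero) h = inj₂ (ℤP.∣i∣≡0⇒i≡0 (ss0 ℤ.∣ S ∣ (ℕP.+-cancelˡ-≡ (p ℕ.* p) _ 0 (≡.trans (≡.trans (cong (ℕ._+ (ℤ.∣ S ∣ ℕ.* ℤ.∣ S ∣)) (≡.sym (≡.trans (cong (λ z → (p ℕ.* z) ℕ.* (p ℕ.* z)) h) (cong₂ ℕ._*_ (ℕP.*-identityʳ p) (ℕP.*-identityʳ p))))) ne) (≡.sym (ℕP.+-identityʳ (p ℕ.* p)))))))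
       where
       ss0 : ∀ s → s ℕ.* s ≡ 0 → s ≡ 0
       ss0 zero _ = refl
     go (suc (suc Q)) h = ⊥-elim (ℕP.<⇒≱ (ℕP.*-mono-< p<pq p<pq) (ℕP.≤-trans (ℕP.m≤m+n _ (ℤ.∣ S ∣ ℕ.* ℤ.∣ S ∣)) (ℕP.≤-reflexive ne)))
       where
       p<pq : p < p ℕ.* ℤ.∣ q ∣
       p<pq = ≡.subst (λ z → p < p ℕ.* z) (≡.sym h) (ℕP.m<m*n p (suc (suc Q)) {{ℕ.>-nonZero 0<p}} (s≤s (s≤s z≤n)))

   cancelP : ∀ x y → P ℤ.* x ≡ P ℤ.* y → x ≡ y
   cancelP x y e = ℤP.*-cancelˡ-≡ P x y {{ℤ.≢-nonZero (λ z → ℕP.<⇒≢ 0<p (≡.sym (ℤP.+-injective z)))}} e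

   unique : ∀ x t A B → P ≡ x ℤ.* x ℤ.+ t ℤ.* t → P ≡ A ℤ.* A ℤ.+ B ℤ.* B → ¬ (t ℤ.* t ≡ A ℤ.* A) → x ℤ.* x ≡ A ℤ.* A
   unique x t A B ex eA ne = concl (M.euclid (x ℤ.* B ℤ.- t ℤ.* A) (x ℤ.* B ℤ.+ t ℤ.* A) (divs (B ℤ.* B ℤ.- t ℤ.* t)
       (≡.trans (solve 4 (λ x t a b → (x :* b :- t :* a) :* (x :* b :+ t :* a) := b :* b :* (x :* x :+ t :* t) :- t :* t :* (a :* a :+ b :* b)) refl x t A B)
         (≡.trans (cong₂ (λ u v → B ℤ.* B ℤ.* u ℤ.- t ℤ.* t ℤ.* v) (≡.sym ex) (≡.sym eA)) (solve 3 (λ p b t → b :* b :* p :- t :* t :* p := p :* (b :* b :- t :* t)) refl P B t)))))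
     where
     pp : ∀ s → (x ℤ.* B ℤ.- s ℤ.* A) ℤ.* (x ℤ.* B ℤ.- s ℤ.* A) ℤ.+ (x ℤ.* A ℤ.+ s ℤ.* B) ℤ.* (x ℤ.* A ℤ.+ s ℤ.* B) ≡ (x ℤ.* x ℤ.+ s ℤ.* s) ℤ.* (A ℤ.* A ℤ.+ B ℤ.* B)
     pp s = solve 4 (λ x s a b → (x :* b :- s :* a) :* (x :* b :- s :* a) :+ (x :* a :+ s :* b) :* (x :* a :+ s :* b) := (x :* x :+ s :* s) :* (a :* a :+ b :* b)) refl x s A B
     main : ∀ s → s ℤ.* s ≡ t ℤ.* t → P ∣ (x ℤ.* B ℤ.- s ℤ.* A) → x ℤ.* x ≡ A ℤ.* A
     main s es (divs q e) = fin (small q (x ℤ.* A ℤ.+ s ℤ.* B) (≡.trans (cong (λ z → z ℤ.* z ℤ.+ (x ℤ.* A ℤ.+ s ℤ.* B) ℤ.* (x ℤ.* A ℤ.+ s ℤ.* B)) (≡.sym e)) (≡.trans (pp s) (cong₂ ℤ._*_ (≡.sym exs) (≡.sym eA)))))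
       where
       exs : P ≡ x ℤ.* x ℤ.+ s ℤ.* s
       exs = ≡.trans ex (cong (λ z → x ℤ.* x ℤ.+ z) (≡.sym es))
       fin : (q ≡ 0ℤ) ⊎ (x ℤ.* A ℤ.+ s ℤ.* B ≡ 0ℤ) → x ℤ.* x ≡ A ℤ.* A
       fin (inj₁ q0) = cancelP _ _ (≡.trans (cong (λ z → z ℤ.* (x ℤ.* x)) eA) (≡.trans (solve 4 (λ x s a b → (a :* a :+ b :* b) :* (x :* x) := (x :* x :+ s :* s) :* (a :* a) :+ (x :* b :- s :* a) :* (x :* b :+ s :* a)) refl x s A B)
           (≡.trans (cong₂ ℤ._+_ (cong (λ z → z ℤ.* (A ℤ.* A)) (≡.sym exs)) (cong (λ z → z ℤ.* (x ℤ.* B ℤ.+ s ℤ.* A)) (≡.trans e (≡.trans (cong (P ℤ.*_) q0) (ℤP.*-zeroʳ P))))) (ℤP.+-identityʳ _))))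
       fin (inj₂ S0) = ⊥-elim (ne (≡.trans (≡.sym es) (cancelP _ _ (≡.trans (cong (λ z → z ℤ.* (s ℤ.* s)) eA) (≡.trans (solve 4 (λ x s a b → (a :* a :+ b :* b) :* (s :* s) := (x :* x :+ s :* s) :* (a :* a) :- (x :* a :+ s :* b) :* (x :* a :- s :* b)) refl x s A B)
           (≡.trans (cong₂ ℤ._-_ (cong (λ z → z ℤ.* (A ℤ.* A)) (≡.sym exs)) (cong (λ z → z ℤ.* (x ℤ.* A ℤ.- s ℤ.* B)) S0)) (ℤP.+-identityʳ _)))))))
     concl : (P ∣ (x ℤ.* B ℤ.- t ℤ.* A)) ⊎ (P ∣ (x ℤ.* B ℤ.+ t ℤ.* A)) → x ℤ.* x ≡ A ℤ.* A
     concl (inj₁ d) = main t refl d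
     concl (inj₂ d) = main (ℤ.- t) (solve 1 (λ t → (:- t) :* (:- t) := t :* t) refl t) (IK.∣-resp (solve 3 (λ xb t a → xb :+ t :* a := xb :- (:- t) :* a) refl (x ℤ.* B) t A) d)

-- Sums over vectors and Parseval's identity

infix 7 _·_
_·_ : ∀ {m} → Vec ℕ m → Vec ℕ m → ℕ
[] · [] = 0
(a ∷ as) · (b ∷ bs) = a ℕ.* b ℕ.+ as · bs

doubled : ∀ {m} → Vec ℕ m → Vec ℕ m
doubled = Vec.map (2 ℕ.*_)

module VSum (Z : ZRing) where
  open ZRing Z
  open Kit Z

  Σᵥ : ∀ n m → (Vec ℕ m → Carrier) → Carrier
  Σᵥ n zero g = g []
  Σᵥ n (suc m) g = ∑< n (λ i → Σᵥ n m (λ v → g (i ∷ v)))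

  Σᵥ-cong : ∀ n m {g h : Vec ℕ m → Carrier} → (∀ v → g v ≈ h v) → Σᵥ n m g ≈ Σᵥ n m h
  Σᵥ-cong n zero e = e []
  Σᵥ-cong n (suc m) e = ∑<-cong n (λ i _ → Σᵥ-cong n m (λ v → e (i ∷ v)))

  Σᵥ-≡ : ∀ {d} n m {g h : Vec ℕ m → Carrier} → (∀ v → g v ≡ h v [ d ]) → Σᵥ n m g ≡ Σᵥ n m h [ d ]
  Σᵥ-≡ n zero e = e []
  Σᵥ-≡ n (suc m) e = ∑<-≡ n (λ i → Σᵥ-≡ n m (λ v → e (i ∷ v)))

  Σᵥ-*ˡ : ∀ n m c (g : Vec ℕ m → Carrier) → c * Σᵥ n m g ≈ Σᵥ n m (λ v → c * g v)
  Σᵥ-*ˡ n zero c g = refl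
  Σᵥ-*ˡ n (suc m) c g = trans (∑<-*ˡ n c _) (∑<-cong n (λ i _ → Σᵥ-*ˡ n m c (λ v → g (i ∷ v))))

  Σᵥ-*ʳ : ∀ n m c (g : Vec ℕ m → Carrier) → Σᵥ n m g * c ≈ Σᵥ n m (λ v → g v * c)
  Σᵥ-*ʳ n m c g = trans (*-comm _ c) (trans (Σᵥ-*ˡ n m c g) (Σᵥ-cong n m (λ v → *-comm c (g v))))

  Σᵥ-∑< : ∀ n m a (g : ℕ → Vec ℕ m → Carrier) → Σᵥ n m (λ v → ∑< a (λ i → g i v)) ≈ ∑< a (λ i → Σᵥ n m (g i))
  Σᵥ-∑< n zero a g = refl
  Σᵥ-∑< n (suc m) a g = trans (∑<-cong n (λ j _ → Σᵥ-∑< n m a (λ i v → g i (j ∷ v)))) (∑<-swap n a (λ j i → Σᵥ n m (λ v → g i (j ∷ v))))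

  Σᵥ-const : ∀ n m c → Σᵥ n m (λ _ → c) ≈ c# n ^ m * c
  Σᵥ-const n zero c = sym (*-identityˡ c)
  Σᵥ-const n (suc m) c = trans (∑<-cong n (λ _ _ → Σᵥ-const n m c)) (trans (∑<-const n _) (sym (*-assoc _ _ _)))

  -1# : Carrier
  -1# = - 1#

  -1²≈1 : -1# * -1# ≈ 1#
  -1²≈1 = trans (sym (-‿distribˡ-* 1# -1#)) (trans (-‿cong (*-identityˡ -1#)) (-‿involutive 1#))

  -1^2n : ∀ n → -1# ^ (2 ℕ.* n) ≈ 1#
  -1^2n n = trans (sym (^-assocʳ -1# 2 n)) (trans (^-congˡ n (trans (*-congˡ (*-identityʳ -1#)) -1²≈1)) (1^ n))

  even-terms : ∀ n (h : ℕ → Carrier) → ∑< (2 ℕ.* n) (λ i → (1# + -1# ^ i) * h i) ≈ c# 2 * ∑< n (λ j → h (2 ℕ.* j))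
  even-terms zero h = sym (zeroʳ _)
  even-terms (suc n) h = trans (reflexive (cong (λ k → ∑< k (λ i → (1# + -1# ^ i) * h i)) (ℕP.*-suc 2 n)))
    (trans (+-cong (+-cong (even-terms n h) (*-congʳ (+-congˡ (-1^2n n)))) (trans (*-congʳ (trans (+-congˡ (trans (*-congˡ (-1^2n n)) (*-identityʳ -1#))) (x-x≈0 1#))) (zeroˡ _)))
    (trans (+-identityʳ _) (trans (+-congˡ (*-congʳ (trans (+-cong (sym ι-1) (sym ι-1)) (sym (ι-+ 1ℤ 1ℤ))))) (sym (distribˡ (c# 2) _ _)))))

  -- Summing the signs (-1)^(s·x) over all s in {0,1}^m gives 2^m if every coordinate of x is even
  -- and 0 otherwise.
  even-sum : ∀ n m (g : Vec ℕ m → Carrier) → Σᵥ 2 m (λ s → Σᵥ (2 ℕ.* n) m (λ x → -1# ^ (s · x) * g x)) ≈ c# 2 ^ m * Σᵥ n m (λ z → g (doubled z))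
  even-sum n zero g = refl
  even-sum n (suc m) g = begin
    ∑< 2 (λ s₀ → Σᵥ 2 m (λ s → ∑< q (λ x₀ → Σᵥ q m (λ x → -1# ^ (s₀ ℕ.* x₀ ℕ.+ s · x) * g (x₀ ∷ x)))))
      ≈⟨ ∑<-cong 2 (λ s₀ _ → Σᵥ-∑< 2 m q (λ x₀ s → Σᵥ q m (λ x → -1# ^ (s₀ ℕ.* x₀ ℕ.+ s · x) * g (x₀ ∷ x)))) ⟩
    ∑< 2 (λ s₀ → ∑< q (λ x₀ → Σᵥ 2 m (λ s → Σᵥ q m (λ x → -1# ^ (s₀ ℕ.* x₀ ℕ.+ s · x) * g (x₀ ∷ x)))))
      ≈⟨ ∑<-cong 2 (λ s₀ _ → ∑<-cong q (λ x₀ _ → inner s₀ x₀)) ⟩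
    ∑< 2 (λ s₀ → ∑< q (λ x₀ → -1# ^ (s₀ ℕ.* x₀) * h x₀)) ≈⟨ ∑<-swap 2 q (λ s₀ x₀ → -1# ^ (s₀ ℕ.* x₀) * h x₀) ⟩
    ∑< q (λ x₀ → ∑< 2 (λ s₀ → -1# ^ (s₀ ℕ.* x₀) * h x₀)) ≈⟨ ∑<-cong q (λ x₀ _ → pair x₀) ⟩
    ∑< q (λ x₀ → (1# + -1# ^ x₀) * h x₀) ≈⟨ even-terms n h ⟩
    c# 2 * ∑< n (λ j → h (2 ℕ.* j)) ≈⟨ *-congˡ (sym (∑<-*ˡ n (c# 2 ^ m) (λ j → H (2 ℕ.* j)))) ⟩
    c# 2 * (c# 2 ^ m * ∑< n (λ j → H (2 ℕ.* j))) ≈⟨ sym (*-assoc _ _ _) ⟩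
    c# 2 ^ suc m * ∑< n (λ j → H (2 ℕ.* j)) ∎
    where
    open RR
    q = 2 ℕ.* n
    H h : ℕ → Carrier
    H x₀ = Σᵥ n m (λ z → g (x₀ ∷ doubled z))
    h x₀ = c# 2 ^ m * H x₀
    inner : ∀ s₀ x₀ → Σᵥ 2 m (λ s → Σᵥ q m (λ x → -1# ^ (s₀ ℕ.* x₀ ℕ.+ s · x) * g (x₀ ∷ x))) ≈ -1# ^ (s₀ ℕ.* x₀) * h x₀
    inner s₀ x₀ = trans (Σᵥ-cong 2 m (λ s → trans (Σᵥ-cong q m (λ x → trans (*-congʳ (^-homo-* -1# (s₀ ℕ.* x₀) (s · x))) (*-assoc _ _ _))) (sym (Σᵥ-*ˡ q m (-1# ^ (s₀ ℕ.* x₀)) (λ x → -1# ^ (s · x) * g (x₀ ∷ x))))))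
      (trans (sym (Σᵥ-*ˡ 2 m (-1# ^ (s₀ ℕ.* x₀)) (λ s → Σᵥ q m (λ x → -1# ^ (s · x) * g (x₀ ∷ x))))) (*-congˡ (even-sum n m (λ x → g (x₀ ∷ x)))))
    pair : ∀ x₀ → ∑< 2 (λ s₀ → -1# ^ (s₀ ℕ.* x₀) * h x₀) ≈ (1# + -1# ^ x₀) * h x₀
    pair x₀ = trans (+-cong (trans (+-identityˡ _) refl) (*-congʳ (^-congʳ -1# (ℕP.*-identityˡ x₀)))) (sym (distribʳ (h x₀) 1# _))

  ∑<-single : ∀ n k (h : ℕ → Carrier) → k < n → (∀ i → i < n → ¬ (i ≡ k) → h i ≈ 0#) → ∑< n h ≈ h k
  ∑<-single (suc n) k h (s≤s k≤n) z = go (k ℕ.≟ n)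
    where
    go : Dec (k ≡ n) → ∑< (suc n) h ≈ h k
    go (yes ≡.refl) = trans (+-congʳ (trans (∑<-cong n (λ i lt → z i (ℕP.m<n⇒m<1+n lt) (ℕP.<⇒≢ lt))) (∑<-0 n))) (+-identityˡ _)
    go (no ne) = trans (+-cong (∑<-single n k h (ℕP.≤∧≢⇒< k≤n ne) (λ i lt → z i (ℕP.m<n⇒m<1+n lt))) (z n (ℕP.n<1+n n) (λ e → ne (≡.sym e)))) (+-identityʳ _)

  module Parseval (n : ℕ) (ξ ξ' : Carrier) (inverse : ξ * ξ' ≈ 1#)
    (orth : ∀ z z' → z < n → z' < n → ¬ (z' ≡ z) → geom n (ξ ^ z * ξ' ^ z') ≈ 0#) where

    geom-diag : ∀ z → geom n (ξ ^ z * ξ' ^ z) ≈ c# n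
    geom-diag z = trans (∑<-cong n (λ i _ → trans (^-congˡ i (trans (sym (^-distrib-* ξ ξ' z)) (trans (^-congˡ z inverse) (1^ z)))) (1^ i))) (trans (∑<-const n 1#) (*-identityʳ _))

    -- The kernel K is arbitrary rather than a product, so that the induction may freeze the first
    -- coordinates of both arguments in it.
    parseval : ∀ m (K : Vec ℕ m → Vec ℕ m → Carrier) →
      Σᵥ n m (λ μ → Σᵥ n m (λ z → Σᵥ n m (λ z' → (ξ ^ (μ · z) * ξ' ^ (μ · z')) * K z z'))) ≈ c# n ^ m * Σᵥ n m (λ z → K z z)
    parseval zero K = *-congʳ (*-identityˡ 1#)
    parseval (suc m) K = begin
      ∑< n (λ μ₀ → Σᵥ n m (λ μ → ∑< n (λ z₀ → Σᵥ n m (λ z → ∑< n (λ z₀' → Σᵥ n m (λ z' → T μ₀ z₀ z₀' μ z z'))))))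
        ≈⟨ ∑<-cong n (λ μ₀ _ → Σᵥ-∑< n m n (λ z₀ μ → Σᵥ n m (λ z → ∑< n (λ z₀' → Σᵥ n m (λ z' → T μ₀ z₀ z₀' μ z z'))))) ⟩
      ∑< n (λ μ₀ → ∑< n (λ z₀ → Σᵥ n m (λ μ → Σᵥ n m (λ z → ∑< n (λ z₀' → Σᵥ n m (λ z' → T μ₀ z₀ z₀' μ z z'))))))
        ≈⟨ ∑<-cong n (λ μ₀ _ → ∑<-cong n (λ z₀ _ → trans (Σᵥ-cong n m (λ μ → Σᵥ-∑< n m n (λ z₀' z → Σᵥ n m (λ z' → T μ₀ z₀ z₀' μ z z')))) (Σᵥ-∑< n m n (λ z₀' μ → Σᵥ n m (λ z → Σᵥ n m (λ z' → T μ₀ z₀ z₀' μ z z')))))) ⟩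
      ∑< n (λ μ₀ → ∑< n (λ z₀ → ∑< n (λ z₀' → Σᵥ n m (λ μ → Σᵥ n m (λ z → Σᵥ n m (λ z' → T μ₀ z₀ z₀' μ z z'))))))
        ≈⟨ ∑<-cong n (λ μ₀ _ → ∑<-cong n (λ z₀ _ → ∑<-cong n (λ z₀' _ → inner μ₀ z₀ z₀'))) ⟩
      ∑< n (λ μ₀ → ∑< n (λ z₀ → ∑< n (λ z₀' → (ξ ^ z₀ * ξ' ^ z₀') ^ μ₀ * L z₀ z₀')))
        ≈⟨ ∑<-swap n n (λ μ₀ z₀ → ∑< n (λ z₀' → (ξ ^ z₀ * ξ' ^ z₀') ^ μ₀ * L z₀ z₀')) ⟩
      ∑< n (λ z₀ → ∑< n (λ μ₀ → ∑< n (λ z₀' → (ξ ^ z₀ * ξ' ^ z₀') ^ μ₀ * L z₀ z₀')))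
        ≈⟨ ∑<-cong n (λ z₀ _ → ∑<-swap n n (λ μ₀ z₀' → (ξ ^ z₀ * ξ' ^ z₀') ^ μ₀ * L z₀ z₀')) ⟩
      ∑< n (λ z₀ → ∑< n (λ z₀' → ∑< n (λ μ₀ → (ξ ^ z₀ * ξ' ^ z₀') ^ μ₀ * L z₀ z₀')))
        ≈⟨ ∑<-cong n (λ z₀ lt → trans (∑<-cong n (λ z₀' _ → geomʳ z₀ z₀')) (trans (∑<-single n z₀ (λ z₀' → geom n (ξ ^ z₀ * ξ' ^ z₀') * L z₀ z₀') lt (λ i lt' ne → trans (*-congʳ (orth z₀ i lt lt' ne)) (zeroˡ _))) (*-congʳ (geom-diag z₀)))) ⟩
      ∑< n (λ z₀ → c# n * L z₀ z₀) ≈⟨ sym (∑<-*ˡ n (c# n) (λ z₀ → L z₀ z₀)) ⟩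
      c# n * ∑< n (λ z₀ → L z₀ z₀) ≈⟨ *-congˡ (sym (∑<-*ˡ n (c# n ^ m) (λ z₀ → Σᵥ n m (λ z → K (z₀ ∷ z) (z₀ ∷ z))))) ⟩
      c# n * (c# n ^ m * ∑< n (λ z₀ → Σᵥ n m (λ z → K (z₀ ∷ z) (z₀ ∷ z)))) ≈⟨ sym (*-assoc _ _ _) ⟩
      c# n ^ suc m * ∑< n (λ z₀ → Σᵥ n m (λ z → K (z₀ ∷ z) (z₀ ∷ z))) ∎
      where
      open RR
      T : ℕ → ℕ → ℕ → Vec ℕ m → Vec ℕ m → Vec ℕ m → Carrier
      T μ₀ z₀ z₀' μ z z' = (ξ ^ (μ₀ ℕ.* z₀ ℕ.+ μ · z) * ξ' ^ (μ₀ ℕ.* z₀' ℕ.+ μ · z')) * K (z₀ ∷ z) (z₀' ∷ z')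
      L : ℕ → ℕ → Carrier
      L z₀ z₀' = c# n ^ m * Σᵥ n m (λ z → K (z₀ ∷ z) (z₀' ∷ z))
      geomʳ : ∀ z₀ z₀' → ∑< n (λ μ₀ → (ξ ^ z₀ * ξ' ^ z₀') ^ μ₀ * L z₀ z₀') ≈ geom n (ξ ^ z₀ * ξ' ^ z₀') * L z₀ z₀'
      geomʳ z₀ z₀' = trans (∑<-cong n (λ i _ → *-comm _ _)) (trans (sym (∑<-*ˡ n (L z₀ z₀') ((ξ ^ z₀ * ξ' ^ z₀') ^_))) (*-comm _ _))
      pw : ∀ x a b c → x ^ (a ℕ.* b ℕ.+ c) ≈ (x ^ b) ^ a * x ^ c
      pw x a b c = trans (^-homo-* x (a ℕ.* b) c) (*-congʳ (trans (^-congʳ x (ℕP.*-comm a b)) (sym (^-assocʳ x b a))))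
      inner : ∀ μ₀ z₀ z₀' → Σᵥ n m (λ μ → Σᵥ n m (λ z → Σᵥ n m (λ z' → T μ₀ z₀ z₀' μ z z'))) ≈ (ξ ^ z₀ * ξ' ^ z₀') ^ μ₀ * L z₀ z₀'
      inner μ₀ z₀ z₀' = trans (Σᵥ-cong n m (λ μ → trans (Σᵥ-cong n m (λ z → trans (Σᵥ-cong n m (λ z' → term μ z z')) (sym (Σᵥ-*ˡ n m r _)))) (sym (Σᵥ-*ˡ n m r _))))
          (trans (sym (Σᵥ-*ˡ n m r _)) (*-congˡ (parseval m (λ z z' → K (z₀ ∷ z) (z₀' ∷ z')))))
        where
        r = (ξ ^ z₀ * ξ' ^ z₀') ^ μ₀
        term : ∀ μ z z' → T μ₀ z₀ z₀' μ z z' ≈ r * ((ξ ^ (μ · z) * ξ' ^ (μ · z')) * K (z₀ ∷ z) (z₀' ∷ z'))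
        term μ z z' = trans (*-congʳ (*-cong (pw ξ μ₀ z₀ (μ · z)) (pw ξ' μ₀ z₀' (μ · z'))))
          (trans (solve 5 (λ a b c d k → ((a :* b) :* (c :* d)) :* k := (a :* c) :* ((b :* d) :* k)) refl ((ξ ^ z₀) ^ μ₀) (ξ ^ (μ · z)) ((ξ' ^ z₀') ^ μ₀) (ξ' ^ (μ · z')) (K (z₀ ∷ z) (z₀' ∷ z')))
          (*-congʳ (sym (^-distrib-* (ξ ^ z₀) (ξ' ^ z₀') μ₀))))

-- Units modulo N and the shape of N

open TwoSquareUniqueness
open Cyclotomic
open IK using () renaming (_∣_ to _∣ℤ_; _^_ to _^ᶻ_; ∑< to ∑ℤ)

-- In the second Bézout case a x ≡ -1, so the inverse of x is a(N-1), where N = n + 2.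
coprime⇒unit : ∀ {n x} → Coprime x (suc (suc n)) → UnitMod (suc (suc n)) x
coprime⇒unit {n} {x} c with coprime-Bézout c
... | Bézout.+- a b e = unit a b (≡.trans (ℕP.*-comm x a) (≡.sym e))
... | Bézout.-+ a zero e = ⊥-elim (ℕP.0≢1+n (≡.sym e))
... | Bézout.-+ a (suc b) e = unit (a ℕ.* suc n) (n ℕ.* b ℕ.+ n ℕ.+ b)
    (≡.trans (solve 3 (λ x a n → x :* (a :* (con 1 :+ n)) := (a :* x) :* (con 1 :+ n)) ≡.refl x a n)
      (≡.trans (cong (ℕ._* suc n) (ℕP.suc-injective e)) (solve 2 (λ b n → (con 1 :+ n :+ b :* (con 2 :+ n)) :* (con 1 :+ n) := con 1 :+ (n :* b :+ n :+ b) :* (con 2 :+ n)) ≡.refl b n)))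
  where open +-*-Solver

prime∣^ : ∀ {p q} → Prime p → ∀ k → p ℕD.∣ q ℕ.^ k → p ℕD.∣ q
prime∣^ pr zero d = ⊥-elim (ℕP.<⇒≱ (ℕ.nonTrivial⇒n>1 _ {{prime⇒nonTrivial pr}}) (ℕD.∣⇒≤ d))
prime∣^ {p} {q} pr (suc k) d with euclidsLemma q (q ℕ.^ k) pr d
... | inj₁ a = a
... | inj₂ b = prime∣^ pr k b

prime∣prime : ∀ {p q} → Prime p → Prime q → p ℕD.∣ q → p ≡ q
prime∣prime prp prq d with prime⇒irreducible prq d
... | inj₁ e = ⊥-elim (ℕP.<⇒≢ (ℕ.nonTrivial⇒n>1 _ {{prime⇒nonTrivial prp}}) (≡.sym e))
... | inj₂ e = e

-1^odd : ∀ h → (ℤ.- 1ℤ) IK.^ suc (h ℕ.+ h) ≡ ℤ.- 1ℤ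
-1^odd zero = ≡.refl
-1^odd (suc h) = ≡.trans (cong ((ℤ.- 1ℤ) IK.^_) (cong (λ k → suc (suc k)) (ℕP.+-suc h h)))
  (≡.trans (cong (λ z → (ℤ.- 1ℤ) ℤ.* ((ℤ.- 1ℤ) ℤ.* z)) (-1^odd h)) ≡.refl)

-1^podd : ∀ {p h} → p ≡ suc (h ℕ.+ h) → ∀ k → (ℤ.- 1ℤ) IK.^ (p ℕ.^ k) ≡ ℤ.- 1ℤ
-1^podd e zero = ≡.refl
-1^podd {p} {h} e (suc k) = ≡.trans (≡.sym (IK.^-assocʳ (ℤ.- 1ℤ) p (p ℕ.^ k))) (≡.trans (cong (IK._^ (p ℕ.^ k)) (≡.trans (cong ((ℤ.- 1ℤ) IK.^_) e) (-1^odd h))) (-1^podd {p} {h} e k))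

infix 4 _≡ℤ_[_]
_≡ℤ_[_] : ℤ → ℤ → ℤ → Set
_≡ℤ_[_] = IK._≡_[_]

module Levels (N' p₁ p₂ G H : ℕ) (pr₁ : Prime p₁) (pr₂ : Prime p₂) (a b e₁' e₂' : ℕ)
  (p₁≡ : p₁ ≡ 3 ℕ.+ 8 ℕ.* a) (p₂≡ : p₂ ≡ 1 ℕ.+ 8 ℕ.* b)
  (N≡ : suc N' ≡ p₁ ℕ.^ suc e₁' ℕ.* p₂ ℕ.^ suc e₂')
  (G≡ : G ≡ p₁ ℕ.^ e₁' ℕ.* p₂ ℕ.^ suc e₂') (H≡ : H ≡ p₁ ℕ.^ suc e₁' ℕ.* p₂ ℕ.^ e₂') where

  private
    module M₂ = ModP p₂ pr₂
    module S' = +-*-Solver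
    N = suc N'

  p₁≢p₂ : ¬ (p₁ ≡ p₂)
  p₁≢p₂ e = bad (≡.trans (≡.sym (DM.[m+kn]%n≡m%n 3 a 8)) (≡.trans (cong (ℕ._% 8) (≡.trans (cong (3 ℕ.+_) (ℕP.*-comm a 8)) (≡.trans (≡.sym p₁≡) (≡.trans e (≡.trans p₂≡ (cong (1 ℕ.+_) (ℕP.*-comm 8 b))))))) (DM.[m+kn]%n≡m%n 1 b 8)))
    where bad : 3 ≡ 1 → ⊥
          bad ()

  N≡₁ : N ≡ p₁ ℕ.* G
  N≡₁ = ≡.trans N≡ (≡.trans (ℕP.*-assoc p₁ (p₁ ℕ.^ e₁') _) (cong (p₁ ℕ.*_) (≡.sym G≡)))
  N≡₂ : N ≡ p₂ ℕ.* H
  N≡₂ = ≡.trans N≡ (≡.trans (S'.solve 3 (λ x y z → x S'.:* (y S'.:* z) S'.:= y S'.:* (x S'.:* z)) ≡.refl (p₁ ℕ.^ suc e₁') p₂ (p₂ ℕ.^ e₂')) (cong (p₂ ℕ.*_) (≡.sym H≡)))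

  h₁ h₂ : ℕ
  h₁ = 1 ℕ.+ 4 ℕ.* a
  h₂ = 4 ℕ.* b
  p₁h : p₁ ≡ suc (h₁ ℕ.+ h₁)
  p₁h = ≡.trans p₁≡ (S'.solve 1 (λ a → S'.con 3 S'.:+ S'.con 8 S'.:* a S'.:= S'.con 1 S'.:+ ((S'.con 1 S'.:+ S'.con 4 S'.:* a) S'.:+ (S'.con 1 S'.:+ S'.con 4 S'.:* a))) ≡.refl a)
  p₂h : p₂ ≡ suc (h₂ ℕ.+ h₂)
  p₂h = ≡.trans p₂≡ (S'.solve 1 (λ a → S'.con 1 S'.:+ S'.con 8 S'.:* a S'.:= S'.con 1 S'.:+ (S'.con 4 S'.:* a S'.:+ S'.con 4 S'.:* a)) ≡.refl b)

  3≤p₁ : 3 ≤ p₁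
  3≤p₁ = ≡.subst (3 ≤_) (≡.sym p₁≡) (ℕP.m≤m+n 3 _)
  b>0 : 0 < b
  b>0 = go b p₂≡
    where go : ∀ b → p₂ ≡ 1 ℕ.+ 8 ℕ.* b → 0 < b
          go zero e = ⊥-elim (ℕP.<⇒≢ M₂.p>1 (≡.sym e))
          go (suc b) _ = s≤s z≤n
  3≤p₂ : 3 ≤ p₂
  3≤p₂ = ≡.subst (3 ≤_) (≡.sym p₂≡) (s≤s (ℕP.≤-trans (s≤s (s≤s z≤n)) (ℕP.*-monoʳ-≤ 8 b>0)))

  divN : ∀ k → k ℕD.∣ N → 1 < k → (p₁ ℕD.∣ k) ⊎ (p₂ ℕD.∣ k)
  divN k d 1<k = fromPrime (factors (factorise k)) (factorsPrime (factorise k)) (isFactorisation (factorise k))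
    where
    open import Data.Nat.Primality.Factorisation using (factorise; PrimeFactorisation; factors)
    open PrimeFactorisation using (factorsPrime; isFactorisation)
    open import Data.List using (List; []; _∷_)
    open import Data.List.Relation.Unary.All using (All; []; _∷_)
    open import Data.Nat.ListAction using (product)
    instance _ = ℕ.>-nonZero (ℕP.<-trans (s≤s z≤n) 1<k)
    fromPrime : ∀ qs → All Prime qs → k ≡ product qs → (p₁ ℕD.∣ k) ⊎ (p₂ ℕD.∣ k)
    fromPrime [] _ e = ⊥-elim (ℕP.<⇒≢ 1<k (≡.sym e))
    fromPrime (q ∷ qs) (prq ∷ _) e with euclidsLemma (p₁ ℕ.^ suc e₁') (p₂ ℕ.^ suc e₂') prq (≡.subst (q ℕD.∣_) N≡ (ℕD.∣-trans (≡.subst (q ℕD.∣_) (≡.sym e) (ℕD.m∣m*n (product qs))) d))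
    ... | inj₁ x = inj₁ (≡.subst (ℕD._∣ k) (prime∣prime prq pr₁ (prime∣^ prq (suc e₁') x)) (≡.subst (q ℕD.∣_) (≡.sym e) (ℕD.m∣m*n (product qs))))
    ... | inj₂ x = inj₂ (≡.subst (ℕD._∣ k) (prime∣prime prq pr₂ (prime∣^ prq (suc e₂') x)) (≡.subst (q ℕD.∣_) (≡.sym e) (ℕD.m∣m*n (product qs))))

  0<p₁ : 0 < p₁
  0<p₁ = ℕP.≤-trans (s≤s z≤n) 3≤p₁
  0<p₂ : 0 < p₂
  0<p₂ = ℕP.≤-trans (s≤s z≤n) 3≤p₂

  GH : ∀ i j → N ℕD.∣ i ℕ.* G ℕ.+ j ℕ.* H → (p₁ ℕD.∣ i) × (p₂ ℕD.∣ j)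
  GH i j d = cancel₁ (euclidsLemma i p₂ pr₁ (ℕD.∣m+n∣m⇒∣n (≡.subst (p₁ ℕD.∣_) (ℕP.+-comm (i ℕ.* p₂) (j ℕ.* p₁)) (ℕD.∣-trans (ℕD.m∣m*n p₂) pp)) (ℕD.n∣m*n j)))
           , cancel₂ (euclidsLemma j p₁ pr₂ (ℕD.∣m+n∣m⇒∣n (ℕD.∣-trans (ℕD.n∣m*n p₁) pp) (ℕD.n∣m*n i)))
    where
    N₀ = p₁ ℕ.^ e₁' ℕ.* p₂ ℕ.^ e₂'
    pp : p₁ ℕ.* p₂ ℕD.∣ i ℕ.* p₂ ℕ.+ j ℕ.* p₁
    pp = ℕD.*-cancelˡ-∣ N₀ {{ℕP.m*n≢0 (p₁ ℕ.^ e₁') (p₂ ℕ.^ e₂') {{ℕP.m^n≢0 p₁ e₁' {{prime⇒nonZero pr₁}}}} {{ℕP.m^n≢0 p₂ e₂' {{prime⇒nonZero pr₂}}}}}} (≡.subst₂ ℕD._∣_ (≡.trans N≡ (S'.solve 4 (λ p q x y → (p S'.:* x) S'.:* (q S'.:* y) S'.:= (x S'.:* y) S'.:* (p S'.:* q)) ≡.refl p₁ p₂ (p₁ ℕ.^ e₁') (p₂ ℕ.^ e₂')))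
      (≡.trans (cong₂ (λ g h → i ℕ.* g ℕ.+ j ℕ.* h) G≡ H≡) (S'.solve 6 (λ i j p q x y → i S'.:* (x S'.:* (q S'.:* y)) S'.:+ j S'.:* ((p S'.:* x) S'.:* y) S'.:= (x S'.:* y) S'.:* (i S'.:* q S'.:+ j S'.:* p)) ≡.refl i j p₁ p₂ (p₁ ℕ.^ e₁') (p₂ ℕ.^ e₂'))) d)
    cancel₁ : (p₁ ℕD.∣ i) ⊎ (p₁ ℕD.∣ p₂) → p₁ ℕD.∣ i
    cancel₁ (inj₁ x) = x
    cancel₁ (inj₂ x) = ⊥-elim (p₁≢p₂ (prime∣prime pr₁ pr₂ x))
    cancel₂ : (p₂ ℕD.∣ j) ⊎ (p₂ ℕD.∣ p₁) → p₂ ℕD.∣ j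
    cancel₂ (inj₁ x) = x
    cancel₂ (inj₂ x) = ⊥-elim (p₁≢p₂ (≡.sym (prime∣prime pr₂ pr₁ x)))

-- Filtered sums, powers of two, and sums over vectors of residues

module Filters (Z : ZRing) where
  open ZRing Z
  open Kit Z

  when : ∀ {A : Set} → Dec A → Carrier → Carrier
  when (yes _) x = x
  when (no _) x = 0#

  ∑-filter : ∀ {A : Set} {P : A → Set} (P? : ∀ x → Dec (P x)) xs (F : A → Carrier) → ∑ (filter P? xs) F ≈ ∑ xs (λ x → when (P? x) (F x))
  ∑-filter P? [] F = refl
  ∑-filter P? (x ∷ xs) F with P? x
  ... | yes _ = +-congˡ (∑-filter P? xs F)
  ... | no _ = trans (∑-filter P? xs F) (sym (+-identityˡ _))

  multiples : ∀ d' M (F : ℕ → Carrier) → let d = suc d' in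
    ∑< (M ℕ.* d) (λ i → when (d ℕD.∣? suc i) (F (suc i))) ≈ ∑< M (λ j → F (d ℕ.* suc j))
  multiples d' zero F = refl
  multiples d' (suc M) F = trans (reflexive (cong (λ k → ∑< k W) (ℕP.+-comm d (M ℕ.* d)))) (trans (∑<-++ (M ℕ.* d) d W)
      (+-cong (multiples d' M F) (trans (+-cong (trans (∑<-cong d' (λ i lt → zer i lt)) (∑<-0 d')) last) (+-identityˡ _))))
    where
    d = suc d'
    W : ℕ → Carrier
    W i = when (d ℕD.∣? suc i) (F (suc i))
    zer : ∀ i → i < d' → W (M ℕ.* d ℕ.+ i) ≈ 0#
    zer i lt with d ℕD.∣? suc (M ℕ.* d ℕ.+ i)
    ... | no _ = refl
    ... | yes p = ⊥-elim (ℕP.<⇒≱ (s≤s lt) (ℕD.∣⇒≤ (ℕD.∣m+n∣m⇒∣n {d} {M ℕ.* d} (≡.subst (d ℕD.∣_) (≡.sym (ℕP.+-suc (M ℕ.* d) i)) p) (ℕD.n∣m*n M))))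
    ar : suc (M ℕ.* d ℕ.+ d') ≡ d ℕ.* suc M
    ar = ≡.trans (≡.sym (ℕP.+-suc (M ℕ.* d) d')) (≡.trans (ℕP.+-comm (M ℕ.* d) d) (ℕP.*-comm (suc M) d))
    last : W (M ℕ.* d ℕ.+ d') ≈ F (d ℕ.* suc M)
    last with d ℕD.∣? suc (M ℕ.* d ℕ.+ d')
    ... | yes _ = reflexive (cong F ar)
    ... | no np = ⊥-elim (np (≡.subst (d ℕD.∣_) (≡.sym ar) (ℕD.m∣m*n (suc M))))

infix 4 _≡ᶻ_[_]
_≡ᶻ_[_] : ℤ → ℤ → ℕ → Set
x ≡ᶻ y [ d ] = IK._≡_[_] x y (+ d)

^2 : ∀ x → x ℤ.^ 2 ≡ x ℤ.* x
^2 x = cong (x ℤ.*_) (ℤP.*-identityʳ x)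

double-square : ∀ k → + 16 ℤ.* + (2 ℕ.^ (k ℕ.+ k)) ≡ + (4 ℕ.* 2 ℕ.^ k) ℤ.* + (4 ℕ.* 2 ℕ.^ k)
double-square k = ≡.trans (≡.sym (ℤP.pos-* 16 (2 ℕ.^ (k ℕ.+ k)))) (≡.trans (cong +_ (≡.trans (cong (16 ℕ.*_) (ℕP.^-distribˡ-+-* 2 k k)) (solve 1 (λ x → con 16 :* (x :* x) := (con 4 :* x) :* (con 4 :* x)) ≡.refl (2 ℕ.^ k)))) (ℤP.pos-* (4 ℕ.* 2 ℕ.^ k) (4 ℕ.* 2 ℕ.^ k)))
  where open +-*-Solver

2^m+4 : ∀ m → + (2 ℕ.^ (m ℕ.+ 4)) ≡ + 16 ℤ.* + (2 ℕ.^ m)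
2^m+4 m = ≡.trans (cong +_ (≡.trans (ℕP.^-distribˡ-+-* 2 m 4) (ℕP.*-comm (2 ℕ.^ m) 16))) (ℤP.pos-* 16 (2 ℕ.^ m))

odd-sq≢even-sq : ∀ {A} → OddZ A → ∀ y → ¬ ((+ 2 ℤ.* y) ℤ.* (+ 2 ℤ.* y) ≡ A ℤ.* A)
odd-sq≢even-sq (k , ≡.refl) y e = M.p∤1 (IK.divs (+ 2 ℤ.* (y ℤ.* y) ℤ.- + 2 ℤ.* (k ℤ.* k) ℤ.- + 2 ℤ.* k)
    (≡.trans (IK.solve 1 (λ k → IK.con 1ℤ IK.:= (IK.con (+ 2) IK.:* k IK.:+ IK.con 1ℤ) IK.:* (IK.con (+ 2) IK.:* k IK.:+ IK.con 1ℤ) IK.:- IK.con (+ 4) IK.:* (k IK.:* k IK.:+ k)) ≡.refl k)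
      (≡.trans (cong (λ z → z ℤ.- + 4 ℤ.* (k ℤ.* k ℤ.+ k)) (≡.sym e))
        (IK.solve 2 (λ k y → (IK.con (+ 2) IK.:* y) IK.:* (IK.con (+ 2) IK.:* y) IK.:- IK.con (+ 4) IK.:* (k IK.:* k IK.:+ k) IK.:= IK.con (+ 2) IK.:* (IK.con (+ 2) IK.:* (y IK.:* y) IK.:- IK.con (+ 2) IK.:* (k IK.:* k) IK.:- IK.con (+ 2) IK.:* k)) ≡.refl k y))))
  where module M = ModP 2 prime[2]

-- For odd M the 2-adic valuation of n²M is even, whereas the displayed power of 2 has odd exponent;
-- factors 4 are cancelled until the parity shows.
even-quotient : ∀ j n M g → ¬ ((+ 2) ∣ℤ M) → n ℤ.* n ℤ.* M ≡ + (2 ℕ.^ suc (j ℕ.+ j)) ℤ.* g → (+ 2) ∣ℤ g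
even-quotient j n M g odd e = go (E2.euclid (n ℤ.* n) M (IK.divs (+ (2 ℕ.^ (j ℕ.+ j)) ℤ.* g) (≡.trans e (≡.trans (cong (ℤ._* g) (ℤP.pos-* 2 (2 ℕ.^ (j ℕ.+ j)))) (ℤP.*-assoc (+ 2) (+ (2 ℕ.^ (j ℕ.+ j))) g)))))
  where
  module E2 = ModP 2 prime[2]
  rec : ∀ j n' → (+ 2 ℤ.* n') ℤ.* (+ 2 ℤ.* n') ℤ.* M ≡ + (2 ℕ.^ suc (j ℕ.+ j)) ℤ.* g → (+ 2) ∣ℤ g
  rec zero n' e' = IK.divs (n' ℤ.* n' ℤ.* M) (ℤP.*-cancelˡ-≡ (+ 2) g _ (≡.trans (≡.sym e') (IK.solve 2 (λ n M → (IK.con (+ 2) IK.:* n) IK.:* (IK.con (+ 2) IK.:* n) IK.:* M IK.:= IK.con (+ 2) IK.:* (IK.con (+ 2) IK.:* (n IK.:* n IK.:* M))) ≡.refl n' M)))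
  rec (suc j) n' e' = even-quotient j n' M g odd (ℤP.*-cancelˡ-≡ (+ 4) _ _ (≡.trans (IK.solve 2 (λ n M → IK.con (+ 4) IK.:* (n IK.:* n IK.:* M) IK.:= (IK.con (+ 2) IK.:* n) IK.:* (IK.con (+ 2) IK.:* n) IK.:* M) ≡.refl n' M)
    (≡.trans e' (≡.trans (cong (ℤ._* g) (≡.trans (cong (λ z → + (2 ℕ.^ suc (suc z))) (ℕP.+-suc j j)) (≡.trans (cong +_ (≡.sym (ℕP.*-assoc 2 2 (2 ℕ.^ suc (j ℕ.+ j))))) (ℤP.pos-* 4 (2 ℕ.^ suc (j ℕ.+ j)))))) (ℤP.*-assoc (+ 4) (+ (2 ℕ.^ suc (j ℕ.+ j))) g)))))
  go : ((+ 2) ∣ℤ (n ℤ.* n)) ⊎ ((+ 2) ∣ℤ M) → (+ 2) ∣ℤ g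
  go (inj₂ d) = ⊥-elim (odd d)
  go (inj₁ d) = half' (E2.sq-∣ n d)
    where
    half' : (+ 2) ∣ℤ n → (+ 2) ∣ℤ g
    half' (IK.divs n' en) = rec j n' (≡.subst (λ z → z ℤ.* z ℤ.* M ≡ + (2 ℕ.^ suc (j ℕ.+ j)) ℤ.* g) en e)

module _ (n : ℕ) .{{_ : NonZero n}} where
  residue : ℕ → Fin n
  residue i = fromℕ< (DM.m%n<n i n)

  toℕ-residue : ∀ i → toℕ (residue i) ≡ i ℕ.% n
  toℕ-residue i = FinP.toℕ-fromℕ< (DM.m%n<n i n)

  residue-toℕ : ∀ i → residue (toℕ i) ≡ i
  residue-toℕ i = FinP.toℕ-injective (≡.trans (toℕ-residue (toℕ i)) (DM.m<n⇒m%n≡m (FinP.toℕ<n i)))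

  residues : ∀ {d} → Vec ℕ d → Vec (Fin n) d
  residues = Vec.map residue

module FinSums (Z : ZRing) where
  open ZRing Z
  open Kit Z
  open VSum Z
  open Eval Z

  ∑-tabulate : ∀ {A : Set} n (g : Fin n → A) (h : A → Carrier) (h' : ℕ → Carrier) → (∀ i → h (g i) ≈ h' (toℕ i)) → ∑ (tabulate g) h ≈ ∑< n h'
  ∑-tabulate zero g h h' e = refl
  ∑-tabulate (suc n) g h h' e = trans (+-cong (e Fin.zero) (∑-tabulate n (g ∘ Fin.suc) h (h' ∘ suc) (e ∘ Fin.suc))) (sym (∑<-first n h'))

  ∑-concatMap : ∀ {A B : Set} (g : A → List B) xs (h : B → Carrier) → ∑ (concatMap g xs) h ≈ ∑ xs (λ x → ∑ (g x) h)
  ∑-concatMap g [] h = refl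
  ∑-concatMap g (x ∷ xs) h = trans (∑-++ (g x) (concatMap g xs) h) (+-congˡ (∑-concatMap g xs h))

  ∑-allVecs : ∀ n .{{_ : NonZero n}} d (h : Vec (Fin n) d → Carrier) → ∑ (allVecs n d) h ≈ Σᵥ n d (h ∘ residues n)
  ∑-allVecs n zero h = +-identityʳ _
  ∑-allVecs n (suc d) h = trans (∑-concatMap (λ i → List.map (i ∷_) (allVecs n d)) (allFin n) h)
    (∑-tabulate n id (λ i → ∑ (List.map (i ∷_) (allVecs n d)) h) (λ i → Σᵥ n d (λ v → h (residue n i ∷ residues n v)))
      (λ i → trans (reflexive (∑-map (allVecs n d) (i ∷_) h)) (trans (∑-allVecs n d (λ v → h (i ∷ v))) (Σᵥ-cong n d (λ v → reflexive (cong (λ j → h (j ∷ residues n v)) (≡.sym (residue-toℕ n i))))))))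

  ev-sum : ∀ {A : Set} r (xs : List A) (e : A → ℕ) → ev r (sumₚ (List.map (λ x → monoₚ (e x)) xs)) ≈ ∑ xs (λ x → r ^ e x)
  ev-sum r [] e = refl
  ev-sum r (x ∷ xs) e = trans (ev-+ r (monoₚ (e x)) _) (+-cong (ev-mono r (e x)) (ev-sum r xs e))

  pow-% : ∀ {r} n .{{_ : NonZero n}} → r ^ n ≈ 1# → ∀ i → r ^ (i ℕ.% n) ≈ r ^ i
  pow-% {r} n e i = sym (trans (^-congʳ r (DM.m≡m%n+[m/n]*n i n)) (trans (^-homo-* r (i ℕ.% n) (i ℕ./ n ℕ.* n))
    (trans (*-congˡ (trans (^-congʳ r (ℕP.*-comm (i ℕ./ n) n)) (trans (sym (^-assocʳ r n (i ℕ./ n))) (trans (^-congˡ (i ℕ./ n) e) (1^ (i ℕ./ n)))))) (*-identityʳ _))))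

  pow-dot : ∀ {r} n .{{_ : NonZero n}} → r ^ n ≈ 1# → ∀ {d} (l x : Vec ℕ d) → r ^ dot (residues n l) (residues n x) ≈ r ^ (l · x)
  pow-dot n e [] [] = refl
  pow-dot {r} n e (a ∷ l) (b ∷ x) = trans (^-homo-* r (toℕ (residue n a) ℕ.* toℕ (residue n b)) (dot (residues n l) (residues n x))) (trans (*-cong head (pow-dot n e l x)) (sym (^-homo-* r (a ℕ.* b) (l · x))))
    where
    head : r ^ (toℕ (residue n a) ℕ.* toℕ (residue n b)) ≈ r ^ (a ℕ.* b)
    head = trans (^-congʳ r (cong₂ ℕ._*_ (toℕ-residue n a) (toℕ-residue n b))) (trans (sym (^-assocʳ r (a ℕ.% n) (b ℕ.% n))) (trans (^-congˡ (b ℕ.% n) (pow-% n e a))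
      (trans (pow-% {r ^ a} n (trans (^-assocʳ r a n) (trans (^-congʳ r (ℕP.*-comm a n)) (trans (sym (^-assocʳ r n a)) (trans (^-congˡ a e) (1^ a))))) b) (^-assocʳ r a b))))

record Setup : Set₁ where
  field
    N' p₁ p₂ G H : ℕ
    CR : CRing N' p₁ p₂ G H
    pr₁ : Prime p₁
    pr₂ : Prime p₂
    a b e₁' e₂' : ℕ
    p₁≡ : p₁ ≡ 3 ℕ.+ 8 ℕ.* a
    p₂≡ : p₂ ≡ 1 ℕ.+ 8 ℕ.* b
    N≡ : suc N' ≡ p₁ ℕ.^ suc e₁' ℕ.* p₂ ℕ.^ suc e₂'
    G≡ : G ≡ p₁ ℕ.^ e₁' ℕ.* p₂ ℕ.^ suc e₂'
    H≡ : H ≡ p₁ ℕ.^ suc e₁' ℕ.* p₂ ℕ.^ e₂'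
    nr : NRes (+ p₁) p₂
    A B : ℤ
    AB : + p₂ ≡ A ℤ.* A ℤ.+ B ℤ.* B
    oddA : OddZ A
    f : ℕ
    φ4 : φ (suc N') ℕ./ 4 ≡ f
    f>0 : 0 < f
    2^f : ((+ 2) ^ᶻ f) ≡ᶻ 1ℤ [ suc N' ]
    f-min : ∀ s → 0 < s → ((+ 2) ^ᶻ s) ≡ᶻ 1ℤ [ suc N' ] → f ≤ s

-- Quadratic characters of -1, 2, p₁ and p₂

module Main (D : Setup) where
  open Setup D
  open CRing CR
  open Basics CR hiding (B)
  open Levels N' p₁ p₂ G H pr₁ pr₂ a b e₁' e₂' p₁≡ p₂≡ N≡ G≡ H≡
  open Filters Z
  open Sums Z
  open VSum Z
  open FinSums Z
  private
    module M₁ = ModP p₁ pr₁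
    module M₂ = ModP p₂ pr₂
    module S' = +-*-Solver
    module I = IK
    instance
      nz₁ : NonZero p₁
      nz₁ = prime⇒nonZero pr₁
      nz₂ : NonZero p₂
      nz₂ = prime⇒nonZero pr₂

  open Nzd N≡₁ N≡₂ 0<p₁ 0<p₂ divN public

  mkUnit : ∀ x → ¬ (p₁ ℕD.∣ x) → ¬ (p₂ ℕD.∣ x) → Unit x
  mkUnit x n₁ n₂ = go N' ≡.refl
    where
    cop : Coprime x N
    cop {d} (d∣x , d∣N) with d ℕ.≟ 1
    ... | yes e = e
    ... | no ne with divN d d∣N (ge2 d d∣N ne)
      where
      ge2 : ∀ d → d ℕD.∣ N → ¬ (d ≡ 1) → 1 < d
      ge2 zero d∣N _ = ⊥-elim (ℕP.0≢1+n (≡.sym (ℕD.0∣⇒≡0 d∣N)))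
      ge2 (suc zero) _ ne = ⊥-elim (ne ≡.refl)
      ge2 (suc (suc d)) _ _ = s≤s (s≤s z≤n)
    ... | inj₁ y = ⊥-elim (n₁ (ℕD.∣-trans y d∣x))
    ... | inj₂ y = ⊥-elim (n₂ (ℕD.∣-trans y d∣x))
    p₁∣N : p₁ ℕD.∣ N
    p₁∣N = ≡.subst (p₁ ℕD.∣_) (≡.sym N≡₁) (ℕD.m∣m*n G)
    go : ∀ n → n ≡ N' → Unit x
    go zero e = ⊥-elim (ℕP.<⇒≱ M₁.p>1 (≡.subst (p₁ ≤_) (cong suc (≡.sym e)) (ℕD.∣⇒≤ p₁∣N)))
    go (suc n) e = ≡.subst (λ m → UnitMod (suc m) x) e (coprime⇒unit (≡.subst (λ m → Coprime x (suc m)) (≡.sym e) cop))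

  module G₁ = Gauss CR p₁ h₁ G pr₁ p₁h N≡₁ nzd
  module G₂ = Gauss CR p₂ h₂ H pr₂ p₂h N≡₂ nzd

  u2 : Unit 2
  u2 = mkUnit 2 G₁.p∤2 G₂.p∤2

  -- c = r² modulo p and d a non-residue: the sums over c x² and d x² are complementary
  module RelSq (p h X : ℕ) (pr : Prime p) (ph : p ≡ suc (h ℕ.+ h)) (NX : N ≡ p ℕ.* X) where
    private
      module Ga = Gauss CR p h X pr ph NX nzd
      module M = ModP p pr
      instance
        nzp : NonZero p
        nzp = prime⇒nonZero pr
    relSq : ∀ c d r → ¬ (p ℕD.∣ c) → (r ℤ.* r) ≡ℤ + c [ + p ] → NRes (+ d) p → Ga.w c + Ga.w d ≈ - 1#
    relSq c d r nc rc nd = Ga.rel c d nc nd' hyp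
      where
      nd' : ¬ (p ℕD.∣ d)
      nd' (ℕD.divides q e) = nd 0ℤ (IK.divs (ℤ.- (+ q)) (≡.trans (cong (λ z → 0ℤ ℤ.- + z) e) (≡.trans (cong (λ z → 0ℤ ℤ.- z) (ℤP.pos-* q p)) (IK.solve 2 (λ q p → IK.con 0ℤ IK.:- q IK.:* p IK.:= p IK.:* (IK.:- q)) ≡.refl (+ q) (+ p)))))
      ps : ∀ c x → + (c ℕ.* (x ℕ.* x)) ≡ + c ℤ.* (+ x ℤ.* + x)
      ps c x = ≡.trans (ℤP.pos-* c (x ℕ.* x)) (cong (λ z → + c ℤ.* z) (ℤP.pos-* x x))
      hyp : ∀ x y → ¬ (p ℕD.∣ x) → ¬ (p ℕD.∣ y) → ¬ ((c ℕ.* (x ℕ.* x)) ℕ.% p ≡ (d ℕ.* (y ℕ.* y)) ℕ.% p)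
      hyp x y nx ny e = nd (proj₁ sq) (proj₂ sq)
        where
        gen : ∀ c d x y → (r ℤ.* r) ≡ℤ c [ + p ] → (c ℤ.* (x ℤ.* x)) ≡ℤ (d ℤ.* (y ℤ.* y)) [ + p ] → ((r ℤ.* x) ℤ.* (r ℤ.* x)) ≡ℤ (d ℤ.* (y ℤ.* y)) [ + p ]
        gen c d x y h1 h2 = IK.≡-trans {x = (r ℤ.* x) ℤ.* (r ℤ.* x)} {y = c ℤ.* (x ℤ.* x)} {z = d ℤ.* (y ℤ.* y)}
          (IK.∣-resp {x = (r ℤ.* r) ℤ.* (x ℤ.* x) ℤ.- c ℤ.* (x ℤ.* x)} (cong (ℤ._- c ℤ.* (x ℤ.* x)) (IK.solve 2 (λ r x → (r IK.:* r) IK.:* (x IK.:* x) IK.:= (r IK.:* x) IK.:* (r IK.:* x)) ≡.refl r x)) (IK.≡-* {x = r ℤ.* r} {c} {x ℤ.* x} {x ℤ.* x} h1 (IK.≡-refl {x = x ℤ.* x}))) h2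
        sq = M.ratio (+ d) (r ℤ.* + x) (+ y) (λ z → ny (toℕ∣ {p} {+ y} z))
           (gen (+ c) (+ d) (+ x) (+ y) rc (≡.subst₂ (λ u v → u ≡ℤ v [ + p ]) (ps c x) (ps d y) (mod⇒≡ {p} {c ℕ.* (x ℕ.* x)} {d ℕ.* (y ℕ.* y)} e)))

  module RS₁ = RelSq p₁ h₁ G pr₁ p₁h N≡₁
  module RS₂ = RelSq p₂ h₂ H pr₂ p₂h N≡₂

  N'≡-1 : ∀ p X → N ≡ p ℕ.* X → (+ N') ≡ℤ (ℤ.- 1ℤ) [ + p ]
  N'≡-1 p X e = IK.divs (+ X) (≡.trans (ℤP.+-comm (+ N') 1ℤ) (≡.trans (cong +_ e) (ℤP.pos-* p X)))

  one² : ∀ p → (1ℤ ℤ.* 1ℤ) ≡ℤ + 1 [ + p ]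
  one² p = IK.≡-refl {+ p} {1ℤ}

  p∤1 : ∀ {p} → Prime p → ¬ (p ℕD.∣ 1)
  p∤1 pr d = ℕP.<⇒≱ (ℕ.nonTrivial⇒n>1 _ {{prime⇒nonTrivial pr}}) (ℕD.∣⇒≤ d)

  -- A/B is the square root of -1. B is prime to p₂: otherwise p₂ would divide A as well, and p₂²
  -- would divide p₂ = A² + B².
  im : ∃ λ i → (i ℤ.* i) ≡ℤ (ℤ.- 1ℤ) [ + p₂ ]
  im = M₂.ratio (ℤ.- 1ℤ) A B nB (IK.divs 1ℤ (≡.trans (IK.solve 2 (λ a b → a IK.:* a IK.:- (IK.:- IK.con 1ℤ) IK.:* (b IK.:* b) IK.:= a IK.:* a IK.:+ b IK.:* b) ≡.refl A B) (≡.trans (≡.sym AB) (≡.sym (ℤP.*-identityʳ (+ p₂))))))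
    where
    nB : ¬ ((+ p₂) IK.∣ B)
    nB d = M₂.p∤1 (IK.divs (x ℤ.* x ℤ.+ y ℤ.* y) (ℤP.*-cancelˡ-≡ (+ p₂) _ _ {{ℤ.≢-nonZero (c#-nz 0<p₂)}} (≡.trans (ℤP.*-identityʳ (+ p₂)) (≡.trans AB (≡.trans (cong₂ (λ u v → u ℤ.* u ℤ.+ v ℤ.* v) (IK.eq dA) (IK.eq d))
        (IK.solve 3 (λ p x y → (p IK.:* x) IK.:* (p IK.:* x) IK.:+ (p IK.:* y) IK.:* (p IK.:* y) IK.:= p IK.:* (p IK.:* (x IK.:* x IK.:+ y IK.:* y))) ≡.refl (+ p₂) x y))))))
      where
      dA : (+ p₂) IK.∣ A
      dA = M₂.sq-∣ A (IK.∣-resp {x = + p₂ ℤ.- B ℤ.* B} (≡.trans (cong (ℤ._- B ℤ.* B) AB) (IK.solve 2 (λ a b → (a IK.:* a IK.:+ b IK.:* b) IK.:- b IK.:* b IK.:= a IK.:* a) ≡.refl A B)) (IK.∣-- (IK.∣-refl {+ p₂}) (IK.∣-*ˡ B d)))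
      x = IK.quo dA
      y = IK.quo d

  rel₂-1 : G₂.w 1 + G₂.w p₁ ≈ - 1#
  rel₂-1 = RS₂.relSq 1 p₁ 1ℤ (p∤1 pr₂) (one² p₂) nr

  ∣-N' : ∀ i → (i ℤ.* i) ≡ℤ (ℤ.- 1ℤ) [ + p₂ ] → (i ℤ.* i) ≡ℤ + N' [ + p₂ ]
  ∣-N' i e = IK.≡-trans {x = i ℤ.* i} {y = ℤ.- 1ℤ} {z = + N'} e (IK.≡-sym {x = + N'} {y = ℤ.- 1ℤ} (N'≡-1 p₂ H N≡₂))

  same₂ : ∀ c r → ¬ (p₂ ℕD.∣ c) → (r ℤ.* r) ≡ℤ + c [ + p₂ ] → G₂.w c ≈ G₂.w 1
  same₂ c r nc e = +-cancelʳ' (trans (RS₂.relSq c p₁ r nc e nr) (sym rel₂-1))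
    where
    +-cancelʳ' : ∀ {x y z} → x + z ≈ y + z → x ≈ y
    +-cancelʳ' {x} {y} {z} e = trans (solve 2 (λ x z → x := (x :+ z) :- z) refl x z) (trans (+-congʳ e) (solve 2 (λ x z → (x :+ z) :- z := x) refl y z))

  S₁ S₂ : Carrier
  S₁ = G₁.S
  S₂ = G₂.S

  S₂-fix : ∀ {c} → Unit c → ∀ r → ¬ (p₂ ℕD.∣ c) → (r ℤ.* r) ≡ℤ + c [ + p₂ ] → σ c S₂ ≈ S₂
  S₂-fix {c} uc r nc e = trans (G₂.σ-S uc) (+-congˡ (*-congˡ (same₂ c r nc e)))

  S̄₂ : S₂ ̄ ≈ S₂
  S̄₂ = S₂-fix unit-N' (proj₁ im) G₂.p∤N' (∣-N' (proj₁ im) (proj₂ im))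

  S₂² : S₂ * S₂ ≈ c# p₂
  S₂² = trans (*-congˡ (sym S̄₂)) G₂.SS̄

  -- With z = (S₂ - 1)/2 the value is (p₂ - 1)/4; it is even because p₂ ≡ 1 modulo 8.
  z₂² : G₂.w 1 * G₂.w 1 + G₂.w 1 ≈ c# 2 * c# b
  z₂² = c#-cancel 4 (s≤s z≤n) (trans (solve 1 (λ z → con (+ 4) :* (z :* z :+ z) := (con 1ℤ :+ con (+ 2) :* z) :* (con 1ℤ :+ con (+ 2) :* z) :- con 1ℤ) refl z)
     (trans (+-congʳ (*-cong (+-congʳ ι-1) (+-congʳ ι-1))) (trans (+-congʳ (trans S₂² (trans (ι-cong (cong +_ p₂≡)) (trans (ι-+ 1ℤ (+ (8 ℕ.* b))) (+-congˡ (c#-* 8 b)))))) (solve 1 (λ b → (con 1ℤ :+ con (+ 8) :* b) :- con 1ℤ := con (+ 4) :* (con (+ 2) :* b)) refl (c# b)))))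
    where z = G₂.w 1

  frob2 : ∀ x → (x * x) ≡ σ 2 x [ c# 2 ]
  frob2 x = ≡-resp (*-congˡ (*-identityʳ x)) refl (frobσ prime[2] u2 x)

  -- If 2 were a non-residue, σ₂ would send the half sum z to -1 - z. But z² ≡ σ₂z modulo 2, and z²
  -- + z is even, so 1 would be even.
  two-res : ∃ λ r → (r ℤ.* r) ≡ℤ + 2 [ + p₂ ]
  two-res with res? (+ 2) p₂
  ... | inj₁ x = x
  ... | inj₂ n2 = ⊥-elim (2∤1 (∣-resp (trans (+-congʳ (trans (+-cong (trans (solve 1 (λ z → z :* z := (z :* z :+ z) :- z) refl z) (+-congʳ z₂²)) (-‿cong σz)) refl))
         (trans (solve 3 (λ z k o → ((k :- z) :- (:- o :- z)) :- k := o) refl z (c# 2 * c# b) 1#) refl)) (∣-- (frob2 z) (∣-*ʳ (c# b) (∣-refl {c# 2})))))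
    where
    z = G₂.w 1
    σz : σ 2 z ≈ - 1# - z
    σz = trans (trans (G₂.σ-w u2 1) refl) (trans (solve 2 (λ y z → y := (z :+ y) :- z) refl (G₂.w 2) z) (+-congʳ (RS₂.relSq 1 2 1ℤ (p∤1 pr₂) (one² p₂) n2)))

  σ₂S₂ : σ 2 S₂ ≈ S₂
  σ₂S₂ = S₂-fix u2 (proj₁ two-res) G₂.p∤2 (proj₂ two-res)

  S₂-anti : ∀ {c} → Unit c → c ℕ.% p₂ ≡ p₁ ℕ.% p₂ → σ c S₂ ≈ - S₂
  S₂-anti {c} uc e = trans (G₂.σ-S uc) (trans (+-congˡ (*-congˡ (trans (G₂.w-mod c p₁ e) (trans (solve 2 (λ y z → y := (z :+ y) :- z) refl (G₂.w p₁) (G₂.w 1)) (+-congʳ rel₂-1)))))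
     (solve 2 (λ o z → o :+ con (+ 2) :* (:- o :- z) := :- (o :+ con (+ 2) :* z)) refl 1# (G₂.w 1)))

  nr₁-1 : NRes (ℤ.- 1ℤ) p₁
  nr₁-1 = M₁.Odd.euler-easy h₁ p₁h (ℤ.- 1ℤ) (IK.≡-reflexive {x = (ℤ.- 1ℤ) IK.^ h₁} (≡.trans (cong ((ℤ.- 1ℤ) IK.^_) (S'.solve 1 (λ a → S'.con 1 S'.:+ S'.con 4 S'.:* a S'.:= S'.con 1 S'.:+ (S'.con 2 S'.:* a S'.:+ S'.con 2 S'.:* a)) ≡.refl a)) (-1^odd (2 ℕ.* a))))

  nr₁-N' : NRes (+ N') p₁
  nr₁-N' x d = nr₁-1 x (IK.≡-trans {x = x ℤ.* x} {y = + N'} {z = ℤ.- 1ℤ} d (N'≡-1 p₁ G N≡₁))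

  rel₁-N' : G₁.w 1 + G₁.w N' ≈ - 1#
  rel₁-N' = RS₁.relSq 1 N' 1ℤ (p∤1 pr₁) (one² p₁) nr₁-N'

  neg-S : ∀ {x y} → x + y ≈ - 1# → 1# + c# 2 * y ≈ - (1# + c# 2 * x)
  neg-S {x} {y} e = trans (+-congˡ (*-congˡ (trans (solve 2 (λ y z → y := (z :+ y) :- z) refl y x) (+-congʳ e)))) (solve 2 (λ o z → o :+ con (+ 2) :* (:- o :- z) := :- (o :+ con (+ 2) :* z)) refl 1# x)

  S̄₁ : S₁ ̄ ≈ - S₁
  S̄₁ = trans (G₁.σ-S unit-N') (neg-S rel₁-N')

  S₁² : S₁ * S₁ ≈ - c# p₁
  S₁² = trans (solve 1 (λ s → s :* s := :- (s :* (:- s))) refl S₁) (-‿cong (trans (*-congˡ (sym S̄₁)) G₁.SS̄))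

  z₁² : G₁.w 1 * G₁.w 1 + G₁.w 1 ≈ - (c# 2 * c# a) - 1#
  z₁² = c#-cancel 4 (s≤s z≤n) (trans (solve 1 (λ z → con (+ 4) :* (z :* z :+ z) := (con 1ℤ :+ con (+ 2) :* z) :* (con 1ℤ :+ con (+ 2) :* z) :- con 1ℤ) refl z)
     (trans (+-congʳ (*-cong (+-congʳ ι-1) (+-congʳ ι-1))) (trans (+-congʳ (trans S₁² (-‿cong (trans (ι-cong (cong +_ p₁≡)) (trans (ι-+ (+ 3) (+ (8 ℕ.* a))) (+-congˡ (c#-* 8 a)))))))
       (trans (solve 1 (λ b → (:- (con (+ 3) :+ con (+ 8) :* b)) :- con 1ℤ := con (+ 4) :* (:- (con (+ 2) :* b) :- con 1ℤ)) refl (c# a)) (*-congˡ (+-congˡ (-‿cong ι-1)))))))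
    where z = G₁.w 1

  -- If 2 were a residue, σ₂ would fix the half sum z, making z² + z even; by `z₁²` it is -(p₁+1)/4
  -- = -2a - 1, which is odd.
  nr₁-2 : NRes (+ 2) p₁
  nr₁-2 r d = 2∤1 (∣-resp (trans (+-congʳ (+-congʳ (+-cong (trans (solve 1 (λ z → z :* z := (z :* z :+ z) :- z) refl z) (+-congʳ z₁²)) (-‿cong σz))))
       (solve 3 (λ z k o → (((:- k :- o) :- z :- z) :+ con (+ 2) :* z) :+ (k :+ con (+ 2) :* o) := o) refl z (c# 2 * c# a) 1#))
       (∣-+ (∣-+ (frob2 z) (∣-*ʳ z (∣-refl {c# 2}))) (∣-+ (∣-*ʳ (c# a) (∣-refl {c# 2})) (∣-*ʳ 1# (∣-refl {c# 2})))))
    where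
    z = G₁.w 1
    σz : σ 2 z ≈ z
    σz = trans (G₁.σ-w u2 1) (trans (solve 2 (λ y z → y := (y :+ z) :- z) refl (G₁.w 2) (G₁.w N')) (trans (+-congʳ (trans (RS₁.relSq 2 N' r G₁.p∤2 d nr₁-N') (sym rel₁-N'))) (solve 2 (λ y z → (y :+ z) :- z := y) refl z (G₁.w N'))))

  σ₂S₁ : σ 2 S₁ ≈ - S₁
  σ₂S₁ = trans (G₁.σ-S u2) (neg-S (RS₁.relSq 1 2 1ℤ (p∤1 pr₁) (one² p₁) nr₁-2))

  S^2n : ∀ s c n → s * s ≈ ι c → s * s ^ suc (n ℕ.+ n) ≈ ι (c IK.^ suc n)
  S^2n s c n e = trans (solve 3 (λ s x y → s :* (s :* (x :* y)) := (s :* s) :* (x :* y)) refl s (s ^ n) (s ^ n) ⟪ (λ q → trans (*-congˡ (*-congˡ (^-homo-* s n n))) q) ⟫)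
     (trans (*-cong e (trans (sym (^-distrib-* s s n)) (trans (^-congˡ n e) (sym (pw n))))) (sym (ι-* c (c IK.^ n))))
    where
    _⟪_⟫ : ∀ {A B : Set} → A → (A → B) → B
    x ⟪ f ⟫ = f x
    pw : ∀ n → ι (c IK.^ n) ≈ ι c ^ n
    pw zero = ι-1
    pw (suc n) = trans (ι-* c _) (*-congˡ (pw n))

  -- Reciprocity: Frobenius gives S₂^p₁ ≡ -S₂ modulo p₁. Multiplying by S₂ and using S₂² = p₂ yields
  -- p₂^(h₁+1) ≡ -p₂, which `int` carries to ℤ.
  qr₁ : ((+ p₂) IK.^ h₁) ≡ℤ (ℤ.- 1ℤ) [ + p₁ ]
  qr₁ = M₁.cancel (+ p₂) ((+ p₂) IK.^ h₁) (ℤ.- 1ℤ) np (IK.∣-resp {x = (+ p₂) IK.^ suc h₁ ℤ.- (ℤ.- (+ p₂))} (cong (λ z → (+ p₂) IK.^ suc h₁ ℤ.- z) (IK.solve 1 (λ p → IK.:- p IK.:= p IK.:* (IK.:- IK.con 1ℤ)) ≡.refl (+ p₂)))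
       (int (+ p₁) (quo d) _ (trans (sym (eq d)) (trans (+-cong (trans (*-congˡ (^-congʳ S₂ p₁h)) (S^2n S₂ (+ p₂) h₁ S₂²)) (-‿cong (trans (sym (-‿distribʳ-* S₂ S₂)) (trans (-‿cong S₂²) (sym (ι-neg (+ p₂))))))) (sym (ι-- ((+ p₂) IK.^ suc h₁) (ℤ.- (+ p₂))))))))
    where
    d : (S₂ * S₂ ^ p₁) ≡ (S₂ * - S₂) [ c# p₁ ]
    d = ≡-* ≡-refl (≡-trans (G₂.S-frob pr₁) (≡-reflexive (neg-S rel₂-1)))
    np : ¬ ((+ p₁) IK.∣ (+ p₂))
    np x = p₁≢p₂ (prime∣prime pr₁ pr₂ (toℕ∣ {p₁} {+ p₂} x))

  nr₁-p₂ : NRes (+ p₂) p₁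
  nr₁-p₂ = M₁.Odd.euler-easy h₁ p₁h (+ p₂) qr₁

  -- The same argument with S₁² = -p₁; the sign disappears at the end because h₂ is even.
  qr₂ : ((+ p₁) IK.^ h₂) ≡ℤ (ℤ.- 1ℤ) [ + p₂ ]
  qr₂ = ≡.subst (λ z → z ≡ℤ (ℤ.- 1ℤ) [ + p₂ ]) even (M₂.cancel (ℤ.- (+ p₁)) ((ℤ.- (+ p₁)) IK.^ h₂) (ℤ.- 1ℤ) np (IK.∣-resp {x = (ℤ.- (+ p₁)) IK.^ suc h₂ ℤ.- (+ p₁)} (cong (λ z → (ℤ.- (+ p₁)) IK.^ suc h₂ ℤ.- z) (IK.solve 1 (λ p → p IK.:= (IK.:- p) IK.:* (IK.:- IK.con 1ℤ)) ≡.refl (+ p₁)))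
       (int (+ p₂) (quo d) _ (trans (sym (eq d)) (trans (+-cong (trans (*-congˡ (^-congʳ S₁ p₂h)) (S^2n S₁ (ℤ.- (+ p₁)) h₂ (trans S₁² (sym (ι-neg (+ p₁)))))) (-‿cong (trans (sym (-‿distribʳ-* S₁ S₁)) (trans (-‿cong S₁²) (-‿involutive _))))) (sym (ι-- ((ℤ.- (+ p₁)) IK.^ suc h₂) (+ p₁)))))))) 
    where
    d : (S₁ * S₁ ^ p₂) ≡ (S₁ * - S₁) [ c# p₂ ]
    d = ≡-* ≡-refl (≡-trans (G₁.S-frob pr₂) (≡-reflexive (neg-S (RS₁.relSq 1 p₂ 1ℤ (p∤1 pr₁) (one² p₁) nr₁-p₂))))
    np : ¬ ((+ p₂) IK.∣ (ℤ.- (+ p₁)))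
    np x = p₁≢p₂ (≡.sym (prime∣prime pr₂ pr₁ (≡.subst (p₂ ℕD.∣_) (ℤP.∣-i∣≡∣i∣ (+ p₁)) (toℕ∣ {p₂} {ℤ.- (+ p₁)} x))))
    even : (ℤ.- (+ p₁)) IK.^ h₂ ≡ (+ p₁) IK.^ h₂
    even = ≡.trans (cong ((ℤ.- (+ p₁)) IK.^_) h2) (≡.trans (≡.sym (IK.^-assocʳ (ℤ.- (+ p₁)) 2 (2 ℕ.* b))) (≡.trans (cong (IK._^ (2 ℕ.* b)) (IK.solve 1 (λ p → (IK.:- p) IK.:* ((IK.:- p) IK.:* IK.con 1ℤ) IK.:= p IK.:* (p IK.:* IK.con 1ℤ)) ≡.refl (+ p₁))) (≡.trans (IK.^-assocʳ (+ p₁) 2 (2 ℕ.* b)) (cong ((+ p₁) IK.^_) (≡.sym h2)))))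
      where h2 : h₂ ≡ 2 ℕ.* (2 ℕ.* b)
            h2 = S'.solve 1 (λ b → S'.con 4 S'.:* b S'.:= S'.con 2 S'.:* (S'.con 2 S'.:* b)) ≡.refl b

  private
    -- Lifts p^j ≡ -1 from modulus q to q^(k+1), the exponent growing by q^k. Fed with `qr₂` and
    -- `qr₁`, it provides the condition of `AtP` that -1 is a power of one prime modulo the power of
    -- the other in N.
    lifted : ∀ p q h (prq : Prime q) j k → q ≡ suc (h ℕ.+ h) → ((+ p) IK.^ j) ≡ℤ (ℤ.- 1ℤ) [ + q ] → (q ℕ.^ suc k) ℕD.∣ p ℕ.^ (j ℕ.* q ℕ.^ k) ℕ.+ 1
    lifted p q h prq j k qh e = toℕ∣ {q ℕ.^ suc k} {+ (p ℕ.^ (j ℕ.* q ℕ.^ k) ℕ.+ 1)} (IK.∣-respˡ (≡.sym (pos-^ q (suc k)))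
      (≡.subst (λ z → ((+ q) IK.^ suc k) IK.∣ z) fin (ModP.lift q prq ((+ p) IK.^ j) (ℤ.- 1ℤ) k e)))
      where
      fin : ((+ p) IK.^ j) IK.^ (q ℕ.^ k) ℤ.- (ℤ.- 1ℤ) IK.^ (q ℕ.^ k) ≡ + (p ℕ.^ (j ℕ.* q ℕ.^ k) ℕ.+ 1)
      fin = ≡.trans (cong₂ ℤ._-_ (≡.trans (IK.^-assocʳ (+ p) j (q ℕ.^ k)) (≡.sym (pos-^ p (j ℕ.* q ℕ.^ k)))) (-1^podd {q} {h} qh k)) ≡.refl

    suc-form : ∀ x → 0 < x → ∃ λ y → x ≡ suc y
    suc-form (suc x) _ = x , ≡.refl

  open Local CR public using (module Two)

  private
    module L = Local CR

  local₁ : ∀ k y → c# p₁ ^ (k ℕ.+ k) ∣ (y * y ̄) → c# p₁ ^ k ∣ y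
  local₁ = L.AtP.local-p^ p₁ pr₁ e₁' M N≡ (trans (reflexive (cong (λ k → geom p₁ (ζ ^ k)) (≡.sym G≡))) Ng≈0) J' k (≡.trans (cong (λ j → p₁ ℕ.^ j ℕ.+ 1) (≡.sym J≡)) (ℕD._∣_.equality dv)) (nzd M N∤M) 3≤p₁
    where
    M = p₂ ℕ.^ suc e₂'
    J = h₂ ℕ.* p₂ ℕ.^ e₂'
    J>0 : 0 < J
    J>0 = ℕP.*-mono-≤ (ℕP.*-mono-≤ {1} {4} (s≤s z≤n) b>0) (ℕP.m^n>0 p₂ e₂')
    J' = proj₁ (suc-form J J>0)
    J≡ = proj₂ (suc-form J J>0)
    dv = lifted p₁ p₂ h₂ pr₂ h₂ e₂' p₂h qr₂
    k = ℕD.quotient dv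
    N∤M : ¬ (N ℕD.∣ M)
    N∤M d = p₁≢p₂ (prime∣prime pr₁ pr₂ (prime∣^ pr₁ (suc e₂') (ℕD.∣-trans (≡.subst (p₁ ℕD.∣_) (≡.sym N≡₁) (ℕD.m∣m*n G)) d)))

  local₂ : ∀ k y → c# p₂ ^ (k ℕ.+ k) ∣ (y * y ̄) → c# p₂ ^ k ∣ y
  local₂ = L.AtP.local-p^ p₂ pr₂ e₂' M (≡.trans N≡ (ℕP.*-comm (p₁ ℕ.^ suc e₁') _)) (trans (reflexive (cong (λ k → geom p₂ (ζ ^ k)) (≡.trans (ℕP.*-comm (p₂ ℕ.^ e₂') _) (≡.sym H≡)))) Nh≈0) J' k (≡.trans (cong (λ j → p₂ ℕ.^ j ℕ.+ 1) (≡.sym J≡)) (ℕD._∣_.equality dv)) (nzd M N∤M) 3≤p₂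
    where
    M = p₁ ℕ.^ suc e₁'
    J = h₁ ℕ.* p₁ ℕ.^ e₁'
    J>0 : 0 < J
    J>0 = ℕP.*-mono-≤ {1} {h₁} (s≤s z≤n) (ℕP.m^n>0 p₁ e₁')
    J' = proj₁ (suc-form J J>0)
    J≡ = proj₂ (suc-form J J>0)
    dv = lifted p₂ p₁ h₁ pr₁ h₁ e₁' p₁h qr₁
    k = ℕD.quotient dv
    N∤M : ¬ (N ℕD.∣ M)
    N∤M d = p₁≢p₂ (≡.sym (prime∣prime pr₂ pr₁ (prime∣^ pr₂ (suc e₁') (ℕD.∣-trans (≡.subst (p₂ ℕD.∣_) (≡.sym N≡₂) (ℕD.m∣m*n H)) d))))

  -- Euler's function, Ramanujan sums and integrality of traces

  N₀ E : ℕ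
  N₀ = p₁ ℕ.^ e₁' ℕ.* p₂ ℕ.^ e₂'
  E = 4 ℕ.* b ℕ.* (1 ℕ.+ 4 ℕ.* a)

  G≡' : G ≡ N₀ ℕ.* p₂
  G≡' = ≡.trans G≡ (S'.solve 3 (λ x p y → x S'.:* (p S'.:* y) S'.:= (x S'.:* y) S'.:* p) ≡.refl (p₁ ℕ.^ e₁') p₂ (p₂ ℕ.^ e₂'))
  H≡' : H ≡ N₀ ℕ.* p₁
  H≡' = ≡.trans H≡ (S'.solve 3 (λ x p y → (p S'.:* x) S'.:* y S'.:= (x S'.:* y) S'.:* p) ≡.refl (p₁ ℕ.^ e₁') p₁ (p₂ ℕ.^ e₂'))
  N≡₀ : N ≡ N₀ ℕ.* (p₁ ℕ.* p₂)
  N≡₀ = ≡.trans N≡₁ (≡.trans (cong (p₁ ℕ.*_) G≡') (S'.solve 3 (λ p n q → p S'.:* (n S'.:* q) S'.:= n S'.:* (p S'.:* q)) ≡.refl p₁ N₀ p₂))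

  p₁∣N : p₁ ℕD.∣ N
  p₁∣N = ≡.subst (p₁ ℕD.∣_) (≡.sym N≡₁) (ℕD.m∣m*n G)
  p₂∣N : p₂ ℕD.∣ N
  p₂∣N = ≡.subst (p₂ ℕD.∣_) (≡.sym N≡₂) (ℕD.m∣m*n H)

  gcd1 : ∀ x → ¬ (p₁ ℕD.∣ x) → ¬ (p₂ ℕD.∣ x) → gcd x N ≡ 1
  gcd1 x n₁ n₂ with gcd x N ℕ.≟ 1
  ... | yes e = e
  ... | no ne with divN (gcd x N) (gcd[m,n]∣n x N) (ge2 (gcd x N) (gcd[m,n]∣n x N) ne)
    where
    ge2 : ∀ d → d ℕD.∣ N → ¬ (d ≡ 1) → 1 < d
    ge2 zero d∣N _ = ⊥-elim (ℕP.0≢1+n (≡.sym (ℕD.0∣⇒≡0 d∣N)))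
    ge2 (suc zero) _ ne = ⊥-elim (ne ≡.refl)
    ge2 (suc (suc d)) _ _ = s≤s (s≤s z≤n)
  ... | inj₁ y = ⊥-elim (n₁ (ℕD.∣-trans y (gcd[m,n]∣m x N)))
  ... | inj₂ y = ⊥-elim (n₂ (ℕD.∣-trans y (gcd[m,n]∣m x N)))

  gcd1⁻ : ∀ {p} x → Prime p → p ℕD.∣ N → gcd x N ≡ 1 → ¬ (p ℕD.∣ x)
  gcd1⁻ {p} x pr pN e d = p∤1 pr (≡.subst (p ℕD.∣_) e (Data.Nat.GCD.gcd-greatest d pN))

  abstract
    UL : List ℕ
    UL = filter (λ k → gcd k N ℕ.≟ 1) (map suc (upTo N))

    UL-length : length UL ≡ φ N
    UL-length = ≡.refl

    ∈UL : ∀ r → suc r ≤ N → ¬ (p₁ ℕD.∣ suc r) → ¬ (p₂ ℕD.∣ suc r) → suc r ∈ UL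
    ∈UL r lt n₁ n₂ = ∈-filter⁺ (λ k → gcd k N ℕ.≟ 1) (∈-map⁺ suc (∈-upTo⁺ lt)) (gcd1 (suc r) n₁ n₂)

    -- inclusion–exclusion over the multiples of p₁ and p₂
    unit-sum : ∀ F → ∑ UL F ≈ ((∑< N (λ i → F (suc i)) - ∑< G (λ j → F (p₁ ℕ.* suc j))) - ∑< H (λ j → F (p₂ ℕ.* suc j))) + ∑< N₀ (λ j → F ((p₁ ℕ.* p₂) ℕ.* suc j))
    unit-sum F = begin
      ∑ UL F ≈⟨ ∑-filter (λ k → gcd k N ℕ.≟ 1) (map suc (upTo N)) F ⟩
      ∑ (map suc (upTo N)) (λ k → when (gcd k N ℕ.≟ 1) (F k)) ≈⟨ reflexive (∑-map (upTo N) suc _) ⟩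
      ∑ (upTo N) (λ i → when (gcd (suc i) N ℕ.≟ 1) (F (suc i))) ≈⟨ ∑-upTo N _ ⟩
      ∑< N (λ i → when (gcd (suc i) N ℕ.≟ 1) (F (suc i))) ≈⟨ ∑<-cong N (λ i _ → point (suc i)) ⟩
      ∑< N (λ i → ((F (suc i) + - W p₁ i) + - W p₂ i) + W (p₁ ℕ.* p₂) i)
        ≈⟨ trans (∑<-+ N _ _) (+-congʳ (trans (∑<-+ N _ _) (+-cong (trans (∑<-+ N _ _) (+-congˡ (sym (∑<-neg N _)))) (sym (∑<-neg N _))))) ⟩
      ((∑< N (λ i → F (suc i)) - ∑< N (W p₁)) - ∑< N (W p₂)) + ∑< N (W (p₁ ℕ.* p₂))
        ≈⟨ +-cong (+-cong (+-congˡ (-‿cong (mult p₁ G (≡.trans N≡₁ (ℕP.*-comm p₁ G)) 0<p₁))) (-‿cong (mult p₂ H (≡.trans N≡₂ (ℕP.*-comm p₂ H)) 0<p₂))) (mult (p₁ ℕ.* p₂) N₀ N≡₀ (ℕP.*-mono-≤ 0<p₁ 0<p₂)) ⟩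
      _ ∎
      where
      open RR
      W : ℕ → ℕ → Carrier
      W d i = when (d ℕD.∣? suc i) (F (suc i))
      mult : ∀ d M → N ≡ M ℕ.* d → 0 < d → ∑< N (W d) ≈ ∑< M (λ j → F (d ℕ.* suc j))
      mult (suc d') M e _ = trans (reflexive (cong (λ k → ∑< k (W (suc d'))) e)) (multiples d' M F)
      both : ∀ k → p₁ ℕD.∣ k → p₂ ℕD.∣ k → p₁ ℕ.* p₂ ℕD.∣ k
      both k (ℕD.divides q ≡.refl) d₂ with euclidsLemma q p₁ pr₂ d₂
      ... | inj₁ x = ≡.subst (p₁ ℕ.* p₂ ℕD.∣_) (ℕP.*-comm p₁ q) (ℕD.*-monoʳ-∣ p₁ x)
      ... | inj₂ y = ⊥-elim (p₁≢p₂ (≡.sym (prime∣prime pr₂ pr₁ y)))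
      point : ∀ k → when (gcd k N ℕ.≟ 1) (F k) ≈ ((F k + - when (p₁ ℕD.∣? k) (F k)) + - when (p₂ ℕD.∣? k) (F k)) + when (p₁ ℕ.* p₂ ℕD.∣? k) (F k)
      point k with p₁ ℕD.∣? k | p₂ ℕD.∣? k | p₁ ℕ.* p₂ ℕD.∣? k | gcd k N ℕ.≟ 1
      ... | yes x | yes y | no z | _ = ⊥-elim (z (both k x y))
      ... | no x | _ | yes z | _ = ⊥-elim (x (ℕD.∣-trans (ℕD.m∣m*n p₂) z))
      ... | yes _ | no y | yes z | _ = ⊥-elim (y (ℕD.∣-trans (ℕD.n∣m*n p₁) z))
      ... | yes x | _ | _ | yes e = ⊥-elim (gcd1⁻ k pr₁ p₁∣N e x)
      ... | no _ | yes y | _ | yes e = ⊥-elim (gcd1⁻ k pr₂ p₂∣N e y)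
      ... | no x | no y | _ | no e = ⊥-elim (e (gcd1 k x y))
      ... | no x | no y | no _ | yes e = sym (trans (+-identityʳ _) (trans (+-cong (trans (+-congˡ -0#≈0#) (+-identityʳ _)) -0#≈0#) (+-identityʳ _)))
      ... | yes x | no y | no _ | no e = sym (trans (+-identityʳ _) (trans (+-cong (x-x≈0 _) -0#≈0#) (+-identityʳ _)))
      ... | no x | yes y | no _ | no e = sym (trans (+-identityʳ _) (trans (+-congʳ (trans (+-congˡ -0#≈0#) (+-identityʳ _))) (x-x≈0 _)))
      ... | yes x | yes y | yes _ | no e = sym (trans (+-congʳ (trans (+-congʳ (x-x≈0 _)) (+-identityˡ _))) (-‿inverseˡ _))

  -- Inclusion and exclusion of the constant 1, evaluated inside the ring and read back by `ι-inj`.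
  -- Here E = (p₁-1)(p₂-1)/4 and N₀ = N/(p₁p₂); E will turn out to be the order of 2 modulo p₁p₂.
  φ≡ : φ N ≡ 4 ℕ.* (N₀ ℕ.* E)
  φ≡ = ℤP.+-injective (ι-inj (+ φ N) (+ (4 ℕ.* (N₀ ℕ.* E))) (trans lhs rhs))
    where
    ones : ∀ M → ∑< M (λ _ → 1#) ≈ c# M
    ones M = trans (∑<-const M 1#) (*-identityʳ _)
    lhs : c# (φ N) ≈ ((c# N - c# G) - c# H) + c# N₀
    lhs = trans (ι-cong (cong +_ (≡.sym UL-length))) (trans (sym (trans (∑-const UL 1#) (*-identityʳ _))) (trans (unit-sum (λ _ → 1#)) (+-cong (+-cong (+-cong (ones N) (-‿cong (ones G))) (-‿cong (ones H))) (ones N₀))))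
    rhs : ((c# N - c# G) - c# H) + c# N₀ ≈ c# (4 ℕ.* (N₀ ℕ.* E))
    rhs = trans (+-congʳ (+-cong (+-cong (trans (ι-cong (cong +_ N≡₀)) (trans (c#-* N₀ _) (*-congˡ (trans (c#-* p₁ p₂) (*-cong q₁ q₂))))) (-‿cong (trans (ι-cong (cong +_ G≡')) (trans (c#-* N₀ p₂) (*-congˡ q₂))))) (-‿cong (trans (ι-cong (cong +_ H≡')) (trans (c#-* N₀ p₁) (*-congˡ q₁))))))
      (trans (solve 3 (λ n a b → ((n :* ((con (+ 3) :+ con (+ 8) :* a) :* (con 1ℤ :+ con (+ 8) :* b)) :- n :* (con 1ℤ :+ con (+ 8) :* b)) :- n :* (con (+ 3) :+ con (+ 8) :* a)) :+ n := con (+ 4) :* (n :* ((con (+ 4) :* b) :* (con 1ℤ :+ con (+ 4) :* a)))) refl (c# N₀) (c# a) (c# b))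
      (sym (trans (c#-* 4 _) (*-congˡ (trans (c#-* N₀ E) (*-congˡ (trans (c#-* (4 ℕ.* b) _) (*-cong (c#-* 4 b) (trans (ι-+ 1ℤ (+ (4 ℕ.* a))) (+-congˡ (c#-* 4 a)))))))))))
      where
      q₁ : c# p₁ ≈ c# 3 + c# 8 * c# a
      q₁ = trans (ι-cong (cong +_ p₁≡)) (trans (ι-+ (+ 3) (+ (8 ℕ.* a))) (+-congˡ (c#-* 8 a)))
      q₂ : c# p₂ ≈ ι 1ℤ + c# 8 * c# b
      q₂ = trans (ι-cong (cong +_ p₂≡)) (trans (ι-+ 1ℤ (+ (8 ℕ.* b))) (+-congˡ (c#-* 8 b)))

  IsInt : Carrier → Set
  IsInt x = ∃ λ n → x ≈ ι n

  int-+ : ∀ {x y} → IsInt x → IsInt y → IsInt (x + y)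
  int-+ (m , e) (n , f) = m ℤ.+ n , trans (+-cong e f) (sym (ι-+ m n))
  int-neg : ∀ {x} → IsInt x → IsInt (- x)
  int-neg (m , e) = ℤ.- m , trans (-‿cong e) (sym (ι-neg m))
  int-*ι : ∀ c {x} → IsInt x → IsInt (ι c * x)
  int-*ι c (m , e) = c ℤ.* m , trans (*-congˡ e) (sym (ι-* c m))
  int-resp : ∀ {x y} → x ≈ y → IsInt x → IsInt y
  int-resp e (m , f) = m , trans (sym e) f

  private
    gs : ∀ k d M → N ≡ M ℕ.* d → IsInt (∑< M (λ j → (ζ ^ (d ℕ.* suc j)) ^ k))
    gs k d M e = by (N ℕD.∣? (d ℕ.* k))
      where
      v = ζ ^ (d ℕ.* k)
      term : ∀ j → (ζ ^ (d ℕ.* suc j)) ^ k ≈ v * v ^ j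
      term j = trans (^-assocʳ ζ (d ℕ.* suc j) k) (trans (^-congʳ ζ (S'.solve 3 (λ d j k → (d S'.:* (S'.con 1 S'.:+ j)) S'.:* k S'.:= (d S'.:* k) S'.:* (S'.con 1 S'.:+ j)) ≡.refl d j k)) (sym (^-assocʳ ζ (d ℕ.* k) (suc j))))
      eqn : ∑< M (λ j → (ζ ^ (d ℕ.* suc j)) ^ k) ≈ v * geom M v
      eqn = trans (∑<-cong M (λ j _ → term j)) (sym (∑<-*ˡ M v (v ^_)))
      v^M : v ^ M ≈ 1#
      v^M = trans (^-assocʳ ζ (d ℕ.* k) M) (ζ-∣ (ℕD.divides k (≡.trans (S'.solve 3 (λ d k m → (d S'.:* k) S'.:* m S'.:= k S'.:* (m S'.:* d)) ≡.refl d k M) (cong (k ℕ.*_) (≡.sym e)))))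
      by : Dec (N ℕD.∣ d ℕ.* k) → IsInt (∑< M (λ j → (ζ ^ (d ℕ.* suc j)) ^ k))
      by (yes p) = + M , trans eqn (trans (*-cong (ζ-∣ p) (trans (geom-cong M (ζ-∣ p)) (trans (∑<-cong M (λ i _ → 1^ i)) (trans (∑<-const M 1#) (*-identityʳ _))))) (*-identityˡ _))
      by (no np) = 0ℤ , trans eqn (trans (*-congˡ (nzd (d ℕ.* k) np _ (trans (geom-tele M v) (trans (+-congˡ (-‿cong v^M)) (x-x≈0 1#))))) (trans (zeroʳ v) (sym ι-0)))

  -- A Ramanujan sum. Inclusion and exclusion splits it into complete geometric sums, each of which
  -- is either its length or zero.
  ram : ∀ k → IsInt (∑ UL (λ a → (ζ ^ a) ^ k))
  ram k = int-resp (sym (unit-sum (λ a → (ζ ^ a) ^ k))) (int-+ (int-+ (int-+ (int-resp (∑<-cong N (λ i _ → ^-congˡ k (^-congʳ ζ (ℕP.*-identityˡ (suc i))))) (gs k 1 N (≡.sym (ℕP.*-identityʳ N))))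
      (int-neg (gs k p₁ G (≡.trans N≡₁ (ℕP.*-comm p₁ G))))) (int-neg (gs k p₂ H (≡.trans N≡₂ (ℕP.*-comm p₂ H))))) (gs k (p₁ ℕ.* p₂) N₀ N≡₀))

  trace-int : ∀ x → IsInt (∑ UL (λ a → ev (ζ ^ a) (rep x)))
  trace-int x = int-resp (∑-cong UL (λ a → *-identityˡ _)) (go (rep x) 0)
    where
    open import Data.List using () renaming ([] to []ₗ; _∷_ to _∷ₗ_)
    go : ∀ p k → IsInt (∑ UL (λ a → (ζ ^ a) ^ k * ev (ζ ^ a) p))
    go []ₗ k = int-resp (sym (trans (∑-cong UL (λ a → zeroʳ _)) (∑-0 UL))) (0ℤ , sym ι-0)
    go (c ∷ₗ p) k = int-resp (sym (trans (∑-cong UL (λ a → solve 4 (λ z c y w → z :* (c :+ y :* w) := c :* z :+ (y :* z) :* w) refl ((ζ ^ a) ^ k) (ι c) (ζ ^ a) (ev (ζ ^ a) p))) (trans (∑-+ UL _ _) (+-congʳ (sym (∑-*ˡ UL (ι c) (λ a → (ζ ^ a) ^ k)))))))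
       (int-+ (int-*ι c (ram k)) (go p (suc k)))

  -- Powers of 2 modulo N and the cosets of ⟨2⟩

  r₂ i₂ : ℤ
  r₂ = proj₁ two-res
  i₂ = proj₁ im

  2^sq : ∀ s → ((r₂ ^ᶻ s) ℤ.* (r₂ ^ᶻ s)) ≡ᶻ (+ 2) ^ᶻ s [ p₂ ]
  2^sq s = IK.≡-trans {x = (r₂ ^ᶻ s) ℤ.* (r₂ ^ᶻ s)} {y = (r₂ ℤ.* r₂) ^ᶻ s} {z = (+ 2) ^ᶻ s} (IK.≡-reflexive (≡.sym (IK.^-distrib-* r₂ r₂ s))) (IK.≡-^ {x = r₂ ℤ.* r₂} {+ 2} s (proj₂ two-res))

  2∤ : ∀ s → ¬ ((+ p₂) ∣ℤ (r₂ ^ᶻ s))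
  2∤ s d = G₂.p∤2 (prime∣^ pr₂ s (≡.subst (p₂ ℕD.∣_) (≡.trans (cong ℤ.∣_∣ (≡.sym (pos-^ 2 s))) ≡.refl) (toℕ∣ {p₂} {(+ 2) ^ᶻ s} (M₂.∣-cong {(r₂ ^ᶻ s) ℤ.* (r₂ ^ᶻ s)} {(+ 2) ^ᶻ s} (2^sq s) (IK.∣-*ʳ (r₂ ^ᶻ s) d)))))

  -- ±2^s' is a square modulo p₂, and p₁·2^s is not.
  no-sq : ∀ s s' ε η → (η ℤ.* η) ≡ᶻ ε [ p₂ ] → ¬ (((+ p₁) ℤ.* (+ 2) ^ᶻ s) ≡ᶻ (ε ℤ.* (+ 2) ^ᶻ s') [ p₂ ])
  no-sq s s' ε η he h = nr (proj₁ sq) (proj₂ sq)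
    where
    v = η ℤ.* r₂ ^ᶻ s'
    u = r₂ ^ᶻ s
    vv : (v ℤ.* v) ≡ᶻ ((+ p₁) ℤ.* (u ℤ.* u)) [ p₂ ]
    vv = IK.≡-trans {x = v ℤ.* v} {y = ε ℤ.* (+ 2) ^ᶻ s'} {z = (+ p₁) ℤ.* (u ℤ.* u)}
       (IK.∣-resp {x = (η ℤ.* η) ℤ.* (r₂ ^ᶻ s' ℤ.* r₂ ^ᶻ s') ℤ.- ε ℤ.* (+ 2) ^ᶻ s'} (cong (λ z → z ℤ.- ε ℤ.* (+ 2) ^ᶻ s') (IK.solve 2 (λ a b → (a IK.:* a) IK.:* (b IK.:* b) IK.:= (a IK.:* b) IK.:* (a IK.:* b)) ≡.refl η (r₂ ^ᶻ s')))
          (IK.≡-* {x = η ℤ.* η} {ε} {r₂ ^ᶻ s' ℤ.* r₂ ^ᶻ s'} {(+ 2) ^ᶻ s'} he (2^sq s')))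
       (IK.≡-trans {x = ε ℤ.* (+ 2) ^ᶻ s'} {y = (+ p₁) ℤ.* (+ 2) ^ᶻ s} {z = (+ p₁) ℤ.* (u ℤ.* u)} (IK.≡-sym {x = (+ p₁) ℤ.* (+ 2) ^ᶻ s} {ε ℤ.* (+ 2) ^ᶻ s'} h)
          (IK.≡-* {x = + p₁} {+ p₁} {(+ 2) ^ᶻ s} {u ℤ.* u} (IK.≡-refl {x = + p₁}) (IK.≡-sym {x = u ℤ.* u} {(+ 2) ^ᶻ s} (2^sq s))))
    sq = M₂.ratio (+ p₁) v u (2∤ s) vv

  -- After multiplication by 2, the congruence would make 2 a square modulo p₁.
  even₁ : ∀ s → ((+ 2) ^ᶻ (suc (s ℕ.+ s))) ≡ᶻ 1ℤ [ p₁ ] → ⊥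
  even₁ s h = nr₁-2 ((+ 2) ^ᶻ suc s) (IK.∣-resp {x = (+ 2) ℤ.* (+ 2) ^ᶻ (suc (s ℕ.+ s)) ℤ.- (+ 2) ℤ.* 1ℤ}
      (cong₂ ℤ._-_ (≡.trans (cong (λ z → (+ 2) ℤ.* ((+ 2) ℤ.* z)) (IK.^-homo-* (+ 2) s s)) (IK.solve 2 (λ t x → t IK.:* (t IK.:* (x IK.:* x)) IK.:= (t IK.:* x) IK.:* (t IK.:* x)) ≡.refl (+ 2) ((+ 2) ^ᶻ s))) (ℤP.*-identityʳ (+ 2)))
      (IK.≡-* {x = + 2} {+ 2} {(+ 2) ^ᶻ (suc (s ℕ.+ s))} {1ℤ} (IK.≡-refl {x = + 2}) h))

  parity : ∀ s → (∃ λ k → s ≡ k ℕ.+ k) ⊎ (∃ λ k → s ≡ suc (k ℕ.+ k))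
  parity zero = inj₁ (0 , ≡.refl)
  parity (suc s) with parity s
  ... | inj₁ (k , e) = inj₂ (k , cong suc e)
  ... | inj₂ (k , e) = inj₁ (suc k , cong suc (≡.trans e (≡.sym (ℕP.+-suc k k))))

  f≡ : f ≡ N₀ ℕ.* E
  f≡ = ≡.trans (≡.sym φ4) (≡.trans (cong (ℕ._/ 4) (≡.trans φ≡ (ℕP.*-comm 4 (N₀ ℕ.* E)))) (DM.m*n/n≡m (N₀ ℕ.* E) 4))

  N₀>0 : 0 < N₀
  N₀>0 = ℕP.*-mono-≤ (ℕP.m^n>0 p₁ e₁') (ℕP.m^n>0 p₂ e₂')

  ≡ᶻ-pow : ∀ {x d} k → x ≡ᶻ 1ℤ [ d ] → (x ^ᶻ k) ≡ᶻ 1ℤ [ d ]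
  ≡ᶻ-pow {x} k h = IK.≡-trans {x = x ^ᶻ k} {y = 1ℤ ^ᶻ k} {z = 1ℤ} (IK.≡-^ {x = x} {1ℤ} k h) (IK.≡-reflexive (IK.1^ k))

  ≡ᶻ-down : ∀ {x y d} → d ℕD.∣ N → x ≡ᶻ y [ N ] → x ≡ᶻ y [ d ]
  ≡ᶻ-down {x} {y} {d} dv h = IK.∣-trans {b = + N} (fromℕ∣ {d} {+ N} dv) h

  2^* : ∀ s k → ((+ 2) ^ᶻ s) ^ᶻ k ≡ (+ 2) ^ᶻ (s ℕ.* k)
  2^* s k = IK.^-assocʳ (+ 2) s k

  two∤₁ : ¬ ((+ p₁) ∣ℤ (+ 2))
  two∤₁ d = G₁.p∤2 (toℕ∣ {p₁} {+ 2} d)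
  two₁ : ∀ k → ((+ 2) ^ᶻ ((2 ℕ.+ 8 ℕ.* a) ℕ.* k)) ≡ᶻ 1ℤ [ p₁ ]
  two₁ k = ≡.subst (λ z → z ≡ᶻ 1ℤ [ p₁ ]) (2^* (2 ℕ.+ 8 ℕ.* a) k) (≡ᶻ-pow {(+ 2) ^ᶻ (2 ℕ.+ 8 ℕ.* a)} {p₁} k (≡.subst (λ m → ((+ 2) ^ᶻ m) ≡ᶻ 1ℤ [ p₁ ]) (cong (_∸ 1) p₁≡) (M₁.fermat₁ (+ 2) two∤₁)))

  two₂ : ((+ 2) ^ᶻ h₂) ≡ᶻ 1ℤ [ p₂ ]
  two₂ = IK.≡-trans {x = (+ 2) ^ᶻ h₂} {y = (r₂ ^ᶻ h₂) ℤ.* (r₂ ^ᶻ h₂)} {z = 1ℤ} (IK.≡-sym {x = (r₂ ^ᶻ h₂) ℤ.* (r₂ ^ᶻ h₂)} {(+ 2) ^ᶻ h₂} (2^sq h₂))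
     (≡.subst (λ z → z ≡ᶻ 1ℤ [ p₂ ]) (≡.trans (cong (r₂ ^ᶻ_) (cong (_∸ 1) p₂h)) (IK.^-homo-* r₂ h₂ h₂)) (M₂.fermat₁ r₂ (λ d → 2∤ 1 (≡.subst (λ z → (+ p₂) ∣ℤ z) (≡.sym (ℤP.*-identityʳ r₂)) d))))

  copow : Coprime (p₁ ℕ.^ suc e₁') (p₂ ℕ.^ suc e₂')
  copow {d} (x , y) with d ℕ.≟ 1
  ... | yes e = e
  ... | no ne with divN d (ℕD.∣-trans x (≡.subst (p₁ ℕ.^ suc e₁' ℕD.∣_) (≡.sym N≡) (ℕD.m∣m*n _))) (ge2 d x ne)
    where
    ge2 : ∀ d → d ℕD.∣ p₁ ℕ.^ suc e₁' → ¬ (d ≡ 1) → 1 < d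
    ge2 zero d∣ _ = ⊥-elim (ℕP.<⇒≢ (ℕP.m^n>0 p₁ (suc e₁')) (≡.sym (ℕD.0∣⇒≡0 d∣)))
    ge2 (suc zero) _ ne = ⊥-elim (ne ≡.refl)
    ge2 (suc (suc d)) _ _ = s≤s (s≤s z≤n)
  ... | inj₁ z = ⊥-elim (p₁≢p₂ (prime∣prime pr₁ pr₂ (prime∣^ pr₁ (suc e₂') (ℕD.∣-trans z y))))
  ... | inj₂ z = ⊥-elim (p₁≢p₂ (≡.sym (prime∣prime pr₂ pr₁ (prime∣^ pr₂ (suc e₁') (ℕD.∣-trans z x)))))

  combine : ∀ x → (p₁ ℕ.^ suc e₁') ℕD.∣ x → (p₂ ℕ.^ suc e₂') ℕD.∣ x → N ℕD.∣ x
  combine x dx (ℕD.divides q ≡.refl) = ≡.subst (ℕD._∣ (q ℕ.* p₂ ℕ.^ suc e₂')) (≡.sym N≡) (ℕD.*-monoˡ-∣ (p₂ ℕ.^ suc e₂') (coprime-divisor copow (≡.subst (p₁ ℕ.^ suc e₁' ℕD.∣_) (ℕP.*-comm q _) dx)))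

  -- Raising to the power N₀ lifts the two congruences to p₁^e₁ and p₂^e₂, hence to N, so the
  -- minimality of f = N₀E gives N₀E ≤ N₀s.
  E-min : ∀ s → 0 < s → ((+ 2) ^ᶻ s) ≡ᶻ 1ℤ [ p₁ ] → ((+ 2) ^ᶻ s) ≡ᶻ 1ℤ [ p₂ ] → E ≤ s
  E-min s 0<s h₁' h₂' = ℕP.*-cancelˡ-≤ N₀ {{ℕ.>-nonZero N₀>0}} (≡.subst₂ _≤_ f≡ (ℕP.*-comm s N₀) (f-min (s ℕ.* N₀) (ℕP.*-mono-≤ 0<s N₀>0) (fromℕ∣ {N} (combine _ (part p₁ pr₁ e₁' (p₂ ℕ.^ e₂') ≡.refl h₁') (part p₂ pr₂ e₂' (p₁ ℕ.^ e₁') (ℕP.*-comm (p₁ ℕ.^ e₁') _) h₂')))))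
    where
    part : ∀ p → Prime p → ∀ e' q → N₀ ≡ p ℕ.^ e' ℕ.* q → ((+ 2) ^ᶻ s) ≡ᶻ 1ℤ [ p ] → p ℕ.^ suc e' ℕD.∣ ℤ.∣ (+ 2) ^ᶻ (s ℕ.* N₀) ℤ.- 1ℤ ∣
    part p pr e' q ne h = toℕ∣ {p ℕ.^ suc e'} (≡.subst (λ z → (((+ 2) ^ᶻ z)) ≡ᶻ 1ℤ [ p ℕ.^ suc e' ]) (≡.trans (ℕP.*-assoc s _ q) (cong (s ℕ.*_) (≡.sym ne)))
       (≡.subst (λ z → z ≡ᶻ 1ℤ [ p ℕ.^ suc e' ]) (2^* (s ℕ.* p ℕ.^ e') q) (≡ᶻ-pow {(+ 2) ^ᶻ (s ℕ.* p ℕ.^ e')} {p ℕ.^ suc e'} q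
         (IK.∣-respˡ (≡.sym (pos-^ p (suc e'))) (≡.subst (λ z → ((+ p) ^ᶻ suc e') ∣ℤ z) (cong₂ ℤ._-_ (2^* s (p ℕ.^ e')) (IK.1^ (p ℕ.^ e'))) (ModP.lift p pr ((+ 2) ^ᶻ s) 1ℤ e' h))))))

  E>0 : 0 < E
  E>0 = ℕP.*-mono-≤ (ℕP.*-mono-≤ {1} {4} (s≤s z≤n) b>0) (s≤s z≤n)

  E₁ : ((+ 2) ^ᶻ E) ≡ᶻ 1ℤ [ p₁ ]
  E₁ = ≡.subst (λ k → ((+ 2) ^ᶻ k) ≡ᶻ 1ℤ [ p₁ ]) (S'.solve 2 (λ a b → (S'.con 2 S'.:+ S'.con 8 S'.:* a) S'.:* (S'.con 2 S'.:* b) S'.:= S'.con 4 S'.:* b S'.:* (S'.con 1 S'.:+ S'.con 4 S'.:* a)) ≡.refl a b) (two₁ (2 ℕ.* b))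
  E₂ : ((+ 2) ^ᶻ E) ≡ᶻ 1ℤ [ p₂ ]
  E₂ = ≡.subst (λ z → z ≡ᶻ 1ℤ [ p₂ ]) (2^* h₂ (1 ℕ.+ 4 ℕ.* a)) (≡ᶻ-pow {(+ 2) ^ᶻ h₂} {p₂} (1 ℕ.+ 4 ℕ.* a) two₂)

  E-div : ∀ s → ((+ 2) ^ᶻ s) ≡ᶻ 1ℤ [ p₁ ] → ((+ 2) ^ᶻ s) ≡ᶻ 1ℤ [ p₂ ] → E ℕD.∣ s
  E-div s k₁ k₂ = ℕD.m%n≡0⇒n∣m s E zero-rem
    where
    instance nzE : NonZero E
             nzE = ℕ.>-nonZero E>0
    r = s ℕ.% E
    q = s ℕ./ E
    red : ∀ {p} → ((+ 2) ^ᶻ E) ≡ᶻ 1ℤ [ p ] → ((+ 2) ^ᶻ s) ≡ᶻ 1ℤ [ p ] → ((+ 2) ^ᶻ r) ≡ᶻ 1ℤ [ p ]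
    red {p} hE hs = IK.≡-trans {x = (+ 2) ^ᶻ r} {y = (+ 2) ^ᶻ s} {z = 1ℤ} (IK.≡-sym {x = (+ 2) ^ᶻ s} {(+ 2) ^ᶻ r} (≡.subst₂ (λ u vt → u ≡ᶻ vt [ p ]) (≡.sym (≡.trans (cong ((+ 2) ^ᶻ_) (DM.m≡m%n+[m/n]*n s E)) (≡.trans (IK.^-homo-* (+ 2) r (q ℕ.* E)) (cong (λ z → (+ 2) ^ᶻ r ℤ.* z) (≡.trans (cong ((+ 2) ^ᶻ_) (ℕP.*-comm q E)) (≡.sym (2^* E q))))))) (ℤP.*-identityʳ _)
        (IK.≡-* {x = (+ 2) ^ᶻ r} {(+ 2) ^ᶻ r} {((+ 2) ^ᶻ E) ^ᶻ q} {1ℤ} (IK.≡-refl {x = (+ 2) ^ᶻ r}) (≡ᶻ-pow {(+ 2) ^ᶻ E} {p} q hE)))) hs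
    zero-rem : r ≡ 0
    zero-rem with r ℕ.≟ 0
    ... | yes e = e
    ... | no ne = ⊥-elim (ℕP.<⇒≱ (DM.m%n<n s E) (E-min r (ℕP.n≢0⇒n>0 ne) (red {p₁} E₁ k₁) (red {p₂} E₂ k₂)))

  -- An even d would make -1 a square modulo p₁. For odd d the square of 2^d is 1 modulo both
  -- primes, so E divides 2d; but 4 divides E.
  no-neg : ∀ d → ((+ 2) ^ᶻ d) ≡ᶻ (ℤ.- 1ℤ) [ p₁ ] → ((+ 2) ^ᶻ d) ≡ᶻ (ℤ.- 1ℤ) [ p₂ ] → ⊥
  no-neg d k₁ k₂ with parity d
  ... | inj₁ (k , ≡.refl) = nr₁-1 ((+ 2) ^ᶻ k) (≡.subst (λ z → z ≡ᶻ (ℤ.- 1ℤ) [ p₁ ]) (IK.^-homo-* (+ 2) k k) k₁)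
  ... | inj₂ (k , ≡.refl) = odd≢ (E-div (dd ℕ.+ dd) (dbl {p₁} k₁) (dbl {p₂} k₂))
    where
    dd = suc (k ℕ.+ k)
    dbl : ∀ {p} → ((+ 2) ^ᶻ dd) ≡ᶻ (ℤ.- 1ℤ) [ p ] → ((+ 2) ^ᶻ (dd ℕ.+ dd)) ≡ᶻ 1ℤ [ p ]
    dbl {p} h = ≡.subst (λ z → z ≡ᶻ 1ℤ [ p ]) (≡.sym (IK.^-homo-* (+ 2) dd dd)) (IK.≡-* {x = (+ 2) ^ᶻ dd} {ℤ.- 1ℤ} {(+ 2) ^ᶻ dd} {ℤ.- 1ℤ} h h)
    odd≢ : E ℕD.∣ dd ℕ.+ dd → ⊥
    odd≢ dv = par (ℕD.quotient 4∣) (ℕD._∣_.equality 4∣)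
      where
      4∣ : 4 ℕD.∣ dd ℕ.+ dd
      4∣ = ℕD.∣-trans (ℕD.∣m⇒∣m*n (1 ℕ.+ 4 ℕ.* a) (ℕD.m∣m*n {4} b)) dv
      par : ∀ q → suc (k ℕ.+ k) ℕ.+ suc (k ℕ.+ k) ≡ q ℕ.* 4 → ⊥
      par q e = contr (cong (ℕ._% 4) e)
        where
        contr : (suc (k ℕ.+ k) ℕ.+ suc (k ℕ.+ k)) ℕ.% 4 ≡ (q ℕ.* 4) ℕ.% 4 → ⊥
        contr e' with ≡.trans (≡.sym (≡.trans (cong (ℕ._% 4) (S'.solve 1 (λ k → (S'.con 1 S'.:+ (k S'.:+ k)) S'.:+ (S'.con 1 S'.:+ (k S'.:+ k)) S'.:= S'.con 2 S'.:+ k S'.:* S'.con 4) ≡.refl k)) (DM.[m+kn]%n≡m%n 2 k 4))) (≡.trans e' (DM.m*n%n≡0 q 4))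
        ... | ()

  -- The square of 2^(2b) is 1 modulo p₂. Were the power itself 1, then E/2 would already be an
  -- exponent of 2 modulo both primes, against `E-min`.
  half : ((+ 2) ^ᶻ (2 ℕ.* b)) ≡ᶻ (ℤ.- 1ℤ) [ p₂ ]
  half = concl (M₂.euclid (x ℤ.- 1ℤ) (x ℤ.- (ℤ.- 1ℤ)) (IK.∣-resp {x = (+ 2) ^ᶻ h₂ ℤ.- 1ℤ} (≡.trans (cong (ℤ._- 1ℤ) sq) (IK.solve 1 (λ x → x IK.:* x IK.:- IK.con 1ℤ IK.:= (x IK.:- IK.con 1ℤ) IK.:* (x IK.:- (IK.:- IK.con 1ℤ))) ≡.refl x)) two₂))
    where
    x = (+ 2) ^ᶻ (2 ℕ.* b)
    sq : (+ 2) ^ᶻ h₂ ≡ x ℤ.* x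
    sq = ≡.trans (cong ((+ 2) ^ᶻ_) (S'.solve 1 (λ b → S'.con 4 S'.:* b S'.:= S'.con 2 S'.:* b S'.:+ S'.con 2 S'.:* b) ≡.refl b)) (IK.^-homo-* (+ 2) (2 ℕ.* b) (2 ℕ.* b))
    concl : ((+ p₂) ∣ℤ (x ℤ.- 1ℤ)) ⊎ ((+ p₂) ∣ℤ (x ℤ.- (ℤ.- 1ℤ))) → x ≡ᶻ (ℤ.- 1ℤ) [ p₂ ]
    concl (inj₂ h) = h
    concl (inj₁ h) = ⊥-elim (ℕP.<⇒≱ lt (E-min K K>0 (≡.subst (λ k → ((+ 2) ^ᶻ k) ≡ᶻ 1ℤ [ p₁ ]) (S'.solve 2 (λ a b → (S'.con 2 S'.:+ S'.con 8 S'.:* a) S'.:* b S'.:= S'.con 2 S'.:* b S'.:* (S'.con 1 S'.:+ S'.con 4 S'.:* a)) ≡.refl a b) (two₁ b))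
         (≡.subst (λ z → z ≡ᶻ 1ℤ [ p₂ ]) (2^* (2 ℕ.* b) (1 ℕ.+ 4 ℕ.* a)) (≡ᶻ-pow {x} {p₂} (1 ℕ.+ 4 ℕ.* a) h))))
      where
      K = 2 ℕ.* b ℕ.* (1 ℕ.+ 4 ℕ.* a)
      K>0 : 0 < K
      K>0 = ℕP.*-mono-≤ (ℕP.*-mono-≤ {1} {2} (s≤s z≤n) b>0) (s≤s z≤n)
      E2 : E ≡ K ℕ.+ K
      E2 = S'.solve 2 (λ a b → S'.con 4 S'.:* b S'.:* (S'.con 1 S'.:+ S'.con 4 S'.:* a) S'.:= S'.con 2 S'.:* b S'.:* (S'.con 1 S'.:+ S'.con 4 S'.:* a) S'.:+ S'.con 2 S'.:* b S'.:* (S'.con 1 S'.:+ S'.con 4 S'.:* a)) ≡.refl a b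
      lt : K < E
      lt = ≡.subst (K <_) (≡.sym E2) (ℕP.m<m+n K K>0)

  abstract
    -- An explicit solution of τ ≡ 1 modulo p₁ and τ ≡ p₁ modulo p₂, by Fermat. On the field fixed
    -- by σ₂ it will generate the Galois group, because p₁ is a non-residue modulo p₂ while 2 and -1
    -- are residues.
    τ : ℕ
    τ = 1 ℕ.+ (p₁ ∸ 1) ℕ.* p₁ ℕ.^ (p₂ ∸ 1)

    τ≡1 : (+ τ) ≡ᶻ 1ℤ [ p₁ ]
    τ≡1 = fromℕ∣ {p₁} {+ τ ℤ.- 1ℤ} (go (p₂ ∸ 1) (ℕP.m<n⇒0<n∸m M₂.p>1))
      where
      go : ∀ k → 0 < k → p₁ ℕD.∣ (p₁ ∸ 1) ℕ.* p₁ ℕ.^ k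
      go (suc k) _ = ℕD.∣n⇒∣m*n (p₁ ∸ 1) (ℕD.m∣m*n _)

    τ≡p₁ : (+ τ) ≡ᶻ (+ p₁) [ p₂ ]
    τ≡p₁ = ≡.subst₂ (λ u vt → u ≡ᶻ vt [ p₂ ]) (≡.sym tz) pz (IK.≡-+ {x = 1ℤ} {1ℤ} {(+ (p₁ ∸ 1)) ℤ.* (+ p₁) ^ᶻ (p₂ ∸ 1)} {(+ (p₁ ∸ 1)) ℤ.* 1ℤ} (IK.≡-refl {x = 1ℤ})
          (IK.≡-* {x = + (p₁ ∸ 1)} {+ (p₁ ∸ 1)} {(+ p₁) ^ᶻ (p₂ ∸ 1)} {1ℤ} (IK.≡-refl {x = + (p₁ ∸ 1)}) (M₂.fermat₁ (+ p₁) (λ d → p₁≢p₂ (≡.sym (prime∣prime pr₂ pr₁ (toℕ∣ {p₂} {+ p₁} d)))))))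
      where
      tz : + τ ≡ 1ℤ ℤ.+ (+ (p₁ ∸ 1)) ℤ.* (+ p₁) ^ᶻ (p₂ ∸ 1)
      tz = cong (λ z → 1ℤ ℤ.+ z) (≡.trans (ℤP.pos-* (p₁ ∸ 1) _) (cong (λ z → + (p₁ ∸ 1) ℤ.* z) (pos-^ p₁ (p₂ ∸ 1))))
      pz : 1ℤ ℤ.+ (+ (p₁ ∸ 1)) ℤ.* 1ℤ ≡ + p₁
      pz = ≡.trans (cong (λ z → 1ℤ ℤ.+ z) (ℤP.*-identityʳ (+ (p₁ ∸ 1)))) (cong +_ (ℕP.m+[n∸m]≡n {1} (ℕP.<⇒≤ M₁.p>1)))

  uτ : Unit τ
  uτ = mkUnit τ (λ d → M₁.p∤1 (M₁.∣-cong {+ τ} {1ℤ} τ≡1 (fromℕ∣ {p₁} {+ τ} d))) (λ d → p₁≢p₂ (≡.sym (prime∣prime pr₂ pr₁ (toℕ∣ {p₂} {+ p₁} (M₂.∣-cong {+ τ} {+ p₁} τ≡p₁ (fromℕ∣ {p₂} {+ τ} d))))))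

  ≡ᶻ⇒% : ∀ {m} x y → .{{_ : NonZero m}} → (+ x) ≡ᶻ (+ y) [ m ] → x ℕ.% m ≡ y ℕ.% m
  ≡ᶻ⇒% {m} x y h with ℕP.≤-total x y
  ... | inj₁ le = ≡.sym (≡.trans (cong (ℕ._% m) (≡.sym (ℕP.m+[n∸m]≡n le))) (≡.trans (cong (λ z → (x ℕ.+ z) ℕ.% m) (ℕD._∣_.equality dv)) (DM.[m+kn]%n≡m%n x (ℕD.quotient dv) m)))
    where dv : m ℕD.∣ y ∸ x
          dv = toℕ∣ {m} {+ (y ∸ x)} (≡.subst (λ z → (+ m) ∣ℤ z) (≡.trans (ℤP.m-n≡m⊖n y x) (ℤP.⊖-≥ le)) (IK.≡-sym {x = + x} {+ y} h))
  ... | inj₂ le = ≡.trans (cong (ℕ._% m) (≡.sym (ℕP.m+[n∸m]≡n le))) (≡.trans (cong (λ z → (y ℕ.+ z) ℕ.% m) (ℕD._∣_.equality dv)) (DM.[m+kn]%n≡m%n y (ℕD.quotient dv) m))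
    where dv : m ℕD.∣ x ∸ y
          dv = toℕ∣ {m} {+ (x ∸ y)} (≡.subst (λ z → (+ m) ∣ℤ z) (≡.trans (ℤP.m-n≡m⊖n x y) (ℤP.⊖-≥ le)) h)

  τS₂ : σ τ S₂ ≈ - S₂
  τS₂ = S₂-anti uτ (≡ᶻ⇒% {p₂} τ p₁ τ≡p₁)

  ucancel : ∀ {t} → Unit t → ∀ x y → ((+ t) ℤ.* x) ≡ᶻ ((+ t) ℤ.* y) [ N ] → x ≡ᶻ y [ N ]
  ucancel {t} (unit t' k e) x y h = IK.∣-resp {x = (+ t') ℤ.* ((+ t) ℤ.* x ℤ.- (+ t) ℤ.* y) ℤ.- (+ N) ℤ.* ((+ k) ℤ.* (x ℤ.- y))}
     (≡.trans (cong (λ z → (+ t') ℤ.* ((+ t) ℤ.* x ℤ.- (+ t) ℤ.* y) ℤ.- z) (IK.solve 3 (λ n k d → n IK.:* (k IK.:* d) IK.:= (k IK.:* n) IK.:* d) ≡.refl (+ N) (+ k) (x ℤ.- y)))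
       (≡.trans (IK.solve 5 (λ t t' x y kn → t' IK.:* (t IK.:* x IK.:- t IK.:* y) IK.:- kn IK.:* (x IK.:- y) IK.:= (t IK.:* t' IK.:- kn) IK.:* (x IK.:- y)) ≡.refl (+ t) (+ t') x y ((+ k) ℤ.* (+ N)))
       (≡.trans (cong (ℤ._* (x ℤ.- y)) one) (ℤP.*-identityˡ (x ℤ.- y)))))
     (IK.∣-- (IK.∣-*ˡ (+ t') h) (IK.∣-*ʳ ((+ k) ℤ.* (x ℤ.- y)) (IK.∣-refl {+ N})))
    where
    one : (+ t) ℤ.* (+ t') ℤ.- (+ k) ℤ.* (+ N) ≡ 1ℤ
    one = ≡.trans (cong₂ ℤ._-_ (≡.trans (≡.sym (ℤP.pos-* t t')) (≡.trans (cong +_ e) (cong (λ z → 1ℤ ℤ.+ z) (ℤP.pos-* k N)))) ≡.refl) (IK.solve 1 (λ z → (IK.con 1ℤ IK.:+ z) IK.:- z IK.:= IK.con 1ℤ) ≡.refl ((+ k) ℤ.* (+ N)))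

  u2^ : ∀ s → Unit (2 ℕ.^ s)
  u2^ s = unit-^ u2 s

  kf1 : ∀ s s' → ¬ (((+ 2) ^ᶻ s ℤ.+ (+ 2) ^ᶻ s') ≡ᶻ 0ℤ [ N ])
  kf1 s s' h with ℕP.≤-total s s'
  ... | inj₁ le = no-neg d (≡ᶻ-down {x = (+ 2) ^ᶻ d} {ℤ.- 1ℤ} p₁∣N c) (≡ᶻ-down {x = (+ 2) ^ᶻ d} {ℤ.- 1ℤ} p₂∣N c)
    where
    d = s' ∸ s
    c : ((+ 2) ^ᶻ d) ≡ᶻ (ℤ.- 1ℤ) [ N ]
    c = ucancel (u2^ s) ((+ 2) ^ᶻ d) (ℤ.- 1ℤ) (IK.∣-resp {x = ((+ 2) ^ᶻ s ℤ.+ (+ 2) ^ᶻ s') ℤ.- 0ℤ} (≡.trans (cong (λ z → ((+ 2) ^ᶻ s ℤ.+ z) ℤ.- 0ℤ) (≡.trans (cong ((+ 2) ^ᶻ_) (≡.sym (ℕP.m+[n∸m]≡n le))) (IK.^-homo-* (+ 2) s d)))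
        (≡.trans (IK.solve 2 (λ p q → (p IK.:+ p IK.:* q) IK.:- IK.con 0ℤ IK.:= p IK.:* q IK.:- p IK.:* (IK.:- IK.con 1ℤ)) ≡.refl ((+ 2) ^ᶻ s) ((+ 2) ^ᶻ d)) (cong (λ z → z ℤ.* (+ 2) ^ᶻ d ℤ.- z ℤ.* (ℤ.- 1ℤ)) (≡.sym (pos-^ 2 s))))) h)
  ... | inj₂ le = kf1' 
    where
    d = s ∸ s'
    c : ((+ 2) ^ᶻ d) ≡ᶻ (ℤ.- 1ℤ) [ N ]
    c = ucancel (u2^ s') ((+ 2) ^ᶻ d) (ℤ.- 1ℤ) (IK.∣-resp {x = ((+ 2) ^ᶻ s ℤ.+ (+ 2) ^ᶻ s') ℤ.- 0ℤ} (≡.trans (cong (λ z → (z ℤ.+ (+ 2) ^ᶻ s') ℤ.- 0ℤ) (≡.trans (cong ((+ 2) ^ᶻ_) (≡.sym (ℕP.m+[n∸m]≡n le))) (IK.^-homo-* (+ 2) s' d)))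
        (≡.trans (IK.solve 2 (λ p q → (p IK.:* q IK.:+ p) IK.:- IK.con 0ℤ IK.:= p IK.:* q IK.:- p IK.:* (IK.:- IK.con 1ℤ)) ≡.refl ((+ 2) ^ᶻ s') ((+ 2) ^ᶻ d)) (cong (λ z → z ℤ.* (+ 2) ^ᶻ d ℤ.- z ℤ.* (ℤ.- 1ℤ)) (≡.sym (pos-^ 2 s'))))) h)
    kf1' : ⊥
    kf1' = no-neg d (≡ᶻ-down {x = (+ 2) ^ᶻ d} {ℤ.- 1ℤ} p₁∣N c) (≡ᶻ-down {x = (+ 2) ^ᶻ d} {ℤ.- 1ℤ} p₂∣N c)

  N'≡ᶻ : (+ N') ≡ᶻ (ℤ.- 1ℤ) [ N ]
  N'≡ᶻ = IK.divs 1ℤ (≡.trans (ℤP.+-comm (+ N') 1ℤ) (≡.sym (ℤP.*-identityʳ (+ N))))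

  neg≡ : ∀ x y → x ≡ᶻ ((+ N') ℤ.* y) [ N ] → x ≡ᶻ (ℤ.- y) [ N ]
  neg≡ x y h = IK.≡-trans {x = x} {y = (+ N') ℤ.* y} {z = ℤ.- y} h (≡.subst (λ z → ((+ N') ℤ.* y) ≡ᶻ z [ N ]) (ℤP.-1*i≡-i y) (IK.≡-* {x = + N'} {ℤ.- 1ℤ} {y} {y} N'≡ᶻ (IK.≡-refl {x = y})))

  pm-clash : ∀ s s' → ¬ (((+ 2) ^ᶻ s) ≡ᶻ ((+ N') ℤ.* (+ 2) ^ᶻ s') [ N ])
  pm-clash s s' h = kf1 s s' (IK.∣-resp {x = (+ 2) ^ᶻ s ℤ.- (ℤ.- ((+ 2) ^ᶻ s'))} (IK.solve 2 (λ x y → x IK.:- (IK.:- y) IK.:= (x IK.:+ y) IK.:- IK.con 0ℤ) ≡.refl ((+ 2) ^ᶻ s) ((+ 2) ^ᶻ s')) (neg≡ ((+ 2) ^ᶻ s) ((+ 2) ^ᶻ s') h))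

  τ→p₁ : ∀ s y → ((+ τ) ℤ.* (+ 2) ^ᶻ s) ≡ᶻ y [ p₂ ] → ((+ p₁) ℤ.* (+ 2) ^ᶻ s) ≡ᶻ y [ p₂ ]
  τ→p₁ s y h = IK.≡-trans {x = (+ p₁) ℤ.* (+ 2) ^ᶻ s} {y = (+ τ) ℤ.* (+ 2) ^ᶻ s} {z = y} (IK.≡-* {x = + p₁} {+ τ} {(+ 2) ^ᶻ s} {(+ 2) ^ᶻ s} (IK.≡-sym {x = + τ} {+ p₁} τ≡p₁) (IK.≡-refl {x = (+ 2) ^ᶻ s})) h

  τ+clash : ∀ s s' → ¬ (((+ τ) ℤ.* (+ 2) ^ᶻ s) ≡ᶻ ((+ 2) ^ᶻ s') [ N ])
  τ+clash s s' h = no-sq s s' 1ℤ 1ℤ (IK.≡-refl {x = 1ℤ}) (τ→p₁ s (1ℤ ℤ.* (+ 2) ^ᶻ s') (≡.subst (λ z → ((+ τ) ℤ.* (+ 2) ^ᶻ s) ≡ᶻ z [ p₂ ]) (≡.sym (ℤP.*-identityˡ ((+ 2) ^ᶻ s'))) (≡ᶻ-down {x = (+ τ) ℤ.* (+ 2) ^ᶻ s} {(+ 2) ^ᶻ s'} p₂∣N h)))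

  τ-clash : ∀ s s' → ¬ (((+ τ) ℤ.* (+ 2) ^ᶻ s) ≡ᶻ ((+ N') ℤ.* (+ 2) ^ᶻ s') [ N ])
  τ-clash s s' h = no-sq s s' (ℤ.- 1ℤ) i₂ (proj₂ im) (τ→p₁ s ((ℤ.- 1ℤ) ℤ.* (+ 2) ^ᶻ s') (≡.subst (λ z → ((+ τ) ℤ.* (+ 2) ^ᶻ s) ≡ᶻ z [ p₂ ]) (≡.sym (ℤP.-1*i≡-i ((+ 2) ^ᶻ s'))) (≡ᶻ-down {x = (+ τ) ℤ.* (+ 2) ^ᶻ s} {ℤ.- ((+ 2) ^ᶻ s')} p₂∣N (neg≡ ((+ τ) ℤ.* (+ 2) ^ᶻ s) ((+ 2) ^ᶻ s') h))))

  vt : ℕ → ℕ → ℕ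
  vt t s = (t ℕ.* 2 ℕ.^ s) ℕ.% N

  Lt : ℕ → List ℕ
  Lt t = applyUpTo (vt t) f

  v⇒ : ∀ t s t' s' → vt t s ≡ vt t' s' → ((+ t) ℤ.* (+ 2) ^ᶻ s) ≡ᶻ ((+ t') ℤ.* (+ 2) ^ᶻ s') [ N ]
  v⇒ t s t' s' e = ≡.subst₂ (λ x y → x ≡ᶻ y [ N ]) (ps t s) (ps t' s') (mod⇒≡ {N} {t ℕ.* 2 ℕ.^ s} {t' ℕ.* 2 ℕ.^ s'} e)
    where
    ps : ∀ t s → + (t ℕ.* 2 ℕ.^ s) ≡ (+ t) ℤ.* (+ 2) ^ᶻ s
    ps t s = ≡.trans (ℤP.pos-* t _) (cong (λ z → + t ℤ.* z) (pos-^ 2 s))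

  uniq : ∀ {t} → Unit t → Unique (Lt t)
  uniq {t} ut = APP.applyUpTo⁺₁ (vt t) f λ {i} {j} i<j j<f e →
    ℕP.<⇒≱ (ℕP.≤-<-trans (ℕP.m∸n≤m j i) j<f) (f-min (j ∸ i) (ℕP.m<n⇒0<n∸m i<j) (IK.≡-sym {x = 1ℤ} {y = (+ 2) ^ᶻ (j ∸ i)}
      (ucancel (u2^ i) 1ℤ ((+ 2) ^ᶻ (j ∸ i)) (≡.subst₂ (λ x y → x ≡ᶻ y [ N ]) (≡.trans (≡.sym (pos-^ 2 i)) (≡.sym (ℤP.*-identityʳ _))) (≡.trans (cong ((+ 2) ^ᶻ_) (≡.sym (ℕP.m+[n∸m]≡n (ℕP.<⇒≤ i<j)))) (≡.trans (IK.^-homo-* (+ 2) i (j ∸ i)) (cong (λ z → z ℤ.* (+ 2) ^ᶻ (j ∸ i)) (≡.sym (pos-^ 2 i)))))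
        (ucancel ut ((+ 2) ^ᶻ i) ((+ 2) ^ᶻ j) (v⇒ t i t j e))))))

  disj : ∀ t t' → (∀ s s' → ¬ (((+ t) ℤ.* (+ 2) ^ᶻ s) ≡ᶻ ((+ t') ℤ.* (+ 2) ^ᶻ s') [ N ])) → ∀ {z} → z ∈ Lt t × z ∈ Lt t' → ⊥
  disj t t' h (m , m') with ∈-applyUpTo⁻ (vt t) m | ∈-applyUpTo⁻ (vt t') m'
  ... | s , _ , e | s' , _ , e' = h s s' (v⇒ t s t' s' (≡.trans (≡.sym e) e'))

  one* : ∀ x → (+ 1) ℤ.* x ≡ x
  one* x = ℤP.*-identityˡ x

  -- The cosets ⟨2⟩, -⟨2⟩, τ⟨2⟩ and -τ⟨2⟩. They are disjoint because -1 is no power of 2 modulo N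
  -- and τ is a non-residue modulo p₂; having 4f = φ(N) elements together, they exhaust the units.
  XL : List ℕ
  XL = (Lt 1 ++ Lt N') ++ (Lt τ ++ Lt (N' ℕ.* τ))

  uN'τ : Unit (N' ℕ.* τ)
  uN'τ = unit-* {N} {N'} {τ} unit-N' uτ

  uniqX : Unique XL
  uniqX = UP.++⁺ (UP.++⁺ (uniq unit-1) (uniq unit-N') (disj 1 N' (λ s s' h → pm-clash s s' (≡.subst (λ z → z ≡ᶻ ((+ N') ℤ.* (+ 2) ^ᶻ s') [ N ]) (one* ((+ 2) ^ᶻ s)) h))))
      (UP.++⁺ (uniq uτ) (uniq uN'τ) (disj τ (N' ℕ.* τ) (λ s s' h → pm-clash s s' (ucancel uτ ((+ 2) ^ᶻ s) ((+ N') ℤ.* (+ 2) ^ᶻ s') (≡.subst (λ z → ((+ τ) ℤ.* (+ 2) ^ᶻ s) ≡ᶻ z [ N ]) (nt ((+ 2) ^ᶻ s')) h)))))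
      both
    where
    nt : ∀ x → + (N' ℕ.* τ) ℤ.* x ≡ (+ τ) ℤ.* ((+ N') ℤ.* x)
    nt x = ≡.trans (cong (ℤ._* x) (ℤP.pos-* N' τ)) (IK.solve 3 (λ n t x → (n IK.:* t) IK.:* x IK.:= t IK.:* (n IK.:* x)) ≡.refl (+ N') (+ τ) x)
    nt' : ∀ x → + (N' ℕ.* τ) ℤ.* x ≡ (+ N') ℤ.* ((+ τ) ℤ.* x)
    nt' x = ≡.trans (cong (ℤ._* x) (ℤP.pos-* N' τ)) (ℤP.*-assoc (+ N') (+ τ) x)
    sy : ∀ {x y} → x ≡ᶻ y [ N ] → y ≡ᶻ x [ N ]
    sy {x} {y} = IK.≡-sym {x = x} {y}
    both : ∀ {z} → z ∈ (Lt 1 ++ Lt N') × z ∈ (Lt τ ++ Lt (N' ℕ.* τ)) → ⊥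
    both {z} (m , m') with ∈-++⁻ (Lt 1) m | ∈-++⁻ (Lt τ) m'
    ... | inj₁ x | inj₁ y = disj 1 τ (λ s s' h → τ+clash s' s (≡.subst (λ z → ((+ τ) ℤ.* (+ 2) ^ᶻ s') ≡ᶻ z [ N ]) (one* ((+ 2) ^ᶻ s)) (sy {(+ 1) ℤ.* (+ 2) ^ᶻ s} {(+ τ) ℤ.* (+ 2) ^ᶻ s'} h))) (x , y)
    ... | inj₂ x | inj₁ y = disj N' τ (λ s s' h → τ-clash s' s (sy {(+ N') ℤ.* (+ 2) ^ᶻ s} {(+ τ) ℤ.* (+ 2) ^ᶻ s'} h)) (x , y)
    ... | inj₂ x | inj₂ y = disj N' (N' ℕ.* τ) (λ s s' h → τ+clash s' s (sy {(+ 2) ^ᶻ s} {(+ τ) ℤ.* (+ 2) ^ᶻ s'} (ucancel unit-N' ((+ 2) ^ᶻ s) ((+ τ) ℤ.* (+ 2) ^ᶻ s') (≡.subst (λ z → ((+ N') ℤ.* (+ 2) ^ᶻ s) ≡ᶻ z [ N ]) (nt' ((+ 2) ^ᶻ s')) h)))) (x , y)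
    ... | inj₁ x | inj₂ y = disj 1 (N' ℕ.* τ) (λ s s' h → τ-clash s' s (flip' s s' (≡.subst₂ (λ u w → u ≡ᶻ w [ N ]) (one* ((+ 2) ^ᶻ s)) (nt' ((+ 2) ^ᶻ s')) h))) (x , y)
      where
      flip' : ∀ s s' → ((+ 2) ^ᶻ s) ≡ᶻ ((+ N') ℤ.* ((+ τ) ℤ.* (+ 2) ^ᶻ s')) [ N ] → ((+ τ) ℤ.* (+ 2) ^ᶻ s') ≡ᶻ ((+ N') ℤ.* (+ 2) ^ᶻ s) [ N ]
      flip' s s' h = IK.∣-resp {x = (x' ℤ.- (ℤ.- y')) ℤ.- (+ N') ℤ.* x' ℤ.+ (ℤ.- 1ℤ) ℤ.* x'} (IK.solve 3 (λ x y n → (x IK.:- (IK.:- y)) IK.:- n IK.:* x IK.:+ (IK.:- IK.con 1ℤ) IK.:* x IK.:= y IK.:- n IK.:* x) ≡.refl x' y' (+ N'))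
           (≡.subst ((+ N) ∣ℤ_) (IK.solve 3 (λ x y n → (x IK.:- (IK.:- y)) IK.:- (n IK.:- (IK.:- IK.con 1ℤ)) IK.:* x IK.:= (x IK.:- (IK.:- y)) IK.:- n IK.:* x IK.:+ (IK.:- IK.con 1ℤ) IK.:* x) ≡.refl x' y' (+ N')) (IK.∣-- (neg≡ x' y' h) (IK.∣-*ʳ x' N'≡ᶻ)))
        where x' = (+ 2) ^ᶻ s
              y' = (+ τ) ℤ.* (+ 2) ^ᶻ s'

  unit∤ : ∀ {p t} → Prime p → p ℕD.∣ N → Unit t → ¬ (p ℕD.∣ t)
  unit∤ {p} {t} pr pN (unit t' k e) d = p∤1 pr (ℕD.∣m+n∣m⇒∣n {p} {k ℕ.* N} (≡.subst (p ℕD.∣_) (≡.trans e (ℕP.+-comm 1 _)) (ℕD.∣m⇒∣m*n t' d)) (ℕD.∣n⇒∣m*n k pN))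

  memUL : ∀ x → Unit x → x ℕ.% N ∈ UL
  memUL x ux = go (x ℕ.% N) ≡.refl
    where
    nd : ∀ {p} → Prime p → p ℕD.∣ N → ¬ (p ℕD.∣ x ℕ.% N)
    nd pr pN d = unit∤ pr pN ux (ℕD.∣n∣m%n⇒∣m pN d)
    go : ∀ r → x ℕ.% N ≡ r → x ℕ.% N ∈ UL
    go zero e = ⊥-elim (nd pr₁ p₁∣N (≡.subst (p₁ ℕD.∣_) (≡.sym e) (p₁ ℕD.∣0)))
    go (suc r) e = ≡.subst (_∈ UL) (≡.sym e) (∈UL r (ℕP.<⇒≤ (≡.subst (_< N) e (DM.m%n<n x N))) (≡.subst (λ z → ¬ (p₁ ℕD.∣ z)) e (nd pr₁ p₁∣N)) (≡.subst (λ z → ¬ (p₂ ℕD.∣ z)) e (nd pr₂ p₂∣N)))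

  subX : ∀ z → z ∈ XL → z ∈ UL
  subX z m with ∈-++⁻ (Lt 1 ++ Lt N') m
  ... | inj₁ m' with ∈-++⁻ (Lt 1) m'
  ... | inj₁ q = inL unit-1 q
    where inL : ∀ {t} → Unit t → z ∈ Lt t → z ∈ UL
          inL {t} ut q with ∈-applyUpTo⁻ (vt t) q
          ... | s , _ , e = ≡.subst (_∈ UL) (≡.sym e) (memUL (t ℕ.* 2 ℕ.^ s) (unit-* ut (u2^ s)))
  ... | inj₂ q with ∈-applyUpTo⁻ (vt N') q
  ... | s , _ , e = ≡.subst (_∈ UL) (≡.sym e) (memUL (N' ℕ.* 2 ℕ.^ s) (unit-* {N} {N'} {2 ℕ.^ s} unit-N' (u2^ s)))
  subX z m | inj₂ m' with ∈-++⁻ (Lt τ) m'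
  ... | inj₁ q with ∈-applyUpTo⁻ (vt τ) q
  ... | s , _ , e = ≡.subst (_∈ UL) (≡.sym e) (memUL (τ ℕ.* 2 ℕ.^ s) (unit-* {N} {τ} {2 ℕ.^ s} uτ (u2^ s)))
  subX z m | inj₂ m' | inj₂ q with ∈-applyUpTo⁻ (vt (N' ℕ.* τ)) q
  ... | s , _ , e = ≡.subst (_∈ UL) (≡.sym e) (memUL (N' ℕ.* τ ℕ.* 2 ℕ.^ s) (unit-* {N} {N' ℕ.* τ} {2 ℕ.^ s} uN'τ (u2^ s)))

  abstract
    perm : XL ↭ UL
    perm = unique-↭ XL UL uniqX subX (ℕP.≤-reflexive (≡.trans (≡.trans UL-length φ≡) (≡.trans (cong (4 ℕ.*_) (≡.sym f≡)) (≡.sym lenX))))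
      where
      lenX : length XL ≡ 4 ℕ.* f
      lenX = ≡.trans (LP.length-++ (Lt 1 ++ Lt N')) (≡.trans (cong₂ ℕ._+_ (≡.trans (LP.length-++ (Lt 1)) (cong₂ ℕ._+_ (LP.length-applyUpTo (vt 1) f) (LP.length-applyUpTo (vt N') f))) (≡.trans (LP.length-++ (Lt τ)) (cong₂ ℕ._+_ (LP.length-applyUpTo (vt τ) f) (LP.length-applyUpTo (vt (N' ℕ.* τ)) f))))
          (S'.solve 1 (λ f → (f S'.:+ f) S'.:+ (f S'.:+ f) S'.:= S'.con 4 S'.:* f) ≡.refl f))

  -- The decomposition ring of 2

  O : Carrier → Set
  O w = σ 2 w ≈ w

  O^ : ∀ {w} → O w → ∀ s → σ (2 ℕ.^ s) w ≈ w
  O^ o zero = σ-id _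
  O^ {w} o (suc s) = trans (sym (σ-σ u2 (u2^ s) w)) (trans (σ-cong u2 (O^ o s)) o)

  ζ% : ∀ x → ζ ^ (x ℕ.% N) ≈ ζ ^ x
  ζ% x = sym (ζ-mod x (x ℕ.% N) (x ℕ./ N) (DM.m≡m%n+[m/n]*n x N))

  Lt-sum : ∀ {t} → Unit t → ∀ {w} → O w → ∑ (Lt t) (λ a → ev (ζ ^ a) (rep w)) ≈ c# f * σ t w
  Lt-sum {t} ut {w} o = trans (∑-applyUpTo (vt t) f _) (trans (∑<-cong f (λ s _ → trans (ev-resp (rep w) (ζ% (t ℕ.* 2 ℕ.^ s))) (trans (sym (σ-rep (unit-* ut (u2^ s)) w)) (trans (sym (σ-σ ut (u2^ s) w)) (σ-cong ut (O^ o s)))))) (∑<-const f (σ t w)))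

  -- Along each coset of ⟨2⟩ the conjugates of w agree, so the integral sum over all units is f
  -- times this trace, and `int` divides by f.
  Tr-int : ∀ {w} → O w → IsInt ((w + w ̄) + (σ τ w + σ τ (w ̄)))
  Tr-int {w} o = IK.quo dv , c#-cancel f f>0 (trans tot (trans (ι-cong (IK.eq dv)) (ι-* (+ f) _)))
    where
    ti = trace-int w
    n = proj₁ ti
    tot : c# f * ((w + w ̄) + (σ τ w + σ τ (w ̄))) ≈ ι n
    tot = trans (solve 5 (λ f a b c d → f :* ((a :+ b) :+ (c :+ d)) := (f :* a :+ f :* b) :+ (f :* c :+ f :* d)) refl (c# f) w (w ̄) (σ τ w) (σ τ (w ̄)))
      (trans (+-cong (+-cong (*-congˡ (sym (σ-id w))) refl) (+-congˡ (*-congˡ (trans (σ-comm uτ unit-N' w) (σ-σ unit-N' uτ w)))))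
      (trans (sym (+-cong (+-cong (Lt-sum unit-1 o) (Lt-sum unit-N' o)) (+-cong (Lt-sum uτ o) (Lt-sum uN'τ o))))
      (trans (sym (trans (∑-++ (Lt 1 ++ Lt N') (Lt τ ++ Lt (N' ℕ.* τ)) F) (+-cong (∑-++ (Lt 1) (Lt N') F) (∑-++ (Lt τ) (Lt (N' ℕ.* τ)) F))))
      (trans (∑-↭ F perm) (proj₂ ti)))))
      where F : ℕ → Carrier
            F a = ev (ζ ^ a) (rep w)
    dv : (+ f) ∣ℤ n
    dv = int (+ f) _ n tot

  -- The coset of τ² is found by exclusion. In ±τ⟨2⟩ it would put τ into ±⟨2⟩. If τ² = 2^s, an odd s
  -- makes 2^s ≡ 1 modulo p₁, which `even₁` forbids, and an even s makes τ ≡ ±2^(s/2) modulo p₂, a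
  -- residue. What remains is -⟨2⟩.
  τ²-in : (τ ℕ.* τ) ℕ.% N ∈ XL → ∃ λ s → ζ ^ (τ ℕ.* τ) ≈ ζ ^ (N' ℕ.* 2 ℕ.^ s)
  τ²-in m₀ with ∈-++⁻ (Lt 1 ++ Lt N') m₀
  ... | inj₂ m = ⊥-elim (bad (∈-++⁻ (Lt τ) m))
    where
    ττ : ∀ t s → (τ ℕ.* τ) ℕ.% N ≡ vt t s → ((+ τ) ℤ.* (+ τ)) ≡ᶻ ((+ t) ℤ.* (+ 2) ^ᶻ s) [ N ]
    ττ t s e = ≡.subst₂ (λ x y → x ≡ᶻ y [ N ]) (ℤP.pos-* τ τ) (≡.trans (ℤP.pos-* t _) (cong (λ z → + t ℤ.* z) (pos-^ 2 s))) (mod⇒≡ {N} {τ ℕ.* τ} {t ℕ.* 2 ℕ.^ s} e)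
    bad : (τ ℕ.* τ) ℕ.% N ∈ Lt τ ⊎ (τ ℕ.* τ) ℕ.% N ∈ Lt (N' ℕ.* τ) → ⊥
    bad (inj₁ q) with ∈-applyUpTo⁻ (vt τ) q
    ... | s , _ , e = τ+clash 0 s (≡.subst (λ z → z ≡ᶻ ((+ 2) ^ᶻ s) [ N ]) (≡.sym (ℤP.*-identityʳ (+ τ))) (ucancel uτ (+ τ) ((+ 2) ^ᶻ s) (ττ τ s e)))
    bad (inj₂ q) with ∈-applyUpTo⁻ (vt (N' ℕ.* τ)) q
    ... | s , _ , e = τ-clash 0 s (≡.subst (λ z → z ≡ᶻ ((+ N') ℤ.* (+ 2) ^ᶻ s) [ N ]) (≡.sym (ℤP.*-identityʳ (+ τ))) (ucancel uτ (+ τ) ((+ N') ℤ.* (+ 2) ^ᶻ s) (≡.subst (λ z → ((+ τ) ℤ.* (+ τ)) ≡ᶻ z [ N ]) (nt ((+ 2) ^ᶻ s)) (ττ (N' ℕ.* τ) s e))))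
      where
      nt : ∀ x → + (N' ℕ.* τ) ℤ.* x ≡ (+ τ) ℤ.* ((+ N') ℤ.* x)
      nt x = ≡.trans (cong (ℤ._* x) (ℤP.pos-* N' τ)) (IK.solve 3 (λ n t x → (n IK.:* t) IK.:* x IK.:= t IK.:* (n IK.:* x)) ≡.refl (+ N') (+ τ) x)
  ... | inj₁ m with ∈-++⁻ (Lt 1) m
  ... | inj₂ q with ∈-applyUpTo⁻ (vt N') q
  ... | s , _ , e = s , trans (sym (ζ% (τ ℕ.* τ))) (trans (^-congʳ ζ e) (ζ% (N' ℕ.* 2 ℕ.^ s)))
  τ²-in m₀ | inj₁ m | inj₁ q with ∈-applyUpTo⁻ (vt 1) q
  ... | s , _ , e = ⊥-elim (bad (parity s) )
    where
    h : ((+ τ) ℤ.* (+ τ)) ≡ᶻ ((+ 2) ^ᶻ s) [ N ]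
    h = ≡.subst₂ (λ x y → x ≡ᶻ y [ N ]) (ℤP.pos-* τ τ) (≡.trans (cong +_ (ℕP.*-identityˡ (2 ℕ.^ s))) (pos-^ 2 s)) (mod⇒≡ {N} {τ ℕ.* τ} {1 ℕ.* 2 ℕ.^ s} e)
    bad : (∃ λ k → s ≡ k ℕ.+ k) ⊎ (∃ λ k → s ≡ suc (k ℕ.+ k)) → ⊥
    bad (inj₂ (k , ≡.refl)) = even₁ k (IK.≡-trans {x = (+ 2) ^ᶻ suc (k ℕ.+ k)} {y = (+ τ) ℤ.* (+ τ)} {z = 1ℤ} (IK.≡-sym {x = (+ τ) ℤ.* (+ τ)} {(+ 2) ^ᶻ suc (k ℕ.+ k)} (≡ᶻ-down {x = (+ τ) ℤ.* (+ τ)} {(+ 2) ^ᶻ suc (k ℕ.+ k)} p₁∣N h)) (IK.≡-* {x = + τ} {1ℤ} {+ τ} {1ℤ} τ≡1 τ≡1))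
    bad (inj₁ (k , ≡.refl)) = concl (M₂.euclid (+ τ ℤ.- x) (+ τ ℤ.+ x) (IK.∣-resp {x = (+ τ) ℤ.* (+ τ) ℤ.- (+ 2) ^ᶻ (k ℕ.+ k)} (≡.trans (cong (λ z → (+ τ) ℤ.* (+ τ) ℤ.- z) (IK.^-homo-* (+ 2) k k)) (IK.solve 2 (λ t x → t IK.:* t IK.:- x IK.:* x IK.:= (t IK.:- x) IK.:* (t IK.:+ x)) ≡.refl (+ τ) x)) (≡ᶻ-down {x = (+ τ) ℤ.* (+ τ)} {(+ 2) ^ᶻ (k ℕ.+ k)} p₂∣N h)))
      where
      x = (+ 2) ^ᶻ k
      concl : ((+ p₂) ∣ℤ (+ τ ℤ.- x)) ⊎ ((+ p₂) ∣ℤ (+ τ ℤ.+ x)) → ⊥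
      concl (inj₁ d) = no-sq 0 k 1ℤ 1ℤ (IK.≡-refl {x = 1ℤ}) (τ→p₁ 0 (1ℤ ℤ.* x) (≡.subst₂ (λ u w → u ≡ᶻ w [ p₂ ]) (≡.sym (ℤP.*-identityʳ (+ τ))) (≡.sym (ℤP.*-identityˡ x)) d))
      concl (inj₂ d) = no-sq 0 k (ℤ.- 1ℤ) i₂ (proj₂ im) (τ→p₁ 0 ((ℤ.- 1ℤ) ℤ.* x) (≡.subst₂ (λ u w → u ≡ᶻ w [ p₂ ]) (≡.sym (ℤP.*-identityʳ (+ τ))) (≡.sym (ℤP.-1*i≡-i x)) (≡.subst ((+ p₂) ∣ℤ_) (cong (λ z → + τ ℤ.+ z) (≡.sym (ℤP.neg-involutive x))) d)))

  τ² : ∃ λ s → ζ ^ (τ ℕ.* τ) ≈ ζ ^ (N' ℕ.* 2 ℕ.^ s)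
  τ² = τ²-in (∈-resp-↭ (↭-sym perm) (memUL (τ ℕ.* τ) (unit-* {N} {τ} {τ} uτ uτ)))

  ττ̄ : ∀ {w} → O w → σ τ (σ τ w) ≈ w ̄
  ττ̄ {w} o = trans (σ-σ uτ uτ w) (trans (σ-mod (unit-* {N} {τ} {τ} uτ uτ) (unit-* {N} {N'} {2 ℕ.^ proj₁ τ²} unit-N' (u2^ (proj₁ τ²))) (proj₂ τ²) w)
     (trans (sym (σ-σ unit-N' (u2^ (proj₁ τ²)) w)) (conj-cong (O^ o (proj₁ τ²)))))

  infix 9 _↑
  _↑ : Carrier → Carrier
  x ↑ = σ τ x

  ↑-cong : ∀ {x gh} → x ≈ gh → x ↑ ≈ gh ↑
  ↑-cong = σ-cong uτ
  ↑-neg : ∀ x → (- x) ↑ ≈ - (x ↑)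
  ↑-neg = σ-neg uτ
  ↑-- : ∀ x gh → (x - gh) ↑ ≈ x ↑ - gh ↑
  ↑-- = σ-- uτ
  ↑̄ : ∀ x → (x ̄) ↑ ≈ (x ↑) ̄
  ↑̄ = σ-comm uτ unit-N'

  O-+ : ∀ {x gh} → O x → O gh → O (x + gh)
  O-+ ox oy = trans (σ-+ 2 _ _) (+-cong ox oy)
  O-* : ∀ {x gh} → O x → O gh → O (x * gh)
  O-* ox oy = trans (σ-* 2 _ _) (*-cong ox oy)
  O-neg : ∀ {x} → O x → O (- x)
  O-neg ox = trans (σ-neg u2 _) (-‿cong ox)
  O-- : ∀ {x gh} → O x → O gh → O (x - gh)
  O-- ox oy = O-+ ox (O-neg oy)
  O-conj : ∀ {x} → O x → O (x ̄)
  O-conj {x} ox = trans (σ-comm u2 unit-N' x) (conj-cong ox)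
  O-↑ : ∀ {x} → O x → O (x ↑)
  O-↑ {x} ox = trans (σ-comm u2 uτ x) (↑-cong ox)
  O-resp : ∀ {x gh} → x ≈ gh → O x → O gh
  O-resp e ox = trans (σ-cong u2 (sym e)) (trans ox e)
  O-tor : ∀ k {x} → 0 < k → O (c# k * x) → O x
  O-tor k {x} 0<k o = c#-cancel k 0<k (trans (sym (trans (σ-* 2 _ x) (*-congʳ (σ-ι 2 _)))) o)

  -- Invariance under σ_τ includes invariance under its square, conjugation, so the integral trace
  -- is four times the element.
  fix-int : ∀ {gh} → O gh → gh ↑ ≈ gh → IsInt gh
  fix-int {gh} oy ey = I.quo dv , c#-cancel 4 (s≤s z≤n) (trans tot (trans (ι-cong (I.eq dv)) (ι-* (+ 4) _)))
    where
    ȳ : gh ̄ ≈ gh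
    ȳ = trans (sym (ττ̄ oy)) (trans (↑-cong ey) ey)
    ti = Tr-int oy
    tot : c# 4 * gh ≈ ι (proj₁ ti)
    tot = trans (sym (trans (+-cong (+-congˡ ȳ) (+-cong ey (trans (↑-cong ȳ) ey))) (solve 1 (λ gh → (gh :+ gh) :+ (gh :+ gh) := con (+ 4) :* gh) refl gh))) (proj₂ ti)
    dv : (+ 4) ∣ℤ proj₁ ti
    dv = int (+ 4) gh (proj₁ ti) tot

  -- The products of the element with S₂ and with itself are invariant, hence integers b and c. Then
  -- b² = p₂ c, so p₂ divides b, and S₂² = p₂ turns b/p₂ into the coefficient.
  anti : ∀ {gh} → O gh → gh ↑ ≈ - gh → ∃ λ b → gh ≈ ι b * S₂
  anti {gh} oy ey = go (fix-int (O-* oy oS) (trans (σ-* τ gh S₂) (trans (*-cong ey τS₂) (solve 2 (λ gh s → (:- gh) :* (:- s) := gh :* s) refl gh S₂))))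
                      (fix-int (O-* oy oy) (trans (σ-* τ gh gh) (trans (*-cong ey ey) (solve 1 (λ gh → (:- gh) :* (:- gh) := gh :* gh) refl gh))))
    where
    oS : O S₂
    oS = σ₂S₂
    fin : ∀ b → gh * S₂ ≈ ι b → (+ p₂) ∣ℤ b → ∃ λ b → gh ≈ ι b * S₂
    fin b eb (I.divs q e) = q , c#-cancel p₂ 0<p₂ (trans (*-comm (c# p₂) gh) (trans (*-congˡ (sym S₂²)) (trans (sym (*-assoc gh S₂ S₂)) (trans (*-congʳ (trans eb (trans (ι-cong e) (ι-* (+ p₂) q)))) (*-assoc (c# p₂) (ι q) S₂)))))
    go : IsInt (gh * S₂) → IsInt (gh * gh) → ∃ λ b → gh ≈ ι b * S₂
    go (b , eb) (cU , ec) = fin b eb (M₂.sq-∣ b (I.divs cU (ι-inj (b ℤ.* b) (+ p₂ ℤ.* cU) (trans (ι-* b b) (trans (*-cong (sym eb) (sym eb)) (trans (solve 2 (λ gh s → (gh :* s) :* (gh :* s) := (s :* s) :* (gh :* gh)) refl gh S₂) (trans (*-cong S₂² ec) (sym (ι-* (+ p₂) cU)))))))))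

  indep : ∀ m k → ι m + ι k * S₂ ≈ 0# → (m ≡ 0ℤ) × (k ≡ 0ℤ)
  indep m k e = m0 , ι-inj k 0ℤ (c#-cancel p₂ 0<p₂ (trans (*-comm _ _) (trans (*-congˡ (sym S₂²)) (trans (sym (*-assoc _ _ _)) (trans (*-congʳ kS) (trans (zeroˡ _) (sym (trans (*-congˡ ι-0) (zeroʳ _)))))))))
    where
    e' : ι m - ι k * S₂ ≈ 0#
    e' = trans (+-cong (sym (σ-ι τ m)) (trans (-‿distribʳ-* _ _) (*-cong (sym (σ-ι τ k)) (sym τS₂)))) (trans (+-congˡ (sym (σ-* τ _ _))) (trans (sym (σ-+ τ _ _)) (trans (↑-cong e) (σ-0 uτ))))
    m0 : m ≡ 0ℤ
    m0 = ι-inj m 0ℤ (c#-cancel 2 (s≤s z≤n) (trans (solve 2 (λ m s → con (+ 2) :* m := (m :+ s) :+ (m :- s)) refl (ι m) (ι k * S₂)) (trans (+-cong e e') (trans (+-identityˡ 0#) (sym (trans (*-congˡ ι-0) (zeroʳ _)))))))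
    kS : ι k * S₂ ≈ 0#
    kS = trans (sym (trans (+-congʳ (trans (ι-cong m0) ι-0)) (+-identityˡ _))) e

  -- Gauss periods and coordinates in the quartic field

  gG hH : Carrier
  gG = ζ ^ G
  hH = ζ ^ H

  gh : ℕ → Carrier
  gh k = gG ^ k * hH ^ k

  y-* : ∀ k m → gh (k ℕ.* m) ≈ gh k ^ m
  y-* k m = trans (*-cong (sym (^-assocʳ gG k m)) (sym (^-assocʳ hH k m))) (sym (^-distrib-* (gG ^ k) (hH ^ k) m))

  σ-y : ∀ {a} → Unit a → ∀ k → σ a (gh k) ≈ gh (k ℕ.* a)
  σ-y {a} ua k = trans (σ-* a _ _) (*-cong (part G) (part H))
    where part : ∀ X → σ a ((ζ ^ X) ^ k) ≈ (ζ ^ X) ^ (k ℕ.* a)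
          part X = trans (σ-^ ua (ζ ^ X) k) (trans (^-congˡ k (σ-ζ^ ua X)) (trans (^-swap (ζ ^ X) a k) (^-assocʳ (ζ ^ X) k a)))

  y-mod : ∀ m k → m ℕ.% p₁ ≡ k ℕ.% p₁ → m ℕ.% p₂ ≡ k ℕ.% p₂ → gh m ≈ gh k
  y-mod m k e₁ e₂ = *-cong (trans (G₁.u-% m) (trans (^-congʳ gG e₁) (sym (G₁.u-% k)))) (trans (G₂.u-% m) (trans (^-congʳ hH e₂) (sym (G₂.u-% k))))

  yE : gh (2 ℕ.^ E) ≈ gh 1
  yE = y-mod (2 ℕ.^ E) 1 (≡ᶻ⇒% {p₁} (2 ℕ.^ E) 1 (≡.subst (λ z → z ≡ᶻ 1ℤ [ p₁ ]) (≡.sym (pos-^ 2 E)) E₁)) (≡ᶻ⇒% {p₂} (2 ℕ.^ E) 1 (≡.subst (λ z → z ≡ᶻ 1ℤ [ p₂ ]) (≡.sym (pos-^ 2 E)) E₂))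

  yN'N' : ∀ k → gh (k ℕ.* N' ℕ.* N') ≈ gh k
  yN'N' k = trans (sym (σ-y unit-N' (k ℕ.* N'))) (trans (conj-cong (sym (σ-y unit-N' k))) (conj-conj (gh k)))

  Fs : ℕ → Carrier
  Fs s = gh (2 ℕ.^ s) - gh (2 ℕ.^ s ℕ.* N')

  -- U = η - η̄, where η is the sum of (g h)^(2^s) for s < E, the Gauss period of a primitive
  -- p₁p₂-th root of unity over ⟨2⟩, and V is its τ-conjugate. Both are purely imaginary and serve
  -- as a basis for differences β - β̄.
  U V : Carrier
  U = ∑< E Fs
  V = U ↑

  O-U : O U
  O-U = trans (σ-∑ u2 E Fs) (trans (∑<-cong E (λ s _ → trans (σ-- u2 _ _) (+-cong (trans (σ-y u2 (2 ℕ.^ s)) (yc (2 ℕ.^ s ℕ.* 2) (2 ℕ.^ suc s) (ℕP.*-comm (2 ℕ.^ s) 2)))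
      (-‿cong (trans (σ-y u2 (2 ℕ.^ s ℕ.* N')) (yc _ _ (S'.solve 2 (λ x n → x S'.:* n S'.:* S'.con 2 S'.:= (S'.con 2 S'.:* x) S'.:* n) ≡.refl (2 ℕ.^ s) N'))))))) (cyc-shift E Fs per))
    where
    yc : ∀ m n → m ≡ n → gh m ≈ gh n
    yc m n e = reflexive (cong gh e)
    per0 : ∀ j → gh (2 ℕ.^ (j ℕ.+ E)) ≈ gh (2 ℕ.^ j)
    per0 j = trans (yc _ _ (≡.trans (cong (2 ℕ.^_) (ℕP.+-comm j E)) (ℕP.^-distribˡ-+-* 2 E j))) (trans (y-* (2 ℕ.^ E) (2 ℕ.^ j)) (trans (^-congˡ (2 ℕ.^ j) yE) (trans (sym (y-* 1 (2 ℕ.^ j))) (yc _ _ (ℕP.*-identityˡ (2 ℕ.^ j))))))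
    per : ∀ j → Fs (j ℕ.+ E) ≈ Fs j
    per j = +-cong (per0 j) (-‿cong (trans (y-* (2 ℕ.^ (j ℕ.+ E)) N') (trans (^-congˡ N' (per0 j)) (sym (y-* (2 ℕ.^ j) N')))))

  Ū : U ̄ ≈ - U
  Ū = trans (σ-∑ unit-N' E Fs) (trans (∑<-cong E (λ s _ → trans (σ-- unit-N' _ _) (trans (+-cong (σ-y unit-N' (2 ℕ.^ s)) (-‿cong (trans (σ-y unit-N' (2 ℕ.^ s ℕ.* N')) (yN'N' (2 ℕ.^ s)))))
      (solve 2 (λ a b → b :- a := :- (a :- b)) refl (gh (2 ℕ.^ s)) (gh (2 ℕ.^ s ℕ.* N')))))) (sym (∑<-neg E Fs)))

  V↑ : V ↑ ≈ - U
  V↑ = trans (ττ̄ O-U) Ū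

  T-0 : T 0# ≡ 0ℤ
  T-0 = ≡.trans (T-cong (sym ι-0)) (T-ι 0ℤ)

  T-∑ : ∀ n (Fs : ℕ → Carrier) → T (∑< n Fs) ≡ ∑ℤ n (λ i → T (Fs i))
  T-∑ zero Fs = T-0
  T-∑ (suc n) Fs = ≡.trans (T-+ _ _) (cong (ℤ._+ T (Fs n)) (T-∑ n Fs))

  x≡-x⇒0 : ∀ x → x ≡ ℤ.- x → x ≡ 0ℤ
  x≡-x⇒0 x e = ℤP.*-cancelˡ-≡ (+ 2) x 0ℤ (≡.trans (I.solve 1 (λ x → I.con (+ 2) I.:* x I.:= x I.:+ x) ≡.refl x) (≡.trans (cong (λ z → x ℤ.+ z) e) (ℤP.+-inverseʳ x)))

  module Imag (ν : Carrier) (oν : O ν) (ν̄ : ν ̄ ≈ - ν) where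
    T-flip : ∀ x → T (ν * x ̄) ≡ ℤ.- T (ν * x)
    T-flip x = ≡.trans (≡.sym (T-σ N' unit-N' (ν * x ̄))) (≡.trans (T-cong (trans (σ-* N' _ _) (trans (*-cong ν̄ (conj-conj x)) (sym (-‿distribˡ-* ν x))))) (T-neg _))

    T-σ2 : ∀ s x → T (ν * σ (2 ℕ.^ s) x) ≡ T (ν * x)
    T-σ2 s x = ≡.trans (T-cong (trans (*-congʳ (sym (O^ oν s))) (sym (σ-* (2 ℕ.^ s) ν x)))) (T-σ (2 ℕ.^ s) (u2^ s) _)

    T-ν : T (ν * 1#) ≡ 0ℤ
    T-ν = x≡-x⇒0 _ (≡.trans (T-cong (*-congˡ (sym (σ-1 unit-N')))) (T-flip 1#))

    -- σ_τ² negates ν and fixes g, because τ ≡ 1 modulo p₁, while T is invariant; so the value is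
    -- its own negative.
    T-νg : T (ν * gG) ≡ 0ℤ
    T-νg = x≡-x⇒0 _ (≡.trans (≡.sym (≡.trans (T-σ τ uτ _) (T-σ τ uτ (ν * gG)))) (≡.trans (T-cong (trans (↑-cong (trans (σ-* τ _ _) (*-congˡ gfix))) (trans (σ-* τ _ _) (trans (*-cong (trans (ττ̄ oν) ν̄) gfix) (sym (-‿distribˡ-* ν gG)))))) (T-neg _)))
      where
      gfix : gG ↑ ≈ gG
      gfix = trans (σ-ζ^ uτ G) (trans (G₁.u-% τ) (trans (^-congʳ gG (≡ᶻ⇒% {p₁} τ 1 τ≡1)) (trans (sym (G₁.u-% 1)) (*-identityʳ gG))))

    -- By `half`, σ at 2^(2b) sends h to h̄ and fixes ν, whereas conjugation negates ν; so the value
    -- is its own negative.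
    T-νh : T (ν * hH) ≡ 0ℤ
    T-νh = x≡-x⇒0 _ (≡.trans (≡.sym (T-σ2 (2 ℕ.* b) hH)) (≡.trans (T-cong (*-congˡ hconj)) (T-flip hH)))
      where
      hconj : σ (2 ℕ.^ (2 ℕ.* b)) hH ≈ hH ̄
      hconj = trans (σ-ζ^ (u2^ (2 ℕ.* b)) H) (trans (G₂.u-% (2 ℕ.^ (2 ℕ.* b))) (trans (^-congʳ hH (≡ᶻ⇒% {p₂} (2 ℕ.^ (2 ℕ.* b)) N' (I.≡-trans {x = + (2 ℕ.^ (2 ℕ.* b))} {y = ℤ.- 1ℤ} {z = + N'} (≡.subst (λ z → z ≡ᶻ (ℤ.- 1ℤ) [ p₂ ]) (≡.sym (pos-^ 2 (2 ℕ.* b))) half) (I.≡-sym {x = + N'} {y = ℤ.- 1ℤ} (N'≡-1 p₂ H N≡₂))))) (trans (sym (G₂.u-% N')) (sym (σ-ζ^ unit-N' H)))))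

    T-gh : T (ν * gh 1) ≡ (+ p₁ ℤ.* + p₂) ℤ.* Kp ν
    T-gh = ≡.trans (≡.sym (≡.trans (T-cong (trans (solve 4 (λ n g h o → n :* ((o :- g) :* (o :- h)) := (n :* (o :* o) :+ (:- (o :* (n :* g)))) :+ ((:- (o :* (n :* h))) :+ n :* (g :* h))) refl ν gG hH 1#)
           (+-cong (+-cong (*-congˡ (*-identityˡ 1#)) (-‿cong (*-identityˡ _))) (+-cong (-‿cong (*-identityˡ _)) (*-congˡ (*-cong (sym (*-identityʳ gG)) (sym (*-identityʳ hH))))))))
         (≡.trans (T-+ _ _) (≡.trans (cong₂ ℤ._+_ (≡.trans (T-+ _ _) (cong₂ ℤ._+_ T-ν (≡.trans (T-neg _) (cong ℤ.-_ T-νg)))) (≡.trans (T-+ _ _) (cong (λ z → z ℤ.+ T (ν * gh 1)) (≡.trans (T-neg _) (cong ℤ.-_ T-νh))))) (≡.trans (ℤP.+-identityˡ _) (ℤP.+-identityˡ _))))))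
       (T-κ ν)

    T-U : T (ν * U) ≡ + E ℤ.* (+ 2 ℤ.* T (ν * gh 1))
    T-U = ≡.trans (T-cong (∑<-*ˡ E ν Fs)) (≡.trans (T-∑ E (λ s → ν * Fs s)) (≡.trans (I.∑<-cong E (λ s _ → term s)) (I.∑<-const E _)))
      where
      term : ∀ s → T (ν * Fs s) ≡ + 2 ℤ.* T (ν * gh 1)
      term s = ≡.trans (T-cong (solve 3 (λ n a b → n :* (a :- b) := n :* a :+ (:- (n :* b))) refl ν (gh (2 ℕ.^ s)) (gh (2 ℕ.^ s ℕ.* N')))) (≡.trans (T-+ _ _) (≡.trans (cong₂ ℤ._+_ t1
         (≡.trans (T-neg _) (cong ℤ.-_ (≡.trans (T-cong (*-congˡ (sym (σ-y unit-N' (2 ℕ.^ s))))) (≡.trans (T-flip (gh (2 ℕ.^ s))) (cong ℤ.-_ t1)))))) (I.solve 1 (λ t → t I.:+ (I.:- (I.:- t)) I.:= I.con (+ 2) I.:* t) ≡.refl (T (ν * gh 1)))))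
        where
        t1 : T (ν * gh (2 ℕ.^ s)) ≡ T (ν * gh 1)
        t1 = ≡.trans (T-cong (*-congˡ (trans (reflexive (cong gh (≡.sym (ℕP.*-identityˡ (2 ℕ.^ s))))) (sym (σ-y (u2^ s) 1))))) (T-σ2 s (gh 1))

    -- The left side is fixed by σ_τ, hence an integer, which T determines. Of the expansion of ν κ
    -- only ν g h has nonzero T, so T(ν g h) = T(ν κ) = p₁p₂ Kp(ν), and every term of U contributes
    -- equally.
    pair : ν * U + ν ↑ * V ≈ ι ((+ p₁ ℤ.* + p₂) ℤ.* Kp ν)
    pair = trans (proj₂ fi) (ι-cong n≡)
      where
      fi = fix-int (O-+ (O-* oν O-U) (O-* (O-↑ oν) (O-↑ O-U))) (trans (σ-+ τ _ _) (trans (+-cong (σ-* τ _ _) (trans (σ-* τ _ _) (*-cong (trans (ττ̄ oν) ν̄) V↑))) (solve 4 (λ a b cU d → a :* b :+ (:- cU) :* (:- d) := cU :* d :+ a :* b) refl (ν ↑) V ν U)))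
      n = proj₁ fi
      T-n : n ℤ.* ((+ p₁ ℤ.- 1ℤ) ℤ.* (+ p₂ ℤ.- 1ℤ)) ≡ + 2 ℤ.* T (ν * U)
      T-n = ≡.trans (≡.sym (T-ι n)) (≡.trans (T-cong (sym (proj₂ fi))) (≡.trans (T-+ _ _) (≡.trans (cong (λ z → T (ν * U) ℤ.+ z) (≡.trans (T-cong (sym (σ-* τ ν U))) (T-σ τ uτ _))) (I.solve 1 (λ t → t I.:+ t I.:= I.con (+ 2) I.:* t) ≡.refl (T (ν * U))))))
      4E : (+ p₁ ℤ.- 1ℤ) ℤ.* (+ p₂ ℤ.- 1ℤ) ≡ + 4 ℤ.* + E
      4E = ≡.trans (cong₂ (λ u v → (u ℤ.- 1ℤ) ℤ.* (v ℤ.- 1ℤ)) (≡.trans (cong +_ p₁≡) (cong (λ z → + 3 ℤ.+ z) (ℤP.pos-* 8 a))) (≡.trans (cong +_ p₂≡) (cong (λ z → + 1 ℤ.+ z) (ℤP.pos-* 8 b))))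
        (≡.trans (I.solve 2 (λ a b → ((I.con (+ 3) I.:+ I.con (+ 8) I.:* a) I.:- I.con 1ℤ) I.:* ((I.con (+ 1) I.:+ I.con (+ 8) I.:* b) I.:- I.con 1ℤ) I.:= I.con (+ 4) I.:* ((I.con (+ 4) I.:* b) I.:* (I.con (+ 1) I.:+ I.con (+ 4) I.:* a))) ≡.refl (+ a) (+ b))
         (cong (+ 4 ℤ.*_) (≡.sym (≡.trans (ℤP.pos-* (4 ℕ.* b) _) (cong₂ ℤ._*_ (ℤP.pos-* 4 b) (cong (λ z → + 1 ℤ.+ z) (ℤP.pos-* 4 a)))))))
      n≡ : n ≡ (+ p₁ ℤ.* + p₂) ℤ.* Kp ν
      n≡ = ≡.trans (ℤP.*-cancelʳ-≡ n (T (ν * gh 1)) (+ 4 ℤ.* + E) {{ℤ.≢-nonZero nz}} (≡.trans (cong (n ℤ.*_) (≡.sym 4E)) (≡.trans T-n (≡.trans (cong (+ 2 ℤ.*_) T-U) (I.solve 2 (λ e t → I.con (+ 2) I.:* (e I.:* (I.con (+ 2) I.:* t)) I.:= t I.:* (I.con (+ 4) I.:* e)) ≡.refl (+ E) (T (ν * gh 1))))))) T-gh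
        where
        nz : ¬ (+ 4 ℤ.* + E ≡ 0ℤ)
        nz e = c#-nz (ℕP.*-mono-≤ {1} {4} (s≤s z≤n) E>0) (≡.trans (ℤP.pos-* 4 E) e)

  Kp-0 : Kp 0# ≡ 0ℤ
  Kp-0 = ∙-cancel (Kp 0#) (≡.trans (Kp-cong (sym (+-identityˡ 0#))) (Kp-+ 0# 0#))
    where ∙-cancel : ∀ x → x ≡ x ℤ.+ x → x ≡ 0ℤ
          ∙-cancel x e = ≡.sym (≡.trans (≡.sym (ℤP.+-inverseʳ x)) (≡.trans (cong (ℤ._- x) e) (I.solve 1 (λ x → (x I.:+ x) I.:- x I.:= x) ≡.refl x)))

  Kp-∑ : ∀ n (Fs : ℕ → Carrier) → Kp (∑< n Fs) ≡ ∑ℤ n (λ i → Kp (Fs i))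
  Kp-∑ zero Fs = Kp-0
  Kp-∑ (suc n) Fs = ≡.trans (Kp-+ _ _) (cong (ℤ._+ Kp (Fs n)) (Kp-∑ n Fs))

  2^∤ : ∀ {p} → Prime p → ¬ (p ℕD.∣ 2) → ∀ s → ¬ (p ℕD.∣ 2 ℕ.^ s)
  2^∤ pr n s d = n (prime∣^ pr s d)

  -- `Kp` sees only the monomial (g h)^k with k ≡ -1 modulo p₁p₂. No 2^s is -1, and -2^s is -1 for s
  -- = 0 alone in the range below E; that term occurs in U with a minus sign.
  KpU : Kp U ≡ ℤ.- 1ℤ
  KpU = ≡.trans (Kp-∑ E Fs) (go E E>0 mi)
    where
    p1∤ : ∀ s → ¬ (p₁ ℕD.∣ 2 ℕ.^ s)
    p1∤ = 2^∤ pr₁ G₁.p∤2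
    p2∤ : ∀ s → ¬ (p₂ ℕD.∣ 2 ℕ.^ s)
    p2∤ = 2^∤ pr₂ G₂.p∤2
    n∤ : ∀ {p} → Prime p → (¬ (p ℕD.∣ N')) → ∀ k → ¬ (p ℕD.∣ k) → ¬ (p ℕD.∣ k ℕ.* N')
    n∤ pr nN k nk d with euclidsLemma k N' pr d
    ... | inj₁ x = nk x
    ... | inj₂ x = nN x
    -1⇒ : ∀ {p} s → p ℕD.∣ suc (2 ℕ.^ s) → ((+ 2) ^ᶻ s) ≡ᶻ (ℤ.- 1ℤ) [ p ]
    -1⇒ {p} s d = ≡.subst (λ z → (+ p) ∣ℤ z) (≡.trans (cong +_ (ℕP.+-comm 1 (2 ℕ.^ s))) (cong (λ z → z ℤ.+ 1ℤ) (pos-^ 2 s))) (fromℕ∣ {p} {+ suc (2 ℕ.^ s)} d)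
    1⇒ : ∀ {p} X s → N ≡ p ℕ.* X → p ℕD.∣ suc (2 ℕ.^ s ℕ.* N') → ((+ 2) ^ᶻ s) ≡ᶻ 1ℤ [ p ]
    1⇒ {p} X s e d = I.∣-resp {x = (+ 2) ^ᶻ s ℤ.* (+ N' ℤ.- (ℤ.- 1ℤ)) ℤ.- (1ℤ ℤ.+ (+ 2) ^ᶻ s ℤ.* + N')} (I.solve 2 (λ x n → x I.:* (n I.:- (I.:- I.con 1ℤ)) I.:- (I.con 1ℤ I.:+ x I.:* n) I.:= x I.:- I.con 1ℤ) ≡.refl ((+ 2) ^ᶻ s) (+ N'))
       (I.∣-- (I.∣-*ˡ ((+ 2) ^ᶻ s) (N'≡-1 p X e)) (≡.subst (λ z → (+ p) ∣ℤ z) (cong (λ z → 1ℤ ℤ.+ z) (≡.trans (ℤP.pos-* (2 ℕ.^ s) N') (cong (ℤ._* + N') (pos-^ 2 s)))) (fromℕ∣ {p} {+ suc (2 ℕ.^ s ℕ.* N')} d)))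
    pl : ∀ s → Kp (gh (2 ℕ.^ s)) ≡ 0ℤ
    pl s = Kp-no (2 ℕ.^ s) (2 ℕ.^ s) (p1∤ s) (p2∤ s) (λ d → no-neg s (-1⇒ {p₁} s (proj₁ d)) (-1⇒ {p₂} s (proj₂ d)))
    split : ∀ s → Kp (Fs s) ≡ ℤ.- Kp (gh (2 ℕ.^ s ℕ.* N'))
    split s = ≡.trans (Kp-+ _ _) (≡.trans (cong₂ ℤ._+_ (pl s) (Kp-neg _)) (ℤP.+-identityˡ _))
    mi : ∀ s → 0 < s → s < E → Kp (Fs s) ≡ 0ℤ
    mi s 0<s s<E = ≡.trans (split s) (cong ℤ.-_ (Kp-no (2 ℕ.^ s ℕ.* N') (2 ℕ.^ s ℕ.* N') (n∤ pr₁ G₁.p∤N' (2 ℕ.^ s) (p1∤ s)) (n∤ pr₂ G₂.p∤N' (2 ℕ.^ s) (p2∤ s))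
       (λ d → ℕP.<⇒≱ s<E (E-min s 0<s (1⇒ {p₁} G s N≡₁ (proj₁ d)) (1⇒ {p₂} H s N≡₂ (proj₂ d))))))
    m0 : Kp (Fs 0) ≡ ℤ.- 1ℤ
    m0 = ≡.trans (split 0) (cong ℤ.-_ (Kp-yes (1 ℕ.* N') (1 ℕ.* N') (n∤ pr₁ G₁.p∤N' 1 (p∤1 pr₁)) (n∤ pr₂ G₂.p∤N' 1 (p∤1 pr₂)) (≡.subst (p₁ ℕD.∣_) (cong suc (≡.sym (ℕP.*-identityˡ N'))) p₁∣N) (≡.subst (p₂ ℕD.∣_) (cong suc (≡.sym (ℕP.*-identityˡ N'))) p₂∣N)))
    go : ∀ n → 0 < n → (∀ s → 0 < s → s < n → Kp (Fs s) ≡ 0ℤ) → ∑ℤ n (λ i → Kp (Fs i)) ≡ ℤ.- 1ℤ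
    go (suc n) _ h = ≡.trans (I.∑<-first n (λ i → Kp (Fs i))) (≡.trans (cong₂ ℤ._+_ m0 (≡.trans (I.∑<-cong n (λ i lt → h (suc i) (s≤s z≤n) (s≤s lt))) (I.∑<-0 n))) ≡.refl)

  PP : ℤ
  PP = + p₁ ℤ.* + p₂

  U²+V² : U * U + V * V ≈ - ι PP
  U²+V² = trans (Imag.pair U O-U Ū) (trans (ι-cong (≡.trans (cong (PP ℤ.*_) KpU) (≡.trans (ℤP.*-comm PP (ℤ.- 1ℤ)) (ℤP.-1*i≡-i PP)))) (ι-neg PP))

  abstract
    U²-V² : ∃ λ cU → U * U - V * V ≈ ι cU * S₂
    U²-V² = anti (O-- (O-* O-U O-U) (O-* (O-↑ O-U) (O-↑ O-U))) (trans (↑-- _ _) (trans (+-cong (σ-* τ _ _) (-‿cong (trans (σ-* τ _ _) (*-cong V↑ V↑)))) (solve 2 (λ u v → v :* v :- (:- u) :* (:- u) := :- (u :* u :- v :* v)) refl U V)))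

  abstract
    UV : ∃ λ cU → U * V ≈ ι cU * S₂
    UV = anti (O-* O-U (O-↑ O-U)) (trans (σ-* τ _ _) (trans (*-congˡ V↑) (solve 2 (λ u v → v :* (:- u) := :- (u :* v)) refl U V)))

  cU cUV : ℤ
  cU = proj₁ U²-V²
  cUV = proj₁ UV

  PP≢0 : ¬ (PP ≡ 0ℤ)
  PP≢0 e = c#-nz (ℕP.*-mono-≤ 0<p₁ 0<p₂) (≡.trans (ℤP.pos-* p₁ p₂) e)

  p₂≢0 : ¬ (+ p₂ ≡ 0ℤ)
  p₂≢0 = c#-nz 0<p₂
  p₁≢0 : ¬ (+ p₁ ≡ 0ℤ)
  p₁≢0 = c#-nz 0<p₁

  h+ : ∀ {x gh X Y} → ι x ≈ X → ι gh ≈ Y → ι (x ℤ.+ gh) ≈ X + Y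
  h+ e f = trans (ι-+ _ _) (+-cong e f)
  h* : ∀ {x gh X Y} → ι x ≈ X → ι gh ≈ Y → ι (x ℤ.* gh) ≈ X * Y
  h* e f = trans (ι-* _ _) (*-cong e f)
  h- : ∀ {x gh X Y} → ι x ≈ X → ι gh ≈ Y → ι (x ℤ.- gh) ≈ X - Y
  h- e f = trans (ι-- _ _) (+-cong e (-‿cong f))

  -- From (U² - V²)² + 4(UV)² = (U² + V²)², where U² - V² and UV are the multiples cU and cUV of S₂
  -- and U² + V² = -p₁p₂.
  cc' : cU ℤ.* cU ℤ.+ + 4 ℤ.* (cUV ℤ.* cUV) ≡ + p₁ ℤ.* + p₁ ℤ.* + p₂
  cc' = ℤP.*-cancelˡ-≡ (+ p₂) _ _ {{ℤ.≢-nonZero p₂≢0}} (≡.trans (ι-inj _ (PP ℤ.* PP) (begin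
      ι (+ p₂ ℤ.* (cU ℤ.* cU ℤ.+ + 4 ℤ.* (cUV ℤ.* cUV))) ≈⟨ h* (sym S₂²) (h+ (h* refl refl) (h* refl (h* refl refl))) ⟩
      (S₂ * S₂) * (ι cU * ι cU + c# 4 * (ι cUV * ι cUV)) ≈⟨ solve 3 (λ s a b → (s :* s) :* (a :* a :+ con (+ 4) :* (b :* b)) := (a :* s) :* (a :* s) :+ con (+ 4) :* ((b :* s) :* (b :* s))) refl S₂ (ι cU) (ι cUV) ⟩
      (ι cU * S₂) * (ι cU * S₂) + c# 4 * ((ι cUV * S₂) * (ι cUV * S₂)) ≈⟨ +-cong (*-cong (sym (proj₂ U²-V²)) (sym (proj₂ U²-V²))) (*-congˡ (*-cong (sym (proj₂ UV)) (sym (proj₂ UV)))) ⟩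
      (U * U - V * V) * (U * U - V * V) + c# 4 * ((U * V) * (U * V)) ≈⟨ solve 2 (λ u v → (u :* u :- v :* v) :* (u :* u :- v :* v) :+ con (+ 4) :* ((u :* v) :* (u :* v)) := (u :* u :+ v :* v) :* (u :* u :+ v :* v)) refl U V ⟩
      (U * U + V * V) * (U * U + V * V) ≈⟨ *-cong U²+V² U²+V² ⟩
      (- ι PP) * (- ι PP) ≈⟨ solve 1 (λ p → (:- p) :* (:- p) := p :* p) refl (ι PP) ⟩
      ι PP * ι PP ≈⟨ sym (ι-* PP PP) ⟩
      ι (PP ℤ.* PP) ∎)) (I.solve 2 (λ p q → (p I.:* q) I.:* (p I.:* q) I.:= q I.:* (p I.:* p I.:* q)) ≡.refl (+ p₁) (+ p₂)))
    where open RR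

  -- Otherwise x/z would be a square root of -1 modulo p₁.
  sum2sq : ∀ x z → (+ p₁) ∣ℤ (x ℤ.* x ℤ.+ z ℤ.* z) → (+ p₁) ∣ℤ z
  sum2sq x z d = go (p₁ ℕD.∣? ℤ.∣ z ∣)
    where
    go : Dec (p₁ ℕD.∣ ℤ.∣ z ∣) → (+ p₁) ∣ℤ z
    go (yes h) = fromℕ∣ {p₁} {z} h
    go (no h) = ⊥-elim (nr₁-1 (proj₁ sq) (proj₂ sq))
      where sq = M₁.ratio (ℤ.- 1ℤ) x z (λ k → h (toℕ∣ {p₁} {z} k)) (I.∣-resp {x = x ℤ.* x ℤ.+ z ℤ.* z} (I.solve 2 (λ x z → x I.:* x I.:+ z I.:* z I.:= x I.:* x I.:- (I.:- I.con 1ℤ) I.:* (z I.:* z)) ≡.refl x z) d)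

  p₁∣cc : (+ p₁) ∣ℤ (cU ℤ.* cU ℤ.+ (+ 2 ℤ.* cUV) ℤ.* (+ 2 ℤ.* cUV))
  p₁∣cc = I.divs (+ p₁ ℤ.* + p₂) (≡.trans (I.solve 2 (λ cU d → cU I.:* cU I.:+ (I.con (+ 2) I.:* d) I.:* (I.con (+ 2) I.:* d) I.:= cU I.:* cU I.:+ I.con (+ 4) I.:* (d I.:* d)) ≡.refl cU cUV) (≡.trans cc' (ℤP.*-assoc (+ p₁) (+ p₁) (+ p₂))))

  abstract
    p₁∣c' : (+ p₁) ∣ℤ cUV
    p₁∣c' = concl (M₁.euclid (+ 2) cUV (sum2sq cU (+ 2 ℤ.* cUV) p₁∣cc))
      where concl : ((+ p₁) ∣ℤ (+ 2)) ⊎ ((+ p₁) ∣ℤ cUV) → (+ p₁) ∣ℤ cUV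
            concl (inj₁ d) = ⊥-elim (two∤₁ d)
            concl (inj₂ d) = d
  abstract
    p₁∣c : (+ p₁) ∣ℤ cU
    p₁∣c = sum2sq (+ 2 ℤ.* cUV) cU (I.∣-resp {x = cU ℤ.* cU ℤ.+ (+ 2 ℤ.* cUV) ℤ.* (+ 2 ℤ.* cUV)} (ℤP.+-comm (cU ℤ.* cU) ((+ 2 ℤ.* cUV) ℤ.* (+ 2 ℤ.* cUV))) p₁∣cc)

  xx yy : ℤ
  xx = I.quo p₁∣c
  yy = I.quo p₁∣c'

  -- Dividing `cc'` by p₁² expresses p₂ by the structure constants of the periods; this is where the
  -- representation A² + B² in the system originates.
  xy : + p₂ ≡ xx ℤ.* xx ℤ.+ (+ 2 ℤ.* yy) ℤ.* (+ 2 ℤ.* yy)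
  xy = ℤP.*-cancelˡ-≡ (+ p₁) _ _ {{ℤ.≢-nonZero p₁≢0}} (ℤP.*-cancelˡ-≡ (+ p₁) _ _ {{ℤ.≢-nonZero p₁≢0}} (≡.trans (≡.sym (ℤP.*-assoc (+ p₁) (+ p₁) (+ p₂))) (≡.trans (≡.sym cc') (≡.trans (cong₂ (λ u v → u ℤ.* u ℤ.+ + 4 ℤ.* (v ℤ.* v)) (I.eq p₁∣c) (I.eq p₁∣c'))
      (I.solve 3 (λ p x gh → (p I.:* x) I.:* (p I.:* x) I.:+ I.con (+ 4) I.:* ((p I.:* gh) I.:* (p I.:* gh)) I.:= p I.:* (p I.:* (x I.:* x I.:+ (I.con (+ 2) I.:* gh) I.:* (I.con (+ 2) I.:* gh)))) ≡.refl (+ p₁) xx yy)))))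

  -- These describe β by 4β = a' + b'S₂ + 2(β - β̄) and β̄ - β = zU + wV. The fields `main` and
  -- `cross` are the coefficients of 1 and of S₂ in 16 β β̄ = 16 n, the second divided by 2.
  record Coords (n : ℤ) : Set where
    field
      a' b' z w : ℤ
      main : + 16 ℤ.* n ≡ a' ℤ.* a' ℤ.+ + p₂ ℤ.* (b' ℤ.* b') ℤ.+ + 2 ℤ.* PP ℤ.* (z ℤ.* z ℤ.+ w ℤ.* w)
      cross : a' ℤ.* b' ≡ + p₁ ℤ.* (xx ℤ.* (z ℤ.* z ℤ.- w ℤ.* w) ℤ.+ + 4 ℤ.* yy ℤ.* (z ℤ.* w))

  coords : ∀ β n → O β → β * β ̄ ≈ ι n → Coords n
  coords β n oβ nβ = core (Tr-int oβ) (anti oY Y↑)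
    where
    Y = (β + β ̄) - (β ↑ + (β ̄) ↑)
    oY : O Y
    oY = O-- (O-+ oβ (O-conj oβ)) (O-+ (O-↑ oβ) (O-↑ (O-conj oβ)))
    Y↑ : Y ↑ ≈ - Y
    Y↑ = trans (↑-- _ _) (trans (+-cong (σ-+ τ _ _) (-‿cong (trans (σ-+ τ _ _) (+-cong (ττ̄ oβ) (trans (ττ̄ (O-conj oβ)) (conj-conj β)))))) (solve 4 (λ b cU d e → (d :+ e) :- (cU :+ b) := :- ((b :+ cU) :- (d :+ e))) refl β (β ̄) (β ↑) ((β ̄) ↑)))
    ν = β - β ̄
    oν : O ν
    oν = O-- oβ (O-conj oβ)
    ν̄ : ν ̄ ≈ - ν
    ν̄ = trans (σ-- unit-N' _ _) (trans (+-congˡ (-‿cong (conj-conj β))) (solve 2 (λ b cU → cU :- b := :- (b :- cU)) refl β (β ̄)))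
    μ = - (ν ↑)
    oμ : O μ
    oμ = O-neg (O-↑ oν)
    μ̄ : μ ̄ ≈ - μ
    μ̄ = trans (σ-neg unit-N' _) (-‿cong (trans (sym (↑̄ ν)) (trans (↑-cong ν̄) (↑-neg ν))))
    μ↑ : μ ↑ ≈ ν
    μ↑ = trans (↑-neg _) (trans (-‿cong (trans (ττ̄ oν) ν̄)) (-‿involutive ν))
    zz = Kp ν
    ww = Kp μ
    -- `pair` for ν and for μ = -σ_τ ν gives two linear equations for ν and σ_τ ν with determinant
    -- U² + V² = -p₁p₂; this solves them for ν.
    -ν : - ν ≈ ι zz * U + ι ww * V
    -ν = tor-cancel PP PP≢0 (begin
      ι PP * - ν ≈⟨ solve 2 (λ p n → p :* (:- n) := (:- p) :* n) refl (ι PP) ν ⟩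
      (- ι PP) * ν ≈⟨ *-congʳ (sym U²+V²) ⟩
      (U * U + V * V) * ν ≈⟨ solve 4 (λ u v n m → (u :* u :+ v :* v) :* n := (n :* u :+ m :* v) :* u :+ ((:- m) :* u :+ n :* v) :* v) refl U V ν (ν ↑) ⟩
      (ν * U + ν ↑ * V) * U + (μ * U + ν * V) * V ≈⟨ +-cong (*-congʳ (Imag.pair ν oν ν̄)) (*-congʳ (trans (+-congˡ (*-congʳ (sym μ↑))) (Imag.pair μ oμ μ̄))) ⟩
      ι (PP ℤ.* zz) * U + ι (PP ℤ.* ww) * V ≈⟨ +-cong (*-congʳ (ι-* PP zz)) (*-congʳ (ι-* PP ww)) ⟩
      (ι PP * ι zz) * U + (ι PP * ι ww) * V ≈⟨ solve 5 (λ p z w u v → (p :* z) :* u :+ (p :* w) :* v := p :* (z :* u :+ w :* v)) refl (ι PP) (ι zz) (ι ww) U V ⟩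
      ι PP * (ι zz * U + ι ww * V) ∎)
      where open RR
    core : IsInt ((β + β ̄) + (β ↑ + (β ̄) ↑)) → (∃ λ b → Y ≈ ι b * S₂) → Coords n
    core (A' , eA) (B' , eB) = record { a' = A' ; b' = B' ; z = zz ; w = ww ; main = mn ; cross = cr }
      where
      Mℤ = (A' ℤ.* A' ℤ.+ + p₂ ℤ.* (B' ℤ.* B') ℤ.+ + 2 ℤ.* PP ℤ.* (zz ℤ.* zz ℤ.+ ww ℤ.* ww)) ℤ.- + 16 ℤ.* n
      Kℤ = (+ 2 ℤ.* (A' ℤ.* B') ℤ.- + 2 ℤ.* cU ℤ.* (zz ℤ.* zz ℤ.- ww ℤ.* ww)) ℤ.- + 8 ℤ.* cUV ℤ.* (zz ℤ.* ww)
      4β : c# 4 * β ≈ (ι A' + ι B' * S₂) + c# 2 * ν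
      4β = sym (trans (+-congʳ (+-cong (sym (eA)) (sym (eB)))) (solve 4 (λ b cU d e → (((b :+ cU) :+ (d :+ e)) :+ ((b :+ cU) :- (d :+ e))) :+ con (+ 2) :* (b :- cU) := con (+ 4) :* b) refl β (β ̄) (β ↑) ((β ̄) ↑)))
      4β̄ : c# 4 * β ̄ ≈ (ι A' + ι B' * S₂) - c# 2 * ν
      4β̄ = trans (solve 2 (λ b cU → con (+ 4) :* cU := con (+ 4) :* b :- con (+ 4) :* (b :- cU)) refl β (β ̄)) (trans (+-congʳ 4β) (solve 2 (λ x n → (x :+ con (+ 2) :* n) :- con (+ 4) :* n := x :- con (+ 2) :* n) refl (ι A' + ι B' * S₂) ν))
      2U² : c# 2 * (U * U) ≈ - ι PP + ι cU * S₂
      2U² = trans (solve 2 (λ u v → con (+ 2) :* u := (u :+ v) :+ (u :- v)) refl (U * U) (V * V)) (+-cong U²+V² (proj₂ U²-V²))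
      2V² : c# 2 * (V * V) ≈ - ι PP - ι cU * S₂
      2V² = trans (solve 2 (λ u v → con (+ 2) :* v := (u :+ v) :- (u :- v)) refl (U * U) (V * V)) (+-cong U²+V² (-‿cong (proj₂ U²-V²)))
      lin : ι Mℤ + ι Kℤ * S₂ ≈ 0#
      lin = begin
        ι Mℤ + ι Kℤ * S₂ ≈⟨ +-cong (h- (h+ (h+ (h* refl refl) (h* (sym S₂²) (h* refl refl))) (h* (h* refl refl) (h+ (h* refl refl) (h* refl refl)))) (h* refl (sym nβ)))
             (*-congʳ (h- (h- (h* refl (h* refl refl)) (h* (h* refl refl) (h- (h* refl refl) (h* refl refl)))) (h* (h* refl refl) (h* refl refl)))) ⟩
        ((ιa * ιa + (S₂ * S₂) * (ιb * ιb) + c# 2 * ι PP * (ιz * ιz + ιw * ιw)) - c# 16 * (β * β ̄)) + ((c# 2 * (ιa * ιb) - c# 2 * ι cU * (ιz * ιz - ιw * ιw)) - c# 8 * ι cUV * (ιz * ιw)) * S₂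
          ≈⟨ solve 10 (λ a b s p z w cU d β β̄ → ((a :* a :+ (s :* s) :* (b :* b) :+ con (+ 2) :* p :* (z :* z :+ w :* w)) :- con (+ 16) :* (β :* β̄)) :+ ((con (+ 2) :* (a :* b) :- con (+ 2) :* cU :* (z :* z :- w :* w)) :- con (+ 8) :* d :* (z :* w)) :* s
               := ((a :+ b :* s) :* (a :+ b :* s) :- (con (+ 2) :* (z :* z) :* (:- p :+ cU :* s) :+ con (+ 2) :* (w :* w) :* (:- p :- cU :* s) :+ con (+ 8) :* (z :* w) :* (d :* s))) :- (con (+ 4) :* β) :* (con (+ 4) :* β̄)) refl ιa ιb S₂ (ι PP) ιz ιw (ι cU) (ι cUV) β (β ̄) ⟩
        (Q * Q - (c# 2 * (ιz * ιz) * (- ι PP + ι cU * S₂) + c# 2 * (ιw * ιw) * (- ι PP - ι cU * S₂) + c# 8 * (ιz * ιw) * (ι cUV * S₂))) - (c# 4 * β) * (c# 4 * β ̄)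
          ≈⟨ +-cong (+-congˡ (-‿cong (+-cong (+-cong (*-congˡ (sym 2U²)) (*-congˡ (sym 2V²))) (*-congˡ (sym (proj₂ UV)))))) (-‿cong (*-cong 4β 4β̄)) ⟩
        (Q * Q - (c# 2 * (ιz * ιz) * (c# 2 * (U * U)) + c# 2 * (ιw * ιw) * (c# 2 * (V * V)) + c# 8 * (ιz * ιw) * (U * V))) - (Q + c# 2 * ν) * (Q - c# 2 * ν)
          ≈⟨ solve 6 (λ x z w u v n → (x :* x :- (con (+ 2) :* (z :* z) :* (con (+ 2) :* (u :* u)) :+ con (+ 2) :* (w :* w) :* (con (+ 2) :* (v :* v)) :+ con (+ 8) :* (z :* w) :* (u :* v))) :- (x :+ con (+ 2) :* n) :* (x :- con (+ 2) :* n)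
               := con (+ 4) :* ((:- n) :* (:- n) :- (z :* u :+ w :* v) :* (z :* u :+ w :* v))) refl Q ιz ιw U V ν ⟩
        c# 4 * ((- ν) * (- ν) - (ιz * U + ιw * V) * (ιz * U + ιw * V)) ≈⟨ *-congˡ (≈⇒-≈0 (*-cong -ν -ν)) ⟩
        c# 4 * 0# ≈⟨ zeroʳ _ ⟩
        0# ∎
        where
        open RR
        ιa = ι A'
        ιb = ι B'
        ιz = ι zz
        ιw = ι ww
        Q = ιa + ιb * S₂
      res = indep Mℤ Kℤ lin
      mn : + 16 ℤ.* n ≡ A' ℤ.* A' ℤ.+ + p₂ ℤ.* (B' ℤ.* B') ℤ.+ + 2 ℤ.* PP ℤ.* (zz ℤ.* zz ℤ.+ ww ℤ.* ww)
      mn = ≡.sym (ℤP.i-j≡0⇒i≡j _ _ (proj₁ res))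
      cr : A' ℤ.* B' ≡ + p₁ ℤ.* (xx ℤ.* (zz ℤ.* zz ℤ.- ww ℤ.* ww) ℤ.+ + 4 ℤ.* yy ℤ.* (zz ℤ.* ww))
      cr = ℤP.*-cancelˡ-≡ (+ 2) _ _ (ℤP.i-j≡0⇒i≡j _ _ (≡.trans (I.solve 6 (λ p s x gh d e → I.con (+ 2) I.:* s I.:- I.con (+ 2) I.:* (p I.:* (x I.:* d I.:+ I.con (+ 4) I.:* gh I.:* e)) I.:= (I.con (+ 2) I.:* s I.:- I.con (+ 2) I.:* (p I.:* x) I.:* d) I.:- I.con (+ 8) I.:* (p I.:* gh) I.:* e) ≡.refl (+ p₁) (A' ℤ.* B') xx yy (zz ℤ.* zz ℤ.- ww ℤ.* ww) (zz ℤ.* ww))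
         (≡.trans (cong₂ (λ u v → (+ 2 ℤ.* (A' ℤ.* B') ℤ.- + 2 ℤ.* u ℤ.* (zz ℤ.* zz ℤ.- ww ℤ.* ww)) ℤ.- + 8 ℤ.* v ℤ.* (zz ℤ.* ww)) (≡.sym (I.eq p₁∣c)) (≡.sym (I.eq p₁∣c'))) (proj₂ res))))

  -- The Diophantine system

  4·2^∤ : ∀ {p} → Prime p → ¬ (p ℕD.∣ 2) → ∀ k → ¬ ((+ p) ∣ℤ + (4 ℕ.* 2 ℕ.^ k))
  4·2^∤ {p} pr n k d = 2^∤ pr n (2 ℕ.+ k) (≡.subst (p ℕD.∣_) (≡.trans (cong (ℕ._* 2 ℕ.^ k) {4} {2 ℕ.^ 2} ≡.refl) (≡.sym (ℕP.^-distribˡ-+-* 2 2 k))) (toℕ∣ {p} {+ (4 ℕ.* 2 ℕ.^ k)} d))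

  m-odd : ∀ k → ¬ Solvable p₁ p₂ A B (k ℕ.+ k)
  m-odd k (X , Y , Z , W , e , _) = go (p₁ ℕD.∣? ℤ.∣ Y ∣)
    where
    -- For exponent 2k the left side of the equation is y², so modulo p₁ it reads y² ≡ p₂Y².
    y = + (4 ℕ.* 2 ℕ.^ k)
    Q = + p₁ ℤ.* (X ℤ.* X) ℤ.+ + 2 ℤ.* + p₂ ℤ.* (Z ℤ.* Z ℤ.+ W ℤ.* W)
    y² : y ℤ.* y ≡ + p₂ ℤ.* (Y ℤ.* Y) ℤ.+ + p₁ ℤ.* Q
    y² = ≡.trans (≡.sym (≡.trans (2^m+4 (k ℕ.+ k)) (double-square k))) (≡.trans e (≡.trans
          (≡.trans (cong₂ (λ u v → u ℤ.+ + 2 ℤ.* + p₁ ℤ.* + p₂ ℤ.* v) (cong₂ ℤ._+_ (cong₂ ℤ._*_ (^2 (+ p₁)) (^2 X)) (cong (+ p₂ ℤ.*_) (^2 Y))) (cong₂ ℤ._+_ (^2 Z) (^2 W))) ≡.refl)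
          (I.solve 6 (λ p q x y z w → p I.:* p I.:* (x I.:* x) I.:+ q I.:* (y I.:* y) I.:+ I.con (+ 2) I.:* p I.:* q I.:* (z I.:* z I.:+ w I.:* w) I.:= q I.:* (y I.:* y) I.:+ p I.:* (p I.:* (x I.:* x) I.:+ I.con (+ 2) I.:* q I.:* (z I.:* z I.:+ w I.:* w))) ≡.refl (+ p₁) (+ p₂) X Y Z W)))
    y∤ = 4·2^∤ pr₁ G₁.p∤2 k
    go : Dec (p₁ ℕD.∣ ℤ.∣ Y ∣) → ⊥
    go (yes d) = y∤ (M₁.sq-∣ y (I.∣-resp {x = + p₂ ℤ.* (Y ℤ.* Y) ℤ.+ + p₁ ℤ.* Q} (≡.sym y²) (I.∣-+ (I.∣-*ˡ (+ p₂) (I.∣-*ˡ Y (fromℕ∣ {p₁} {Y} d))) (I.∣-*ʳ Q (I.∣-refl {+ p₁})))))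
    go (no d) = nr₁-p₂ (proj₁ sq) (proj₂ sq)
      where sq = M₁.ratio (+ p₂) y Y (λ h → d (toℕ∣ {p₁} {Y} h)) (I.divs Q (≡.trans (cong (λ z → z ℤ.- + p₂ ℤ.* (Y ℤ.* Y)) y²) (I.solve 2 (λ u v → (u I.:+ v) I.:- u I.:= v) ≡.refl (+ p₂ ℤ.* (Y ℤ.* Y)) (+ p₁ ℤ.* Q))))

  p₁∣a'b' : ∀ {n} (C : Coords n) → let open Coords C in ((+ p₁) ∣ℤ a') ⊎ ((+ p₁) ∣ℤ b')
  p₁∣a'b' C = M₁.euclid a' b' (I.divs _ cross) where open Coords C

  -- A is odd and 2·yy is even, so uniqueness of the two squares can only match xx with A.
  xxA : xx ℤ.* xx ≡ A ℤ.* A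
  xxA = TwoSquares.unique p₂ pr₂ xx (+ 2 ℤ.* yy) A B xy AB (odd-sq≢even-sq oddA yy)

  yyB : (+ 2 ℤ.* yy) ℤ.* (+ 2 ℤ.* yy) ≡ B ℤ.* B
  yyB = cancel (xx ℤ.* xx) ((+ 2 ℤ.* yy) ℤ.* (+ 2 ℤ.* yy)) (B ℤ.* B) (≡.trans (≡.sym xy) (≡.trans AB (cong (ℤ._+ B ℤ.* B) (≡.sym xxA))))
    where
    cancel : ∀ x y z → x ℤ.+ y ≡ x ℤ.+ z → y ≡ z
    cancel x y z e = ≡.trans (I.solve 2 (λ x y → y I.:= (x I.:+ y) I.:- x) ≡.refl x y) (≡.trans (cong (ℤ._- x) e) (I.solve 2 (λ x y → (x I.:+ y) I.:- x I.:= y) ≡.refl x z))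

  private
    mk : ∀ {m} X Y Z W → + 16 ℤ.* + (2 ℕ.^ m) ≡ (+ p₁ ℤ.* X) ℤ.* (+ p₁ ℤ.* X) ℤ.+ + p₂ ℤ.* (Y ℤ.* Y) ℤ.+ + 2 ℤ.* PP ℤ.* (Z ℤ.* Z ℤ.+ W ℤ.* W) →
      X ℤ.* Y ≡ A ℤ.* (Z ℤ.* Z ℤ.- W ℤ.* W) ℤ.- + 2 ℤ.* (B ℤ.* (Z ℤ.* W)) → Solvable p₁ p₂ A B m
    mk {m} X Y Z W e₁ e₂ = X , Y , Z , W , ≡.trans (2^m+4 m) (≡.trans e₁ (≡.sym (≡.trans (cong₂ (λ u v → u ℤ.+ + 2 ℤ.* + p₁ ℤ.* + p₂ ℤ.* v) (cong₂ ℤ._+_ (cong₂ ℤ._*_ (^2 (+ p₁)) (^2 X)) (cong (+ p₂ ℤ.*_) (^2 Y))) (cong₂ ℤ._+_ (^2 Z) (^2 W)))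
        (I.solve 6 (λ p q x y z w → p I.:* p I.:* (x I.:* x) I.:+ q I.:* (y I.:* y) I.:+ I.con (+ 2) I.:* p I.:* q I.:* (z I.:* z I.:+ w I.:* w) I.:= (p I.:* x) I.:* (p I.:* x) I.:+ q I.:* (y I.:* y) I.:+ I.con (+ 2) I.:* (p I.:* q) I.:* (z I.:* z I.:+ w I.:* w)) ≡.refl (+ p₁) (+ p₂) X Y Z W))))
      , ≡.trans (cong₂ (λ u v → X ℤ.* Y ℤ.+ + 2 ℤ.* B ℤ.* Z ℤ.* W ℤ.+ A ℤ.* (u ℤ.- v)) (^2 W) (^2 Z)) (≡.trans (cong (λ u → u ℤ.+ + 2 ℤ.* B ℤ.* Z ℤ.* W ℤ.+ A ℤ.* (W ℤ.* W ℤ.- Z ℤ.* Z)) e₂)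
        (I.solve 4 (λ a b z w → (a I.:* (z I.:* z I.:- w I.:* w) I.:- I.con (+ 2) I.:* (b I.:* (z I.:* w))) I.:+ I.con (+ 2) I.:* b I.:* z I.:* w I.:+ a I.:* (w I.:* w I.:- z I.:* z) I.:= I.con 0ℤ) ≡.refl A B Z W))

  -- `cross` makes p₁ divide a' or b'. If it divided b', the main equation would read a'² ≡ 2y²
  -- modulo p₁, although 2 is a non-residue. So X = a'/p₁, and the remaining coordinates are those
  -- of the system up to signs.
  solvable : ∀ k → let m = suc (k ℕ.+ k) in Coords (+ (2 ℕ.^ m)) → Solvable p₁ p₂ A B m
  solvable k C = go (p₁∣a'b' C)
    where
    m = suc (k ℕ.+ k)
    open Coords C
    y = + (4 ℕ.* 2 ℕ.^ k)
    2y² : + 16 ℤ.* + (2 ℕ.^ m) ≡ + 2 ℤ.* (y ℤ.* y)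
    2y² = ≡.trans (cong (+ 16 ℤ.*_) (ℤP.pos-* 2 (2 ℕ.^ (k ℕ.+ k)))) (≡.trans (I.solve 1 (λ x → I.con (+ 16) I.:* (I.con (+ 2) I.:* x) I.:= I.con (+ 2) I.:* (I.con (+ 16) I.:* x)) ≡.refl (+ (2 ℕ.^ (k ℕ.+ k)))) (cong (+ 2 ℤ.*_) (double-square k)))
    go : ((+ p₁) ∣ℤ a') ⊎ ((+ p₁) ∣ℤ b') → Solvable p₁ p₂ A B m
    go (inj₂ (I.divs q eq)) = ⊥-elim (nr₁-2 (proj₁ sq) (proj₂ sq))
      where
      R = + p₁ ℤ.* + p₂ ℤ.* (q ℤ.* q) ℤ.+ + 2 ℤ.* + p₂ ℤ.* (z ℤ.* z ℤ.+ w ℤ.* w)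
      e : a' ℤ.* a' ℤ.- + 2 ℤ.* (y ℤ.* y) ≡ + p₁ ℤ.* (ℤ.- R)
      e = ≡.trans (cong (λ u → a' ℤ.* a' ℤ.- u) (≡.trans (≡.sym 2y²) (≡.trans main (cong (λ u → a' ℤ.* a' ℤ.+ + p₂ ℤ.* (u ℤ.* u) ℤ.+ + 2 ℤ.* PP ℤ.* (z ℤ.* z ℤ.+ w ℤ.* w)) eq))))
          (I.solve 6 (λ a p q' q z w → a I.:* a I.:- (a I.:* a I.:+ q' I.:* ((p I.:* q) I.:* (p I.:* q)) I.:+ I.con (+ 2) I.:* (p I.:* q') I.:* (z I.:* z I.:+ w I.:* w)) I.:= p I.:* (I.:- (p I.:* q' I.:* (q I.:* q) I.:+ I.con (+ 2) I.:* q' I.:* (z I.:* z I.:+ w I.:* w)))) ≡.refl a' (+ p₁) (+ p₂) q z w)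
      sq = M₁.ratio (+ 2) a' y (4·2^∤ pr₁ G₁.p∤2 k) (I.divs (ℤ.- R) e)
    go (inj₁ (I.divs X eq)) = pick (sq≡⇒± xx A xxA) (sq≡⇒± (+ 2 ℤ.* yy) B yyB)
      where
      mn : + 16 ℤ.* + (2 ℕ.^ m) ≡ (+ p₁ ℤ.* X) ℤ.* (+ p₁ ℤ.* X) ℤ.+ + p₂ ℤ.* (b' ℤ.* b') ℤ.+ + 2 ℤ.* PP ℤ.* (z ℤ.* z ℤ.+ w ℤ.* w)
      mn = ≡.trans main (cong (λ u → u ℤ.* u ℤ.+ + p₂ ℤ.* (b' ℤ.* b') ℤ.+ + 2 ℤ.* PP ℤ.* (z ℤ.* z ℤ.+ w ℤ.* w)) eq)
      mn' : ∀ z' w' → z ℤ.* z ℤ.+ w ℤ.* w ≡ z' ℤ.* z' ℤ.+ w' ℤ.* w' → + 16 ℤ.* + (2 ℕ.^ m) ≡ (+ p₁ ℤ.* X) ℤ.* (+ p₁ ℤ.* X) ℤ.+ + p₂ ℤ.* (b' ℤ.* b') ℤ.+ + 2 ℤ.* PP ℤ.* (z' ℤ.* z' ℤ.+ w' ℤ.* w')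
      mn' z' w' e = ≡.trans mn (cong (λ u → (+ p₁ ℤ.* X) ℤ.* (+ p₁ ℤ.* X) ℤ.+ + p₂ ℤ.* (b' ℤ.* b') ℤ.+ + 2 ℤ.* PP ℤ.* u) e)
      cr : X ℤ.* b' ≡ xx ℤ.* (z ℤ.* z ℤ.- w ℤ.* w) ℤ.+ + 2 ℤ.* ((+ 2 ℤ.* yy) ℤ.* (z ℤ.* w))
      cr = ℤP.*-cancelˡ-≡ (+ p₁) _ _ {{ℤ.≢-nonZero p₁≢0}} (≡.trans (≡.sym (ℤP.*-assoc (+ p₁) X b')) (≡.trans (cong (ℤ._* b') (≡.sym eq)) (≡.trans cross (I.solve 5 (λ p x y d e → p I.:* (x I.:* d I.:+ I.con (+ 4) I.:* y I.:* e) I.:= p I.:* (x I.:* d I.:+ I.con (+ 2) I.:* ((I.con (+ 2) I.:* y) I.:* e))) ≡.refl (+ p₁) xx yy (z ℤ.* z ℤ.- w ℤ.* w) (z ℤ.* w)))))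
      cr' : ∀ α β → xx ≡ α → + 2 ℤ.* yy ≡ β → X ℤ.* b' ≡ α ℤ.* (z ℤ.* z ℤ.- w ℤ.* w) ℤ.+ + 2 ℤ.* (β ℤ.* (z ℤ.* w))
      cr' α β e f = ≡.trans cr (cong₂ (λ u v → u ℤ.* (z ℤ.* z ℤ.- w ℤ.* w) ℤ.+ + 2 ℤ.* (v ℤ.* (z ℤ.* w))) e f)
      -- The signs of A and B are absorbed by symmetries of Z² + W²: negating one variable reverses
      -- the sign of ZW, and exchanging the two reverses that of Z² - W².
      pick : (xx ≡ A) ⊎ (xx ≡ ℤ.- A) → (+ 2 ℤ.* yy ≡ B) ⊎ (+ 2 ℤ.* yy ≡ ℤ.- B) → Solvable p₁ p₂ A B m
      pick (inj₁ e) (inj₁ f) = mk {m} X b' z (ℤ.- w) (mn' z (ℤ.- w) (I.solve 2 (λ z w → z I.:* z I.:+ w I.:* w I.:= z I.:* z I.:+ (I.:- w) I.:* (I.:- w)) ≡.refl z w))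
        (≡.trans (cr' A B e f) (I.solve 4 (λ a b z w → a I.:* (z I.:* z I.:- w I.:* w) I.:+ I.con (+ 2) I.:* (b I.:* (z I.:* w)) I.:= a I.:* (z I.:* z I.:- (I.:- w) I.:* (I.:- w)) I.:- I.con (+ 2) I.:* (b I.:* (z I.:* (I.:- w)))) ≡.refl A B z w))
      pick (inj₁ e) (inj₂ f) = mk {m} X b' z w mn
        (≡.trans (cr' A (ℤ.- B) e f) (I.solve 4 (λ a b z w → a I.:* (z I.:* z I.:- w I.:* w) I.:+ I.con (+ 2) I.:* ((I.:- b) I.:* (z I.:* w)) I.:= a I.:* (z I.:* z I.:- w I.:* w) I.:- I.con (+ 2) I.:* (b I.:* (z I.:* w))) ≡.refl A B z w))
      pick (inj₂ e) (inj₁ f) = mk {m} X b' w (ℤ.- z) (mn' w (ℤ.- z) (I.solve 2 (λ z w → z I.:* z I.:+ w I.:* w I.:= w I.:* w I.:+ (I.:- z) I.:* (I.:- z)) ≡.refl z w))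
        (≡.trans (cr' (ℤ.- A) B e f) (I.solve 4 (λ a b z w → (I.:- a) I.:* (z I.:* z I.:- w I.:* w) I.:+ I.con (+ 2) I.:* (b I.:* (z I.:* w)) I.:= a I.:* (w I.:* w I.:- (I.:- z) I.:* (I.:- z)) I.:- I.con (+ 2) I.:* (b I.:* (w I.:* (I.:- z)))) ≡.refl A B z w))
      pick (inj₂ e) (inj₂ f) = mk {m} X b' w z (mn' w z (ℤP.+-comm (z ℤ.* z) (w ℤ.* w)))
        (≡.trans (cr' (ℤ.- A) (ℤ.- B) e f) (I.solve 4 (λ a b z w → (I.:- a) I.:* (z I.:* z I.:- w I.:* w) I.:+ I.con (+ 2) I.:* ((I.:- b) I.:* (z I.:* w)) I.:= a I.:* (w I.:* w I.:- z I.:* z) I.:- I.con (+ 2) I.:* (b I.:* (w I.:* z))) ≡.refl A B z w))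

  solv : ∀ k β → O β → β * β ̄ ≈ c# (2 ℕ.^ suc (k ℕ.+ k)) → Solvable p₁ p₂ A B (suc (k ℕ.+ k))
  solv k β o n = solvable k (coords β _ o n)

  -- Here p₁ divides both a' and b'. Dividing the main equation by p₁ and reducing modulo p₂ gives
  -- 2^(m+4) ≡ p₁α²; but 2 is a square modulo p₂ and p₁ is not.
  no-coords : ∀ m → ¬ Coords (+ p₁ ℤ.* + (2 ℕ.^ m))
  no-coords m C = final (both (p₁∣a'b' C))
    where
    open Coords C
    S = z ℤ.* z ℤ.+ w ℤ.* w
    two = + 16 ℤ.* + (2 ℕ.^ m)
    both : ((+ p₁) ∣ℤ a') ⊎ ((+ p₁) ∣ℤ b') → ((+ p₁) ∣ℤ a') × ((+ p₁) ∣ℤ b')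
    both (inj₁ d) = d , sel (M₁.euclid (+ p₂) (b' ℤ.* b') (I.∣-resp {x = + p₁ ℤ.* (two ℤ.- + 2 ℤ.* + p₂ ℤ.* S) ℤ.- a' ℤ.* a'}
         (≡.trans (I.solve 5 (λ p q t s a → p I.:* (t I.:- I.con (+ 2) I.:* q I.:* s) I.:- a I.:* a I.:= p I.:* t I.:- (I.con (+ 2) I.:* (p I.:* q) I.:* s I.:+ a I.:* a)) ≡.refl (+ p₁) (+ p₂) two S a')
         (≡.trans (cong (ℤ._- (+ 2 ℤ.* PP ℤ.* S ℤ.+ a' ℤ.* a')) (≡.trans (I.solve 2 (λ p t → p I.:* (I.con (+ 16) I.:* t) I.:= I.con (+ 16) I.:* (p I.:* t)) ≡.refl (+ p₁) (+ (2 ℕ.^ m))) main)) (I.solve 3 (λ u v w → (u I.:+ v I.:+ w) I.:- (w I.:+ u) I.:= v) ≡.refl (a' ℤ.* a') (+ p₂ ℤ.* (b' ℤ.* b')) (+ 2 ℤ.* PP ℤ.* S))))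
         (I.∣-- (I.∣-*ʳ (two ℤ.- + 2 ℤ.* + p₂ ℤ.* S) (I.∣-refl {+ p₁})) (I.∣-*ˡ a' d))))
      where
      sel : ((+ p₁) ∣ℤ (+ p₂)) ⊎ ((+ p₁) ∣ℤ (b' ℤ.* b')) → (+ p₁) ∣ℤ b'
      sel (inj₁ h) = ⊥-elim (p₁≢p₂ (prime∣prime pr₁ pr₂ (toℕ∣ {p₁} {+ p₂} h)))
      sel (inj₂ h) = M₁.sq-∣ b' h
    both (inj₂ d) = M₁.sq-∣ a' (I.∣-resp {x = + p₁ ℤ.* (two ℤ.- + 2 ℤ.* + p₂ ℤ.* S) ℤ.- + p₂ ℤ.* (b' ℤ.* b')}
         (≡.trans (I.solve 5 (λ p q t s a → p I.:* (t I.:- I.con (+ 2) I.:* q I.:* s) I.:- q I.:* (a I.:* a) I.:= p I.:* t I.:- (I.con (+ 2) I.:* (p I.:* q) I.:* s I.:+ q I.:* (a I.:* a))) ≡.refl (+ p₁) (+ p₂) two S b')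
         (≡.trans (cong (ℤ._- (+ 2 ℤ.* PP ℤ.* S ℤ.+ + p₂ ℤ.* (b' ℤ.* b'))) (≡.trans (I.solve 2 (λ p t → p I.:* (I.con (+ 16) I.:* t) I.:= I.con (+ 16) I.:* (p I.:* t)) ≡.refl (+ p₁) (+ (2 ℕ.^ m))) main)) (I.solve 3 (λ u v w → (u I.:+ v I.:+ w) I.:- (w I.:+ v) I.:= u) ≡.refl (a' ℤ.* a') (+ p₂ ℤ.* (b' ℤ.* b')) (+ 2 ℤ.* PP ℤ.* S))))
         (I.∣-- (I.∣-*ʳ (two ℤ.- + 2 ℤ.* + p₂ ℤ.* S) (I.∣-refl {+ p₁})) (I.∣-*ˡ (+ p₂) (I.∣-*ˡ b' d)))) , d
    final : ((+ p₁) ∣ℤ a') × ((+ p₁) ∣ℤ b') → ⊥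
    final (I.divs α ea , I.divs β eb) = dec (p₂ ℕD.∣? ℤ.∣ α ∣)
      where
      Q = + p₁ ℤ.* (β ℤ.* β) ℤ.+ + 2 ℤ.* S
      main' : two ≡ + p₁ ℤ.* (α ℤ.* α) ℤ.+ + p₂ ℤ.* Q
      main' = ℤP.*-cancelˡ-≡ (+ p₁) _ _ {{ℤ.≢-nonZero p₁≢0}} (≡.trans (I.solve 2 (λ p t → p I.:* (I.con (+ 16) I.:* t) I.:= I.con (+ 16) I.:* (p I.:* t)) ≡.refl (+ p₁) (+ (2 ℕ.^ m))) (≡.trans main (≡.trans (cong₂ (λ u v → u ℤ.* u ℤ.+ + p₂ ℤ.* (v ℤ.* v) ℤ.+ + 2 ℤ.* PP ℤ.* S) ea eb)
        (I.solve 5 (λ p q a b s → (p I.:* a) I.:* (p I.:* a) I.:+ q I.:* ((p I.:* b) I.:* (p I.:* b)) I.:+ I.con (+ 2) I.:* (p I.:* q) I.:* s I.:= p I.:* (p I.:* (a I.:* a) I.:+ q I.:* (p I.:* (b I.:* b) I.:+ I.con (+ 2) I.:* s))) ≡.refl (+ p₁) (+ p₂) α β S))))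
      m4 : two ≡ (+ 2) ^ᶻ (m ℕ.+ 4)
      m4 = ≡.trans (≡.sym (2^m+4 m)) (pos-^ 2 (m ℕ.+ 4))
      r = r₂ ^ᶻ (m ℕ.+ 4)
      dec : Dec (p₂ ℕD.∣ ℤ.∣ α ∣) → ⊥
      dec (yes d) = 2^∤ pr₂ G₂.p∤2 (m ℕ.+ 4) (toℕ∣ {p₂} {+ (2 ℕ.^ (m ℕ.+ 4))} (I.∣-resp {x = + p₁ ℤ.* (α ℤ.* α) ℤ.+ + p₂ ℤ.* Q} (≡.trans (≡.sym main') (≡.sym (2^m+4 m))) (I.∣-+ (I.∣-*ˡ (+ p₁) (I.∣-*ˡ α (fromℕ∣ {p₂} {α} d))) (I.∣-*ʳ Q (I.∣-refl {+ p₂})))))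
      dec (no d) = nr (proj₁ sq) (proj₂ sq)
        where sq = M₂.ratio (+ p₁) r α (λ h → d (toℕ∣ {p₂} {α} h)) (I.≡-trans {x = r ℤ.* r} {y = two} {z = + p₁ ℤ.* (α ℤ.* α)} (≡.subst (λ u → (+ p₂) ∣ℤ (r ℤ.* r ℤ.- u)) (≡.sym m4) (2^sq (m ℕ.+ 4)))
                (I.divs Q (≡.trans (cong (ℤ._- (+ p₁ ℤ.* (α ℤ.* α))) main') (I.solve 2 (λ u v → (u I.:+ v) I.:- u I.:= v) ≡.refl (+ p₁ ℤ.* (α ℤ.* α)) (+ p₂ ℤ.* Q)))))

  noneg : ∀ m β → O β → β * β ̄ ≈ ι (+ p₁ ℤ.* + (2 ℕ.^ m)) → ⊥
  noneg m β o n = no-coords m (coords β _ o n)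

  -- Elements of norm 2^m in the decomposition ring

  module Minimal (k : ℕ) (minimal : ∀ j → j < k → ¬ Solvable p₁ p₂ A B (suc (j ℕ.+ j))) where

    m : ℕ
    m = suc (k ℕ.+ k)

    2# Q : Carrier
    2# = c# 2
    Q = 2# ^ m

    pow-cancel : ∀ j {x y} → 2# ^ j * x ≈ 2# ^ j * y → x ≈ y
    pow-cancel zero e = trans (sym (*-identityˡ _)) (trans e (*-identityˡ _))
    pow-cancel (suc j) e = pow-cancel j (c#-cancel 2 (s≤s z≤n) (trans (sym (*-assoc _ _ _)) (trans e (*-assoc _ _ _))))

    pow-down : ∀ j {x} → 2# ^ suc j ∣ x → 2# ^ j ∣ x
    pow-down j = ∣-trans (divs 2# (*-comm 2# (2# ^ j)))

    -- x = F x - (F - 1) x with F - 1 even. It allows a divisibility by powers of 2 to be tested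
    -- after multiplication by a partition of 1 modulo 2.
    unit2 : ∀ {F} → F ≡ 1# [ 2# ] → ∀ j x → 2# ^ j ∣ (F * x) → 2# ^ j ∣ x
    unit2 F1 zero x d = divs x (sym (*-identityˡ x))
    unit2 {F} F1 (suc j) x d = ∣-resp (trans (solve 3 (λ f o x → f :* x :- (f :- o) :* x := o :* x) refl F 1# x) (*-identityˡ x)) (∣-- d (∣-* F1 (unit2 F1 j x (pow-down j d))))

    -- The residue fields of the decomposition ring at 2 have two elements: x² ≡ σ₂x = x.
    idem : ∀ {x} → O x → (x * x) ≡ x [ 2# ]
    idem {x} ox = ≡-trans (frob2 x) (≡-reflexive ox)

    Tr : Carrier → Carrier
    Tr w = (w + w ̄) + (w ↑ + (w ̄) ↑)

    int-parity : ∀ n → (ι n ≡ 0# [ 2# ]) ⊎ (ι n ≡ 1# [ 2# ])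
    int-parity (+ n) = go (parity n)
      where
      go : (∃ λ j → n ≡ j ℕ.+ j) ⊎ (∃ λ j → n ≡ suc (j ℕ.+ j)) → (c# n ≡ 0# [ 2# ]) ⊎ (c# n ≡ 1# [ 2# ])
      go (inj₁ (j , ≡.refl)) = inj₁ (∣⇒≡0 (divs (c# j) (trans (ι-+ (+ j) (+ j)) (solve 1 (λ x → x :+ x := con (+ 2) :* x) refl (c# j)))))
      go (inj₂ (j , ≡.refl)) = inj₂ (divs (c# j) (trans (+-congʳ (trans (c#-suc (j ℕ.+ j)) (+-congˡ (ι-+ (+ j) (+ j))))) (solve 2 (λ o x → (o :+ (x :+ x)) :- o := con (+ 2) :* x) refl 1# (c# j))))
    int-parity -[1+ n ] = flip (int-parity (+ n))
      where
      e : ι -[1+ n ] ≈ - (1# + c# n)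
      e = trans (ι-neg (+ suc n)) (-‿cong (c#-suc n))
      flip : (c# n ≡ 0# [ 2# ]) ⊎ (c# n ≡ 1# [ 2# ]) → (ι -[1+ n ] ≡ 0# [ 2# ]) ⊎ (ι -[1+ n ] ≡ 1# [ 2# ])
      flip (inj₁ d) = inj₂ (∣-resp (trans (solve 2 (λ o x → :- x :- con (+ 2) :* o := (:- (o :+ x)) :- o) refl 1# (c# n)) (+-congʳ (sym e))) (∣-- (∣-neg (≡0⇒∣ d)) (∣-*ʳ 1# ∣-refl)))
      flip (inj₂ d) = inj₁ (∣⇒≡0 (∣-resp (trans (solve 2 (λ o x → :- (x :- o) :- con (+ 2) :* o := :- (o :+ x)) refl 1# (c# n)) (sym e)) (∣-- (∣-neg d) (∣-*ʳ 1# ∣-refl))))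

    Tr-parity : ∀ {w} → O w → (Tr w ≡ 0# [ 2# ]) ⊎ (Tr w ≡ 1# [ 2# ])
    Tr-parity {w} ow = go (Tr-int ow)
      where
      go : IsInt (Tr w) → (Tr w ≡ 0# [ 2# ]) ⊎ (Tr w ≡ 1# [ 2# ])
      go (n , e) with int-parity n
      ... | inj₁ d = inj₁ (≡-trans (≡-reflexive e) d)
      ... | inj₂ d = inj₂ (≡-trans (≡-reflexive e) d)

    -- γ would have norm 2^(m-2). For m = 1 this says 2 γ γ̄ = 1, making 2 a unit; for larger m its
    -- coordinates solve the system with a smaller odd exponent.
    descend : ∀ γ → O γ → c# 4 * (γ * γ ̄) ≈ Q → ⊥
    descend γ oγ e = go k ≡.refl
      where
      go : ∀ k' → k ≡ k' → ⊥
      go zero ≡.refl = 2∤1 (divs (γ * γ ̄) (c#-cancel 2 (s≤s z≤n) (sym (trans (solve 1 (λ g → con (+ 2) :* (con (+ 2) :* g) := con (+ 4) :* g) refl (γ * γ ̄)) e))))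
      go (suc k') ≡.refl = minimal k' (ℕP.n<1+n k') (solv k' γ oγ (c#-cancel 4 (s≤s z≤n) (trans e (trans (^-congʳ 2# (cong (λ z → suc (suc z)) (ℕP.+-suc k' k'))) (trans (solve 1 (λ g → con (+ 2) :* (con (+ 2) :* g) := con (+ 4) :* g) refl (2# ^ suc (k' ℕ.+ k'))) (*-congˡ (sym (c#-^ 2 (suc (k' ℕ.+ k'))))))))))

    O-pow : ∀ j {x} → O (2# ^ j * x) → O x
    O-pow zero o = O-resp (*-identityˡ _) o
    O-pow (suc j) o = O-pow j (O-tor 2 (s≤s z≤n) (O-resp (*-assoc _ _ _) o))

    conj-2^ : ∀ j → (2# ^ j) ̄ ≈ 2# ^ j
    conj-2^ j = trans (σ-^ unit-N' 2# j) (^-congˡ j (σ-ι N' (+ 2)))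

    ↑-2^∣ : ∀ j {x} → 2# ^ j ∣ x → 2# ^ j ∣ (x ↑)
    ↑-2^∣ j d = ∣-respˡ (trans (σ-^ uτ 2# j) (^-congˡ j (σ-ι τ (+ 2)))) (σ-∣ uτ d)

    conj-2^∣ : ∀ j {x} → 2# ^ j ∣ x → 2# ^ j ∣ (x ̄)
    conj-2^∣ j d = ∣-respˡ (conj-2^ j) (σ-∣ unit-N' d)

    ↑-≡ : ∀ {x y} → x ≡ y [ 2# ] → (x ↑) ≡ (y ↑) [ 2# ]
    ↑-≡ = σ-≡ι uτ
    conj-≡ : ∀ {x y} → x ≡ y [ 2# ] → (x ̄) ≡ (y ̄) [ 2# ]
    conj-≡ = σ-≡ι unit-N'

    -- Modulo 2 the decomposition ring is a product of four copies of the field with two elements,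
    -- permuted cyclically by τ. Since b b̄ is even and b is not, b is odd at a single place or at
    -- two adjacent ones. In the first case b · σ_τ b is even; in the second that product c is odd
    -- at a single place and has odd trace.
    record Norm2 (b : Carrier) : Set where
      field
        ob : O b
        n02 : b * b ̄ ≈ Q

      b1 b2 b3 : Carrier
      b1 = b ↑
      b2 = b ̄
      b3 = (b ↑) ̄

      ob1 : O b1
      ob1 = O-↑ ob
      ob2 : O b2
      ob2 = O-conj ob
      ob3 : O b3
      ob3 = O-conj ob1

      b1↑ : b1 ↑ ≈ b2
      b1↑ = ττ̄ ob
      b2↑ : b2 ↑ ≈ b3
      b2↑ = ↑̄ b
      b3↑ : b3 ↑ ≈ b
      b3↑ = trans (↑̄ b1) (trans (conj-cong b1↑) (conj-conj b))
      b2̄ : b2 ̄ ≈ b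
      b2̄ = conj-conj b
      b3̄ : b3 ̄ ≈ b1
      b3̄ = conj-conj b1

      n13 : b1 * b3 ≈ Q
      n13 = trans (nrm-σ uτ {b} {+ (2 ℕ.^ m)} (trans n02 (sym (c#-^ 2 m)))) (c#-^ 2 m)

      2∣02 : 2# ∣ (b * b2)
      2∣02 = divs (2# ^ (k ℕ.+ k)) n02
      2∣13 : 2# ∣ (b1 * b3)
      2∣13 = divs (2# ^ (k ℕ.+ k)) n13

      2∤b : ¬ (2# ∣ b)
      2∤b (divs γ e) = descend γ (O-tor 2 (s≤s z≤n) (O-resp e ob)) (trans (solve 2 (λ g h → con (+ 4) :* (g :* h) := (con (+ 2) :* g) :* (con (+ 2) :* h)) refl γ (γ ̄)) (trans (*-cong (sym e) (trans (*-congʳ (sym (σ-ι N' (+ 2)))) (trans (sym (σ-* N' 2# γ)) (conj-cong (sym e))))) n02))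

      c : Carrier
      c = b * b1
      oc : O c
      oc = O-* ob ob1
      Tr-c : Tr c ≈ ((b * b1) + (b2 * b3)) + ((b1 * b2) + (b3 * b))
      Tr-c = +-cong (+-congˡ c̄) (+-cong (trans (σ-* τ b b1) (*-congˡ b1↑)) (trans (↑-cong c̄) (trans (σ-* τ b2 b3) (*-cong b2↑ b3↑))))
        where c̄ : c ̄ ≈ b2 * b3
              c̄ = σ-* N' b b1

      Tr-b : Tr b ≈ (b + b2) + (b1 + b3)
      Tr-b = +-congˡ (+-congˡ b2↑)

      -- Modulo 2 the product of c with each of its other conjugates contains b b̄ or its
      -- τ-conjugate, so c ≡ c² ≡ c · Tr c.
      2∣c : Tr c ≡ 0# [ 2# ] → 2# ∣ c
      2∣c d = ≡0⇒∣ (≡-trans (≡-sym (idem oc)) (≡-trans red (∣⇒≡0 (∣-*ˡ c (≡0⇒∣ d)))))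
        where
        red : (c * c) ≡ (c * Tr c) [ 2# ]
        red = ≡-sym (≡-trans (≡-reflexive (*-congˡ Tr-c)) (∣-resp (solve 4 (λ b b1 b2 b3 → (b :* b2) :* (b1 :* b3 :+ b1 :* b1) :+ (b1 :* b3) :* (b :* b) := (b :* b1) :* (((b :* b1) :+ (b2 :* b3)) :+ ((b1 :* b2) :+ (b3 :* b))) :- (b :* b1) :* (b :* b1)) refl b b1 b2 b3)
           (∣-+ (∣-*ʳ (b1 * b3 + b1 * b1) 2∣02) (∣-*ʳ (b * b) 2∣13))))

    record Norm2A (b : Carrier) : Set where
      field
        nb : Norm2 b
        2∣01 : 2# ∣ (b * b ↑)
      open Norm2 nb public

      2∣12 : 2# ∣ (b1 * b2)
      2∣12 = ∣-resp (trans (σ-* τ b b1) (*-congˡ b1↑)) (σ-∣ι uτ 2∣01)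
      2∣23 : 2# ∣ (b2 * b3)
      2∣23 = ∣-resp (trans (σ-* τ b1 b2) (*-cong b1↑ b2↑)) (σ-∣ι uτ 2∣12)
      2∣30 : 2# ∣ (b3 * b)
      2∣30 = ∣-resp (trans (σ-* τ b2 b3) (*-cong b2↑ b3↑)) (σ-∣ι uτ 2∣23)

      Tr-odd : Tr b ≡ 1# [ 2# ]
      Tr-odd = go (Tr-parity ob)
        where
        go : (Tr b ≡ 0# [ 2# ]) ⊎ (Tr b ≡ 1# [ 2# ]) → Tr b ≡ 1# [ 2# ]
        go (inj₂ d) = d
        go (inj₁ d) = ⊥-elim (2∤b (≡0⇒∣ (≡-trans (≡-sym (idem ob)) (≡-trans red (∣⇒≡0 (∣-*ˡ b (≡0⇒∣ d)))))))
          where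
          red : (b * b) ≡ (b * Tr b) [ 2# ]
          red = ≡-sym (≡-trans (≡-reflexive (*-congˡ Tr-b)) (∣-resp (solve 4 (λ b b1 b2 b3 → (b :* b2 :+ b :* b1) :+ b3 :* b := b :* ((b :+ b2) :+ (b1 :+ b3)) :- b :* b) refl b b1 b2 b3) (∣-+ (∣-+ 2∣02 2∣01) 2∣30)))

      -- The bᵢ are orthogonal idempotents modulo 2, and b₃ is primitive.
      place3 : ∀ {w} → O w → (2# ∣ (b3 * w)) ⊎ ((b3 * w) ≡ b3 [ 2# ])
      place3 {w} ow = go (Tr-parity (O-* ob3 ow))
        where
        Tr-x : Tr (b3 * w) ≈ (b3 * w + b1 * w ̄) + (b * w ↑ + b2 * (w ̄) ↑)
        Tr-x = +-cong (+-congˡ x̄) (+-cong (trans (σ-* τ b3 w) (*-congʳ b3↑)) (trans (↑-cong x̄) (trans (σ-* τ b1 (w ̄)) (*-congʳ b1↑))))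
          where x̄ : (b3 * w) ̄ ≈ b1 * w ̄
                x̄ = trans (σ-* N' b3 w) (*-congʳ b3̄)
        red : (b3 * w) ≡ (b3 * Tr (b3 * w)) [ 2# ]
        red = ≡-sym (≡-trans (≡-reflexive (*-congˡ Tr-x)) (≡-trans
           (∣-resp (solve 8 (λ b b1 b2 b3 w w1 w2 w3 → ((b1 :* b3) :* w2 :+ (b3 :* b) :* w1) :+ (b2 :* b3) :* w3 := b3 :* ((b3 :* w :+ b1 :* w2) :+ (b :* w1 :+ b2 :* w3)) :- (b3 :* b3) :* w) refl b b1 b2 b3 w (w ↑) (w ̄) ((w ̄) ↑))
              (∣-+ (∣-+ (∣-*ʳ (w ̄) 2∣13) (∣-*ʳ (w ↑) 2∣30)) (∣-*ʳ ((w ̄) ↑) 2∣23)))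
           (≡-* (idem ob3) ≡-refl)))
        go : (Tr (b3 * w) ≡ 0# [ 2# ]) ⊎ (Tr (b3 * w) ≡ 1# [ 2# ]) → (2# ∣ (b3 * w)) ⊎ ((b3 * w) ≡ b3 [ 2# ])
        go (inj₁ d) = inj₁ (≡0⇒∣ (≡-trans red (∣⇒≡0 (∣-*ˡ b3 (≡0⇒∣ d)))))
        go (inj₂ d) = inj₂ (≡-trans red (≡-trans (≡-* ≡-refl d) (≡-reflexive (*-identityʳ b3))))

    module TwoA {b b'} (nA : Norm2A b) (nA' : Norm2A b') (cg : b' ≡ b [ 2# ]) where
      open Norm2A nA
      open Norm2A nA' using () renaming (b1 to b'1; b2 to b'2; b3 to b'3; ob to ob'; n02 to n02'; n13 to n13'; ob1 to ob'1)

      u : Carrier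
      u = b' * b2
      ou : O u
      ou = O-* ob' ob2

      cg1 : b'1 ≡ b1 [ 2# ]
      cg1 = ↑-≡ cg
      cg2 : b'2 ≡ b2 [ 2# ]
      cg2 = conj-≡ cg
      cg3 : b'3 ≡ b3 [ 2# ]
      cg3 = conj-≡ cg1

      ∣Q* : ∀ {x y} → x ≈ Q * y → 2# ∣ y → 2# ^ suc m ∣ x
      ∣Q* e d = ∣-resp (trans (*-comm _ _) (sym e)) (∣-* d ∣-refl)

      -- Comparing 2-adic valuations at the four places, b b'₁ b₃ / 2^(m+1) would be an element of norm 2^(m-2).
      star : ∀ Ek → Ek ≡ b3 [ 2# ] → 2# ^ suc m ∣ (Ek * u) → ⊥
      star Ek E3 d = fin (unit2 F1 (suc m) X FX)
        where
        X = b * b'1 * b3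
        oX : O X
        oX = O-* (O-* ob ob'1) ob3
        -- The terms are congruent to the conjugates of b, whose sum Tr b is odd. By `unit2` the
        -- divisibility of X may be checked on F X term by term.
        F = (Ek ↑ + b'2') + (b1 + b'3)
          where b'2' = b2
        F1 : F ≡ 1# [ 2# ]
        F1 = ≡-trans (≡-+ (≡-+ (≡-trans (↑-≡ E3) (≡-reflexive b3↑)) ≡-refl) (≡-+ ≡-refl cg3)) (≡-trans (≡-reflexive (sym Tr-b)) Tr-odd)
        FX : 2# ^ suc m ∣ (F * X)
        FX = ∣-resp (solve 7 (λ e b b1 b2 b3 c1 c3 → ((e :* (c1 :* b3)) :* b :+ (b :* b2) :* (c1 :* b3)) :+ ((b1 :* b3) :* (b :* c1) :+ (c1 :* c3) :* (b3 :* b)) := ((e :+ b2) :+ (b1 :+ c3)) :* (b :* c1 :* b3)) refl (Ek ↑) b b1 b2 b3 b'1 b'3)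
          (∣-+ (∣-+ (∣-*ʳ b (∣-resp (trans (σ-* τ Ek u) (*-congˡ (trans (σ-* τ b' b2) (*-congˡ b2↑)))) (↑-2^∣ (suc m) d)))
                    (∣Q* (*-congʳ n02) (∣-≡ (≡-* (≡-sym cg1) ≡-refl) 2∣13)))
               (∣-+ (∣Q* (*-congʳ n13) (∣-≡ (≡-* ≡-refl (≡-sym cg1)) 2∣01)) (∣Q* (*-congʳ n13') 2∣30)))
        nX : X * X ̄ ≈ (Q * Q) * Q
        nX = trans (nrm-* (b * b'1) b3) (*-cong (trans (nrm-* b b'1) (*-cong n02 n13')) (nrm-conj n13))
        fin : 2# ^ suc m ∣ X → ⊥
        fin (divs γ e) = descend γ (O-pow (suc m) (O-resp e oX)) (pow-cancel m (pow-cancel m (begin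
          Q * (Q * (c# 4 * (γ * γ ̄))) ≈⟨ solve 3 (λ q g h → q :* (q :* (con (+ 4) :* (g :* h))) := ((con (+ 2) :* q) :* g) :* ((con (+ 2) :* q) :* h)) refl Q γ (γ ̄) ⟩
          (2# ^ suc m * γ) * (2# ^ suc m * γ ̄) ≈⟨ *-cong (sym e) (trans (*-congʳ (sym (conj-2^ (suc m)))) (trans (sym (σ-* N' _ γ)) (conj-cong (sym e)))) ⟩
          X * X ̄ ≈⟨ nX ⟩
          (Q * Q) * Q ≈⟨ *-assoc Q Q Q ⟩
          Q * (Q * Q) ∎)))
          where open RR

    module Kills {b b'} (nA : Norm2A b) (nA' : Norm2A b') (cg : b' ≡ b [ 2# ]) where
      open Norm2A nA
      open TwoA nA nA' cg
      open Norm2A nA' using () renaming (b2 to b'2; n02 to n02'; b2̄ to b'2̄)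
      private module Sw = TwoA nA' nA (≡-sym cg)

      uū : u * Sw.u ≈ Q * Q
      uū = trans (solve 4 (λ b b2 c c2 → (c :* b2) :* (b :* c2) := (b :* b2) :* (c :* c2)) refl b b2 b' b'2) (*-cong n02 n02')

      -- Modulo 2, `Ek` is the indicator of the place where b₃ is odd; `kill` thus stands for a
      -- valuation of u at least j at that place.
      record Kill (j : ℕ) : Set where
        field
          Ek : Carrier
          oE : O Ek
          E3 : Ek ≡ b3 [ 2# ]
          kill : 2# ^ j ∣ (Ek * u)

      -- By `place3` the cofactor w is even or odd at the place of b₃. If even, multiplying `Ek` by
      -- b₃ gains a power of 2. If odd, then since u times its counterpart is 2^(2m) and j < m, the
      -- counterpart would have valuation above m there, which `star` with b and b' exchanged
      -- excludes.
      step : ∀ j → j < m → Kill j → Kill (suc j)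
      step j j<m K = go (place3 ow)
        where
        open Kill K
        w = quo kill
        ow : O w
        ow = O-pow j (O-resp (eq kill) (O-* oE ou))
        r = m ∸ suc j
        go : (2# ∣ (b3 * w)) ⊎ ((b3 * w) ≡ b3 [ 2# ]) → Kill (suc j)
        go (inj₁ d) = record { Ek = b3 * Ek ; oE = O-* ob3 oE ; E3 = ≡-trans (≡-* ≡-refl E3) (idem ob3)
           ; kill = ∣-resp (trans (solve 3 (λ p b w → (b :* w) :* p := b :* (p :* w)) refl (2# ^ j) b3 w) (trans (*-congˡ (sym (eq kill))) (sym (*-assoc b3 Ek u)))) (∣-* d ∣-refl) }
        go (inj₂ d) = ⊥-elim (Sw.star (b3 * w) (≡-trans d (≡-sym cg3)) (divs (2# ^ r * (b3 * Ek)) (pow-cancel j (begin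
           2# ^ j * ((b3 * w) * Sw.u) ≈⟨ solve 4 (λ p b w v → p :* ((b :* w) :* v) := b :* ((p :* w) :* v)) refl (2# ^ j) b3 w Sw.u ⟩
           b3 * ((2# ^ j * w) * Sw.u) ≈⟨ *-congˡ (*-congʳ (sym (eq kill))) ⟩
           b3 * ((Ek * u) * Sw.u) ≈⟨ solve 4 (λ b e u v → b :* ((e :* u) :* v) := (b :* e) :* (u :* v)) refl b3 Ek u Sw.u ⟩
           (b3 * Ek) * (u * Sw.u) ≈⟨ *-congˡ uū ⟩
           (b3 * Ek) * (Q * Q) ≈⟨ *-congˡ (*-congˡ (trans (^-congʳ 2# (≡.sym (ℕP.m+[n∸m]≡n j<m))) (^-homo-* 2# (suc j) r))) ⟩
           (b3 * Ek) * (Q * ((2# * 2# ^ j) * 2# ^ r)) ≈⟨ solve 5 (λ x q p r t → x :* (q :* ((t :* p) :* r)) := p :* ((t :* q) :* (r :* x))) refl (b3 * Ek) Q (2# ^ j) (2# ^ r) 2# ⟩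
           2# ^ j * (2# ^ suc m * (2# ^ r * (b3 * Ek))) ∎))))
          where open RR

      abstract
        all : ∀ j → j ≤ m → Kill j
        all zero _ = record { Ek = b3 ; oE = ob3 ; E3 = ≡-refl ; kill = divs (b3 * u) (sym (*-identityˡ _)) }
        all (suc j) j<m = step j j<m (all j (ℕP.<⇒≤ j<m))

    -- b, b̄' and the two killing elements are congruent to the four conjugates of b and add up to 1
    -- modulo 2. Each sends b' b̄ into the multiples of 2^m: the first two through b b̄ and b' b̄',
    -- the others by construction.
    caseA : ∀ {b b'} → Norm2A b → Norm2A b' → b' ≡ b [ 2# ] → Q ∣ (b' * b ̄)
    caseA {b} {b'} nA nA' cg = unit2 F1 m u (∣-resp (solve 6 (λ b c b2 c2 f e → ((b :* b2) :* c :+ (c :* c2) :* b2) :+ (f :* (c :* b2) :+ e :* (c :* b2)) := ((b :+ c2) :+ (f :+ e)) :* (c :* b2)) refl b b' b2 b'2 (Kill.Ek K) (Kill'.Ek K' ̄))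
        (∣-+ (∣-+ (∣-*ʳ b' (divs 1# (trans n02 (sym (*-identityʳ Q))))) (∣-*ʳ b2 (divs 1# (trans n02' (sym (*-identityʳ Q))))))
             (∣-+ (Kill.kill K) (∣-resp (trans (σ-* N' _ _) (*-congˡ (trans (σ-* N' b b'2) (trans (*-congˡ b'2̄) (*-comm b2 b'))))) (conj-2^∣ m (Kill'.kill K'))))))
      where
      open Norm2A nA
      open Norm2A nA' using () renaming (b2 to b'2; n02 to n02'; b2̄ to b'2̄; b3 to b'3)
      open TwoA nA nA' cg using (u; cg2; cg3)
      module Lk = Kills nA nA' cg
      module Lk' = Kills nA' nA (≡-sym cg)
      module Kill = Lk.Kill
      module Kill' = Lk'.Kill
      K = Lk.all m ℕP.≤-refl
      K' = Lk'.all m ℕP.≤-refl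
      F1 : ((b + b'2) + (Kill.Ek K + Kill'.Ek K' ̄)) ≡ 1# [ 2# ]
      F1 = ≡-trans (≡-+ (≡-+ ≡-refl cg2) (≡-+ (Kill.E3 K) (≡-trans (conj-≡ (≡-trans (Kill'.E3 K') cg3)) (≡-reflexive b3̄))))
           (≡-trans (≡-reflexive (trans (+-congˡ (+-comm b3 b1)) (sym Tr-b))) Tr-odd)

    -- Modulo 2 the partition of 1 consists of the conjugates of c = b · σ_τ b, with b̄ replaced by
    -- b̄' where useful; each product with b' b̄ then contains b b̄ or b' b̄'.
    caseB : ∀ {b b'} (n : Norm2 b) → Norm2 b' → b' ≡ b [ 2# ] → Tr (Norm2.c n) ≡ 1# [ 2# ] → Q ∣ (b' * b ̄)
    caseB {b} {b'} n n' cg t = unit2 F1 m (b' * b2) (∣-resp (solve 6 (λ b b1 b2 b3 c c2 → (b :* b2) :* (c :* (b1 :+ b3)) :+ (c :* c2) :* (b2 :* (b1 :+ b3)) := ((b :* b1 :+ c2 :* b3) :+ (b1 :* c2 :+ b3 :* b)) :* (c :* b2)) refl b b1 b2 b3 b' b'2)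
        (∣-+ (∣-*ʳ (b' * (b1 + b3)) (divs 1# (trans n02 (sym (*-identityʳ Q))))) (∣-*ʳ (b2 * (b1 + b3)) (divs 1# (trans n02' (sym (*-identityʳ Q)))))))
      where
      open Norm2 n
      open Norm2 n' using () renaming (b2 to b'2; n02 to n02')
      F1 : ((b * b1 + b'2 * b3) + (b1 * b'2 + b3 * b)) ≡ 1# [ 2# ]
      F1 = ≡-trans (≡-+ (≡-+ ≡-refl (≡-* (conj-≡ cg) ≡-refl)) (≡-+ (≡-* ≡-refl (conj-≡ cg)) ≡-refl)) (≡-trans (≡-reflexive (sym Tr-c)) t)

    Q∣ : ∀ {b b'} → Norm2 b → Norm2 b' → b' ≡ b [ 2# ] → Q ∣ (b' * b ̄)
    Q∣ {b} {b'} n n' cg = go (Tr-parity (Norm2.oc n))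
      where
      go : (Tr (Norm2.c n) ≡ 0# [ 2# ]) ⊎ (Tr (Norm2.c n) ≡ 1# [ 2# ]) → Q ∣ (b' * b ̄)
      go (inj₂ t) = caseB n n' cg t
      go (inj₁ t) = caseA (record { nb = n ; 2∣01 = d }) (record { nb = n' ; 2∣01 = ∣-≡ (≡-sym (≡-* cg (↑-≡ cg))) d }) cg
        where d = Norm2.2∣c n t

    -- The quotient ε = b' b̄ / 2^m lies in the decomposition ring and has norm 1. Idempotence gives
    -- ε = ε² ε̄ ≡ ε ε̄ = 1 modulo 2, and `NormOne` leaves only ±1.
    rigid : ∀ {b b'} → Norm2 b → Norm2 b' → b' ≡ b [ 2# ] → b' ≈± b
    rigid {b} {b'} n n' cg = go (Q∣ n n' cg)
      where
      open Norm2 n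
      module n' = Norm2 n'
      go : Q ∣ (b' * b2) → b' ≈± b
      go (divs ε e) = fin (NormOne.two ε nε 2 (s≤s z≤n) ε1 ≡.refl)
        where
        oε : O ε
        oε = O-pow m (O-resp e (O-* n'.ob ob2))
        nε : ε * ε ̄ ≈ 1#
        nε = pow-cancel m (pow-cancel m (begin
          Q * (Q * (ε * ε ̄)) ≈⟨ solve 3 (λ q g h → q :* (q :* (g :* h)) := (q :* g) :* (q :* h)) refl Q ε (ε ̄) ⟩
          (Q * ε) * (Q * ε ̄) ≈⟨ *-cong (sym e) (trans (*-congʳ (sym (conj-2^ m))) (trans (sym (σ-* N' _ ε)) (conj-cong (sym e)))) ⟩
          (b' * b2) * (b' * b2) ̄ ≈⟨ trans (nrm-* b' b2) (*-cong n'.n02 (nrm-conj n02)) ⟩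
          Q * Q ≈⟨ *-congˡ (sym (*-identityʳ Q)) ⟩
          Q * (Q * 1#) ∎))
          where open RR
        ε1 : ε ≡ 1# [ 2# ]
        ε1 = ≡-trans (≡-reflexive (trans (sym (*-identityʳ ε)) (trans (*-congˡ (sym nε)) (sym (*-assoc _ _ _))))) (≡-trans (≡-* (idem oε) ≡-refl) (≡-reflexive nε))
        b'≈ : b' ≈ ε * b
        b'≈ = pow-cancel m (trans (*-comm Q b') (trans (*-congˡ (trans (sym n02) (*-comm b b2))) (trans (sym (*-assoc b' b2 b)) (trans (*-congʳ e) (*-assoc Q ε b)))))
        fin : ε ≈± 1# → b' ≈± b
        fin (inj₁ x) = inj₁ (trans b'≈ (trans (*-congʳ x) (*-identityˡ b)))
        fin (inj₂ x) = inj₂ (trans b'≈ (trans (*-congʳ x) (trans (sym (-‿distribˡ-* 1# b)) (-‿cong (*-identityˡ b)))))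

    -- Elements of norm 2^m in the whole cyclotomic ring

    f' : ℕ
    f' = f ∸ 1
    sf' : suc f' ≡ f
    sf' = ℕP.m+[n∸m]≡n f>0

    ζ2f : ζ ^ (2 ℕ.^ suc f') ≈ ζ
    ζ2f = trans (^-congʳ ζ (cong (2 ℕ.^_) sf')) (trans (sym (ζ% (2 ℕ.^ f))) (trans (^-congʳ ζ (≡ᶻ⇒% {N} (2 ℕ.^ f) 1 (≡.subst (λ z → z ≡ᶻ 1ℤ [ N ]) (≡.sym (pos-^ 2 f)) 2^f))) (trans (ζ% 1) (*-identityʳ ζ))))

    open Two u2 f' ζ2f using (pow2f; local2)

    -- If y is a norm-one element η times something fixed by σ₂, then σ₂η = ±η² makes σ₂y / y equal
    -- to ±η. The quotient ε = σ₂y / y is therefore itself the unit to divide by, and `local2` makes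
    -- it integral.
    module Twist {y : Carrier} (ny : y * y ̄ ≈ Q) where
      dv : Q ∣ (σ 2 y * y ̄)
      dv = local2 m y (y ̄) (divs 1# (trans ny (sym (*-identityʳ Q))))

      ε β : Carrier
      ε = quo dv
      β = ε ̄ * y

      nσy : σ 2 y * (σ 2 y) ̄ ≈ Q
      nσy = trans (nrm-σ u2 {y} {+ (2 ℕ.^ m)} (trans ny (sym (c#-^ 2 m)))) (c#-^ 2 m)

      σy : σ 2 y ≈ ε * y
      σy = pow-cancel m (trans (*-comm Q (σ 2 y)) (trans (*-congˡ (trans (sym ny) (*-comm y (y ̄)))) (trans (sym (*-assoc (σ 2 y) (y ̄) y)) (trans (*-congʳ (eq dv)) (*-assoc Q ε y)))))

      nε : ε * ε ̄ ≈ 1#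
      nε = pow-cancel m (trans (*-comm Q _) (trans (*-congˡ (sym ny)) (trans (sym (nrm-* ε y)) (trans (*-cong (sym σy) (conj-cong (sym σy))) (trans nσy (sym (*-identityʳ Q)))))))

      nβ : β * β ̄ ≈ Q
      nβ = trans (nrm-* (ε ̄) y) (trans (*-cong (nrm-conj nε) ny) (*-identityˡ Q))

      y≈ : y ≈ ε * β
      y≈ = sym (trans (sym (*-assoc ε (ε ̄) y)) (trans (*-congʳ nε) (*-identityˡ y)))

      σβ± : σ 2 β ≈± β
      σβ± = go (σ-± unit-N' (σ-prime-pow nε prime[2] u2))
        where
        e : σ 2 β ≈ (σ 2 ε) ̄ * (ε * y)
        e = trans (σ-* 2 (ε ̄) y) (*-cong (σ-comm u2 unit-N' ε) σy)
        ε̄² : (ε ^ 2) ̄ ≈ ε ̄ * ε ̄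
        ε̄² = trans (σ-^ unit-N' ε 2) (*-congˡ (*-identityʳ (ε ̄)))
        e' : (ε ^ 2) ̄ * (ε * y) ≈ β
        e' = trans (*-congʳ ε̄²) (trans (solve 3 (λ e f y → (f :* f) :* (e :* y) := (e :* f) :* (f :* y)) refl ε (ε ̄) y) (trans (*-congʳ nε) (*-identityˡ β)))
        go : (σ 2 ε) ̄ ≈± (ε ^ 2) ̄ → σ 2 β ≈± β
        go (inj₁ h) = inj₁ (trans e (trans (*-congʳ h) e'))
        go (inj₂ h) = inj₂ (trans e (trans (*-congʳ h) (trans (sym (-‿distribˡ-* ((ε ^ 2) ̄) (ε * y))) (-‿cong e'))))

      -- If σ₂ negated β, then S₁β, with S₁ also negated, would be fixed by σ₂ and have norm p₁ 2^m,
      -- which `noneg` excludes.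
      oβ : O β
      oβ = go σβ±
        where
        go : σ 2 β ≈± β → O β
        go (inj₁ h) = h
        go (inj₂ h) = ⊥-elim (noneg m (S₁ * β) (trans (σ-* 2 S₁ β) (trans (*-cong σ₂S₁ h) (solve 2 (λ s b → (:- s) :* (:- b) := s :* b) refl S₁ β)))
           (trans (nrm-* S₁ β) (trans (*-cong nS₁ (trans nβ (sym (c#-^ 2 m)))) (sym (ι-* (+ p₁) (+ (2 ℕ.^ m)))))))
          where
          nS₁ : S₁ * S₁ ̄ ≈ c# p₁
          nS₁ = trans (*-congˡ S̄₁) (trans (sym (-‿distribʳ-* S₁ S₁)) (trans (-‿cong S₁²) (-‿involutive (c# p₁))))

      norm2 : Norm2 β
      norm2 = record { ob = oβ ; n02 = nβ }

      -- Raising y = ε β to the power 2^f - 1 turns ε into 1 modulo 2 and leaves the idempotent β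
      -- unchanged. Hence β modulo 2 depends only on y modulo 2.
      β≡ : β ≡ (y ^ (2 ℕ.^ suc f' ∸ 1)) [ 2# ]
      β≡ = go (2 ℕ.^ suc f') (ℕP.m^n>0 2 (suc f')) (ℕP.^-monoʳ-≤ 2 {1} {suc f'} (s≤s z≤n)) (pow2f ε)
        where
        β^ : ∀ j → (β ^ suc j) ≡ β [ 2# ]
        β^ zero = ≡-reflexive (*-identityʳ β)
        β^ (suc j) = ≡-trans (≡-* ≡-refl (β^ j)) (idem oβ)
        go : ∀ n → 0 < n → 2 ≤ n → (ε ^ n) ≡ ε [ 2# ] → β ≡ (y ^ (n ∸ 1)) [ 2# ]
        go (suc (suc n)) _ (s≤s (s≤s _)) h = ≡-sym (≡-trans (≡-reflexive (trans (^-congˡ (suc n) y≈) (^-distrib-* ε β (suc n)))) (≡-trans (≡-* ε1 (β^ n)) (≡-reflexive (*-identityˡ β))))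
          where
          ε1 : (ε ^ suc n) ≡ 1# [ 2# ]
          ε1 = ≡-trans (≡-reflexive (sym (trans (sym (*-assoc (ε ̄) ε _)) (trans (*-congʳ (trans (*-comm (ε ̄) ε) nε)) (*-identityˡ _))))) (≡-trans (≡-* (≡-refl {x = ε ̄}) h) (≡-reflexive (trans (*-comm (ε ̄) ε) nε)))

    -- σ_t ρ = ± ρ^t for units t, so ρ^τ and ρ have the same annihilators modulo 2.
    spread : ∀ {ρ} → ρ * ρ ̄ ≈ 1# → ∀ {w} → (ρ * w) ≡ w [ 2# ] → (ρ * w ↑) ≡ (w ↑) [ 2# ]
    spread {ρ} nρ {w} h = ≡-trans (≡-* back ≡-refl) (pow inv)
      where
      open UnitMod uτ
      pos : 0 < τ ℕ.* inv
      pos = ≡.subst (0 <_) (≡.sym inv-eq) (s≤s z≤n)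
      posτ : ∀ t → 0 < t ℕ.* inv → 0 < t
      posτ (suc t) _ = s≤s z≤n
      uti : Unit (τ ℕ.* inv)
      uti = unit-* uτ (unit τ wit (≡.trans (ℕP.*-comm inv τ) inv-eq))
      back : ρ ≡ (ρ ^ (τ ℕ.* inv)) [ 2# ]
      back = ±-≡2 (±-trans (inj₁ (sym (σ-is-id uti (trans (ζ-mod (τ ℕ.* inv) 1 wit inv-eq) (*-identityʳ ζ)) ρ))) (σ-pow nρ (τ ℕ.* inv) pos uti))
      one : (ρ ^ τ * w ↑) ≡ (w ↑) [ 2# ]
      one = ≡-trans (≡-* (≡-sym (±-≡2 (σ-pow nρ τ (posτ τ pos) uτ))) ≡-refl) (≡-trans (≡-reflexive (sym (σ-* τ ρ w))) (↑-≡ h))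
      pows : ∀ i → ((ρ ^ τ) ^ i * w ↑) ≡ (w ↑) [ 2# ]
      pows zero = ≡-reflexive (*-identityˡ _)
      pows (suc i) = ≡-trans (≡-reflexive (*-assoc (ρ ^ τ) ((ρ ^ τ) ^ i) (w ↑))) (≡-trans (≡-* ≡-refl (pows i)) one)
      pow : ∀ i → (ρ ^ (τ ℕ.* i) * w ↑) ≡ (w ↑) [ 2# ]
      pow i = ≡-trans (≡-reflexive (*-congʳ (sym (^-assocʳ ρ τ i)))) (pows i)

    spread-Tr : ∀ {ρ} → ρ * ρ ̄ ≈ 1# → ∀ {w} → O w → (ρ * w) ≡ w [ 2# ] → (ρ * Tr w) ≡ Tr w [ 2# ]
    spread-Tr {ρ} nρ {w} ow h = ≡-trans (≡-reflexive (solve 5 (λ r a b c d → r :* ((a :+ b) :+ (c :+ d)) := (r :* a :+ r :* b) :+ (r :* c :+ r :* d)) refl ρ w (w ̄) (w ↑) ((w ̄) ↑)))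
        (≡-+ (≡-+ h h̄) (≡-+ (spread nρ h) (spread nρ h̄)))
      where h̄ : (ρ * w ̄) ≡ (w ̄) [ 2# ]
            h̄ = ≡-trans (≡-* ≡-refl (≡-reflexive (sym (ττ̄ ow)))) (≡-trans (spread nρ (spread nρ h)) (≡-reflexive (ττ̄ ow)))

    -- If ρ fixes β modulo 2, it fixes c = β · σ_τ β too, and by `spread-Tr` the traces of both. One
    -- of these is odd, so ρ ≡ 1 modulo 2 and `NormOne` applies.
    trivial-twist : ∀ {ρ β} → ρ * ρ ̄ ≈ 1# → Norm2 β → (ρ * β) ≡ β [ 2# ] → ρ ≈± 1#
    trivial-twist {ρ} {β} nρ n h = NormOne.two ρ nρ 2 (s≤s z≤n) (go (Tr-parity oc)) ≡.refl
      where
      open Norm2 n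
      fin : ∀ {w} → O w → (ρ * w) ≡ w [ 2# ] → Tr w ≡ 1# [ 2# ] → ρ ≡ 1# [ 2# ]
      fin ow hw t = ≡-trans (≡-reflexive (sym (*-identityʳ ρ))) (≡-trans (≡-* ≡-refl (≡-sym t)) (≡-trans (spread-Tr nρ ow hw) t))
      go : (Tr c ≡ 0# [ 2# ]) ⊎ (Tr c ≡ 1# [ 2# ]) → ρ ≡ 1# [ 2# ]
      go (inj₁ t) = fin ob h (Norm2A.Tr-odd (record { nb = n ; 2∣01 = 2∣c t }))
      go (inj₂ t) = fin oc (≡-trans (≡-reflexive (sym (*-assoc ρ β b1))) (≡-* h ≡-refl)) t

    sign₂ : ∀ {y y'} → y * y ̄ ≈ Q → y' * y' ̄ ≈ Q → y' ≡ y [ 2# ] → y' ≈± y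
    sign₂ {y} {y'} ny ny' cg = go (rigid T.norm2 T'.norm2 cgβ)
      where
      module T = Twist ny
      module T' = Twist ny'
      cgβ : T'.β ≡ T.β [ 2# ]
      cgβ = ≡-trans T'.β≡ (≡-trans (≡-^ (2 ℕ.^ suc f' ∸ 1) cg) (≡-sym T.β≡))
      ρ : Carrier
      ρ = T'.ε * T.ε ̄
      nρ : ρ * ρ ̄ ≈ 1#
      nρ = trans (nrm-* T'.ε (T.ε ̄)) (trans (*-cong T'.nε (nrm-conj T.nε)) (*-identityˡ 1#))
      ρβ : (ρ * T.β) ≡ T.β [ 2# ]
      ρβ = ≡-trans (≡-reflexive (solve 3 (λ e f b → (e :* f) :* b := f :* (e :* b)) refl T'.ε (T.ε ̄) T.β))
          (≡-* (≡-refl {x = T.ε ̄}) (≡-trans (≡-* ≡-refl (≡-sym cgβ)) (≡-trans (≡-reflexive (sym T'.y≈)) cg)))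
      ρ± : ρ ≈± 1#
      ρ± = trivial-twist nρ T.norm2 ρβ
      ρy : T'.ε * T.β ≈ ρ * y
      ρy = sym (*-assoc T'.ε (T.ε ̄) y)
      go : T'.β ≈± T.β → y' ≈± y
      go h = ±-trans (inj₁ T'.y≈) (±-trans (±-*ˡ T'.ε h) (±-trans (inj₁ (trans ρy (*-comm ρ y))) (±-trans (±-*ˡ y ρ±) (inj₁ (*-identityʳ y)))))

    -- From norm (2N)^m to norm 2^m

    k₁ k₂ : ℕ
    k₁ = suc e₁' ℕ.* m
    k₂ = suc e₂' ℕ.* m

    P₁ P₂ SS : Carrier
    P₁ = c# p₁ ^ k₁
    P₂ = c# p₂ ^ k₂
    SS = S₁ ^ k₁ * S₂ ^ k₂

    nSS : SS * SS ̄ ≈ P₁ * P₂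
    nSS = trans (nrm-* _ _) (*-cong (trans (nrm-^ S₁ k₁) (^-congˡ k₁ (trans (*-congˡ S̄₁) (trans (sym (-‿distribʳ-* S₁ S₁)) (trans (-‿cong S₁²) (-‿involutive (c# p₁)))))))
       (trans (nrm-^ S₂ k₂) (^-congˡ k₂ (trans (*-congˡ S̄₂) S₂²))))

    conj-c#^ : ∀ n j → (c# n ^ j) ̄ ≈ c# n ^ j
    conj-c#^ n j = trans (σ-^ unit-N' (c# n) j) (^-congˡ j (σ-ι N' (+ n)))

    c#^-cancel : ∀ n j {x y} → 0 < n → c# n ^ j * x ≈ c# n ^ j * y → x ≈ y
    c#^-cancel n zero _ e = trans (sym (*-identityˡ _)) (trans e (*-identityˡ _))
    c#^-cancel n (suc j) p e = c#^-cancel n j p (c#-cancel n p (trans (sym (*-assoc _ _ _)) (trans e (*-assoc _ _ _))))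

    P-cancel : ∀ {x y} → (P₁ * P₂) * x ≈ (P₁ * P₂) * y → x ≈ y
    P-cancel e = c#^-cancel p₂ k₂ 0<p₂ (c#^-cancel p₁ k₁ 0<p₁ (trans (sym (*-assoc _ _ _)) (trans e (*-assoc _ _ _))))

    -- The product of powers of Gauss sums `SS` has norm N^m, so α · SS has norm 2^m N^(2m); the
    -- local lemmas at p₁ and p₂ extract the full factor N^m and leave norm 2^m.
    reduce : ∀ α → α * α ̄ ≈ Q * (P₁ * P₂) → ∃ λ y → (α * SS ≈ (P₁ * P₂) * y) × (y * y ̄ ≈ Q)
    reduce α nα = step₁ (local₁ k₁ x (divs (Q * (P₂ * P₂)) (trans nx (trans (solve 3 (λ q a b → (q :* (a :* b)) :* (a :* b) := (a :* a) :* (q :* (b :* b))) refl Q P₁ P₂) (*-congʳ (sym (^-homo-* (c# p₁) k₁ k₁)))))))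
      where
      x = α * SS
      nx : x * x ̄ ≈ (Q * (P₁ * P₂)) * (P₁ * P₂)
      nx = trans (nrm-* α SS) (*-cong nα nSS)
      step₁ : P₁ ∣ x → ∃ λ y → (x ≈ (P₁ * P₂) * y) × (y * y ̄ ≈ Q)
      step₁ (divs x' e) = step₂ (local₂ k₂ x' (divs Q (trans nx' (trans (*-comm Q (P₂ * P₂)) (*-congʳ (sym (^-homo-* (c# p₂) k₂ k₂)))))))
        where
        nx' : x' * x' ̄ ≈ Q * (P₂ * P₂)
        nx' = c#^-cancel p₁ k₁ 0<p₁ (c#^-cancel p₁ k₁ 0<p₁ (trans (solve 3 (λ p a b → p :* (p :* (a :* b)) := (p :* a) :* (p :* b)) refl P₁ x' (x' ̄))
           (trans (*-cong (sym e) (trans (*-congʳ (sym (conj-c#^ p₁ k₁))) (trans (sym (σ-* N' P₁ x')) (conj-cong (sym e))))) (trans nx (solve 3 (λ q a b → (q :* (a :* b)) :* (a :* b) := a :* (a :* (q :* (b :* b)))) refl Q P₁ P₂)))))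
        step₂ : P₂ ∣ x' → ∃ λ y → (x ≈ (P₁ * P₂) * y) × (y * y ̄ ≈ Q)
        step₂ (divs y e') = y , trans e (trans (*-congˡ e') (sym (*-assoc P₁ P₂ y)))
          , c#^-cancel p₂ k₂ 0<p₂ (c#^-cancel p₂ k₂ 0<p₂ (trans (solve 3 (λ p a b → p :* (p :* (a :* b)) := (p :* a) :* (p :* b)) refl P₂ y (y ̄))
           (trans (*-cong (sym e') (trans (*-congʳ (sym (conj-c#^ p₂ k₂))) (trans (sym (σ-* N' P₂ y)) (conj-cong (sym e'))))) (trans nx' (solve 2 (λ q b → q :* (b :* b) := b :* (b :* q)) refl Q P₂)))))

    odd≡1 : ∀ n j → n ≡ 1 ℕ.+ 2 ℕ.* j → c# n ≡ 1# [ 2# ]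
    odd≡1 n j ≡.refl = divs (c# j) (trans (+-congʳ (trans (c#-suc (2 ℕ.* j)) (+-congˡ (c#-* 2 j)))) (solve 2 (λ o x → (o :+ con (+ 2) :* x) :- o := con (+ 2) :* x) refl 1# (c# j)))

    c#p₁≡1 : c# p₁ ≡ 1# [ 2# ]
    c#p₁≡1 = odd≡1 p₁ (1 ℕ.+ 4 ℕ.* a) (≡.trans p₁≡ (S'.solve 1 (λ a → S'.con 3 S'.:+ S'.con 8 S'.:* a S'.:= S'.con 1 S'.:+ S'.con 2 S'.:* (S'.con 1 S'.:+ S'.con 4 S'.:* a)) ≡.refl a))

    c#p₂≡1 : c# p₂ ≡ 1# [ 2# ]
    c#p₂≡1 = odd≡1 p₂ (4 ℕ.* b) (≡.trans p₂≡ (cong suc (ℕP.*-assoc 2 4 b)))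

    P≡1 : (P₁ * P₂) ≡ 1# [ 2# ]
    P≡1 = ≡-trans (≡-* (≡-trans (≡-^ k₁ c#p₁≡1) (≡-reflexive (1^ k₁))) (≡-trans (≡-^ k₂ c#p₂≡1) (≡-reflexive (1^ k₂)))) (≡-reflexive (*-identityˡ 1#))

    cancel-odd : ∀ {F x y} → F ≡ 1# [ 2# ] → (F * x) ≡ (F * y) [ 2# ] → x ≡ y [ 2# ]
    cancel-odd {F} {x} {y} F1 h = ≡-trans (≡-sym (one x)) (≡-trans h (one y))
      where one : ∀ z → (F * z) ≡ z [ 2# ]
            one z = ≡-trans (≡-* F1 ≡-refl) (≡-reflexive (*-identityˡ z))

    c#2N^m : c# ((2 ℕ.* N) ℕ.^ m) ≈ Q * (P₁ * P₂)
    c#2N^m = trans (c#-^ (2 ℕ.* N) m) (trans (^-congˡ m (c#-* 2 N)) (trans (^-distrib-* 2# (c# N) m) (*-congˡ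
       (trans (^-congˡ m (trans (ι-cong (cong +_ N≡)) (trans (c#-* (p₁ ℕ.^ suc e₁') (p₂ ℕ.^ suc e₂')) (*-cong (c#-^ p₁ (suc e₁')) (c#-^ p₂ (suc e₂'))))))
        (trans (^-distrib-* (c# p₁ ^ suc e₁') (c# p₂ ^ suc e₂') m) (*-cong (^-assocʳ (c# p₁) (suc e₁') m) (^-assocʳ (c# p₂) (suc e₂') m)))))))

    sign : ∀ {α α'} → α * α ̄ ≈ c# ((2 ℕ.* N) ℕ.^ m) → α' * α' ̄ ≈ c# ((2 ℕ.* N) ℕ.^ m) → α' ≡ α [ 2# ] → α' ≈± α
    sign {α} {α'} n n' cg = go (reduce α (trans n c#2N^m)) (reduce α' (trans n' c#2N^m))
      where
      go : (∃ λ y → (α * SS ≈ (P₁ * P₂) * y) × (y * y ̄ ≈ Q)) → (∃ λ y → (α' * SS ≈ (P₁ * P₂) * y) × (y * y ̄ ≈ Q)) → α' ≈± α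
      go (y , e , ny) (y' , e' , ny') = fin (sign₂ ny ny' (cancel-odd P≡1 (≡-trans (≡-reflexive (sym e')) (≡-trans (≡-* cg ≡-refl) (≡-reflexive e)))))
        where
        back : ∀ {x} → (x * SS) * SS ̄ ≈ (P₁ * P₂) * x
        back {x} = trans (*-assoc x SS (SS ̄)) (trans (*-congˡ nSS) (*-comm x _))
        fin : y' ≈± y → α' ≈± α
        fin (inj₁ h) = inj₁ (P-cancel (trans (sym back) (trans (*-congʳ (trans e' (trans (*-congˡ h) (sym e)))) back)))
        fin (inj₂ h) = inj₂ (P-cancel (trans (sym back) (trans (*-congʳ (trans e' (trans (*-congˡ h) (trans (sym (-‿distribʳ-* _ y)) (-‿cong (sym e)))))) (trans (sym (-‿distribˡ-* _ (SS ̄))) (trans (-‿cong back) (-‿distribʳ-* _ α))))))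

    -- Fourier transforms of unimodular functions

    q : ℕ
    q = 2 ℕ.* N

    c#N≡1 : c# N ≡ 1# [ 2# ]
    c#N≡1 = ≡-trans (≡-reflexive (trans (ι-cong (cong +_ N≡)) (trans (c#-* (p₁ ℕ.^ suc e₁') (p₂ ℕ.^ suc e₂')) (*-cong (c#-^ p₁ (suc e₁')) (c#-^ p₂ (suc e₂'))))))
      (≡-trans (≡-* (≡-trans (≡-^ (suc e₁') c#p₁≡1) (≡-reflexive (1^ (suc e₁')))) (≡-trans (≡-^ (suc e₂') c#p₂≡1) (≡-reflexive (1^ (suc e₂'))))) (≡-reflexive (*-identityˡ 1#)))

    c#N^≡1 : ∀ j → (c# N ^ j) ≡ 1# [ 2# ]
    c#N^≡1 j = ≡-trans (≡-^ j c#N≡1) (≡-reflexive (1^ j))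

    N-odd : ∃ λ j → N ≡ suc (j ℕ.+ j)
    N-odd = go (parity N)
      where
      go : (∃ λ j → N ≡ j ℕ.+ j) ⊎ (∃ λ j → N ≡ suc (j ℕ.+ j)) → ∃ λ j → N ≡ suc (j ℕ.+ j)
      go (inj₂ h) = h
      go (inj₁ (j , e)) = ⊥-elim (2∤1 (∣-≡ c#N≡1 (divs (c# j) (trans (ι-cong (cong +_ e)) (trans (ι-+ (+ j) (+ j)) (solve 1 (λ x → x :+ x := con (+ 2) :* x) refl (c# j)))))))

    -1^odd# : ∀ j → -1# ^ suc (2 ℕ.* j) ≈ -1#
    -1^odd# j = trans (*-congˡ (-1^2n j)) (*-identityʳ -1#)

    -1^N : -1# ^ N ≈ -1#
    -1^N = trans (^-congʳ -1# (≡.trans (proj₂ N-odd) (cong (λ z → suc (proj₁ N-odd ℕ.+ z)) (≡.sym (ℕP.+-identityʳ (proj₁ N-odd)))))) (-1^odd# (proj₁ N-odd))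

    -1^≡1 : ∀ j → (-1# ^ j) ≡ 1# [ 2# ]
    -1^≡1 j = ≡-trans (≡-^ j (divs -1# (solve 1 (λ o → (:- o) :- o := con (+ 2) :* (:- o)) refl 1#))) (≡-reflexive (1^ j))

    -- As N is odd, -ζ serves as the primitive root of unity of order 2N inside the same ring; θ is
    -- its inverse.
    ω θ : Carrier
    ω = - ζ
    θ = ω ^ (q ∸ 1)

    ω^ : ∀ n → ω ^ n ≈ -1# ^ n * ζ ^ n
    ω^ n = trans (^-congˡ n (trans (-‿cong (sym (*-identityˡ ζ))) (-‿distribˡ-* 1# ζ))) (^-distrib-* -1# ζ n)

    ω^N : ω ^ N ≈ -1#
    ω^N = trans (ω^ N) (trans (*-cong -1^N ζ^N) (*-identityʳ -1#))

    ω^q : ω ^ q ≈ 1#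
    ω^q = trans (ω^ q) (trans (*-cong (-1^2n N) (ζ^kN 2)) (*-identityʳ 1#))

    ωω̄ : ω * ω ̄ ≈ 1#
    ωω̄ = trans (nrm-neg ζ) (trans (*-cong (sym (*-identityʳ ζ)) (conj-cong (sym (*-identityʳ ζ)))) (conj-ζ^ 1))

    θ≈ : θ ≈ ω ̄
    θ≈ = trans (sym (*-identityˡ θ)) (trans (*-congʳ (trans (sym ωω̄) (*-comm ω (ω ̄)))) (trans (*-assoc (ω ̄) ω θ) (trans (*-congˡ ω^q) (*-identityʳ _))))

    θθ̄ : θ * θ ̄ ≈ 1#
    θθ̄ = trans (*-cong θ≈ (conj-cong θ≈)) (nrm-conj ωω̄)

    θ^N : θ ^ N ≈ -1#
    θ^N = trans (^-congˡ N θ≈) (trans (sym (σ-^ unit-N' ω N)) (trans (conj-cong ω^N) (trans (σ-neg unit-N' 1#) (-‿cong (σ-1 unit-N')))))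

    σ-Σᵥ : ∀ {a} → Unit a → ∀ n d g → σ a (Σᵥ n d g) ≈ Σᵥ n d (λ v → σ a (g v))
    σ-Σᵥ ua n zero g = refl
    σ-Σᵥ ua n (suc d) g = trans (σ-∑ ua n _) (∑<-cong n (λ i _ → σ-Σᵥ ua n d (λ v → g (i ∷ v))))

    infixl 6 _⊕_
    _⊕_ : ∀ {d} → Vec ℕ d → Vec ℕ d → Vec ℕ d
    _⊕_ = Vec.zipWith (λ l s → l ℕ.+ N ℕ.* s)

    ⊕-· : ∀ {d} (l s x : Vec ℕ d) → (l ⊕ s) · x ≡ l · x ℕ.+ N ℕ.* (s · x)
    ⊕-· [] [] [] = ≡.sym (ℕP.*-zeroʳ N)
    ⊕-· (l ∷ ls) (s ∷ ss) (x ∷ xs) = ≡.trans (cong ((l ℕ.+ N ℕ.* s) ℕ.* x ℕ.+_) (⊕-· ls ss xs))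
      (S'.solve 6 (λ l n s x a b → (l S'.:+ n S'.:* s) S'.:* x S'.:+ (a S'.:+ n S'.:* b) S'.:= (l S'.:* x S'.:+ a) S'.:+ n S'.:* (s S'.:* x S'.:+ b)) ≡.refl l N s x (ls · xs) (ss · xs))

    doubled-· : ∀ {d} (l x : Vec ℕ d) → doubled l · doubled x ≡ 4 ℕ.* (l · x)
    doubled-· [] [] = ≡.refl
    doubled-· (l ∷ ls) (x ∷ xs) = ≡.trans (cong ((2 ℕ.* l) ℕ.* (2 ℕ.* x) ℕ.+_) (doubled-· ls xs))
      (S'.solve 3 (λ l x a → (S'.con 2 S'.:* l) S'.:* (S'.con 2 S'.:* x) S'.:+ S'.con 4 S'.:* a S'.:= S'.con 4 S'.:* (l S'.:* x S'.:+ a)) ≡.refl l x (ls · xs))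

    sum-± : ∀ n d a (g : Vec ℕ d → Carrier) → (∀ s → g s ≈± a) → ∃ λ j → Σᵥ n d g ≈ ι j * a
    sum-± n zero a g h = go (h [])
      where
      go : g [] ≈± a → ∃ λ j → g [] ≈ ι j * a
      go (inj₁ e) = 1ℤ , trans e (sym (trans (*-congʳ ι-1) (*-identityˡ a)))
      go (inj₂ e) = ℤ.- 1ℤ , trans e (sym (trans (*-congʳ (trans (ι-neg 1ℤ) (-‿cong ι-1))) (trans (sym (-‿distribˡ-* 1# a)) (-‿cong (*-identityˡ a)))))
    sum-± n (suc d) a g h = go n
      where
      go : ∀ n' → ∃ λ j → ∑< n' (λ i → Σᵥ n d (λ v → g (i ∷ v))) ≈ ι j * a
      go zero = 0ℤ , sym (trans (*-congʳ ι-0) (zeroˡ a))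
      go (suc n') = proj₁ (go n') ℤ.+ proj₁ r , trans (+-cong (proj₂ (go n')) (proj₂ r)) (sym (trans (*-congʳ (ι-+ _ _)) (distribʳ a _ _)))
        where r = sum-± n d a (λ v → g (n' ∷ v)) (λ s → h (n' ∷ s))

    unit-cancel-∣ : ∀ {c} → Unit c → ∀ j → N ℕD.∣ c ℕ.* j → N ℕD.∣ j
    unit-cancel-∣ {c} (unit i w e) j d = ℕD.∣m+n∣m⇒∣n {N} {w ℕ.* N ℕ.* j} (≡.subst (N ℕD.∣_) (≡.trans (≡.trans (≡.sym (ℕP.*-assoc i c j)) (cong (ℕ._* j) (≡.trans (ℕP.*-comm i c) e))) (ℕP.+-comm j (w ℕ.* N ℕ.* j))) (ℕD.∣n⇒∣m*n i d)) (ℕD.∣m⇒∣m*n j (ℕD.∣n⇒∣m*n w ℕD.∣-refl))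

    -- Even frequencies against even arguments bring out a factor 4 in the dot product. Since 4 is a
    -- unit modulo N, ξ is a primitive N-th root of unity.
    ξ : Carrier
    ξ = θ ^ 4

    ξξ̄ : ξ * ξ ̄ ≈ 1#
    ξξ̄ = trans (nrm-^ θ 4) (trans (^-congˡ 4 θθ̄) (1^ 4))

    ω⁴ : ω ^ 4 ≈ ζ ^ 4
    ω⁴ = trans (ω^ 4) (trans (*-congʳ (-1^2n 2)) (*-identityˡ _))

    ξ̄≈ : ξ ̄ ≈ ζ ^ 4
    ξ̄≈ = trans (σ-^ unit-N' θ 4) (trans (^-congˡ 4 (trans (conj-cong θ≈) (conj-conj ω))) ω⁴)

    ξ≈ : ξ ≈ ζ ^ (4 ℕ.* N')
    ξ≈ = trans (sym (conj-conj ξ)) (trans (conj-cong ξ̄≈) (trans (σ-ζ^ unit-N' 4) (^-assocʳ ζ 4 N')))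

    orth : ∀ z z' → z < N → z' < N → ¬ (z' ≡ z) → geom N (ξ ^ z * (ξ ̄) ^ z') ≈ 0#
    orth z z' z<N z'<N ne = trans (geom-cong N r≈) (nzd j N∤j _ (trans (geom-tele N (ζ ^ j)) (≈⇒-≈0 (sym (trans (^-swap' j) (trans (^-congˡ j ζ^N) (1^ j)))))))
      where
      i = N' ℕ.* z ℕ.+ z'
      j = 4 ℕ.* i
      ^-swap' : ∀ j → (ζ ^ j) ^ N ≈ (ζ ^ N) ^ j
      ^-swap' j = ^-swap ζ j N
      r≈ : ξ ^ z * (ξ ̄) ^ z' ≈ ζ ^ j
      r≈ = trans (*-cong (trans (^-congˡ z ξ≈) (^-assocʳ ζ (4 ℕ.* N') z)) (trans (^-congˡ z' ξ̄≈) (^-assocʳ ζ 4 z'))) (trans (sym (^-homo-* ζ (4 ℕ.* N' ℕ.* z) (4 ℕ.* z'))) (^-congʳ ζ (≡.trans (cong (ℕ._+ 4 ℕ.* z') (ℕP.*-assoc 4 N' z)) (≡.sym (ℕP.*-distribˡ-+ 4 (N' ℕ.* z) z')))))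
      N∤j : ¬ (N ℕD.∣ j)
      N∤j d = ne (≡.trans (≡.sym (DM.m<n⇒m%n≡m z'<N)) (≡.trans (≡.sym (DM.[m+kn]%n≡m%n z' z N)) (≡.trans (cong (ℕ._% N) (≡.trans (cong (z' ℕ.+_) (ℕP.*-comm z N)) (S'.solve 3 (λ z' z n → z' S'.:+ (z S'.:+ n S'.:* z) S'.:= z S'.:+ (n S'.:* z S'.:+ z')) ≡.refl z' z N')))
          (≡.trans (cong (λ y → (z ℕ.+ y) ℕ.% N) (ℕD._∣_.equality di)) (≡.trans (DM.[m+kn]%n≡m%n z (ℕD.quotient di) N) (DM.m<n⇒m%n≡m z<N))))))
        where di : N ℕD.∣ i
              di = unit-cancel-∣ (unit-^ u2 2) i d

    open Parseval N ξ (ξ ̄) ξξ̄ orth using (parseval)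

    N^m-odd : ¬ ((+ 2) ∣ℤ (+ (N ℕ.^ m)))
    N^m-odd (IK.divs r e) = 2∤1 (∣-≡ (≡-trans (≡-reflexive (c#-^ N m)) (c#N^≡1 m)) (divs (ι r) (trans (ι-cong e) (ι-* (+ 2) r))))

    module Transform {d : ℕ} (F : Vec ℕ d → Carrier) (F1 : ∀ x → F x * F x ̄ ≈ 1#) where

      A^ G^ : Vec ℕ d → Carrier
      A^ l = Σᵥ q d (λ x → F x * θ ^ (l · x))
      G^ l = Σᵥ N d (λ z → F (doubled z) * θ ^ (l · doubled z))

      flip-term : ∀ l s x → F x * θ ^ ((l ⊕ s) · x) ≈ -1# ^ (s · x) * (F x * θ ^ (l · x))
      flip-term l s x = trans (*-congˡ flip) (solve 3 (λ f e t → f :* (e :* t) := e :* (f :* t)) refl (F x) (-1# ^ (s · x)) (θ ^ (l · x)))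
        where
        flip : θ ^ ((l ⊕ s) · x) ≈ -1# ^ (s · x) * θ ^ (l · x)
        flip = trans (^-congʳ θ (⊕-· l s x)) (trans (^-homo-* θ (l · x) (N ℕ.* (s · x))) (trans (*-congˡ (trans (sym (^-assocʳ θ N (s · x))) (^-congˡ (s · x) θ^N))) (*-comm _ _)))

      flip≡ : ∀ l s → A^ (l ⊕ s) ≡ A^ l [ 2# ]
      flip≡ l s = Σᵥ-≡ q d (λ x → ≡-trans (≡-reflexive (flip-term l s x)) (≡-trans (≡-* (-1^≡1 (s · x)) ≡-refl) (≡-reflexive (*-identityˡ (F x * θ ^ (l · x))))))

      -- Summing the coefficients over all shifts by N s leaves 2^d times the sum over even
      -- arguments, by `even-sum`, while each summand is ± the coefficient at l.
      even-part : ∀ l → (∀ s → A^ (l ⊕ s) ≈± A^ l) → ∃ λ j → 2# ^ d * G^ l ≈ ι j * A^ l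
      even-part l flip± = proj₁ r , trans (sym (even-sum N d (λ x → F x * θ ^ (l · x)))) (trans (Σᵥ-cong 2 d (λ s → Σᵥ-cong q d (λ x → sym (flip-term l s x)))) (proj₂ r))
        where r = sum-± 2 d (A^ l) (λ s → A^ (l ⊕ s)) flip±

      -- Parseval on the even arguments, with only the doubled frequencies, gives total energy N^d ·
      -- N^d, an odd number.
      odd-energy : ¬ (∀ l → 2# ∣ (G^ l * G^ l ̄))
      odd-energy even-norm = 2∤1 (∣-≡ (≡-trans (≡-* (c#N^≡1 d) (c#N^≡1 d)) (≡-reflexive (*-identityˡ 1#))) (≡0⇒∣ (≡-trans (≡-reflexive (sym total)) even)))
        where
        K : Vec ℕ d → Vec ℕ d → Carrier
        K z z' = F (doubled z) * F (doubled z') ̄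
        S = Σᵥ N d (λ μ → G^ (doubled μ) * G^ (doubled μ) ̄)
        even : S ≡ 0# [ 2# ]
        even = ≡-trans (Σᵥ-≡ N d (λ μ → ∣⇒≡0 (even-norm (doubled μ)))) (≡-reflexive (trans (Σᵥ-const N d 0#) (zeroʳ _)))
        θξ : ∀ μ z → θ ^ (doubled μ · doubled z) ≈ ξ ^ (μ · z)
        θξ μ z = trans (^-congʳ θ (doubled-· μ z)) (sym (^-assocʳ θ 4 (μ · z)))
        Ḡ : ∀ μ → G^ (doubled μ) ̄ ≈ Σᵥ N d (λ z' → F (doubled z') ̄ * (ξ ̄) ^ (μ · z'))
        Ḡ μ = trans (σ-Σᵥ unit-N' N d (λ z → F (doubled z) * θ ^ (doubled μ · doubled z))) (Σᵥ-cong N d (λ z' → trans (σ-* N' (F (doubled z')) (θ ^ (doubled μ · doubled z'))) (*-congˡ (trans (conj-cong (θξ μ z')) (σ-^ unit-N' ξ (μ · z'))))))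
        prod : ∀ μ → G^ (doubled μ) * G^ (doubled μ) ̄ ≈ Σᵥ N d (λ z → Σᵥ N d (λ z' → (ξ ^ (μ · z) * (ξ ̄) ^ (μ · z')) * K z z'))
        prod μ = trans (*-congˡ (Ḡ μ)) (trans (Σᵥ-*ʳ N d (Σᵥ N d (λ z' → F (doubled z') ̄ * (ξ ̄) ^ (μ · z'))) (λ z → F (doubled z) * θ ^ (doubled μ · doubled z)))
          (Σᵥ-cong N d (λ z → trans (Σᵥ-*ˡ N d (F (doubled z) * θ ^ (doubled μ · doubled z)) (λ z' → F (doubled z') ̄ * (ξ ̄) ^ (μ · z'))) (Σᵥ-cong N d (λ z' → trans (*-congʳ (*-congˡ (θξ μ z)))
            (solve 4 (λ f t g u → (f :* t) :* (g :* u) := (t :* u) :* (f :* g)) refl (F (doubled z)) (ξ ^ (μ · z)) (F (doubled z') ̄) ((ξ ̄) ^ (μ · z'))))))))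
        total : S ≈ c# N ^ d * c# N ^ d
        total = trans (Σᵥ-cong N d prod) (trans (parseval d K) (*-congˡ (trans (Σᵥ-cong N d (λ z → F1 (doubled z))) (trans (Σᵥ-const N d 1#) (*-identityʳ _)))))

    not-flat : (F : Vec ℕ m → Carrier) (F1 : ∀ x → F x * F x ̄ ≈ 1#) → let open Transform F F1 in ¬ (∀ l → A^ l * A^ l ̄ ≈ c# (q ℕ.^ m))
    not-flat F F1 flat = odd-energy even-norm
      where
      open Transform F F1
      -- 2^m |G|² = j² N^m and m is odd
      even-norm : ∀ l → 2# ∣ (G^ l * G^ l ̄)
      even-norm l = go (even-part l (λ s → sign {A^ l} {A^ (l ⊕ s)} (flat l) (flat (l ⊕ s)) (flip≡ l s)))
        where
        X = G^ l * G^ l ̄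
        go : (∃ λ j → Q * G^ l ≈ ι j * A^ l) → 2# ∣ X
        go (j , e) = fin (int (+ (2 ℕ.^ m)) X (j ℤ.* j ℤ.* + (N ℕ.^ m)) nX)
          where
          nX : c# (2 ℕ.^ m) * X ≈ ι (j ℤ.* j ℤ.* + (N ℕ.^ m))
          nX = trans (*-congʳ (c#-^ 2 m)) (pow-cancel m (begin
            Q * (Q * X) ≈⟨ solve 3 (λ q g h → q :* (q :* (g :* h)) := (q :* g) :* (q :* h)) refl Q (G^ l) (G^ l ̄) ⟩
            (Q * G^ l) * (Q * G^ l ̄) ≈⟨ *-cong e (trans (*-congʳ (sym (conj-2^ m))) (trans (sym (σ-* N' Q (G^ l))) (trans (conj-cong e) (trans (σ-* N' (ι j) (A^ l)) (*-congʳ (σ-ι N' j)))))) ⟩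
            (ι j * A^ l) * (ι j * A^ l ̄) ≈⟨ solve 3 (λ j a b → (j :* a) :* (j :* b) := (j :* j) :* (a :* b)) refl (ι j) (A^ l) (A^ l ̄) ⟩
            (ι j * ι j) * (A^ l * A^ l ̄) ≈⟨ *-cong (sym (ι-* j j)) (trans (flat l) (trans (c#-^ q m) (trans (^-congˡ m (c#-* 2 N)) (trans (^-distrib-* 2# (c# N) m) (*-congˡ (sym (c#-^ N m))))))) ⟩
            ι (j ℤ.* j) * (Q * c# (N ℕ.^ m)) ≈⟨ solve 3 (λ j q n → j :* (q :* n) := q :* (j :* n)) refl (ι (j ℤ.* j)) Q (c# (N ℕ.^ m)) ⟩
            Q * (ι (j ℤ.* j) * c# (N ℕ.^ m)) ≈⟨ *-congˡ (sym (ι-* (j ℤ.* j) (+ (N ℕ.^ m)))) ⟩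
            Q * ι (j ℤ.* j ℤ.* + (N ℕ.^ m)) ∎))
            where open RR
          fin : (+ (2 ℕ.^ m)) ∣ℤ (j ℤ.* j ℤ.* + (N ℕ.^ m)) → 2# ∣ X
          fin (IK.divs g eg) = fin' (even-quotient k j (+ (N ℕ.^ m)) g N^m-odd eg)
            where
            X≈ : X ≈ ι g
            X≈ = c#-cancel (2 ℕ.^ m) (ℕP.m^n>0 2 m) (trans nX (trans (ι-cong eg) (ι-* (+ (2 ℕ.^ m)) g)))
            fin' : (+ 2) ∣ℤ g → 2# ∣ X
            fin' (IK.divs h eh) = divs (ι h) (trans X≈ (trans (ι-cong eh) (ι-* (+ 2) h)))

    -- Unless N divides d, multiplying by ω^d + 1 leads to ζ^(2d) - 1, where 2 is a unit modulo N.
    -- The only remaining exponent is d = N, where ω^d - 1 = -2.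
    ω-nzd : ∀ d → 0 < d → d < q → d ℕD.∣ q → ∀ y → (ω ^ d - 1#) * y ≈ 0# → y ≈ 0#
    ω-nzd d 0<d d<q _ y e = go (N ℕD.∣? d)
      where
      go : Dec (N ℕD.∣ d) → y ≈ 0#
      go (no n) = nzd (2 ℕ.* d) (λ h → n (unit-cancel-∣ u2 d h)) y (begin
        (1# - ζ ^ (2 ℕ.* d)) * y ≈⟨ *-congʳ (+-congˡ (-‿cong (sym ω²))) ⟩
        (1# - ω ^ d * ω ^ d) * y ≈⟨ *-congʳ (+-congʳ (sym (*-identityˡ 1#))) ⟩
        (1# * 1# - ω ^ d * ω ^ d) * y ≈⟨ solve 3 (λ o w y → (o :* o :- w :* w) :* y := (:- (o :+ w)) :* ((w :- o) :* y)) refl 1# (ω ^ d) y ⟩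
        (- (1# + ω ^ d)) * ((ω ^ d - 1#) * y) ≈⟨ *-congˡ e ⟩
        (- (1# + ω ^ d)) * 0# ≈⟨ zeroʳ _ ⟩
        0# ∎)
        where
        open RR
        ω² : ω ^ d * ω ^ d ≈ ζ ^ (2 ℕ.* d)
        ω² = trans (sym (^-homo-* ω d d)) (trans (^-congʳ ω (cong (d ℕ.+_) (≡.sym (ℕP.+-identityʳ d)))) (trans (ω^ (2 ℕ.* d)) (trans (*-congʳ (-1^2n d)) (*-identityˡ _))))
      go (yes (ℕD.divides zero e')) = ⊥-elim (ℕP.<⇒≢ 0<d (≡.sym e'))
      go (yes (ℕD.divides (suc (suc j)) e')) = ⊥-elim (ℕP.<⇒≱ d<q (≡.subst (q ≤_) (≡.sym e') (ℕP.*-monoˡ-≤ N {2} {suc (suc j)} (s≤s (s≤s z≤n)))))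
      go (yes (ℕD.divides (suc zero) e')) = tor (+ 2) y (λ ()) (trans (sym (-‿involutive _)) (trans (-‿cong neg) -0#≈0#))
        where
        ω^d : ω ^ d ≈ -1#
        ω^d = trans (^-congʳ ω (≡.trans e' (ℕP.*-identityˡ N))) ω^N
        neg : - (c# 2 * y) ≈ 0#
        neg = trans (sym (trans (*-congʳ (+-congʳ ω^d)) (trans (solve 2 (λ o y → (:- o :- o) :* y := :- (con (+ 2) :* (o :* y))) refl 1# y) (-‿cong (*-congˡ (*-identityˡ y)))))) e

    Φ-root : ev ω (Φ q) ≈ 0#
    Φ-root = Φcyc.cyc-root Z ω (q ∸ 1) ω^q ω-nzd

    no-gbf : (g : Vec (Fin q) m → Fin q) → ¬ IsGBF m q g
    no-gbf g gbf = not-flat F F1 flat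
      where
      F : Vec ℕ m → Carrier
      F x = ω ^ toℕ (g (residues q x))
      F1 : ∀ x → F x * F x ̄ ≈ 1#
      F1 x = trans (nrm-^ ω (toℕ (g (residues q x)))) (trans (^-congˡ (toℕ (g (residues q x))) ωω̄) (1^ (toℕ (g (residues q x)))))
      open Transform F F1
      θ^q : θ ^ q ≈ 1#
      θ^q = trans (^-assocʳ ω (q ∸ 1) q) (trans (^-congʳ ω (ℕP.*-comm (q ∸ 1) q)) (trans (sym (^-assocʳ ω q (q ∸ 1))) (trans (^-congˡ (q ∸ 1) ω^q) (1^ (q ∸ 1)))))
      module _ (l : Vec ℕ m) where
        lam = residues q l
        term : ∀ x → ω ^ expo g lam (residues q x) ≈ F x * θ ^ (l · x)
        term x = trans (^-homo-* ω (toℕ (g (residues q x))) ((q ∸ 1) ℕ.* dot lam (residues q x))) (*-congˡ (trans (sym (^-assocʳ ω (q ∸ 1) (dot lam (residues q x)))) (pow-dot q θ^q l x)))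
        α≈ : ev ω (αₚ q m g lam) ≈ A^ l
        α≈ = trans (ev-sum ω (allVecs q m) (expo g lam)) (trans (∑-allVecs q m (λ x → ω ^ expo g lam x)) (Σᵥ-cong q m {λ x → ω ^ expo g lam (residues q x)} {λ x → F x * θ ^ (l · x)} term))
        ᾱ≈ : ev ω (αₚ-conj q m g lam) ≈ A^ l ̄
        ᾱ≈ = trans (ev-sum ω (allVecs q m) (λ x → (q ∸ 1) ℕ.* expo g lam x)) (trans (∑-allVecs q m (λ x → ω ^ ((q ∸ 1) ℕ.* expo g lam x)))
          (trans (Σᵥ-cong q m {λ x → ω ^ ((q ∸ 1) ℕ.* expo g lam (residues q x))} {λ x → (F x * θ ^ (l · x)) ̄} (λ x → trans (sym (^-assocʳ ω (q ∸ 1) (expo g lam (residues q x)))) (trans (^-congˡ (expo g lam (residues q x)) θ≈) (trans (sym (σ-^ unit-N' ω (expo g lam (residues q x)))) (conj-cong (term x))))))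
            (sym (σ-Σᵥ unit-N' q m (λ x → F x * θ ^ (l · x))))))
        flat : A^ l * A^ l ̄ ≈ c# (q ℕ.^ m)
        flat = go (gbf lam)
          where
          P = αₚ q m g lam *ₚ αₚ-conj q m g lam -ₚ constₚ (+ (q ℕ.^ m))
          go : Φ q ∣ₚ P → A^ l * A^ l ̄ ≈ c# (q ℕ.^ m)
          go (h , z) = trans (*-cong (sym α≈) (sym ᾱ≈)) (trans (sym (ev-* ω (αₚ q m g lam) (αₚ-conj q m g lam))) (trans (-≈0⇒≈ (trans (sym (ev-- ω (αₚ q m g lam *ₚ αₚ-conj q m g lam) (constₚ (+ (q ℕ.^ m))))) P≈0)) (ev-const ω (+ (q ℕ.^ m)))))
            where
            P≈0 : ev ω P ≈ 0#
            P≈0 = trans (-≈0⇒≈ (trans (sym (ev-- ω P (Φ q *ₚ h))) (ev-zero ω (P -ₚ Φ q *ₚ h) (IsZero⇒ z)))) (trans (ev-* ω (Φ q) h) (trans (*-congʳ Φ-root) (zeroˡ _)))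

-- Passage from the hypotheses of the theorem to the cyclotomic setting

open import Data.Nat using (_*_; _^_; _%_; _/_; pred)
open import Data.Integer using () renaming (_+_ to _+ℤ_; _*_ to _*ℤ_; _^_ to _^ℤ_)

split-mod8 : ∀ p r → p % 8 ≡ r → p ≡ r ℕ.+ 8 * (p / 8)
split-mod8 p r e = ≡.trans (DM.m≡m%n+[m/n]*n p 8) (cong₂ ℕ._+_ e (ℕP.*-comm (p / 8) 8))

module Hypotheses (p₁ p₂ e₁' e₂' N' f : ℕ) (pr₁ : Prime p₁) (pr₂ : Prime p₂) (r₁ : p₁ % 8 ≡ 3) (r₂ : p₂ % 8 ≡ 1)
  (N≡ : suc N' ≡ p₁ ^ suc e₁' * p₂ ^ suc e₂') (nr : NonResidue p₁ p₂) (φ4 : φ (suc N') / 4 ≡ f) (ord : IsMultOrder 2 (suc N') f)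
  (A B : ℤ) (AB : + p₂ ≡ A ^ℤ 2 +ℤ B ^ℤ 2) (oddA : OddZ A) where

  G H : ℕ
  G = p₁ ^ e₁' * p₂ ^ suc e₂'
  H = p₁ ^ suc e₁' * p₂ ^ e₂'

  open Levels N' p₁ p₂ G H pr₁ pr₂ (p₁ / 8) (p₂ / 8) e₁' e₂' (split-mod8 p₁ 3 r₁) (split-mod8 p₂ 1 r₂) N≡ ≡.refl ≡.refl

  abstract
    cring : CRing N' p₁ p₂ G H
    cring = Abs.cring (Make.coefData N' p₁ p₂ G H N≡₁ N≡₂ 3≤p₁ 3≤p₂ GH divN) p₁ p₂ G H N≡₁ N≡₂ 3≤p₁ 3≤p₂ GH divN

  2^-1 : ∀ s → + (2 ^ s) ℤ.- 1ℤ ≡ (+ 2) IK.^ s ℤ.- 1ℤ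
  2^-1 s = cong (ℤ._- 1ℤ) (pos-^ 2 s)

  setup : Setup
  setup = record
    { N' = N' ; p₁ = p₁ ; p₂ = p₂ ; G = G ; H = H ; CR = cring ; pr₁ = pr₁ ; pr₂ = pr₂
    ; a = p₁ / 8 ; b = p₂ / 8 ; e₁' = e₁' ; e₂' = e₂' ; p₁≡ = split-mod8 p₁ 3 r₁ ; p₂≡ = split-mod8 p₂ 1 r₂
    ; N≡ = N≡ ; G≡ = ≡.refl ; H≡ = ≡.refl
    ; nr = λ x d → proj₂ nr x (toℕ∣ {p₂} {x *ℤ x ℤ.- + p₁} d)
    ; A = A ; B = B ; AB = ≡.trans AB (cong₂ _+ℤ_ (^2 A) (^2 B)) ; oddA = oddA
    ; f = f ; φ4 = φ4 ; f>0 = proj₁ ord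
    ; 2^f = ≡.subst (λ z → (+ suc N') IK.∣ z) (2^-1 f) (fromℕ∣ {suc N'} {+ (2 ^ f) ℤ.- 1ℤ} (proj₁ (proj₂ ord)))
    ; f-min = λ s 0<s d → proj₂ (proj₂ ord) s 0<s (toℕ∣ {suc N'} {+ (2 ^ s) ℤ.- 1ℤ} (≡.subst (λ z → (+ suc N') IK.∣ z) (≡.sym (2^-1 s)) d)) }

  module _ (m : ℕ) (sol : Solvable p₁ p₂ A B m) (min : ∀ m′ → 1 ≤ m′ → Solvable p₁ p₂ A B m′ → m ≤ m′) where

    conclusion : (m % 2 ≡ 1) × ¬ (∃[ g ] IsGBF m (2 * suc N') g)
    conclusion = go (Main.parity setup m)
      where
      go : (∃ λ k → m ≡ k ℕ.+ k) ⊎ (∃ λ k → m ≡ suc (k ℕ.+ k)) → (m % 2 ≡ 1) × ¬ (∃[ g ] IsGBF m (2 * suc N') g)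
      go (inj₁ (k , e)) = ⊥-elim (Main.m-odd setup k (≡.subst (Solvable p₁ p₂ A B) e sol))
      go (inj₂ (k , e)) = ≡.subst (λ m → (m % 2 ≡ 1) × ¬ (∃[ g ] IsGBF m (2 * suc N') g)) (≡.sym e)
          ( ≡.trans (cong (λ z → suc z % 2) (≡.trans (cong (k ℕ.+_) (≡.sym (ℕP.+-identityʳ k))) (ℕP.*-comm 2 k))) (DM.[m+kn]%n≡m%n 1 k 2)
          , λ gbf → Main.Minimal.no-gbf setup k minimal (proj₁ gbf) (proj₂ gbf) )
        where
        minimal : ∀ j → j < k → ¬ Solvable p₁ p₂ A B (suc (j ℕ.+ j))
        minimal j j<k s = ℕP.<⇒≱ (s≤s (ℕP.+-mono-< j<k j<k)) (≡.subst (_≤ suc (j ℕ.+ j)) e (min (suc (j ℕ.+ j)) (s≤s z≤n) s))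

theorem3 : (p₁ p₂ e₁ e₂ : ℕ) → Prime p₁ → Prime p₂ → p₁ % 8 ≡ 3 → p₂ % 8 ≡ 1 →
    1 ≤ e₁ → 1 ≤ e₂ →
    NonResidue p₁ p₂ →
    IsMultOrder 2 (p₁ ^ e₁ * p₂ ^ e₂) (φ (p₁ ^ e₁ * p₂ ^ e₂) / 4) →
    (A B : ℤ) → + p₂ ≡ A ^ℤ 2 +ℤ B ^ℤ 2 → OddZ A →
    (m : ℕ) → 1 ≤ m → Solvable p₁ p₂ A B m →
    (∀ m′ → 1 ≤ m′ → Solvable p₁ p₂ A B m′ → m ≤ m′) →
    (m % 2 ≡ 1) ×
    ¬ (∃[ f ] IsGBF m (2 * (p₁ ^ e₁ * p₂ ^ e₂)) f)
theorem3 p₁ p₂ (suc e₁') (suc e₂') pr₁ pr₂ r₁ r₂ _ _ nr ord A B AB oddA m _ sol min =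
  ≡.subst (λ n → (m % 2 ≡ 1) × ¬ (∃[ g ] IsGBF m (2 * n) g)) N≡
    (Hypotheses.conclusion p₁ p₂ e₁' e₂' (pred P) (φ (suc (pred P)) / 4) pr₁ pr₂ r₁ r₂ N≡ nr ≡.refl (≡.subst (λ n → IsMultOrder 2 n (φ n / 4)) (≡.sym N≡) ord) A B AB oddA m sol min)
  where
  P : ℕ
  P = p₁ ^ suc e₁' * p₂ ^ suc e₂'
  N≡ : suc (pred P) ≡ P
  N≡ = ℕP.suc-pred P {{ℕP.m*n≢0 (p₁ ^ suc e₁') (p₂ ^ suc e₂') {{ℕP.m^n≢0 p₁ (suc e₁') {{prime⇒nonZero pr₁}}}} {{ℕP.m^n≢0 p₂ (suc e₂') {{prime⇒nonZero pr₂}}}}}}
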